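{- For $|q|<1$, $$\mathrm{C}\Phi_9(q)=324q\frac{(q^3;q^3)_\infty^8}{(q;q)_\infty^9}+19683q^4\frac{(q^9;q^9)_\infty^{12}}{(q;q)_\infty^9(q^3;q^3)_\infty^4}-240q\frac{(q^9;q^9)_\infty^3}{(q^3;q^3)_\infty^4}-1458q^2\frac{(q^9;q^9)_\infty^6}{(q;q)_\infty^3(q^3;q^3)_\infty^4}+\frac{(q;q)_\infty^3}{(q^3;q^3)_\infty^4}$$ $$=\frac{1}{(q;q)_\infty^9}\Big(81E_{9,1}-84E_{9,2}+243E_{9,3}-3E_{9,4}-6q(q^3;q^3)_\infty^8\Big),$$ where $E_{9,1}=\frac1{240}+\sum_{k\ge1}\frac{k^3q^k}{1-q^k}$, $E_{9,2}=\frac1{240}+\sum_{k\ge1}\frac{k^3q^{3k}}{1-q^{3k}}$, $E_{9,3}=\frac1{240}+\sum_{k\ge1}\frac{k^3q^{9k}}{1-q^{9k}}$, and $E_{9,4}=\sum_{n\ge1}\big(\frac n3\big)\sum_{d\mid n}d^3q^n$.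
   Context: A $k$-colored generalized Frobenius symbol is a two-row array with $d\ge 0$ columns whose entries are colored nonnegative integers $\ell_c$ ($\ell\ge 0$, color $c\in\{1,\dots,k\}$), each row strictly decreasing with respect to the total order $0_1\prec 0_2\prec\cdots\prec 0_k\prec 1_1\prec\cdots\prec 1_k\prec 2_1\prec\cdots$. It is a $k$-colored generalized Frobenius partition of $n=d+\sum(\text{integer values of all entries})$. $c\phi_k(n)$ is the number of such partitions of $n$ (with $c\phi_k(0)=1$), and $\mathrm{C}\Phi_k(q)=\sum_{n\ge0}c\phi_k(n)q^n$. $(a;q)_\infty=\prod_{j\ge1}(1-aq^{j-1})$; $\left(\frac n3\right)$ is the Legendre symbol. -}

module Defs where

open import Data.Nat as ℕ using (ℕ; zero; suc)
open import Data.Nat.Divisibility using (_∣?_)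
open import Data.Nat.DivMod using (_%_)
open import Data.Nat.ListAction using (sum)
open import Data.Integer as ℤ using (ℤ; +_)
open import Data.Rational as ℚ using (ℚ; 0ℚ; 1ℚ; _+_; _*_; -_; _/_)
open import Data.Fin as Fin using (Fin; toℕ; remQuot)
open import Data.Bool using (Bool; true; false; if_then_else_; _∧_)
open import Data.Vec using (Vec; []; _∷_; lookup)
open import Data.List as List using (List; []; _∷_; map; allFin; length; filter; upTo; zipWith; cartesianProduct; foldr)
open import Data.Product using (_×_; _,_; proj₁; proj₂)
open import Relation.Nullary.Decidable using (does)
open import Relation.Binary.PropositionalEquality using (_≡_)

-- k-colored generalized Frobenius partitions
--
-- A colored entry ℓ_c with ℓ ≤ n, c ∈ {1..k} is encoded as an element of
-- Fin (suc n * k) via remQuot/combine:  code = ℓ * k + (c - 1).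
-- This encoding is order preserving for the order 0_1 ≺ 0_2 ≺ … ≺ 0_k ≺ 1_1 ≺ …
-- A strictly decreasing row is the same thing as a finite set of entries,
-- i.e. a Subset (Vec Bool) of the codes.  Entries of a symbol of weight n
-- have value ≤ n, so the codes in Fin (suc n * k) suffice.

Row : ℕ → ℕ → Set
Row k n = Vec Bool (suc n ℕ.* k)

allRows : (m : ℕ) → List (Vec Bool m)
allRows zero = [] ∷ []
allRows (suc m) = List.concatMap (λ v → (false ∷ v) ∷ (true ∷ v) ∷ []) (allRows m)

rowLen : ∀ {m} → Vec Bool m → ℕ
rowLen {m} S = sum (map (λ i → if lookup S i then 1 else 0) (allFin m))

rowVal : (k n : ℕ) → Row k n → ℕ
rowVal k n S = sum (map (λ i → if lookup S i then toℕ (proj₁ (remQuot {suc n} k i)) else 0) (allFin (suc n ℕ.* k)))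

isCFP : (k n : ℕ) → Row k n × Row k n → Bool
isCFP k n (S , T) = does (rowLen S ℕ.≟ rowLen T) ∧ does ((rowLen S ℕ.+ rowVal k n S ℕ.+ rowVal k n T) ℕ.≟ n)

cφ : ℕ → ℕ → ℕ
cφ k n = length (List.filter (λ p → isCFP k n p ≡? true) (cartesianProduct (allRows (suc n ℕ.* k)) (allRows (suc n ℕ.* k))))
  where
  open import Data.Bool.Properties using () renaming (_≟_ to _≡?_)

PS : Set
PS = ℕ → ℚ

ℕ→ℚ : ℕ → ℚ
ℕ→ℚ n = + n / 1

ℤ→ℚ : ℤ → ℚ
ℤ→ℚ z = z / 1

sumℚ : List ℚ → ℚ
sumℚ = foldr _+_ 0ℚ

_⊕_ : PS → PS → PS
(f ⊕ g) n = f n + g n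
infixl 6 _⊕_

_⊖_ : PS → PS → PS
(f ⊖ g) n = f n + (- g n)
infixl 6 _⊖_

_·_ : ℚ → PS → PS
(c · f) n = c * f n
infixr 7.5 _·_

_⊛_ : PS → PS → PS
(f ⊛ g) n = sumℚ (map (λ i → f i * g (n ℕ.∸ i)) (upTo (suc n)))
infixl 7 _⊛_

one : PS
one zero = 1ℚ
one (suc _) = 0ℚ

qPow : ℕ → PS
qPow m n = if does (m ℕ.≟ n) then 1ℚ else 0ℚ

_^_ : PS → ℕ → PS
f ^ zero = one
f ^ suc e = f ⊛ (f ^ e)
infixr 8 _^_

-- multiplicative inverse of a series with constant term 1
-- (all series inverted below have constant term 1).
-- invRev f m = [g m, g (m-1), …, g 0] where g = 1/f, computed from
-- g 0 = 1, g m = - Σ_{i=1}^{m} f i * g (m - i).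
invRev : PS → ℕ → List ℚ
invRev f zero = 1ℚ ∷ []
invRev f (suc m) = (- sumℚ (zipWith (λ i gi → f i * gi) (upTo (suc (suc m))) (0ℚ ∷ prev))) ∷ prev
  where prev = invRev f m

hdℚ : List ℚ → ℚ
hdℚ [] = 0ℚ
hdℚ (x ∷ _) = x

inv : PS → PS
inv f m = hdℚ (invRev f m)

-- (q^a ; q^a)_∞ = ∏_{j≥1} (1 - q^{a j}), a ≥ 1.  For a ≥ 1 the coefficient
-- of q^n only involves the factors with j ≤ n, so it equals the
-- coefficient of the finite product ∏_{j=1}^{n} (1 - q^{a j}).
finProd : ℕ → ℕ → PS
finProd a zero = one
finProd a (suc N) = (one ⊖ qPow (a ℕ.* suc N)) ⊛ finProd a N

poch : ℕ → PS
poch a n = finProd a n n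

-- Σ_{k≥1} k^3 q^{b k} / (1 - q^{b k}) = Σ_{k≥1} Σ_{m≥1} k^3 q^{b k m};
-- coefficient of q^n (n ≥ 1) is Σ_{1≤k≤n, b k ∣ n} k^3  (terms with k > n vanish)
lambert3 : ℕ → PS
lambert3 b zero = 0ℚ
lambert3 b n@(suc _) = sumℚ (map (λ k → if does ((b ℕ.* suc k) ∣? n) then ℕ→ℚ (suc k ℕ.^ 3) else 0ℚ) (upTo n))

const : ℚ → PS
const c = c · one

E91 E92 E93 E94 : PS
E91 = const (+ 1 / 240) ⊕ lambert3 1
E92 = const (+ 1 / 240) ⊕ lambert3 3
E93 = const (+ 1 / 240) ⊕ lambert3 9

legendre3 : ℕ → ℤ
legendre3 n with n % 3
... | 0 = + 0
... | 1 = + 1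
... | _ = ℤ.-[1+ 0 ]

σ3 : ℕ → ℕ
σ3 n = sum (map (λ d → if does (suc d ∣? n) then suc d ℕ.^ 3 else 0) (upTo n))

E94 zero = 0ℚ
E94 n@(suc _) = ℤ→ℚ (legendre3 n) * ℕ→ℚ (σ3 n)

CΦ9 : PS
CΦ9 n = ℕ→ℚ (cφ 9 n)

c : ℤ → ℚ
c z = z / 1

RHS₁ : PS
RHS₁ = c (+ 324) · qPow 1 ⊛ poch 3 ^ 8 ⊛ inv (poch 1 ^ 9)
     ⊕ c (+ 19683) · qPow 4 ⊛ poch 9 ^ 12 ⊛ inv (poch 1 ^ 9 ⊛ poch 3 ^ 4)
     ⊖ c (+ 240) · qPow 1 ⊛ poch 9 ^ 3 ⊛ inv (poch 3 ^ 4)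
     ⊖ c (+ 1458) · qPow 2 ⊛ poch 9 ^ 6 ⊛ inv (poch 1 ^ 3 ⊛ poch 3 ^ 4)
     ⊕ poch 1 ^ 3 ⊛ inv (poch 3 ^ 4)

RHS₂ : PS
RHS₂ = inv (poch 1 ^ 9) ⊛
  ( c (+ 81) · E91 ⊖ c (+ 84) · E92 ⊕ c (+ 243) · E93 ⊖ c (+ 3) · E94
    ⊖ c (+ 6) · qPow 1 ⊛ poch 3 ^ 8 )

{-# OPTIONS --safe #-}
-- Put Q = XY and T = Σ_m X^{m(m+1)/2} Y^{m(m-1)/2}, and let δ extract the coefficients of (XY)^n = q^n. By the triple product
-- (q;q)⁹ CΦ₉ = δ(T⁹). Invariance of T³ under an affine map of the exponents gives T³ = a Ψ + C (Θ₁ + Θ₂) with Ψ, Θ₁, Θ₂ theta functions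
-- of level 3. Trisecting T = t₀ + t₁ + t₂ one has t₀³ + t₁³ + t₂³ - 3 t₀t₁t₂ = b Ψ and t₀t₁t₂ = y Ψ by infinite products, where
-- b = (q;q)³/(q³;q³) and y = q (q⁹;q⁹)³/(q³;q³); hence a = b + 9y and T⁹ is a cubic form in Ψ, Θ₁, Θ₂.
-- With u = b + 3y and n = u² + 3uy + 9y², the norm of (q;q) over the series in q³ gives b(q³)³ = bn and a(q³) = u, so C = 3 (q³;q³)³/(q;q)
-- and δ(T⁹) = b³u + 81ayn.
-- For the Eisenstein series, the products of the u_m = q^m/(1-q^m) satisfy u_m u_k = u_{m+k} (1 + u_m + u_k), which yields Ramanujan's
-- E₄ = E₂² - 12 q dE₂/dq. The logarithmic derivatives of b and y express E₂ in a and n. An equation s d = t d(q³) with s(0) = 1 and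
-- d(0) = 0 forces d = 0, and this gives E₄ = a⁴ + 216 ayn. Everything is then a polynomial in u and y; the twist by the Legendre symbol
-- selects residues of exponents modulo 3, where u is supported on the residue 0 and y on the residue 1.
module Submission where

open import Defs using (Row; allRows; rowLen; rowVal; isCFP; cφ)
open import Level using (0ℓ)
open import Function using (_∘_)
open import Algebra.Bundles using (CommutativeRing)
open import Algebra.Structures using (IsCommutativeRing)
open import Algebra.Solver.Ring.AlmostCommutativeRing using (fromCommutativeRing; _-Raw-AlmostCommutative⟶_)
import Algebra.Solver.Ring
import Algebra.Properties.Ring
open import Data.Bool using (Bool; true; false; if_then_else_; _∧_)
import Data.Bool.Properties as BoolP
open import Data.Empty using (⊥; ⊥-elim)
open import Data.Fin as Fin using (Fin; toℕ; remQuot; _↑ˡ_; _↑ʳ_)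
import Data.Fin.Properties as FinP
open import Data.Integer as ℤ using (ℤ; +_; -[1+_])
import Data.Integer.Properties as ℤP
open import Data.Integer.Tactic.RingSolver using () renaming (solve-∀ to ℤ-solve-∀)
open import Data.List using (List; []; _∷_; _++_; map; allFin; tabulate; concatMap; cartesianProduct; length; filter; applyUpTo; zipWith)
open import Data.Maybe using (Maybe; just; nothing)
open import Data.Nat as ℕ using (ℕ; zero; suc; z≤n; s≤s)
import Data.Nat.Properties as ℕP
open import Data.Nat.Divisibility using (_∣_; _∣?_; ∣m+n∣m⇒∣n; ∣m∣n⇒∣m+n; ∣-refl; ∣-trans; ∣⇒≤; m∣m*n; *-monoʳ-∣; *-cancelˡ-∣)
open import Data.Nat.DivMod using (_%_; [m+n]%n≡m%n)
open import Data.Nat.ListAction using (sum)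
open import Data.Nat.Tactic.RingSolver using () renaming (solve-∀ to ℕ-solve-∀)
open import Data.Product using (_×_; _,_; proj₁; proj₂; Σ-syntax)
open import Data.Rational as ℚ using (ℚ; 0ℚ; 1ℚ)
import Data.Rational.Properties as ℚP
open import Data.Rational.Unnormalised as ℚᵘ using (mkℚᵘ; *≡*)
import Data.Rational.Unnormalised.Properties as ℚᵘP
open import Data.Sum using (_⊎_; inj₁; inj₂)
open import Data.Vec using (Vec; []; _∷_; lookup)
open import Relation.Binary.PropositionalEquality as ≡ using (_≡_; _≢_)
import Relation.Binary.Reasoning.Setoid as SetoidReasoning
open import Relation.Nullary using (yes; no; Dec)
open import Relation.Nullary.Decidable using (does; dec-true; dec-false)

-- Put X = z q^(1/2) and Y = q^(1/2)/z. Then T is the sum of z^m q^(m²/2), δ extracts the part free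
-- of z, and the exponent of z modulo 3 is a grading. It stands in for a cube root of unity ω: a
-- product over z, ωz, ω²z becomes a norm from R[t]/(t³ - 1). The level 3 functions are, up to a
-- factor q^(1/3), the parts of the sum of z^r q^(r²/6) by the residue of r, and the trisection of T
-- is the same triple at q³; this is why t₀t₁t₂ also gives the constant part of ΨΘ₁Θ₂. The series a,
-- b and q^(1/3) C are the cubic theta functions of the Borweins. C is the delicate coefficient. No
-- product formula for it is at hand, but the norm of T³ can be taken through the trisection or
-- through Ψ, Θ₁, Θ₂. Comparison gives an equation between C(q) and q C(q³), and the factor q
-- determines C from its constant term 3. The shift of the summation index sends some exponents out
-- of ℕ², so it is not a substitution in power series. Symmetries are therefore relations between
-- pairs of series, witnessed up to every degree by finite lists of matched monomials.

-- Integer constants in a commutative ring and the ring solver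

module Integers (R : CommutativeRing 0ℓ 0ℓ) where
  open CommutativeRing R hiding (zero)
  open Algebra.Properties.Ring ring
  open SetoidReasoning setoid

  -- The separate clause for 1 makes `int (+ 1)` definitionally the unit, without a trailing `0#`,
  -- so that constants of the solver match `1#` by `refl`.
  nat : ℕ → Carrier
  nat 0 = 0#
  nat 1 = 1#
  nat (suc (suc n)) = 1# + nat (suc n)

  int : ℤ → Carrier
  int (+ n) = nat n
  int -[1+ n ] = - nat (suc n)

  nat-suc : ∀ n → nat (suc n) ≈ 1# + nat n
  nat-suc zero = sym (+-identityʳ 1#)
  nat-suc (suc n) = refl

  nat-+ : ∀ m n → nat (m ℕ.+ n) ≈ nat m + nat n
  nat-+ zero n = sym (+-identityˡ _)
  nat-+ (suc m) n = begin
    nat (suc (m ℕ.+ n))     ≈⟨ nat-suc (m ℕ.+ n) ⟩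
    1# + nat (m ℕ.+ n)      ≈⟨ +-congˡ (nat-+ m n) ⟩
    1# + (nat m + nat n)    ≈⟨ +-assoc _ _ _ ⟨
    1# + nat m + nat n      ≈⟨ +-congʳ (nat-suc m) ⟨
    nat (suc m) + nat n     ∎

  nat-* : ∀ m n → nat (m ℕ.* n) ≈ nat m * nat n
  nat-* zero n = sym (zeroˡ _)
  nat-* (suc m) n = begin
    nat (n ℕ.+ m ℕ.* n)          ≈⟨ nat-+ n (m ℕ.* n) ⟩
    nat n + nat (m ℕ.* n)        ≈⟨ +-cong (sym (*-identityˡ _)) (nat-* m n) ⟩
    1# * nat n + nat m * nat n   ≈⟨ distribʳ _ _ _ ⟨
    (1# + nat m) * nat n         ≈⟨ *-congʳ (nat-suc m) ⟨
    nat (suc m) * nat n          ∎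

  int-⊖ : ∀ m n → int (m ℤ.⊖ n) ≈ nat m + - nat n
  int-⊖ m zero = sym (trans (+-congˡ -0#≈0#) (+-identityʳ _))
  int-⊖ zero (suc n) = sym (+-identityˡ _)
  int-⊖ (suc m) (suc n) = begin
    int (suc m ℤ.⊖ suc n)                ≡⟨ ≡.cong int (ℤP.[1+m]⊖[1+n]≡m⊖n m n) ⟩
    int (m ℤ.⊖ n)                        ≈⟨ int-⊖ m n ⟩
    nat m + - nat n                      ≈⟨ +-congʳ (+-identityˡ _) ⟨
    0# + nat m + - nat n                 ≈⟨ +-congʳ (+-congʳ (-‿inverseʳ 1#)) ⟨
    1# + - 1# + nat m + - nat n          ≈⟨ +-congʳ (trans (+-assoc _ _ _) (trans (+-congˡ (+-comm _ _)) (sym (+-assoc _ _ _)))) ⟩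
    1# + nat m + - 1# + - nat n          ≈⟨ +-assoc _ _ _ ⟩
    1# + nat m + (- 1# + - nat n)        ≈⟨ +-congˡ (-‿+-comm 1# (nat n)) ⟩
    1# + nat m + - (1# + nat n)          ≈⟨ +-cong (nat-suc m) (-‿cong (nat-suc n)) ⟨
    nat (suc m) + - nat (suc n)          ∎

  int-neg : ∀ i → int (ℤ.- i) ≈ - int i
  int-neg (+ zero) = sym -0#≈0#
  int-neg (+ suc n) = refl
  int-neg -[1+ n ] = sym (-‿involutive _)

  int-+ : ∀ i j → int (i ℤ.+ j) ≈ int i + int j
  int-+ (+ m) (+ n) = nat-+ m n
  int-+ (+ m) -[1+ n ] = int-⊖ m (suc n)
  int-+ -[1+ m ] (+ n) = trans (int-⊖ n (suc m)) (+-comm _ _)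
  int-+ -[1+ m ] -[1+ n ] = begin
    - nat (suc (suc (m ℕ.+ n)))       ≡⟨ ≡.cong (λ k → - nat k) (≡.sym (ℕP.+-suc (suc m) n)) ⟩
    - nat (suc m ℕ.+ suc n)           ≈⟨ -‿cong (nat-+ (suc m) (suc n)) ⟩
    - (nat (suc m) + nat (suc n))     ≈⟨ -‿+-comm _ _ ⟨
    - nat (suc m) + - nat (suc n)     ∎

  int-*⁺ : ∀ m j → int (+ m ℤ.* j) ≈ nat m * int j
  int-*⁺ m (+ n) = trans (reflexive (≡.cong int (≡.sym (ℤP.pos-* m n)))) (nat-* m n)
  int-*⁺ m -[1+ n ] = begin
    int (+ m ℤ.* (ℤ.- + suc n))    ≡⟨ ≡.cong int (≡.sym (ℤP.neg-distribʳ-* (+ m) (+ suc n))) ⟩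
    int (ℤ.- (+ m ℤ.* + suc n))    ≈⟨ int-neg (+ m ℤ.* + suc n) ⟩
    - int (+ m ℤ.* + suc n)        ≈⟨ -‿cong (int-*⁺ m (+ suc n)) ⟩
    - (nat m * nat (suc n))        ≈⟨ -‿distribʳ-* _ _ ⟩
    nat m * - nat (suc n)          ∎

  int-* : ∀ i j → int (i ℤ.* j) ≈ int i * int j
  int-* (+ m) j = int-*⁺ m j
  int-* -[1+ m ] j = begin
    int ((ℤ.- + suc m) ℤ.* j)      ≡⟨ ≡.cong int (≡.sym (ℤP.neg-distribˡ-* (+ suc m) j)) ⟩
    int (ℤ.- (+ suc m ℤ.* j))      ≈⟨ int-neg (+ suc m ℤ.* j) ⟩
    - int (+ suc m ℤ.* j)          ≈⟨ -‿cong (int-*⁺ (suc m) j) ⟩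
    - (nat (suc m) * int j)        ≈⟨ -‿distribˡ-* _ _ ⟩
    - nat (suc m) * int j          ∎

  int-morphism : CommutativeRing.rawRing ℤP.+-*-commutativeRing -Raw-AlmostCommutative⟶ fromCommutativeRing R
  int-morphism = record
    { ⟦_⟧ = int ; +-homo = int-+ ; *-homo = int-* ; -‿homo = int-neg
    ; 0-homo = refl ; 1-homo = refl }

  int-≟ : (i j : ℤ) → Maybe (int i ≈ int j)
  int-≟ i j with i ℤ.≟ j
  ... | yes i≡j = just (reflexive (≡.cong int i≡j))
  ... | no _ = nothing

  open Algebra.Solver.Ring (CommutativeRing.rawRing ℤP.+-*-commutativeRing) (fromCommutativeRing R) int-morphism int-≟
    public using (solve; _:=_; _:+_; _:*_; _:-_; :-_; con; _:^_; Polynomial)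

-- The norm form of R[t]/(t³ - 1) and the components of a cube in it.
module CubicForms (R : CommutativeRing 0ℓ 0ℓ) where
  open CommutativeRing R hiding (zero)
  open Integers R

  cubed : Carrier → Carrier
  cubed x = x * x * x

  thrice-of : Carrier → Carrier
  thrice-of x = x + x + x

  Norm C₀ C₁ C₂ : Carrier → Carrier → Carrier → Carrier
  Norm f g h = f * f * f + g * g * g + h * h * h - int (+ 3) * (f * g * h)
  C₀ f g h = f * f * f + g * g * g + h * h * h + int (+ 6) * (f * g * h)
  C₁ f g h = thrice-of (f * f * g + g * g * h + h * h * f)
  C₂ f g h = C₁ f h g

  private
    norm p₀ p₁ p₂ : ∀ {n} → (f g h : Polynomial n) → Polynomial n
    norm f g h = f :* f :* f :+ g :* g :* g :+ h :* h :* h :- con (+ 3) :* (f :* g :* h)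
    p₀ f g h = f :* f :* f :+ g :* g :* g :+ h :* h :* h :+ con (+ 6) :* (f :* g :* h)
    p₁ f g h = s :+ s :+ s
      where s = f :* f :* g :+ g :* g :* h :+ h :* h :* f
    p₂ f g h = p₁ f h g

  Norm-cong : ∀ {f f′ g g′ h h′} → f ≈ f′ → g ≈ g′ → h ≈ h′ → Norm f g h ≈ Norm f′ g′ h′
  Norm-cong p q r = +-cong (+-cong (+-cong (*-cong (*-cong p p) p) (*-cong (*-cong q q) q)) (*-cong (*-cong r r) r)) (-‿cong (*-congˡ (*-cong (*-cong p q) r)))

  Norm-1 : Norm 1# 0# 0# ≈ 1#
  Norm-1 = solve 0 (norm (con (+ 1)) (con (+ 0)) (con (+ 0)) := con (+ 1)) refl

  Norm-scale : ∀ s f g h → Norm (s * f) (s * g) (s * h) ≈ cubed s * Norm f g h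
  Norm-scale = solve 4 (λ s f g h → norm (s :* f) (s :* g) (s :* h) := s :* s :* s :* norm f g h) refl

  Norm-step : ∀ c f g h → Norm (f + c * h) (g + c * f) (h + c * g) ≈ (1# + cubed c) * Norm f g h
  Norm-step = solve 4 (λ c f g h → norm (f :+ c :* h) (g :+ c :* f) (h :+ c :* g) := (con (+ 1) :+ c :* c :* c) :* norm f g h) refl

  Norm-step′ : ∀ c f g h → Norm (f + c * g) (g + c * h) (h + c * f) ≈ (1# + cubed c) * Norm f g h
  Norm-step′ = solve 4 (λ c f g h → norm (f :+ c :* g) (g :+ c :* h) (h :+ c :* f) := (con (+ 1) :+ c :* c :* c) :* norm f g h) refl

  cube-components : ∀ f g h → cubed (f + g + h) ≈ C₀ f g h + C₁ f g h + C₂ f g h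
  cube-components = solve 3 (λ f g h → (f :+ g :+ h) :* (f :+ g :+ h) :* (f :+ g :+ h) := p₀ f g h :+ p₁ f g h :+ p₂ f g h) refl

  norm-components : ∀ f g h → Norm (C₀ f g h) (C₁ f g h) (C₂ f g h) ≈ cubed (Norm f g h)
  norm-components = solve 3 (λ f g h → norm (p₀ f g h) (p₁ f g h) (p₂ f g h) := norm f g h :* norm f g h :* norm f g h) refl

  C₀-Norm : ∀ f g h → C₀ f g h ≈ Norm f g h + int (+ 9) * (f * g * h)
  C₀-Norm = solve 3 (λ f g h → p₀ f g h := norm f g h :+ con (+ 9) :* (f :* g :* h)) refl

  Norm-cubes : ∀ f g h → Norm f g h + int (+ 3) * (f * g * h) ≈ cubed f + cubed g + cubed h
  Norm-cubes = solve 3 (λ f g h → norm f g h :+ con (+ 3) :* (f :* g :* h) := f :* f :* f :+ g :* g :* g :+ h :* h :* h) refl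

  cubed-* : ∀ f g → cubed (f * g) ≈ cubed f * cubed g
  cubed-* = solve 2 (λ f x → f :* x :* (f :* x) :* (f :* x) := f :* f :* f :* (x :* x :* x)) refl

  cubed-cong : ∀ {f g} → f ≈ g → cubed f ≈ cubed g
  cubed-cong p = *-cong (*-cong p p) p

  swap-left : ∀ x y z → x * (y * z) ≈ y * (x * z)
  swap-left = solve 3 (λ x y z → x :* (y :* z) := y :* (x :* z)) refl

  collect-factors : ∀ a c x y z → a * x * (c * y) * (c * z) ≈ a * c * c * (x * y * z)
  collect-factors = solve 5 (λ a c x y z → a :* x :* (c :* y) :* (c :* z) := a :* c :* c :* (x :* y :* z)) refl

-- Power series

module Series (R : CommutativeRing 0ℓ 0ℓ) where
  open CommutativeRing R hiding (zero)
  open Algebra.Properties.Ring ring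
  private module RI = Integers R
  open SetoidReasoning setoid

  Ser : Set
  Ser = ℕ → Carrier

  infix 4 _≋_
  _≋_ : Ser → Ser → Set
  f ≋ g = ∀ n → f n ≈ g n

  tl : Ser → Ser
  tl f n = f (suc n)

  infixl 6 _⊞_
  _⊞_ : Ser → Ser → Ser
  (f ⊞ g) n = f n + g n

  infixr 7 _•_
  _•_ : Carrier → Ser → Ser
  (c • f) n = c * f n

  mul : Ser → Ser → Ser
  mul f g zero = f 0 * g 0
  mul f g (suc n) = f 0 * g (suc n) + mul (tl f) g n

  0ₛ 1ₛ : Ser
  0ₛ _ = 0#
  1ₛ zero = 1#
  1ₛ (suc _) = 0#

  mul-cong : ∀ {f f′ g g′} → f ≋ f′ → g ≋ g′ → mul f g ≋ mul f′ g′
  mul-cong p q zero = *-cong (p 0) (q 0)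
  mul-cong p q (suc n) = +-cong (*-cong (p 0) (q (suc n))) (mul-cong (λ i → p (suc i)) q n)

  mul-vanish : ∀ f g n → (∀ i j → i ℕ.+ j ≡ n → f i ≈ 0# ⊎ g j ≈ 0#) → mul f g n ≈ 0#
  mul-vanish f g n h = go f n h
    where
    factor : ∀ {a b} → a ≈ 0# ⊎ b ≈ 0# → a * b ≈ 0#
    factor (inj₁ p) = trans (*-congʳ p) (zeroˡ _)
    factor (inj₂ p) = trans (*-congˡ p) (zeroʳ _)
    go : ∀ f n → (∀ i j → i ℕ.+ j ≡ n → f i ≈ 0# ⊎ g j ≈ 0#) → mul f g n ≈ 0#
    go f zero h = factor (h 0 0 ≡.refl)
    go f (suc n) h = trans (+-cong (factor (h 0 (suc n) ≡.refl)) (go (tl f) n (λ i j e → h (suc i) j (≡.cong suc e)))) (+-identityˡ 0#)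

  mul-zeroˡ : ∀ g → mul 0ₛ g ≋ 0ₛ
  mul-zeroˡ g n = mul-vanish 0ₛ g n (λ _ _ _ → inj₁ refl)

  interchange : ∀ a b c d → a + b + (c + d) ≈ a + c + (b + d)
  interchange a b c d = trans (+-assoc _ _ _) (trans (+-congˡ (trans (sym (+-assoc _ _ _)) (trans (+-congʳ (+-comm b c)) (+-assoc _ _ _)))) (sym (+-assoc _ _ _)))

  mul-distribʳ : ∀ h f g → mul (f ⊞ g) h ≋ mul f h ⊞ mul g h
  mul-distribʳ h f g zero = distribʳ _ _ _
  mul-distribʳ h f g (suc n) =
    trans (+-cong (distribʳ _ _ _) (mul-distribʳ h (tl f) (tl g) n)) (interchange _ _ _ _)

  mul-•ˡ : ∀ c f g → mul (c • f) g ≋ c • mul f g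
  mul-•ˡ c f g zero = *-assoc _ _ _
  mul-•ˡ c f g (suc n) = trans (+-cong (*-assoc _ _ _) (mul-•ˡ c (tl f) g n)) (sym (distribˡ _ _ _))

  mul-assoc : ∀ f g h → mul (mul f g) h ≋ mul f (mul g h)
  mul-assoc f g h zero = *-assoc _ _ _
  mul-assoc f g h (suc n) = begin
    f 0 * g 0 * h (suc n) + mul (tl (mul f g)) h n
      ≈⟨ +-congˡ (trans (mul-distribʳ h (f 0 • tl g) (mul (tl f) g) n) (+-cong (mul-•ˡ (f 0) (tl g) h n) (mul-assoc (tl f) g h n))) ⟩
    f 0 * g 0 * h (suc n) + (f 0 * mul (tl g) h n + mul (tl f) (mul g h) n)
      ≈⟨ +-assoc _ _ _ ⟨
    f 0 * g 0 * h (suc n) + f 0 * mul (tl g) h n + mul (tl f) (mul g h) n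
      ≈⟨ +-congʳ (trans (+-congʳ (*-assoc _ _ _)) (sym (distribˡ _ _ _))) ⟩
    f 0 * mul g h (suc n) + mul (tl f) (mul g h) n ∎

  mul-sucʳ : ∀ f g n → mul f g (suc n) ≈ f (suc n) * g 0 + mul f (tl g) n
  mul-sucʳ f g zero = +-comm _ _
  mul-sucʳ f g (suc n) = begin
    f 0 * g (suc (suc n)) + mul (tl f) g (suc n)
      ≈⟨ +-congˡ (mul-sucʳ (tl f) g n) ⟩
    f 0 * g (suc (suc n)) + (f (suc (suc n)) * g 0 + mul (tl f) (tl g) n)
      ≈⟨ trans (sym (+-assoc _ _ _)) (trans (+-congʳ (+-comm _ _)) (+-assoc _ _ _)) ⟩
    f (suc (suc n)) * g 0 + mul f (tl g) (suc n) ∎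

  mul-comm : ∀ f g → mul f g ≋ mul g f
  mul-comm f g zero = *-comm _ _
  mul-comm f g (suc n) = trans (mul-sucʳ f g n) (+-cong (*-comm _ _) (mul-comm f (tl g) n))

  mul-identityˡ : ∀ g → mul 1ₛ g ≋ g
  mul-identityˡ g zero = *-identityˡ _
  mul-identityˡ g (suc n) = trans (+-cong (*-identityˡ _) (mul-zeroˡ g n)) (+-identityʳ _)

  isSeriesRing : IsCommutativeRing _≋_ _⊞_ mul (λ f n → - f n) 0ₛ 1ₛ
  isSeriesRing = record
    { isRing = record
      { +-isAbelianGroup = record
        { isGroup = record
          { isMonoid = record
            { isSemigroup = record
              { isMagma = record
                { isEquivalence = record
                  { refl = λ _ → refl
                  ; sym = λ p n → sym (p n)
                  ; trans = λ p q n → trans (p n) (q n) }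
                ; ∙-cong = λ p q n → +-cong (p n) (q n) }
              ; assoc = λ f g h n → +-assoc _ _ _ }
            ; identity = (λ f n → +-identityˡ _) , (λ f n → +-identityʳ _) }
          ; inverse = (λ f n → -‿inverseˡ _) , (λ f n → -‿inverseʳ _)
          ; ⁻¹-cong = λ p n → -‿cong (p n) }
        ; comm = λ f g n → +-comm _ _ }
      ; *-cong = mul-cong
      ; *-assoc = mul-assoc
      ; *-identity = mul-identityˡ , (λ f n → trans (mul-comm f 1ₛ n) (mul-identityˡ f n))
      ; distrib = (λ f g h n → trans (mul-comm f (g ⊞ h) n) (trans (mul-distribʳ f g h n) (+-cong (mul-comm g f n) (mul-comm h f n)))) , mul-distribʳ }
    ; *-comm = mul-comm }

  seriesRing : CommutativeRing 0ℓ 0ℓ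
  seriesRing = record { isCommutativeRing = isSeriesRing }

  mon : Carrier → ℕ → Ser
  mon c zero zero = c
  mon c zero (suc _) = 0#
  mon c (suc i) zero = 0#
  mon c (suc i) (suc n) = mon c i n

  mon-diag : ∀ c i → mon c i i ≡ c
  mon-diag c zero = ≡.refl
  mon-diag c (suc i) = mon-diag c i

  mon-off : ∀ c i n → i ≢ n → mon c i n ≡ 0#
  mon-off c zero zero ne with () ← ne ≡.refl
  mon-off c zero (suc n) ne = ≡.refl
  mon-off c (suc i) zero ne = ≡.refl
  mon-off c (suc i) (suc n) ne = mon-off c i n (λ e → ne (≡.cong suc e))

  mon-cong : ∀ {c d} i → c ≈ d → mon c i ≋ mon d i
  mon-cong zero p zero = p
  mon-cong zero p (suc n) = refl
  mon-cong (suc i) p zero = refl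
  mon-cong (suc i) p (suc n) = mon-cong i p n

  mon0-mul : ∀ c g → mul (mon c 0) g ≋ c • g
  mon0-mul c g zero = refl
  mon0-mul c g (suc n) = trans (+-congˡ (mul-zeroˡ g n)) (+-identityʳ _)

  shift-mul-suc : ∀ c i g n → mul (mon c (suc i)) g (suc n) ≈ mul (mon c i) g n
  shift-mul-suc c i g n = trans (+-congʳ (zeroˡ _)) (+-identityˡ _)

  mon-mul : ∀ c d i j → mul (mon c i) (mon d j) ≋ mon (c * d) (i ℕ.+ j)
  mon-mul c d zero j n = trans (mon0-mul c (mon d j) n) (scale j n)
    where
    scale : ∀ j n → c * mon d j n ≈ mon (c * d) j n
    scale zero zero = refl
    scale zero (suc n) = zeroʳ _
    scale (suc j) zero = zeroʳ _
    scale (suc j) (suc n) = scale j n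
  mon-mul c d (suc i) j zero = zeroˡ _
  mon-mul c d (suc i) j (suc n) = trans (shift-mul-suc c i (mon d j) n) (mon-mul c d i j n)

  q^ : ℕ → Ser
  q^ = mon 1#

  infix 4 _≋[_]_
  _≋[_]_ : Ser → ℕ → Ser → Set
  f ≋[ N ] g = ∀ n → n ℕ.< N → f n ≈ g n

  mul-cong[] : ∀ {N f f′ g g′} → f ≋[ N ] f′ → g ≋[ N ] g′ → mul f g ≋[ N ] mul f′ g′
  mul-cong[] p q zero lt = *-cong (p 0 lt) (q 0 lt)
  mul-cong[] p q (suc n) lt = +-cong (*-cong (p 0 (ℕP.≤-trans (s≤s z≤n) lt)) (q (suc n) lt))
    (mul-cong[] {suc n} (λ i l → p (suc i) (ℕP.≤-trans (s≤s l) lt)) (λ i l → q i (ℕP.<-trans l lt)) n ℕP.≤-refl)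

  -- Cancellation is phrased through regular constant terms rather than units. It then applies to
  -- series over series, where the constant term is itself a series, and to constant terms such as
  -- 3, 18 or 240.
  Regular : Carrier → Set
  Regular c = ∀ x → c * x ≈ 0# → x ≈ 0#

  -- Induction on the order: once `g` vanishes below `n`, the coefficient of index `n` of the
  -- product is `f 0 * g n`, and regularity removes `f 0`.
  mul-regular[] : ∀ f g → Regular (f 0) → ∀ N → mul f g ≋[ N ] 0ₛ → g ≋[ N ] 0ₛ
  mul-regular[] f g reg (suc N) h n lt with ℕP.m≤n⇒m<n∨m≡n (ℕP.≤-pred lt)
  ... | inj₁ n<N = mul-regular[] f g reg N (λ i l → h i (ℕP.m<n⇒m<1+n l)) n n<N
  ... | inj₂ ≡.refl = reg (g n) (trans (sym (last n below)) (h n lt))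
    where
    below : g ≋[ n ] 0ₛ
    below = mul-regular[] f g reg n (λ i l → h i (ℕP.m<n⇒m<1+n l))
    last : ∀ n → g ≋[ n ] 0ₛ → mul f g n ≈ f 0 * g n
    last zero _ = refl
    last (suc n) z = trans (+-congˡ (mul-vanish (tl f) g n (λ i j e → inj₂ (z j (s≤s (≡.subst (j ℕ.≤_) e (ℕP.m≤n+m j i))))))) (+-identityʳ _)

  mul-regular : ∀ f g → Regular (f 0) → mul f g ≋ 0ₛ → g ≋ 0ₛ
  mul-regular f g reg h n = mul-regular[] f g reg (suc n) (λ i _ → h i) n ℕP.≤-refl

  unit-regular : ∀ {c} → c ≈ 1# → Regular c
  unit-regular p x e = trans (sym (*-identityˡ x)) (trans (*-congʳ (sym p)) e)

  mul-cancel[] : ∀ N f g h → Regular (f 0) → mul f g ≋[ N ] mul f h → g ≋[ N ] h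
  mul-cancel[] N f g h reg e n lt = x-y≈0 (mul-regular[] f (λ i → g i + - h i) reg N d n lt)
    where
    x-y≈0 : ∀ {x y} → x + - y ≈ 0# → x ≈ y
    x-y≈0 {x} {y} p = trans (sym (+-identityʳ x)) (trans (+-congˡ (sym (-‿inverseˡ y))) (trans (sym (+-assoc _ _ _)) (trans (+-congʳ p) (+-identityˡ y))))
    d : mul f (λ i → g i + - h i) ≋[ N ] 0ₛ
    d i l = begin
      mul f (λ i → g i + - h i) i      ≈⟨ CommutativeRing.distribˡ seriesRing f g (λ i → - h i) i ⟩
      mul f g i + mul f (λ i → - h i) i ≈⟨ +-cong (e i l) (sym (Algebra.Properties.Ring.-‿distribʳ-* (CommutativeRing.ring seriesRing) f h i)) ⟩
      mul f h i + - mul f h i           ≈⟨ -‿inverseʳ _ ⟩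
      0#                                ∎

  mul-cancel : ∀ f g h → Regular (f 0) → mul f g ≋ mul f h → g ≋ h
  mul-cancel f g h reg e n = mul-cancel[] (suc n) f g h reg (λ i _ → e i) n ℕP.≤-refl

  -- V f = f(q³).
  V : Ser → Ser
  V f zero = f 0
  V f (suc zero) = 0#
  V f (suc (suc zero)) = 0#
  V f (suc (suc (suc n))) = V (tl f) n

  V-cong : ∀ {f g} → f ≋ g → V f ≋ V g
  V-cong p zero = p 0
  V-cong p (suc zero) = refl
  V-cong p (suc (suc zero)) = refl
  V-cong p (suc (suc (suc n))) = V-cong (λ i → p (suc i)) n

  V-cong[] : ∀ {N f g} → f ≋[ N ] g → V f ≋[ N ] V g
  V-cong[] p zero l = p 0 l
  V-cong[] p (suc zero) l = refl
  V-cong[] p (suc (suc zero)) l = refl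
  V-cong[] {suc (suc (suc N))} p (suc (suc (suc n))) (s≤s (s≤s (s≤s l))) = V-cong[] {N} (λ i l′ → p (suc i) (s≤s (ℕP.m≤n⇒m≤1+n (ℕP.m≤n⇒m≤1+n l′)))) n l

  V-+ : ∀ f g → V (f ⊞ g) ≋ V f ⊞ V g
  V-+ f g zero = refl
  V-+ f g (suc zero) = sym (+-identityˡ _)
  V-+ f g (suc (suc zero)) = sym (+-identityˡ _)
  V-+ f g (suc (suc (suc n))) = V-+ (tl f) (tl g) n

  V-neg : ∀ f → V (λ n → - f n) ≋ λ n → - V f n
  V-neg f zero = refl
  V-neg f (suc zero) = sym -0#≈0#
  V-neg f (suc (suc zero)) = sym -0#≈0#
  V-neg f (suc (suc (suc n))) = V-neg (tl f) n

  V-• : ∀ c f → V (c • f) ≋ c • V f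
  V-• c f zero = refl
  V-• c f (suc zero) = sym (zeroʳ c)
  V-• c f (suc (suc zero)) = sym (zeroʳ c)
  V-• c f (suc (suc (suc n))) = V-• c (tl f) n

  V-0 : V 0ₛ ≋ 0ₛ
  V-0 zero = refl
  V-0 (suc zero) = refl
  V-0 (suc (suc zero)) = refl
  V-0 (suc (suc (suc n))) = V-0 n

  V-1 : V 1ₛ ≋ 1ₛ
  V-1 zero = refl
  V-1 (suc zero) = refl
  V-1 (suc (suc zero)) = refl
  V-1 (suc (suc (suc n))) = V-0 n

  V-mul : ∀ f g → V (mul f g) ≋ mul (V f) (V g)
  V-mul f g zero = refl
  V-mul f g (suc zero) = sym (trans (+-cong (zeroʳ _) (zeroˡ _)) (+-identityˡ 0#))
  V-mul f g (suc (suc zero)) = sym (trans (+-cong (zeroʳ _) (trans (+-cong (zeroˡ _) (zeroˡ _)) (+-identityˡ 0#))) (+-identityˡ 0#))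
  V-mul f g (suc (suc (suc n))) = begin
    V (tl (mul f g)) n                               ≈⟨ V-+ (f 0 • tl g) (mul (tl f) g) n ⟩
    V (f 0 • tl g) n + V (mul (tl f) g) n            ≈⟨ +-cong (V-• (f 0) (tl g) n) (V-mul (tl f) g n) ⟩
    f 0 * V (tl g) n + mul (V (tl f)) (V g) n        ≈⟨ +-congˡ (trans (skip _) (skip _)) ⟨
    mul (V f) (V g) (suc (suc (suc n)))              ∎
    where
    skip : ∀ {x} y → 0# * x + y ≈ y
    skip y = trans (+-congʳ (zeroˡ _)) (+-identityˡ y)

  V-at : ∀ f k → V f (3 ℕ.* k) ≡ f k
  V-at f zero = ≡.refl
  V-at f (suc k) = ≡.trans (≡.cong (V f) (ℕP.*-suc 3 k)) (V-at (tl f) k)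

  V-at1 : ∀ f k → V f (suc (3 ℕ.* k)) ≡ 0#
  V-at1 f zero = ≡.refl
  V-at1 f (suc k) = ≡.trans (≡.cong (λ m → V f (suc m)) (ℕP.*-suc 3 k)) (V-at1 (tl f) k)

  V-at2 : ∀ f k → V f (suc (suc (3 ℕ.* k))) ≡ 0#
  V-at2 f zero = ≡.refl
  V-at2 f (suc k) = ≡.trans (≡.cong (λ m → V f (suc (suc m))) (ℕP.*-suc 3 k)) (V-at2 (tl f) k)

  V-injective : ∀ {f g} → V f ≋ V g → f ≋ g
  V-injective {f} {g} p n = begin
    f n             ≡⟨ V-at f n ⟨
    V f (3 ℕ.* n)   ≈⟨ p (3 ℕ.* n) ⟩
    V g (3 ℕ.* n)   ≡⟨ V-at g n ⟩
    g n             ∎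

  data Mod3 : ℕ → Set where
    rem0 : ∀ k → Mod3 (3 ℕ.* k)
    rem1 : ∀ k → Mod3 (suc (3 ℕ.* k))
    rem2 : ∀ k → Mod3 (suc (suc (3 ℕ.* k)))

  mod3 : ∀ n → Mod3 n
  mod3 0 = rem0 0
  mod3 1 = rem1 0
  mod3 2 = rem2 0
  mod3 (suc (suc (suc n))) with mod3 n
  ... | rem0 k = ≡.subst Mod3 (ℕP.*-suc 3 k) (rem0 (suc k))
  ... | rem1 k = ≡.subst Mod3 (≡.cong suc (ℕP.*-suc 3 k)) (rem1 (suc k))
  ... | rem2 k = ≡.subst Mod3 (≡.cong (λ m → suc (suc m)) (ℕP.*-suc 3 k)) (rem2 (suc k))

  V-mon : ∀ c i → V (mon c i) ≋ mon c (3 ℕ.* i)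
  V-mon c i n with mod3 n
  ... | rem0 k = trans (reflexive (V-at (mon c i) k)) (eq (i ℕP.≟ k))
    where
    eq : _ → mon c i k ≈ mon c (3 ℕ.* i) (3 ℕ.* k)
    eq (yes ≡.refl) = reflexive (≡.trans (mon-diag c i) (≡.sym (mon-diag c (3 ℕ.* i))))
    eq (no i≢k) = reflexive (≡.trans (mon-off c i k i≢k) (≡.sym (mon-off c (3 ℕ.* i) (3 ℕ.* k) (λ e → i≢k (ℕP.*-cancelˡ-≡ i k 3 e)))))
  ... | rem1 k = trans (reflexive (V-at1 (mon c i) k)) (reflexive (≡.sym (mon-off c (3 ℕ.* i) _ (off i k))))
    where
    off : ∀ i k → 3 ℕ.* i ≢ suc (3 ℕ.* k)
    off (suc i) (suc k) e rewrite ℕP.*-suc 3 i | ℕP.*-suc 3 k = off i k (ℕP.+-cancelˡ-≡ 3 _ _ e)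
    off (suc i) zero e rewrite ℕP.*-suc 3 i with () ← e
  ... | rem2 k = trans (reflexive (V-at2 (mon c i) k)) (reflexive (≡.sym (mon-off c (3 ℕ.* i) _ (off i k))))
    where
    off : ∀ i k → 3 ℕ.* i ≢ suc (suc (3 ℕ.* k))
    off (suc i) (suc k) e rewrite ℕP.*-suc 3 i | ℕP.*-suc 3 k = off i k (ℕP.+-cancelˡ-≡ 3 _ _ e)
    off (suc i) zero e rewrite ℕP.*-suc 3 i with () ← e

  -- The derivation q d/dq. Unlike d/dq it keeps the exponents, so its relation to `V` is just the
  -- factor 3 of `D-V`.
  D : Ser → Ser
  D f n = RI.nat n * f n

  D-cong : ∀ {f g} → f ≋ g → D f ≋ D g
  D-cong p n = *-congˡ (p n)

  D-+ : ∀ f g → D (f ⊞ g) ≋ D f ⊞ D g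
  D-+ f g n = distribˡ _ _ _

  D-neg : ∀ f → D (λ n → - f n) ≋ λ n → - D f n
  D-neg f n = sym (-‿distribʳ-* _ _)

  D-mul : ∀ f g → D (mul f g) ≋ mul (D f) g ⊞ mul f (D g)
  D-mul f g zero = begin
    0# * (f 0 * g 0)                         ≈⟨ zeroˡ _ ⟩
    0#                                       ≈⟨ trans (+-cong (trans (*-congʳ (zeroˡ _)) (zeroˡ _)) (trans (*-congˡ (zeroˡ _)) (zeroʳ _))) (+-identityˡ 0#) ⟨
    0# * f 0 * g 0 + f 0 * (0# * g 0)        ∎
  D-mul f g (suc n) = begin
    nat (suc n) * (f 0 * g (suc n) + mul (tl f) g n)
      ≈⟨ distribˡ _ _ _ ⟩
    nat (suc n) * (f 0 * g (suc n)) + nat (suc n) * mul (tl f) g n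
      ≈⟨ +-cong (trans (sym (*-assoc _ _ _)) (trans (*-congʳ (*-comm _ _)) (*-assoc _ _ _)))
           (trans (*-congʳ (RI.nat-suc n)) (trans (distribʳ _ _ _) (+-cong (*-identityˡ _) (D-mul (tl f) g n)))) ⟩
    f 0 * D g (suc n) + (mul (tl f) g n + (mul (D (tl f)) g n + mul (tl f) (D g) n))
      ≈⟨ +-congˡ (+-assoc _ _ _) ⟨
    f 0 * D g (suc n) + (mul (tl f) g n + mul (D (tl f)) g n + mul (tl f) (D g) n)
      ≈⟨ +-congˡ (+-congʳ tails) ⟩
    f 0 * D g (suc n) + (mul (tl (D f)) g n + mul (tl f) (D g) n)
      ≈⟨ trans (sym (+-assoc _ _ _)) (trans (+-congʳ (+-comm _ _)) (+-assoc _ _ _)) ⟩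
    mul (tl (D f)) g n + (f 0 * D g (suc n) + mul (tl f) (D g) n)
      ≈⟨ +-congʳ (trans (+-congʳ (trans (*-congʳ (zeroˡ _)) (zeroˡ _))) (+-identityˡ _)) ⟨
    0# * f 0 * g (suc n) + mul (tl (D f)) g n + (f 0 * D g (suc n) + mul (tl f) (D g) n) ∎
    where
    open RI using (nat)
    tails : mul (tl f) g n + mul (D (tl f)) g n ≈ mul (tl (D f)) g n
    tails = trans (sym (mul-distribʳ g (tl f) (D (tl f)) n))
      (mul-cong {tl f ⊞ D (tl f)} {tl (D f)} {g} {g} (λ i → sym (trans (*-congʳ (RI.nat-suc i)) (trans (distribʳ _ _ _) (+-congʳ (*-identityˡ _))))) (λ _ → refl) n)

  D-V : ∀ f → D (V f) ≋ V (λ n → RI.nat 3 * D f n)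
  D-V f n with mod3 n
  ... | rem0 k = begin
    RI.nat (3 ℕ.* k) * V f (3 ℕ.* k)             ≈⟨ *-cong (RI.nat-* 3 k) (reflexive (V-at f k)) ⟩
    RI.nat 3 * RI.nat k * f k                    ≈⟨ *-assoc _ _ _ ⟩
    RI.nat 3 * D f k                             ≡⟨ V-at (λ n → RI.nat 3 * D f n) k ⟨
    V (λ n → RI.nat 3 * D f n) (3 ℕ.* k)         ∎
  ... | rem1 k = trans (*-congˡ (reflexive (V-at1 f k))) (trans (zeroʳ _) (reflexive (≡.sym (V-at1 (λ n → RI.nat 3 * D f n) k))))
  ... | rem2 k = trans (*-congˡ (reflexive (V-at2 f k))) (trans (zeroʳ _) (reflexive (≡.sym (V-at2 (λ n → RI.nat 3 * D f n) k))))

module FiniteSums (R : CommutativeRing 0ℓ 0ℓ) where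
  open CommutativeRing R hiding (zero)
  open SetoidReasoning setoid

  -- Σ_{a+b=n} f a b, in order of increasing b.
  ∑ₐ : ℕ → (ℕ → ℕ → Carrier) → Carrier
  ∑ₐ zero f = f 0 0
  ∑ₐ (suc n) f = f (suc n) 0 + ∑ₐ n (λ a b → f a (suc b))

  ∑ₐ-cong : ∀ n {f g} → (∀ a b → a ℕ.+ b ≡ n → f a b ≈ g a b) → ∑ₐ n f ≈ ∑ₐ n g
  ∑ₐ-cong zero p = p 0 0 ≡.refl
  ∑ₐ-cong (suc n) p = +-cong (p (suc n) 0 (ℕP.+-identityʳ _)) (∑ₐ-cong n (λ a b e → p a (suc b) (≡.trans (ℕP.+-suc a b) (≡.cong suc e))))

  ∑ₐ-last : ∀ n f → ∑ₐ (suc n) f ≈ ∑ₐ n (λ a b → f (suc a) b) + f 0 (suc n)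
  ∑ₐ-last zero f = refl
  ∑ₐ-last (suc n) f = trans (+-congˡ (∑ₐ-last n (λ a b → f a (suc b)))) (sym (+-assoc _ _ _))

  ∑ₐ-+ : ∀ n f g → ∑ₐ n (λ a b → f a b + g a b) ≈ ∑ₐ n f + ∑ₐ n g
  ∑ₐ-+ zero f g = refl
  ∑ₐ-+ (suc n) f g = trans (+-congˡ (∑ₐ-+ n _ _)) (Series.interchange R _ _ _ _)

  ∑ₐ-*ˡ : ∀ n c f → c * ∑ₐ n f ≈ ∑ₐ n (λ a b → c * f a b)
  ∑ₐ-*ˡ zero c f = refl
  ∑ₐ-*ˡ (suc n) c f = trans (distribˡ _ _ _) (+-congˡ (∑ₐ-*ˡ n c _))

  ∏ : ℕ → (ℕ → Carrier) → Carrier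
  ∏ zero f = 1#
  ∏ (suc n) f = f n * ∏ n f

-- Triangular numbers with integer index

tri : ℕ → ℕ
tri zero = 0
tri (suc n) = suc n ℕ.+ tri n

-- tr i l = t (i − l), where t m = m (m + 1) / 2; hence tr l i = t (i − l − 1).
tr : ℕ → ℕ → ℕ
tr i zero = tri i
tr zero (suc l) = tri l
tr (suc i) (suc l) = tr i l

tri-≥ : ∀ n → n ℕ.≤ tri n
tri-≥ zero = z≤n
tri-≥ (suc n) = ℕP.m≤m+n (suc n) (tri n)

-- The sum `tr i l + tr l i` is the square of i - l, which dominates i - l. This growth makes the
-- theta series converge degree by degree.
tr-degˡ : ∀ i l → i ℕ.≤ l ℕ.+ (tr i l ℕ.+ tr l i)
tr-degˡ i zero = ℕP.≤-trans (tri-≥ i) (ℕP.m≤m+n _ _)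
tr-degˡ zero (suc l) = z≤n
tr-degˡ (suc i) (suc l) = s≤s (tr-degˡ i l)

tr-degʳ : ∀ i l → l ℕ.≤ i ℕ.+ (tr i l ℕ.+ tr l i)
tr-degʳ i l = ≡.subst (λ d → l ℕ.≤ i ℕ.+ d) (ℕP.+-comm (tr l i) (tr i l)) (tr-degˡ l i)

-- The reflection t(-m - 1) = t(m).
tr-left : ∀ i l → tr l (suc i) ≡ tr i l
tr-left zero zero = ≡.refl
tr-left (suc i) zero = ≡.refl
tr-left zero (suc zero) = ≡.refl
tr-left zero (suc (suc l)) = ≡.refl
tr-left (suc i) (suc l) = tr-left i l

-- The recursion t(m) = m + t(m - 1) for m = i - l, with `l` moved across so that no subtraction
-- occurs.
tr-diff : ∀ i l → l ℕ.+ tr i l ≡ i ℕ.+ tr l i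
tr-diff zero zero = ≡.refl
tr-diff (suc i) zero = ≡.refl
tr-diff zero (suc l) = ≡.refl
tr-diff (suc i) (suc l) = ≡.cong suc (tr-diff i l)

tr-step : ∀ i l → l ℕ.+ tr (suc i) l ≡ suc i ℕ.+ tr i l
tr-step i l = ≡.trans (tr-diff (suc i) l) (≡.cong (suc i ℕ.+_) (tr-left i l))

-- Power series in two variables and the finite triple product

module Bivariate (K : CommutativeRing 0ℓ 0ℓ) where
  open CommutativeRing K hiding (zero)
  open SetoidReasoning setoid
  module P = Series K
  module S = Series P.seriesRing
  module PR = CommutativeRing P.seriesRing
  module SR = CommutativeRing S.seriesRing
  module SF = FiniteSums S.seriesRing
  module PF = FiniteSums P.seriesRing

  Ser² : Set
  Ser² = ℕ → ℕ → Carrier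

  infix 4 _≊[_]_
  _≊[_]_ : Ser² → ℕ → Ser² → Set
  F ≊[ N ] G = ∀ i j → i ℕ.+ j ℕ.< N → F i j ≈ G i j

  ≊-of : ∀ {N F G} → F SR.≈ G → F ≊[ N ] G
  ≊-of p i j _ = p i j

  ≊-all : ∀ {F G} → (∀ N → F ≊[ N ] G) → F SR.≈ G
  ≊-all p i j = p (suc (i ℕ.+ j)) i j ℕP.≤-refl

  ≊-≤ : ∀ {M N F G} → M ℕ.≤ N → F ≊[ N ] G → F ≊[ M ] G
  ≊-≤ le p i j l = p i j (ℕP.≤-trans l le)

  ≊-+ : ∀ {N F F′ G G′} → F ≊[ N ] F′ → G ≊[ N ] G′ → F SR.+ G ≊[ N ] F′ SR.+ G′
  ≊-+ p q i j l = +-cong (p i j l) (q i j l)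

  ≊-neg : ∀ {N F F′} → F ≊[ N ] F′ → SR.- F ≊[ N ] SR.- F′
  ≊-neg p i j l = -‿cong (p i j l)

  *-box : ∀ F F′ G G′ I J → (∀ i j → i ℕ.≤ I → j ℕ.≤ J → F i j ≈ F′ i j) → (∀ i j → i ℕ.≤ I → j ℕ.≤ J → G i j ≈ G′ i j) →
    (F SR.* G) I J ≈ (F′ SR.* G′) I J
  *-box F F′ G G′ zero J p q = P.mul-cong[] {suc J} (λ j l → p 0 j z≤n (ℕP.≤-pred l)) (λ j l → q 0 j z≤n (ℕP.≤-pred l)) J ℕP.≤-refl
  *-box F F′ G G′ (suc I) J p q = +-cong
    (P.mul-cong[] {suc J} (λ j l → p 0 j z≤n (ℕP.≤-pred l)) (λ j l → q (suc I) j ℕP.≤-refl (ℕP.≤-pred l)) J ℕP.≤-refl)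
    (*-box (S.tl F) (S.tl F′) G G′ I J (λ i j l → p (suc i) j (s≤s l)) (λ i j l → q i j (ℕP.m≤n⇒m≤1+n l)))

  ≊-* : ∀ {N F F′ G G′} → F ≊[ N ] F′ → G ≊[ N ] G′ → F SR.* G ≊[ N ] F′ SR.* G′
  ≊-* {N} {F} {F′} {G} {G′} p q I J l = *-box F F′ G G′ I J
    (λ i j li lj → p i j (ℕP.≤-<-trans (ℕP.+-mono-≤ li lj) l)) (λ i j li lj → q i j (ℕP.≤-<-trans (ℕP.+-mono-≤ li lj) l))

  *-vanish : ∀ F G I J → (∀ i i′ j j′ → i ℕ.+ i′ ≡ I → j ℕ.+ j′ ≡ J → F i j ≈ 0# ⊎ G i′ j′ ≈ 0#) → (F SR.* G) I J ≈ 0#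
  *-vanish F G zero J h = P.mul-vanish (F 0) (G 0) J (λ j j′ e → h 0 0 j j′ ≡.refl e)
  *-vanish F G (suc I) J h = trans (+-cong
    (P.mul-vanish (F 0) (G (suc I)) J (λ j j′ e → h 0 (suc I) j j′ ≡.refl e))
    (*-vanish (S.tl F) G I J (λ i i′ j j′ e e′ → h (suc i) i′ j j′ (≡.cong suc e) e′))) (+-identityˡ 0#)

  mono : Carrier → ℕ → ℕ → Ser²
  mono c i j = S.mon (P.mon c j) i

  mono-mul : ∀ c d i i′ j j′ → mono c i j SR.* mono d i′ j′ SR.≈ mono (c * d) (i ℕ.+ i′) (j ℕ.+ j′)
  mono-mul c d i i′ j j′ = SR.trans (S.mon-mul (P.mon c j) (P.mon d j′) i i′) (S.mon-cong (i ℕ.+ i′) (P.mon-mul c d j j′))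

  mono-cong : ∀ {c d} i j → c ≈ d → mono c i j SR.≈ mono d i j
  mono-cong i j p = S.mon-cong i (P.mon-cong j p)

  mono-at : ∀ c i j → mono c i j i j ≈ c
  mono-at c i j = reflexive (≡.trans (≡.cong (λ f → f j) (S.mon-diag (P.mon c j) i)) (P.mon-diag c j))

  mono-off : ∀ c i j I J → (i ≡ I → j ≡ J → ⊥) → mono c i j I J ≈ 0#
  mono-off c i j I J h with i ℕP.≟ I | j ℕP.≟ J
  ... | yes ≡.refl | yes ≡.refl = ⊥-elim (h ≡.refl ≡.refl)
  ... | yes ≡.refl | no j≢J = reflexive (≡.trans (≡.cong (λ f → f J) (S.mon-diag (P.mon c j) i)) (P.mon-off c j J j≢J))
  ... | no i≢I | _ = reflexive (≡.cong (λ f → f J) (S.mon-off (P.mon c j) i I i≢I))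

  mono-low : ∀ {N} c i j → N ℕ.≤ i ℕ.+ j → mono c i j ≊[ N ] SR.0#
  mono-low c i j le I J l = mono-off c i j I J (λ { ≡.refl ≡.refl → ℕP.<⇒≱ l le })

  *-mono-low : ∀ {M N} F c i j → F ≊[ M ] SR.0# → N ℕ.≤ M ℕ.+ (i ℕ.+ j) → F SR.* mono c i j ≊[ N ] SR.0#
  *-mono-low {M} {N} F c i j p le I J l = *-vanish F (mono c i j) I J h
    where
    h : ∀ a a′ b b′ → a ℕ.+ a′ ≡ I → b ℕ.+ b′ ≡ J → F a b ≈ 0# ⊎ mono c i j a′ b′ ≈ 0#
    h a a′ b b′ e e′ with a ℕ.+ b ℕP.<? M
    ... | yes lt = inj₁ (p a b lt)
    ... | no ge = inj₂ (mono-off c i j a′ b′ (λ { ≡.refl ≡.refl → ℕP.<⇒≱ l (ℕP.≤-trans le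
            (≡.subst (M ℕ.+ (i ℕ.+ j) ℕ.≤_) (≡.trans (rearr a b i j) (≡.cong₂ ℕ._+_ e e′)) (ℕP.+-monoˡ-≤ (i ℕ.+ j) (ℕP.≮⇒≥ ge)))) }))
      where
      rearr : ∀ a b i j → a ℕ.+ b ℕ.+ (i ℕ.+ j) ≡ a ℕ.+ i ℕ.+ (b ℕ.+ j)
      rearr = ℕ-solve-∀

  -- ι substitutes XY for q, δ extracts the diagonal.
  ι : P.Ser → Ser²
  ι g zero zero = g 0
  ι g zero (suc j) = 0#
  ι g (suc i) zero = 0#
  ι g (suc i) (suc j) = ι (P.tl g) i j

  δ : Ser² → P.Ser
  δ F n = F n n

  private
    sh : P.Ser → P.Ser
    sh f zero = 0#
    sh f (suc j) = f j

    shY : Ser² → Ser²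
    shY H i = sh (H i)

    shY-zero : ∀ H F i → (shY H SR.* F) i 0 ≈ 0#
    shY-zero H F zero = zeroˡ _
    shY-zero H F (suc i) = trans (+-cong (zeroˡ _) (shY-zero (S.tl H) F i)) (+-identityˡ 0#)

    shY-suc : ∀ H F i j → (shY H SR.* F) i (suc j) ≈ (H SR.* F) i j
    shY-suc H F zero j = trans (+-congʳ (zeroˡ _)) (+-identityˡ _)
    shY-suc H F (suc i) j = +-cong (trans (+-congʳ (zeroˡ _)) (+-identityˡ _)) (shY-suc (S.tl H) F i j)

    ι-row : ∀ g → ι g 0 P.≋ P.mon (g 0) 0
    ι-row g zero = refl
    ι-row g (suc j) = refl

    ι-tail : ∀ g i → ι g (suc i) P.≋ shY (ι (P.tl g)) i
    ι-tail g i zero = refl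
    ι-tail g i (suc j) = refl

    row-mul : ∀ g f j → P.mul (ι g 0) f j ≈ g 0 * f j
    row-mul g f j = trans (P.mul-cong (ι-row g) (λ _ → refl) j) (P.mon0-mul (g 0) f j)

    tail-mul : ∀ g F i j → (S.tl (ι g) SR.* F) i j ≈ (shY (ι (P.tl g)) SR.* F) i j
    tail-mul g F i j = S.mul-cong (ι-tail g) (λ _ _ → refl) i j

  ι*-0 : ∀ g F j → (ι g SR.* F) 0 j ≈ g 0 * F 0 j
  ι*-0 g F j = row-mul g (F 0) j

  ι*-suc0 : ∀ g F i → (ι g SR.* F) (suc i) 0 ≈ g 0 * F (suc i) 0
  ι*-suc0 g F i = trans (+-cong (row-mul g (F (suc i)) 0) (trans (tail-mul g F i 0) (shY-zero (ι (P.tl g)) F i))) (+-identityʳ _)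

  ι*-suc : ∀ g F i j → (ι g SR.* F) (suc i) (suc j) ≈ g 0 * F (suc i) (suc j) + (ι (P.tl g) SR.* F) i j
  ι*-suc g F i j = +-cong (row-mul g (F (suc i)) (suc j)) (trans (tail-mul g F i (suc j)) (shY-suc (ι (P.tl g)) F i j))

  -- Linearity of `δ` over the series in q = XY: multiplication by a diagonal monomial maps the
  -- diagonal to itself and nothing else into it.
  δ-ι* : ∀ g F → δ (ι g SR.* F) P.≋ P.mul g (δ F)
  δ-ι* g F zero = ι*-0 g F 0
  δ-ι* g F (suc n) = trans (ι*-suc g F n n) (+-congˡ (δ-ι* (P.tl g) F n))

  ι-cong : ∀ {f g} → f P.≋ g → ι f SR.≈ ι g
  ι-cong p zero zero = p 0
  ι-cong p zero (suc j) = refl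
  ι-cong p (suc i) zero = refl
  ι-cong p (suc i) (suc j) = ι-cong (λ n → p (suc n)) i j

  ι-+ : ∀ f g → ι (f P.⊞ g) SR.≈ ι f SR.+ ι g
  ι-+ f g zero zero = refl
  ι-+ f g zero (suc j) = sym (+-identityˡ _)
  ι-+ f g (suc i) zero = sym (+-identityˡ _)
  ι-+ f g (suc i) (suc j) = ι-+ (P.tl f) (P.tl g) i j

  ι-• : ∀ c f i j → ι (c P.• f) i j ≈ c * ι f i j
  ι-• c f zero zero = refl
  ι-• c f zero (suc j) = sym (zeroʳ _)
  ι-• c f (suc i) zero = sym (zeroʳ _)
  ι-• c f (suc i) (suc j) = ι-• c (P.tl f) i j

  ι-mul : ∀ f g → ι (P.mul f g) SR.≈ ι f SR.* ι g
  ι-mul f g zero zero = sym (ι*-0 f (ι g) 0)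
  ι-mul f g zero (suc j) = sym (trans (ι*-0 f (ι g) (suc j)) (zeroʳ _))
  ι-mul f g (suc i) zero = sym (trans (ι*-suc0 f (ι g) i) (zeroʳ _))
  ι-mul f g (suc i) (suc j) = begin
    ι (f 0 P.• P.tl g P.⊞ P.mul (P.tl f) g) i j                  ≈⟨ ι-+ (f 0 P.• P.tl g) (P.mul (P.tl f) g) i j ⟩
    ι (f 0 P.• P.tl g) i j + ι (P.mul (P.tl f) g) i j            ≈⟨ +-cong (ι-• (f 0) (P.tl g) i j) (ι-mul (P.tl f) g i j) ⟩
    f 0 * ι (P.tl g) i j + (ι (P.tl f) SR.* ι g) i j             ≈⟨ ι*-suc f (ι g) i j ⟨
    (ι f SR.* ι g) (suc i) (suc j)                               ∎

  ι-0 : ι P.0ₛ SR.≈ SR.0#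
  ι-0 zero zero = refl
  ι-0 zero (suc j) = refl
  ι-0 (suc i) zero = refl
  ι-0 (suc i) (suc j) = ι-0 i j

  ι-1 : ι P.1ₛ SR.≈ SR.1#
  ι-1 zero zero = refl
  ι-1 zero (suc j) = refl
  ι-1 (suc i) zero = refl
  ι-1 (suc i) (suc j) = ι-0 i j

  mono-1 : mono 1# 0 0 SR.≈ SR.1#
  mono-1 zero zero = refl
  mono-1 zero (suc j) = refl
  mono-1 (suc i) j = refl

  ι-mon : ∀ c i → ι (P.mon c i) SR.≈ mono c i i
  ι-mon c zero zero zero = refl
  ι-mon c zero zero (suc b) = refl
  ι-mon c zero (suc a) zero = refl
  ι-mon c zero (suc a) (suc b) = ι-0 a b
  ι-mon c (suc i) zero zero = refl
  ι-mon c (suc i) zero (suc b) = refl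
  ι-mon c (suc i) (suc a) zero = sym (mono-off c (suc i) (suc i) (suc a) 0 (λ _ ()))
  ι-mon c (suc i) (suc a) (suc b) = trans (ι-mon c i a b) (shift i i a b)
    where
    shift : ∀ i j a b → mono c i j a b ≈ mono c (suc i) (suc j) (suc a) (suc b)
    shift zero j zero b = refl
    shift zero j (suc a) b = refl
    shift (suc i) j zero b = refl
    shift (suc i) j (suc a) b = shift i j a b

  ι-cong[] : ∀ {N f g} → f P.≋[ N ] g → ι f ≊[ N ] ι g
  ι-cong[] p zero zero l = p 0 l
  ι-cong[] p zero (suc j) l = refl
  ι-cong[] p (suc i) zero l = refl
  ι-cong[] {suc N} p (suc i) (suc j) l = ι-cong[] {N} (λ n l′ → p (suc n) (s≤s l′)) i j
    (ℕP.≤-trans (s≤s (ℕP.+-monoʳ-≤ i (ℕP.n≤1+n j))) (ℕP.≤-pred l))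

  infixl 7 _*ₚ_
  _*ₚ_ = PR._*_

  fq : ℕ → P.Ser
  fq n = PF.∏ n (λ j → PR.1# PR.+ PR.- P.q^ (suc j))

  euler : P.Ser
  euler n = fq n n

  fq-0 : ∀ n → fq n 0 ≈ 1#
  fq-0 zero = refl
  fq-0 (suc n) = trans (*-congʳ (trans (+-congˡ (Algebra.Properties.Ring.-0#≈0# ring)) (+-identityʳ _))) (trans (*-identityˡ _) (fq-0 n))

  fq-step : ∀ n → fq (suc n) P.≋[ suc n ] fq n
  fq-step n i l = trans (P.mul-cong[] {suc n} {f = PR.1# PR.+ PR.- P.q^ (suc n)} {PR.1#} {fq n} {fq n} low (λ _ _ → refl) i l) (P.mul-identityˡ (fq n) i)
    where
    low : (PR.1# PR.+ PR.- P.q^ (suc n)) P.≋[ suc n ] PR.1#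
    low i l = trans (+-congˡ (trans (-‿cong (reflexive (P.mon-off 1# (suc n) i (λ e → ℕP.<⇒≢ l (≡.sym e))))) (Algebra.Properties.Ring.-0#≈0# ring))) (+-identityʳ _)

  fq-stable : ∀ d n → fq (d ℕ.+ n) P.≋[ suc n ] fq n
  fq-stable zero n i l = refl
  fq-stable (suc d) n i l = trans (fq-step (d ℕ.+ n) i (ℕP.≤-trans l (s≤s (ℕP.m≤n+m n d)))) (fq-stable d n i l)

  euler-fq : ∀ N → euler P.≋[ suc N ] fq N
  euler-fq N n l = sym (trans (reflexive (≡.cong (λ m → fq m n) (≡.sym (ℕP.m∸n+n≡m (ℕP.≤-pred l))))) (fq-stable (N ℕ.∸ n) n n ℕP.≤-refl))

  -- Gaussian binomial coefficient (a+b choose b).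
  gauss : ℕ → ℕ → P.Ser
  gauss zero b = PR.1#
  gauss (suc a) zero = PR.1#
  gauss (suc a) (suc b) = gauss (suc a) b PR.+ P.q^ (suc b) *ₚ gauss a (suc b)

  gauss-0 : ∀ a → gauss a 0 ≡ PR.1#
  gauss-0 zero = ≡.refl
  gauss-0 (suc a) = ≡.refl

  private module PS = Integers P.seriesRing

  -- Induction along the Pascal rule. With x = q^(a+1) and y = q^(b+1) both summands reduce to the
  -- same product, with weights 1 - y and y (1 - x), and these add up to 1 - y x.
  gauss-fq : ∀ a b → fq a *ₚ (fq b *ₚ gauss a b) PR.≈ fq (a ℕ.+ b)
  gauss-fq zero b = PR.trans (PR.*-identityˡ _) (PR.*-identityʳ _)
  gauss-fq (suc a) zero = PR.trans (PR.*-congˡ (PR.*-identityˡ _)) (PR.trans (PR.*-identityʳ _) (PR.reflexive (≡.cong fq (≡.sym (ℕP.+-identityʳ (suc a))))))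
  gauss-fq (suc a) (suc b) = PR.trans
    (PS.solve 6 (λ x y u v g h → (PS.con (+ 1) PS.:- x) PS.:* u PS.:* ((PS.con (+ 1) PS.:- y) PS.:* v PS.:* (g PS.:+ y PS.:* h)) PS.:=
        (PS.con (+ 1) PS.:- y) PS.:* ((PS.con (+ 1) PS.:- x) PS.:* u PS.:* (v PS.:* g)) PS.:+ y PS.:* (PS.con (+ 1) PS.:- x) PS.:* (u PS.:* ((PS.con (+ 1) PS.:- y) PS.:* v PS.:* h)))
      PR.refl (P.q^ (suc a)) (P.q^ (suc b)) (fq a) (fq b) (gauss (suc a) b) (gauss a (suc b)))
    (PR.trans (PR.+-cong (PR.*-congˡ (gauss-fq (suc a) b)) (PR.*-congˡ (PR.trans (gauss-fq a (suc b)) (PR.reflexive (≡.cong fq (ℕP.+-suc a b))))))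
    (PR.trans (PS.solve 3 (λ x y w → (PS.con (+ 1) PS.:- y) PS.:* w PS.:+ y PS.:* (PS.con (+ 1) PS.:- x) PS.:* w PS.:= (PS.con (+ 1) PS.:- y PS.:* x) PS.:* w)
        PR.refl (P.q^ (suc a)) (P.q^ (suc b)) (fq (suc (a ℕ.+ b))))
    (PR.trans (PR.*-congʳ (PR.+-congˡ (PR.-‿cong (PR.trans (P.mon-mul 1# 1# (suc b) (suc a)) (PR.trans (P.mon-cong (suc b ℕ.+ suc a) (*-identityˡ 1#)) (PR.reflexive (≡.cong P.q^ idx)))))))
      (PR.reflexive (≡.cong fq (≡.cong suc (≡.sym (ℕP.+-suc a b))))))))
    where
    idx : suc b ℕ.+ suc a ≡ suc (suc (a ℕ.+ b))
    idx = ≡.cong suc (≡.trans (ℕP.+-suc b a) (≡.cong suc (ℕP.+-comm b a)))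

  fq-regular : ∀ n → P.Regular (fq n 0)
  fq-regular n = P.unit-regular (fq-0 n)

  gauss-sym : ∀ a b → gauss a b PR.≈ gauss b a
  gauss-sym a b = P.mul-cancel (fq b) _ _ (fq-regular b) (P.mul-cancel (fq a) _ _ (fq-regular a)
    (PR.trans (gauss-fq a b) (PR.trans (PR.reflexive (≡.cong fq (ℕP.+-comm a b))) (PR.trans (PR.sym (gauss-fq b a))
      (PS.solve 3 (λ x y z → x PS.:* (y PS.:* z) PS.:= y PS.:* (x PS.:* z)) PR.refl (fq b) (fq a) (gauss b a))))))

  -- Each end of the triple product needs its own Pascal rule: the defining one inserts a factor in
  -- Y (`H-left`), this one a factor in X (`H-right`).
  gauss-pascal′ : ∀ a b → gauss (suc a) (suc b) PR.≈ gauss a (suc b) PR.+ P.q^ (suc a) *ₚ gauss (suc a) b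
  gauss-pascal′ a b = PR.trans (gauss-sym (suc a) (suc b)) (PR.+-cong (gauss-sym (suc b) a) (PR.*-congˡ (gauss-sym b (suc a))))

  -- Gaussian binomials tend to the inverse Euler product. After multiplication by one more `euler`,
  -- the two Euler products may be read as `fq a` and `fq b` below order `N`, and `gauss-fq`
  -- applies.
  euler-gauss : ∀ a b N → N ℕ.≤ a → N ℕ.≤ b → euler *ₚ gauss a b P.≋[ N ] PR.1#
  euler-gauss a b N la lb = P.mul-cancel[] N euler _ _ (fq-regular 0) λ n l →
    trans (P.mul-cong[] {N} (λ i li → euler-fq a i (le la li))
             (P.mul-cong[] {N} (λ i li → euler-fq b i (le lb li)) (λ _ _ → refl)) n l)
    (trans (gauss-fq a b n) (trans (sym (euler-fq (a ℕ.+ b) n (le (ℕP.≤-trans la (ℕP.m≤m+n a b)) l))) (sym (PR.*-identityʳ euler n))))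
    where
    le : ∀ {a N n} → N ℕ.≤ a → n ℕ.< N → n ℕ.< suc a
    le l l′ = ℕP.≤-trans l′ (ℕP.m≤n⇒m≤1+n l)

  -- The finite triple product  Π_{j<k} (1 + X Q^j) Π_{j<l} (1 + Y Q^j) = Σ_m [k+l choose l+m]_Q X^{t m} Y^{t (m-1)}, with Q = XY.
  μ : ℕ → ℕ → Ser²
  μ i l = mono 1# (tr i l) (tr l i)

  Xfactor Yfactor : ℕ → Ser²
  Xfactor j = SR.1# SR.+ mono 1# (suc j) j
  Yfactor j = SR.1# SR.+ mono 1# j (suc j)

  H : ℕ → ℕ → ℕ → Ser²
  H n k l = SF.∑ₐ n (λ a b → ι (gauss a b) SR.* μ b l)

  mono-mono : ∀ i i′ j j′ k k′ l l′ → i ℕ.+ i′ ≡ k ℕ.+ k′ → j ℕ.+ j′ ≡ l ℕ.+ l′ →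
    mono 1# i j SR.* mono 1# i′ j′ SR.≈ mono 1# k l SR.* mono 1# k′ l′
  mono-mono i i′ j j′ k k′ l l′ e e′ = SR.trans (mono-mul 1# 1# i i′ j j′)
    (SR.trans (SR.reflexive (≡.cong₂ (mono (1# * 1#)) e e′)) (SR.sym (mono-mul 1# 1# k k′ l l′)))

  μ-left : ∀ b l → mono 1# l (suc l) SR.* μ b l SR.≈ mono 1# b b SR.* μ b (suc l)
  μ-left b l = mono-mono l (tr b l) (suc l) (tr l b) b (tr b (suc l)) b (tr (suc l) b) (≡.trans (tr-diff b l) (≡.cong (b ℕ.+_) (≡.sym (tr-left l b))))
    (≡.sym (tr-step l b))

  μ-right : ∀ a b k l → a ℕ.+ b ≡ k ℕ.+ l → mono 1# (suc k) k SR.* μ b l SR.≈ mono 1# a a SR.* μ (suc b) l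
  μ-right a b k l e = mono-mono (suc k) (tr b l) k (tr l b) a (tr (suc b) l) a (tr l (suc b))
    (ℕP.+-cancelˡ-≡ l _ _ (≡.trans (e₁ k l (tr b l)) (≡.trans (≡.cong (λ s → suc (s ℕ.+ tr b l)) (≡.sym e)) (≡.trans (e₂ a b (tr b l)) (≡.trans (≡.cong (a ℕ.+_) (≡.sym (tr-step b l))) (e₃ a l (tr (suc b) l)))))))
    (ℕP.+-cancelˡ-≡ l _ _ (≡.trans (e₄ k l (tr l b)) (≡.trans (≡.cong (ℕ._+ tr l b) (≡.sym e)) (≡.trans (ℕP.+-assoc a b _) (≡.trans (≡.cong (a ℕ.+_) (≡.trans (≡.sym (tr-diff b l)) (≡.cong (l ℕ.+_) (≡.sym (tr-left b l))))) (e₃ a l (tr l (suc b))))))))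
    where
    e₁ : ∀ k l t → l ℕ.+ (suc k ℕ.+ t) ≡ suc (k ℕ.+ l ℕ.+ t)
    e₁ = ℕ-solve-∀
    e₂ : ∀ a b t → suc (a ℕ.+ b ℕ.+ t) ≡ a ℕ.+ (suc b ℕ.+ t)
    e₂ = ℕ-solve-∀
    e₃ : ∀ a l t → a ℕ.+ (l ℕ.+ t) ≡ l ℕ.+ (a ℕ.+ t)
    e₃ = ℕ-solve-∀
    e₄ : ∀ k l t → l ℕ.+ (k ℕ.+ t) ≡ k ℕ.+ l ℕ.+ t
    e₄ = ℕ-solve-∀

  private
    -- The summation pattern of a Pascal rule: the antidiagonal n + 1 becomes two copies of the
    -- antidiagonal n, in which one or the other index has been lowered. Each boundary term belongs
    -- to one copy only.
    split : ∀ n (f g : ℕ → ℕ → Ser²) (h : ℕ → ℕ → Ser²) →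
      (∀ b → h 0 (suc b) SR.≈ f 0 b) → (∀ a → h (suc a) 0 SR.≈ g a 0) → (∀ a b → suc (suc (a ℕ.+ b)) ≡ suc n → h (suc a) (suc b) SR.≈ f (suc a) b SR.+ g a (suc b)) →
      SF.∑ₐ (suc n) h SR.≈ SF.∑ₐ n f SR.+ SF.∑ₐ n g
    split n f g h p₀ p₁ p = SR.trans (SF.∑ₐ-cong (suc n) {h} {λ a b → f′ a b SR.+ g′ a b} cases) (SR.trans (SF.∑ₐ-+ (suc n) f′ g′)
      (SR.+-cong (SR.+-identityˡ _) (SR.trans (SF.∑ₐ-last n g′) (SR.+-identityʳ _))))
      where
      f′ g′ : ℕ → ℕ → Ser²
      f′ a zero = SR.0#
      f′ a (suc b) = f a b
      g′ zero b = SR.0#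
      g′ (suc a) b = g a b
      cases : ∀ a b → a ℕ.+ b ≡ suc n → h a b SR.≈ f′ a b SR.+ g′ a b
      cases zero (suc b) e = SR.trans (p₀ b) (SR.sym (SR.+-identityʳ _))
      cases (suc a) zero e = SR.trans (p₁ a) (SR.sym (SR.+-identityˡ _))
      cases (suc a) (suc b) e = p a b (≡.trans (≡.cong suc (≡.sym (ℕP.+-suc a b))) e)

    pull : ∀ x g m y m′ → x SR.* m SR.≈ y SR.* m′ → x SR.* (g SR.* m) SR.≈ y SR.* g SR.* m′
    pull x g m y m′ e = SR.trans (SZ.solve 3 (λ x g m → x SZ.:* (g SZ.:* m) SZ.:= g SZ.:* (x SZ.:* m)) SR.refl x g m)
      (SR.trans (SR.*-congˡ e) (SZ.solve 3 (λ g y m → g SZ.:* (y SZ.:* m) SZ.:= y SZ.:* g SZ.:* m) SR.refl g y m′))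
      where module SZ = Integers S.seriesRing

    ι-q^* : ∀ i g → ι (P.q^ i *ₚ g) SR.≈ mono 1# i i SR.* ι g
    ι-q^* i g = SR.trans (ι-mul (P.q^ i) g) (SR.*-congʳ (ι-mon 1# i))

    expand : ∀ x h → (SR.1# SR.+ x) SR.* h SR.≈ h SR.+ x SR.* h
    expand x h = SR.trans (SR.distribʳ _ _ _) (SR.+-congʳ (SR.*-identityˡ _))

  H-left : ∀ n k l → Yfactor l SR.* H n k l SR.≈ H (suc n) k (suc l)
  H-left n k l = SR.trans (expand _ _) (SR.sym (SR.trans
    (split n (λ a b → ι (gauss a b) SR.* μ b l) (λ a b → mono 1# l (suc l) SR.* (ι (gauss a b) SR.* μ b l)) (λ a b → ι (gauss a b) SR.* μ b (suc l))
      (λ b → SR.refl)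
      (λ a → SR.sym (SR.trans (pull _ _ _ _ _ (μ-left 0 l)) (SR.*-congʳ (SR.trans (SR.*-congʳ mono-1) (SR.trans (SR.*-identityˡ _) (SR.reflexive (≡.cong ι (gauss-0 a))))))))
      (λ a b _ → SR.trans (SR.*-congʳ (SR.trans (ι-+ (gauss (suc a) b) (P.q^ (suc b) *ₚ gauss a (suc b))) (SR.+-congˡ (ι-q^* (suc b) (gauss a (suc b))))))
         (SR.trans (SR.distribʳ _ _ _) (SR.+-congˡ (SR.sym (pull _ _ _ _ _ (μ-left (suc b) l)))))))
    (SR.+-congˡ (SR.sym (SF.∑ₐ-*ˡ n _ _)))))

  H-right : ∀ n k l → n ≡ k ℕ.+ l → Xfactor k SR.* H n k l SR.≈ H (suc n) (suc k) l
  H-right n k l e = SR.trans (expand _ _) (SR.trans (SR.+-comm _ _) (SR.sym (SR.trans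
    (split n (λ a b → mono 1# a a SR.* ι (gauss a b) SR.* μ (suc b) l) (λ a b → ι (gauss a b) SR.* μ b l) (λ a b → ι (gauss a b) SR.* μ b l)
      (λ b → SR.*-congʳ (SR.sym (SR.trans (SR.*-congʳ mono-1) (SR.*-identityˡ _))))
      (λ a → SR.*-congʳ (SR.reflexive (≡.cong ι (≡.sym (gauss-0 a)))))
      (λ a b _ → SR.trans (SR.*-congʳ (SR.trans (ι-cong (gauss-pascal′ a b)) (SR.trans (ι-+ (gauss a (suc b)) (P.q^ (suc a) *ₚ gauss (suc a) b)) (SR.+-congˡ (ι-q^* (suc a) (gauss (suc a) b))))))
         (SR.trans (SR.distribʳ _ _ _) (SR.+-comm _ _))))
    (SR.+-congʳ (SR.trans (SF.∑ₐ-cong n (λ a b e′ → SR.sym (pull _ _ _ _ _ (μ-right a b k l (≡.trans e′ e))))) (SR.sym (SF.∑ₐ-*ˡ n _ _)))))))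

  G : ℕ → Ser²
  G N = SF.∏ N Xfactor SR.* SF.∏ N Yfactor

  finite-triple-product : ∀ N → G N SR.≈ H (N ℕ.+ N) N N
  finite-triple-product N = SR.trans (SR.*-congˡ (ys N)) (xs N N)
    where
    ys : ∀ l → SF.∏ l Yfactor SR.≈ H l 0 l
    ys zero = SR.sym (SR.trans (SR.*-cong ι-1 mono-1) (SR.*-identityˡ _))
    ys (suc l) = SR.trans (SR.*-congˡ (ys l)) (H-left l 0 l)
    xs : ∀ k l → SF.∏ k Xfactor SR.* H l 0 l SR.≈ H (k ℕ.+ l) k l
    xs zero l = SR.*-identityˡ _
    xs (suc k) l = SR.trans (SR.*-assoc _ _ _) (SR.trans (SR.*-congˡ (xs k l)) (H-right (k ℕ.+ l) k l ≡.refl))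

-- Families of monomials and affine maps of their exponents

-- The affine map (p, k) ↦ (a p + b k + e v, c p + d k + f v) on exponents.
record Affine : Set where
  field
    a b c d e f : ℤ
    {{det≢0}} : ℤ.NonZero (a ℤ.* d ℤ.- b ℤ.* c)

module _ (L : Affine) where
  open Affine L

  -- The translation is multiplied by a weight `v`: exponents add under multiplication of monomials,
  -- so translations have to add as well, and `Maps-+` adds the weights. A relation stated in ℤ
  -- leaves room for points whose image is not in ℕ².
  Maps : (v p k I J : ℕ) → Set
  Maps v p k I J = + I ≡ a ℤ.* + p ℤ.+ b ℤ.* + k ℤ.+ e ℤ.* + v × + J ≡ c ℤ.* + p ℤ.+ d ℤ.* + k ℤ.+ f ℤ.* + v

  Maps-+ : ∀ {v p k I J v′ p′ k′ I′ J′} → Maps v p k I J → Maps v′ p′ k′ I′ J′ →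
    Maps (v ℕ.+ v′) (p ℕ.+ p′) (k ℕ.+ k′) (I ℕ.+ I′) (J ℕ.+ J′)
  Maps-+ {v} {p} {k} {v′ = v′} {p′} {k′} (x , y) (x′ , y′) =
    ≡.trans (≡.cong₂ ℤ._+_ x x′) (lin a b e (+ p) (+ k) (+ v) (+ p′) (+ k′) (+ v′)) ,
    ≡.trans (≡.cong₂ ℤ._+_ y y′) (lin c d f (+ p) (+ k) (+ v) (+ p′) (+ k′) (+ v′))
    where
    lin : ∀ a b e p k v p′ k′ v′ → a ℤ.* p ℤ.+ b ℤ.* k ℤ.+ e ℤ.* v ℤ.+ (a ℤ.* p′ ℤ.+ b ℤ.* k′ ℤ.+ e ℤ.* v′) ≡
      a ℤ.* (p ℤ.+ p′) ℤ.+ b ℤ.* (k ℤ.+ k′) ℤ.+ e ℤ.* (v ℤ.+ v′)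
    lin = ℤ-solve-∀

  Maps-functional : ∀ {v p k I J I′ J′} → Maps v p k I J → Maps v p k I′ J′ → I ≡ I′ × J ≡ J′
  Maps-functional (x , y) (x′ , y′) = ℤP.+-injective (≡.trans x (≡.sym x′)) , ℤP.+-injective (≡.trans y (≡.sym y′))

  Maps-injective : ∀ {v p k p′ k′ I J} → Maps v p k I J → Maps v p′ k′ I J → p ≡ p′ × k ≡ k′
  Maps-injective {v} {p} {k} {p′} {k′} {I} {J} (x , y) (x′ , y′) =
    ℤP.+-injective (ℤP.*-cancelˡ-≡ (a ℤ.* d ℤ.- b ℤ.* c) (+ p) (+ p′) (≡.trans (cramer₁ x y) (≡.sym (cramer₁ x′ y′)))) ,
    ℤP.+-injective (ℤP.*-cancelˡ-≡ (a ℤ.* d ℤ.- b ℤ.* c) (+ k) (+ k′) (≡.trans (cramer₂ x y) (≡.sym (cramer₂ x′ y′))))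
    where
    cramer₁ : ∀ {p k} → + I ≡ a ℤ.* p ℤ.+ b ℤ.* k ℤ.+ e ℤ.* + v → + J ≡ c ℤ.* p ℤ.+ d ℤ.* k ℤ.+ f ℤ.* + v →
      (a ℤ.* d ℤ.- b ℤ.* c) ℤ.* p ≡ d ℤ.* + I ℤ.- b ℤ.* + J ℤ.- (d ℤ.* e ℤ.- b ℤ.* f) ℤ.* + v
    cramer₁ {p} {k} x y = ≡.trans (id a b c d e f p k (+ v)) (≡.cong₂ (λ I J → d ℤ.* I ℤ.- b ℤ.* J ℤ.- (d ℤ.* e ℤ.- b ℤ.* f) ℤ.* + v) (≡.sym x) (≡.sym y))
      where
      id : ∀ a b c d e f p k v → (a ℤ.* d ℤ.- b ℤ.* c) ℤ.* p ≡
        d ℤ.* (a ℤ.* p ℤ.+ b ℤ.* k ℤ.+ e ℤ.* v) ℤ.- b ℤ.* (c ℤ.* p ℤ.+ d ℤ.* k ℤ.+ f ℤ.* v) ℤ.- (d ℤ.* e ℤ.- b ℤ.* f) ℤ.* v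
      id = ℤ-solve-∀
    cramer₂ : ∀ {p k} → + I ≡ a ℤ.* p ℤ.+ b ℤ.* k ℤ.+ e ℤ.* + v → + J ≡ c ℤ.* p ℤ.+ d ℤ.* k ℤ.+ f ℤ.* + v →
      (a ℤ.* d ℤ.- b ℤ.* c) ℤ.* k ≡ a ℤ.* + J ℤ.- c ℤ.* + I ℤ.- (a ℤ.* f ℤ.- c ℤ.* e) ℤ.* + v
    cramer₂ {p} {k} x y = ≡.trans (id a b c d e f p k (+ v)) (≡.cong₂ (λ I J → a ℤ.* J ℤ.- c ℤ.* I ℤ.- (a ℤ.* f ℤ.- c ℤ.* e) ℤ.* + v) (≡.sym x) (≡.sym y))
      where
      id : ∀ a b c d e f p k v → (a ℤ.* d ℤ.- b ℤ.* c) ℤ.* k ≡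
        a ℤ.* (c ℤ.* p ℤ.+ d ℤ.* k ℤ.+ f ℤ.* v) ℤ.- c ℤ.* (a ℤ.* p ℤ.+ b ℤ.* k ℤ.+ e ℤ.* v) ℤ.- (a ℤ.* f ℤ.- c ℤ.* e) ℤ.* v
      id = ℤ-solve-∀

-- Exponents (x, y) of a sequence of monomials indexed by m = i − l ∈ ℤ.
record Exponents : Set where
  field
    x y : ℕ → ℕ → ℕ
    x-inv : ∀ i l → x (suc i) (suc l) ≡ x i l
    y-inv : ∀ i l → y (suc i) (suc l) ≡ y i l
    growthˡ : ∀ i l → i ℕ.≤ l ℕ.+ (x i l ℕ.+ y i l)
    growthʳ : ∀ i l → l ℕ.≤ i ℕ.+ (x i l ℕ.+ y i l)

difference-invariant : (x : ℕ → ℕ → ℕ) → (∀ i l → x (suc i) (suc l) ≡ x i l) → ∀ i l i′ l′ → i ℕ.+ l′ ≡ i′ ℕ.+ l → x i l ≡ x i′ l′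
difference-invariant x inv (suc i) (suc l) i′ l′ e = ≡.trans (inv i l) (difference-invariant x inv i l i′ l′ (ℕP.suc-injective (≡.trans e (ℕP.+-suc i′ l))))
difference-invariant x inv zero l (suc i′) (suc l′) e = ≡.trans (difference-invariant x inv zero l i′ l′ (ℕP.suc-injective e)) (≡.sym (inv i′ l′))
difference-invariant x inv (suc i) zero (suc i′) (suc l′) e = ≡.trans (difference-invariant x inv (suc i) zero i′ l′ (ℕP.suc-injective (≡.trans (≡.sym (ℕP.+-suc (suc i) l′)) e))) (≡.sym (inv i′ l′))
difference-invariant x inv zero l zero l′ e = ≡.cong (x 0) (≡.sym e)
difference-invariant x inv zero l (suc i′) zero ()
difference-invariant x inv (suc i) zero (suc i′) zero e = ≡.cong (λ i → x i 0) (≡.trans (≡.sym (ℕP.+-identityʳ _)) (≡.trans e (ℕP.+-identityʳ _)))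
difference-invariant x inv (suc i) zero zero l′ ()

-- Series indexed by the integers and the infinite triple product

module Theta (K : CommutativeRing 0ℓ 0ℓ) where
  open CommutativeRing K hiding (zero)
  open Bivariate K public
  open SetoidReasoning setoid
  module SI = Integers S.seriesRing

  module _ (E : Exponents) where
    open Exponents E

    term : ℕ → ℕ → Ser²
    term b N = mono 1# (x b N) (y b N)

    -- The index `b` stands for m = b - N, so the sum runs over -N ≤ m ≤ N. By the growth conditions
    -- |m| is at most the degree of the term, hence a coefficient of degree i + j is complete once N
    -- = i + j, as used in `family`.
    partial : ℕ → Ser²
    partial N = SF.∑ₐ (N ℕ.+ N) (λ a b → term b N)

    family : Ser²
    family i j = partial (i ℕ.+ j) i j

    term-inv : ∀ b N → term (suc b) (suc N) SR.≈ term b N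
    term-inv b N = SR.reflexive (≡.cong₂ (mono 1#) (x-inv b N) (y-inv b N))

    term-lowˡ : ∀ M N b → M ℕ.+ N ℕ.≤ b → term b N ≊[ M ] SR.0#
    term-lowˡ M N b le = mono-low 1# (x b N) (y b N) (ℕP.+-cancelʳ-≤ N M _ (ℕP.≤-trans le (ℕP.≤-trans (growthˡ b N) (ℕP.≤-reflexive (ℕP.+-comm N _)))))

    term-lowʳ : ∀ M N b → M ℕ.+ b ℕ.≤ N → term b N ≊[ M ] SR.0#
    term-lowʳ M N b le = mono-low 1# (x b N) (y b N) (ℕP.+-cancelʳ-≤ b M _ (ℕP.≤-trans le (ℕP.≤-trans (growthʳ b N) (ℕP.≤-reflexive (ℕP.+-comm b _)))))

    partial-suc : ∀ N → partial (suc N) ≊[ suc N ] partial N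
    partial-suc N rewrite ℕP.+-suc N N = λ i j l → begin
      (term 0 (suc N) SR.+ SF.∑ₐ (suc (N ℕ.+ N)) (λ a b → term (suc b) (suc N))) i j
        ≈⟨ +-cong (term-lowʳ (suc N) (suc N) 0 (ℕP.≤-reflexive (ℕP.+-identityʳ _)) i j l) (SF.∑ₐ-last (N ℕ.+ N) (λ a b → term (suc b) (suc N)) i j) ⟩
      0# + (SF.∑ₐ (N ℕ.+ N) (λ a b → term (suc b) (suc N)) i j + term (suc (suc (N ℕ.+ N))) (suc N) i j)
        ≈⟨ trans (+-identityˡ _) (+-cong (SF.∑ₐ-cong (N ℕ.+ N) (λ a b _ → term-inv b N) i j) (term-lowˡ (suc N) (suc N) (suc (suc (N ℕ.+ N))) (ℕP.≤-reflexive (≡.cong suc (ℕP.+-suc N N))) i j l)) ⟩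
      partial N i j + 0#
        ≈⟨ +-identityʳ _ ⟩
      partial N i j ∎

    family-partial : ∀ N → family ≊[ N ] partial N
    family-partial N i j l = sym (trans (reflexive (≡.cong (λ M → partial M i j) (≡.sym (ℕP.m∸n+n≡m (ℕP.<⇒≤ l))))) (go (N ℕ.∸ (i ℕ.+ j))))
      where
      go : ∀ d → partial (d ℕ.+ (i ℕ.+ j)) i j ≈ family i j
      go zero = refl
      go (suc d) = trans (partial-suc (d ℕ.+ (i ℕ.+ j)) i j (s≤s (ℕP.m≤n+m _ d))) (go d)

  ∑ₐ-≊ : ∀ {N} n {f g : ℕ → ℕ → Ser²} → (∀ a b → a ℕ.+ b ≡ n → f a b ≊[ N ] g a b) → SF.∑ₐ n f ≊[ N ] SF.∑ₐ n g
  ∑ₐ-≊ zero p = p 0 0 ≡.refl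
  ∑ₐ-≊ (suc n) {f} {g} p = ≊-+ {F = f (suc n) 0} {g (suc n) 0} (p (suc n) 0 (ℕP.+-identityʳ _)) (∑ₐ-≊ n (λ a b e → p a (suc b) (≡.trans (ℕP.+-suc a b) (≡.cong suc e))))

  -- Shifting the index loses the term m = -N and gains m = N + 1, and both have degree at least
  -- `N`. This is how invariance under a shift of the index survives truncation.
  family-shifted : ∀ E N → SF.∑ₐ (N ℕ.+ N) (λ a b → term E (suc b) N) ≊[ N ] family E
  family-shifted E N i j l = begin
    shiftedSum i j                                        ≈⟨ +-identityˡ _ ⟨
    0# + shiftedSum i j                                   ≈⟨ +-congʳ (term-lowʳ E N N 0 (ℕP.≤-reflexive (ℕP.+-identityʳ N)) i j l) ⟨
    term E 0 N i j + shiftedSum i j                       ≈⟨ SF.∑ₐ-last (N ℕ.+ N) (λ a b → term E b N) i j ⟩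
    partial E N i j + term E (suc (N ℕ.+ N)) N i j        ≈⟨ +-cong (sym (family-partial E N i j l)) (term-lowˡ E N N (suc (N ℕ.+ N)) (ℕP.n≤1+n _) i j l) ⟩
    family E i j + 0#                                     ≈⟨ +-identityʳ _ ⟩
    family E i j                                          ∎
    where
    shiftedSum : Ser²
    shiftedSum = SF.∑ₐ (N ℕ.+ N) (λ a b → term E (suc b) N)

  reversed : Exponents → Exponents
  reversed E = record
    { x = λ i l → x l i ; y = λ i l → y l i ; x-inv = λ i l → x-inv l i ; y-inv = λ i l → y-inv l i
    ; growthˡ = λ i l → growthʳ l i ; growthʳ = λ i l → growthˡ l i }
    where open Exponents E

  ∑ₐ-reverse : ∀ n f → SF.∑ₐ n f SR.≈ SF.∑ₐ n (λ a b → f b a)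
  ∑ₐ-reverse zero f = SR.refl
  ∑ₐ-reverse (suc n) f = SR.trans (SR.+-congˡ (∑ₐ-reverse n _)) (SR.trans (SR.+-comm _ _) (SR.sym (SF.∑ₐ-last n (λ a b → f b a))))

  family-reversed : ∀ E → family (reversed E) SR.≈ family E
  family-reversed E i j = begin
    family (reversed E) i j                                   ≈⟨ ∑ₐ-reverse (N ℕ.+ N) (λ a b → term (reversed E) b N) i j ⟩
    SF.∑ₐ (N ℕ.+ N) (λ a b → term (reversed E) a N) i j       ≈⟨ SF.∑ₐ-cong (N ℕ.+ N) (λ a b e → SR.reflexive (≡.cong₂ (mono 1#)
        (difference-invariant x x-inv N a b N (≡.sym (≡.trans (ℕP.+-comm b a) e))) (difference-invariant y y-inv N a b N (≡.sym (≡.trans (ℕP.+-comm b a) e))))) i j ⟩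
    family E i j                                              ∎
    where
    open Exponents E
    N = i ℕ.+ j

  thetaExponents : Exponents
  thetaExponents = record
    { x = tr ; y = λ i l → tr l i ; x-inv = λ _ _ → ≡.refl ; y-inv = λ _ _ → ≡.refl ; growthˡ = tr-degˡ ; growthʳ = tr-degʳ }

  T : Ser²
  T = family thetaExponents

  -- In the finite identity the Gaussian coefficient is correct only up to order min(a, b), which
  -- falls short of N by |b - N|. The monomial beside it has degree (b - N)², which makes up for the
  -- loss.
  triple-product : ∀ N → T ≊[ N ] ι euler SR.* G N
  triple-product N i j l = begin
    T i j                                                        ≈⟨ family-partial thetaExponents N i j l ⟩
    SF.∑ₐ (N ℕ.+ N) (λ a b → μ b N) i j                          ≈⟨ ∑ₐ-≊ (N ℕ.+ N) each i j l ⟩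
    SF.∑ₐ (N ℕ.+ N) (λ a b → ι euler SR.* (ι (gauss a b) SR.* μ b N)) i j  ≈⟨ SF.∑ₐ-*ˡ (N ℕ.+ N) (ι euler) (λ a b → ι (gauss a b) SR.* μ b N) i j ⟨
    (ι euler SR.* H (N ℕ.+ N) N N) i j                           ≈⟨ SR.*-congˡ {ι euler} (finite-triple-product N) i j ⟨
    (ι euler SR.* G N) i j                                       ∎
    where
    close : ∀ M g b → g P.≋[ M ] PR.1# → N ℕ.≤ M ℕ.+ (tr b N ℕ.+ tr N b) → μ b N ≊[ N ] ι g SR.* μ b N
    close M g b p le i j l = sym (begin
      (ι g SR.* μ b N) i j                                        ≈⟨ SI.solve 2 (λ g m → g SI.:* m SI.:= (g SI.:- SI.con (+ 1)) SI.:* m SI.:+ m) SR.refl (ι g) (μ b N) i j ⟩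
      ((ι g SR.- SR.1#) SR.* μ b N) i j + μ b N i j               ≈⟨ +-congʳ (*-mono-low {M} {N} (ι g SR.- SR.1#) 1# (tr b N) (tr N b) low le i j l) ⟩
      0# + μ b N i j                                              ≈⟨ +-identityˡ _ ⟩
      μ b N i j                                                   ∎)
      where
      low : (ι g SR.- SR.1#) ≊[ M ] SR.0#
      low i j l = trans (+-cong (trans (ι-cong[] p i j l) (ι-1 i j)) refl) (-‿inverseʳ _)
    each : ∀ a b → a ℕ.+ b ≡ N ℕ.+ N → μ b N ≊[ N ] ι euler SR.* (ι (gauss a b) SR.* μ b N)
    each a b e i j l = trans (closed (ℕP.≤-total b N) i j l)
      (SR.trans (SR.*-congʳ (ι-mul euler (gauss a b))) (SR.*-assoc (ι euler) (ι (gauss a b)) (μ b N)) i j)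
      where
      closed : b ℕ.≤ N ⊎ N ℕ.≤ b → μ b N ≊[ N ] ι (euler *ₚ gauss a b) SR.* μ b N
      closed (inj₁ b≤N) = close b (euler *ₚ gauss a b) b (euler-gauss a b b (ℕP.≤-trans b≤N N≤a) ℕP.≤-refl) (tr-degʳ b N)
        where
        N≤a : N ℕ.≤ a
        N≤a = ℕP.+-cancelʳ-≤ N N a (ℕP.≤-trans (ℕP.≤-reflexive (≡.sym e)) (ℕP.+-monoʳ-≤ a b≤N))
      closed (inj₂ N≤b) = close a (euler *ₚ gauss a b) b (euler-gauss a b a ℕP.≤-refl (ℕP.≤-trans a≤N N≤b))
        (ℕP.+-cancelˡ-≤ N N _ (≡.subst₂ ℕ._≤_ e (swapˡ a N _) (ℕP.+-monoʳ-≤ a (tr-degˡ b N))))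
        where
        a≤N : a ℕ.≤ N
        a≤N = ℕP.+-cancelʳ-≤ N a N (ℕP.≤-trans (ℕP.+-monoʳ-≤ a N≤b) (ℕP.≤-reflexive e))
        swapˡ : ∀ a n s → a ℕ.+ (n ℕ.+ s) ≡ n ℕ.+ (a ℕ.+ s)
        swapˡ = ℕ-solve-∀

-- Transport of series along affine maps of exponents

module Transports (K : CommutativeRing 0ℓ 0ℓ) where
  open CommutativeRing K hiding (zero)
  open Theta K public
  open SetoidReasoning setoid

  data Side : Set where
    source target : Side

  -- One monomial together with its image. A list of entries can be read at either end, and since
  -- products of entries are again entries, transports multiply.
  record Entry (L : Affine) (v : ℕ) : Set where
    constructor entry
    field
      coefficient : Carrier
      {p k I J} : ℕ
      maps : Maps L v p k I J

    pos : Side → ℕ × ℕ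
    pos source = p , k
    pos target = I , J

    monomial : Side → Ser²
    monomial s = mono coefficient (proj₁ (pos s)) (proj₂ (pos s))

  open Entry

  module _ {L : Affine} where

    ev : ∀ {v} → Side → List (Entry L v) → Ser²
    ev s [] = SR.0#
    ev s (x ∷ xs) = monomial x s SR.+ ev s xs

    infixr 7 _⊗_ _⊗⊗_
    _⊗_ : ∀ {v w} → Entry L v → Entry L w → Entry L (v ℕ.+ w)
    x ⊗ y = entry (coefficient x * coefficient y) (Maps-+ L (maps x) (maps y))

    _⊗⊗_ : ∀ {v w} → List (Entry L v) → List (Entry L w) → List (Entry L (v ℕ.+ w))
    [] ⊗⊗ ys = []
    (x ∷ xs) ⊗⊗ ys = map (x ⊗_) ys ++ xs ⊗⊗ ys

    ev-++ : ∀ {v} s (xs ys : List (Entry L v)) → ev s (xs ++ ys) SR.≈ ev s xs SR.+ ev s ys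
    ev-++ s [] ys = SR.sym (SR.+-identityˡ _)
    ev-++ s (x ∷ xs) ys = SR.trans (SR.+-congˡ (ev-++ s xs ys)) (SR.sym (SR.+-assoc _ _ _))

    monomial-⊗ : ∀ {v w} s (x : Entry L v) (y : Entry L w) → monomial (x ⊗ y) s SR.≈ monomial x s SR.* monomial y s
    monomial-⊗ source x y = SR.sym (mono-mul (coefficient x) (coefficient y) (p x) (p y) (k x) (k y))
    monomial-⊗ target x y = SR.sym (mono-mul (coefficient x) (coefficient y) (I x) (I y) (J x) (J y))

    ev-map-⊗ : ∀ {v w} s (x : Entry L v) (ys : List (Entry L w)) → ev s (map (x ⊗_) ys) SR.≈ monomial x s SR.* ev s ys
    ev-map-⊗ s x [] = SR.sym (SR.zeroʳ _)
    ev-map-⊗ s x (y ∷ ys) = SR.trans (SR.+-cong (monomial-⊗ s x y) (ev-map-⊗ s x ys)) (SR.sym (SR.distribˡ _ _ _))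

    ev-⊗⊗ : ∀ {v w} s (xs : List (Entry L v)) (ys : List (Entry L w)) → ev s (xs ⊗⊗ ys) SR.≈ ev s xs SR.* ev s ys
    ev-⊗⊗ s [] ys = SR.sym (SR.zeroˡ _)
    ev-⊗⊗ s (x ∷ xs) ys = SR.trans (ev-++ s (map (x ⊗_) ys) (xs ⊗⊗ ys))
      (SR.trans (SR.+-cong (ev-map-⊗ s x ys) (ev-⊗⊗ s xs ys)) (SR.sym (SR.distribʳ _ _ _)))

    ev-search : ∀ {v} s (xs : List (Entry L v)) a b → ev s xs a b ≈ 0# ⊎ Σ[ x ∈ Entry L v ] pos x s ≡ (a , b)
    ev-search s [] a b = inj₁ refl
    ev-search s (x ∷ xs) a b with proj₁ (pos x s) ℕP.≟ a | proj₂ (pos x s) ℕP.≟ b | ev-search s xs a b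
    ... | yes ≡.refl | yes ≡.refl | _ = inj₂ (x , ≡.refl)
    ... | _ | _ | inj₂ found = inj₂ found
    ... | no ne | _ | inj₁ z = inj₁ (trans (+-cong (mono-off (coefficient x) (proj₁ (pos x s)) (proj₂ (pos x s)) a b (λ e _ → ne e)) z) (+-identityˡ 0#))
    ... | yes _ | no ne | inj₁ z = inj₁ (trans (+-cong (mono-off (coefficient x) (proj₁ (pos x s)) (proj₂ (pos x s)) a b (λ _ e → ne e)) z) (+-identityˡ 0#))

    monomial-transfer : ∀ {v a b A B} (x : Entry L v) → Maps L v a b A B → monomial x source a b ≈ monomial x target A B
    monomial-transfer {v} {a} {b} {A} {B} x r with p x ℕP.≟ a | k x ℕP.≟ b
    ... | yes ≡.refl | yes ≡.refl with ≡.refl , ≡.refl ← Maps-functional L (maps x) r =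
      trans (mono-at (coefficient x) a b) (sym (mono-at (coefficient x) A B))
    ... | no ne | _ = trans (mono-off (coefficient x) (p x) (k x) a b (λ e _ → ne e))
          (sym (mono-off (coefficient x) (I x) (J x) A B (λ { ≡.refl ≡.refl → ne (proj₁ (Maps-injective L {v} (maps x) r)) })))
    ... | yes _ | no ne = trans (mono-off (coefficient x) (p x) (k x) a b (λ _ e → ne e))
          (sym (mono-off (coefficient x) (I x) (J x) A B (λ { ≡.refl ≡.refl → ne (proj₂ (Maps-injective L {v} (maps x) r)) })))

    ev-transfer : ∀ {v a b A B} (xs : List (Entry L v)) → Maps L v a b A B → ev source xs a b ≈ ev target xs A B
    ev-transfer [] r = refl
    ev-transfer (x ∷ xs) r = +-cong (monomial-transfer x r) (ev-transfer xs r)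

    negate : ∀ {v} → Entry L v → Entry L v
    negate x = entry (- coefficient x) (maps x)

    ev-negate : ∀ {v} s (xs : List (Entry L v)) → ev s (map negate xs) SR.≈ SR.- ev s xs
    ev-negate s [] = SR.sym (Algebra.Properties.Ring.-0#≈0# SR.ring)
    ev-negate s (x ∷ xs) = SR.trans (SR.+-cong (monomial-negate s) (ev-negate s xs)) (Algebra.Properties.Ring.-‿+-comm SR.ring _ _)
      where
      mono-neg : ∀ c i j → mono (- c) i j SR.≈ SR.- mono c i j
      mono-neg c i j I J with i ℕP.≟ I | j ℕP.≟ J
      ... | yes ≡.refl | yes ≡.refl = trans (mono-at (- c) i j) (-‿cong (sym (mono-at c i j)))
      ... | no ne | _ = trans (mono-off (- c) i j I J (λ e _ → ne e)) (sym (trans (-‿cong (mono-off c i j I J (λ e _ → ne e))) (Algebra.Properties.Ring.-0#≈0# ring)))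
      ... | yes _ | no ne = trans (mono-off (- c) i j I J (λ _ e → ne e)) (sym (trans (-‿cong (mono-off c i j I J (λ _ e → ne e))) (Algebra.Properties.Ring.-0#≈0# ring)))
      monomial-negate : ∀ s → monomial (negate x) s SR.≈ SR.- monomial x s
      monomial-negate source = mono-neg (coefficient x) (p x) (k x)
      monomial-negate target = mono-neg (coefficient x) (I x) (J x)

  -- A truncated series written as an explicit sum of monomials, the form needed to list its
  -- entries; `e` carries the exponents of the image.
  spread : ℕ → (ℕ → ℕ) → P.Ser → P.Ser
  spread zero e g = P.0ₛ
  spread (suc N) e g = P.mon (g N) (e N) P.⊞ spread N e g

  spread-self : ∀ g N → g P.≋[ N ] spread N (λ n → n) g
  spread-self g (suc N) n l with N ℕP.≟ n
  ... | yes ≡.refl = sym (trans (+-cong (reflexive (P.mon-diag (g N) N)) (empty N ℕP.≤-refl)) (+-identityʳ _))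
    where
    empty : ∀ M → M ℕ.≤ n → spread M (λ n → n) g n ≈ 0#
    empty zero _ = refl
    empty (suc M) le = trans (+-cong (reflexive (P.mon-off (g M) M n (ℕP.<⇒≢ le))) (empty M (ℕP.<⇒≤ le))) (+-identityˡ 0#)
  ... | no ne = sym (trans (+-cong (reflexive (P.mon-off (g N) N n ne)) (sym (spread-self g N n (ℕP.≤∧≢⇒< (ℕP.≤-pred l) (λ e → ne (≡.sym e)))))) (+-identityˡ _))

  spread-V : ∀ f e g → (∀ N → f P.≋[ N ] spread N e g) → ∀ N → P.V f P.≋[ N ] spread N (λ n → 3 ℕ.* e n) g
  spread-V f e g h N n l = trans (P.V-cong[] (h N) n l) (V-spread N n)
    where
    V-spread : ∀ N → P.V (spread N e g) P.≋ spread N (λ n → 3 ℕ.* e n) g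
    V-spread zero = P.V-0
    V-spread (suc N) = PR.trans (P.V-+ (P.mon (g N) (e N)) (spread N e g)) (PR.+-cong (P.V-mon (g N) (e N)) (V-spread N))

  -- F′ is obtained from F by applying the affine map L, with shift v, to the exponents of all monomials.
  -- L need not preserve ℕ², but F must be supported where it does.
  Transport : Affine → ℕ → Ser² → Ser² → Set
  Transport L v F F′ = ∀ N → Σ[ xs ∈ List (Entry L v) ] (F ≊[ N ] ev source xs × F′ ≊[ N ] ev target xs)

  module _ {L : Affine} where

    transport-≈ : ∀ {v F F′ G G′} → F SR.≈ G → F′ SR.≈ G′ → Transport L v F F′ → Transport L v G G′
    transport-≈ p q t N with xs , a , b ← t N = xs , (λ i j l → trans (sym (p i j)) (a i j l)) , (λ i j l → trans (sym (q i j)) (b i j l))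

    transport-* : ∀ {v w F F′ G G′} → Transport L v F F′ → Transport L w G G′ → Transport L (v ℕ.+ w) (F SR.* G) (F′ SR.* G′)
    transport-* {F = F} {F′} {G} {G′} t u N with xs , a , b ← t N | ys , c , d ← u N =
      xs ⊗⊗ ys ,
      (λ i j l → trans (≊-* {F = F} {ev source xs} {G} {ev source ys} a c i j l) (sym (ev-⊗⊗ source xs ys i j))) ,
      (λ i j l → trans (≊-* {F = F′} {ev target xs} {G′} {ev target ys} b d i j l) (sym (ev-⊗⊗ target xs ys i j)))

    transport-+ : ∀ {v F F′ G G′} → Transport L v F F′ → Transport L v G G′ → Transport L v (F SR.+ G) (F′ SR.+ G′)
    transport-+ t u N with xs , a , b ← t N | ys , c , d ← u N =
      xs ++ ys ,
      (λ i j l → trans (+-cong (a i j l) (c i j l)) (sym (ev-++ source xs ys i j))) ,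
      (λ i j l → trans (+-cong (b i j l) (d i j l)) (sym (ev-++ target xs ys i j)))

    transport-neg : ∀ {v F F′} → Transport L v F F′ → Transport L v (SR.- F) (SR.- F′)
    transport-neg t N with xs , a , b ← t N =
      map negate xs ,
      (λ i j l → trans (-‿cong (a i j l)) (sym (ev-negate source xs i j))) ,
      (λ i j l → trans (-‿cong (b i j l)) (sym (ev-negate target xs i j)))

    transport-mono : ∀ {v i j I J} c → Maps L v i j I J → Transport L v (mono c i j) (mono c I J)
    transport-mono c r N = entry c r ∷ [] , (λ i j l → sym (+-identityʳ _)) , (λ i j l → sym (+-identityʳ _))

    -- The order of truncation exceeds both degrees, because the map need not respect the degree.
    -- Functionality and injectivity of the map then make both coefficients sums over the same
    -- entries.
    transport-coefficient : ∀ {v F F′ a b A B} → Transport L v F F′ → Maps L v a b A B → F a b ≈ F′ A B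
    transport-coefficient {a = a} {b} {A} {B} t r with xs , p , q ← t (suc (a ℕ.+ b ℕ.+ (A ℕ.+ B))) =
      trans (p a b (s≤s (ℕP.m≤m+n _ _))) (trans (ev-transfer xs r) (sym (q A B (s≤s (ℕP.m≤n+m _ (a ℕ.+ b))))))

    -- The first alternative carries information: a monomial whose image would leave ℕ² must have
    -- coefficient zero.
    transport-source : ∀ {v F F′} → Transport L v F F′ → ∀ a b → F a b ≈ 0# ⊎ Σ[ A ∈ ℕ ] Σ[ B ∈ ℕ ] (Maps L v a b A B × F a b ≈ F′ A B)
    transport-source t a b with xs , p , q ← t (suc (a ℕ.+ b)) with ev-search source xs a b
    ... | inj₁ z = inj₁ (trans (p a b ℕP.≤-refl) z)
    ... | inj₂ (x , ≡.refl) = inj₂ (I x , J x , maps x , transport-coefficient t (maps x))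

    transport-target : ∀ {v F F′} → Transport L v F F′ → ∀ A B → F′ A B ≈ 0# ⊎ Σ[ a ∈ ℕ ] Σ[ b ∈ ℕ ] (Maps L v a b A B × F a b ≈ F′ A B)
    transport-target t A B with xs , p , q ← t (suc (A ℕ.+ B)) with ev-search target xs A B
    ... | inj₁ z = inj₁ (trans (q A B ℕP.≤-refl) z)
    ... | inj₂ (x , ≡.refl) = inj₂ (Entry.p x , k x , maps x , transport-coefficient t (maps x))

    entries : ∀ {v} → ℕ → (ℕ → Entry L v) → List (Entry L v)
    entries zero f = f 0 ∷ []
    entries (suc n) f = f 0 ∷ entries n (λ b → f (suc b))

    ev-entries : ∀ {v} s n (f : ℕ → Entry L v) → ev s (entries n f) SR.≈ SF.∑ₐ n (λ a b → monomial (f b) s)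
    ev-entries s zero f = SR.+-identityʳ _
    ev-entries s (suc n) f = SR.+-congˡ (ev-entries s n (λ b → f (suc b)))

    transport-family : ∀ {v} E E′ → (∀ i l → Maps L v (Exponents.x E i l) (Exponents.y E i l) (Exponents.x E′ i l) (Exponents.y E′ i l)) →
      Transport L v (family E) (family E′)
    transport-family {v} E E′ r N = entries (N ℕ.+ N) f ,
      (λ i j l → trans (family-partial E N i j l) (sym (ev-entries source (N ℕ.+ N) f i j))) ,
      (λ i j l → trans (family-partial E′ N i j l) (sym (ev-entries target (N ℕ.+ N) f i j)))
      where
      f : ℕ → Entry L v
      f b = entry 1# (r b N)

    transport-family-shifted : ∀ {v} E → (∀ i l → Maps L v (Exponents.x E i l) (Exponents.y E i l) (Exponents.x E (suc i) l) (Exponents.y E (suc i) l)) →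
      Transport L v (family E) (family E)
    transport-family-shifted {v} E r N = entries (N ℕ.+ N) f ,
      (λ i j l → trans (family-partial E N i j l) (sym (ev-entries source (N ℕ.+ N) f i j))) ,
      (λ i j l → trans (sym (family-shifted E N i j l)) (sym (ev-entries target (N ℕ.+ N) f i j)))
      where
      f : ℕ → Entry L v
      f b = entry 1# (r b N)

    transport-ι : ∀ e g g′ → (∀ N → g′ P.≋[ N ] spread N e g) → (∀ n → Maps L 0 n n (e n) (e n)) → Transport L 0 (ι g) (ι g′)
    transport-ι e g g′ g′-spread r N = list N ,
      (λ i j l → trans (ι-cong[] (spread-self g N) i j l) (ι-spread source N i j)) ,
      (λ i j l → trans (ι-cong[] (g′-spread N) i j l) (ι-spread target N i j))
      where
      list : ℕ → List (Entry L 0)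
      list zero = []
      list (suc N) = entry (g N) (r N) ∷ list N
      index : Side → ℕ → ℕ
      index source n = n
      index target n = e n
      ι-spread : ∀ s N → ι (spread N (index s) g) SR.≈ ev s (list N)
      ι-spread s zero = ι-0
      ι-spread source (suc N) = SR.trans (ι-+ (P.mon (g N) N) (spread N (λ n → n) g)) (SR.+-cong (ι-mon (g N) N) (ι-spread source N))
      ι-spread target (suc N) = SR.trans (ι-+ (P.mon (g N) (e N)) (spread N e g)) (SR.+-cong (ι-mon (g N) (e N)) (ι-spread target N))

-- Triangular numbers at multiples of three

thrice : ℕ → ℕ
thrice zero = 0
thrice (suc n) = suc (suc (suc (thrice n)))

thrice-+ : ∀ m n → thrice (m ℕ.+ n) ≡ thrice m ℕ.+ thrice n
thrice-+ zero n = ≡.refl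
thrice-+ (suc m) n = ≡.cong (λ s → suc (suc (suc s))) (thrice-+ m n)

thrice-* : ∀ n → thrice n ≡ 3 ℕ.* n
thrice-* zero = ≡.refl
thrice-* (suc n) = ≡.trans (≡.cong (3 ℕ.+_) (thrice-* n)) (≡.sym (ℕP.*-suc 3 n))

tri-thrice : ∀ n → tri (thrice n) ℕ.+ thrice n ≡ 9 ℕ.* tri n
tri-thrice zero = ≡.refl
tri-thrice (suc n) = ≡.trans (lin (thrice n) (tri (thrice n))) (≡.trans (≡.cong₂ (λ a b → a ℕ.+ (9 ℕ.+ 3 ℕ.* b)) (tri-thrice n) (thrice-* n)) (lin′ n (tri n)))
  where
  lin : ∀ n t → suc (suc (suc n)) ℕ.+ (suc (suc n) ℕ.+ (suc n ℕ.+ t)) ℕ.+ suc (suc (suc n)) ≡ t ℕ.+ n ℕ.+ (9 ℕ.+ 3 ℕ.* n)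
  lin = ℕ-solve-∀
  lin′ : ∀ n t → 9 ℕ.* t ℕ.+ (9 ℕ.+ 3 ℕ.* (3 ℕ.* n)) ≡ 9 ℕ.* (suc n ℕ.+ t)
  lin′ = ℕ-solve-∀

tr-thrice : ∀ i l → tr (thrice i) (thrice l) ≡ 6 ℕ.* tr i l ℕ.+ 3 ℕ.* tr l i
tr-thrice (suc i) (suc l) = tr-thrice i l
tr-thrice i zero = ℕP.+-cancelʳ-≡ (3 ℕ.* i) _ _ (≡.trans (≡.cong (tri (thrice i) ℕ.+_) (≡.sym (thrice-* i)))
  (≡.trans (tri-thrice i) (≡.trans (lin (tri i)) (≡.trans (≡.cong (λ s → 6 ℕ.* tri i ℕ.+ 3 ℕ.* s) (tr-diff i 0)) (lin′ i (tri i) (tr 0 i))))))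
  where
  lin : ∀ t → 9 ℕ.* t ≡ 6 ℕ.* t ℕ.+ 3 ℕ.* t
  lin = ℕ-solve-∀
  lin′ : ∀ i t s → 6 ℕ.* t ℕ.+ 3 ℕ.* (i ℕ.+ s) ≡ 6 ℕ.* t ℕ.+ 3 ℕ.* s ℕ.+ 3 ℕ.* i
  lin′ = ℕ-solve-∀
tr-thrice zero (suc l) = ℕP.+-cancelʳ-≡ (6 ℕ.* suc l) _ _ (≡.trans (lin₁ (suc l) (tr 0 (thrice (suc l)))) (≡.trans (≡.cong (λ s → s ℕ.+ tr 0 (thrice (suc l)) ℕ.+ s) (≡.sym (thrice-* (suc l))))
  (≡.trans (≡.cong (ℕ._+ thrice (suc l)) (≡.sym (tr-diff (thrice (suc l)) 0))) (≡.trans (tri-thrice (suc l)) (lin₂ l (tri l))))))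
  where
  lin₁ : ∀ l s → s ℕ.+ 6 ℕ.* l ≡ 3 ℕ.* l ℕ.+ s ℕ.+ 3 ℕ.* l
  lin₁ = ℕ-solve-∀
  lin₂ : ∀ l t → 9 ℕ.* (suc l ℕ.+ t) ≡ 6 ℕ.* t ℕ.+ 3 ℕ.* (suc l ℕ.+ t) ℕ.+ 6 ℕ.* suc l
  lin₂ = ℕ-solve-∀

tr-suc-thrice : ∀ i l → tr (suc (thrice i)) (thrice l) ≡ 9 ℕ.* tr i l ℕ.+ 1
tr-suc-thrice i l = ℕP.+-cancelˡ-≡ (thrice l) _ _ (≡.trans (tr-step (thrice i) (thrice l))
  (≡.trans (≡.cong₂ (λ a b → suc a ℕ.+ b) (thrice-* i) (tr-thrice i l)) (≡.trans (lin i (tr i l) (tr l i))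
  (≡.trans (≡.cong (λ s → 1 ℕ.+ 6 ℕ.* tr i l ℕ.+ 3 ℕ.* s) (≡.sym (tr-diff i l))) (≡.trans (lin′ l (tr i l)) (≡.cong (ℕ._+ (9 ℕ.* tr i l ℕ.+ 1)) (≡.sym (thrice-* l))))))))
  where
  lin : ∀ i p k → suc (3 ℕ.* i) ℕ.+ (6 ℕ.* p ℕ.+ 3 ℕ.* k) ≡ 1 ℕ.+ 6 ℕ.* p ℕ.+ 3 ℕ.* (i ℕ.+ k)
  lin = ℕ-solve-∀
  lin′ : ∀ l p → 1 ℕ.+ 6 ℕ.* p ℕ.+ 3 ℕ.* (l ℕ.+ p) ≡ 3 ℕ.* l ℕ.+ (9 ℕ.* p ℕ.+ 1)
  lin′ = ℕ-solve-∀

-- Guarantees that the truncated subtraction in `θ₁-exp` and `θ₂-exp` is a true one.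
tr-opposite-≤ : ∀ i l → tr l i ℕ.≤ 4 ℕ.* tr i l ℕ.+ 1
tr-opposite-≤ (suc i) (suc l) = tr-opposite-≤ i l
tr-opposite-≤ i zero = ℕP.≤-trans (≡.subst (tr 0 i ℕ.≤_) (≡.sym (tr-diff i 0)) (ℕP.m≤n+m _ i)) (ℕP.≤-trans (ℕP.m≤n*m (tri i) 4) (ℕP.m≤m+n _ 1))
tr-opposite-≤ zero (suc l) = ℕP.≤-trans (s≤s (ℕP.+-monoˡ-≤ (tri l) (tri-≥ l))) (≡.subst (suc (tri l ℕ.+ tri l) ℕ.≤_) (lin (tri l)) (ℕP.m≤m+n _ _))
  where
  lin : ∀ t → suc (t ℕ.+ t) ℕ.+ (t ℕ.+ t) ≡ 4 ℕ.* t ℕ.+ 1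
  lin = ℕ-solve-∀

-- The second difference of t is 1. In this form the step from m to m + 1 is affine in the pair
-- (t(m), t(m - 1)), and that affine map is `levelMap`.
tr-next : ∀ i l → + tr (suc i) l ≡ + 2 ℤ.* + tr i l ℤ.- + tr l i ℤ.+ + 1
tr-next i l = ≡.trans (lin (+ tr (suc i) l) (+ tr l i)) (≡.cong (λ s → s ℤ.- + tr l i) (≡.trans (≡.cong +_ next-sum) (≡.cong (λ s → s ℤ.+ + 1) (ℤP.pos-* 2 (tr i l)))) ⟨≡⟩ lin′ (+ tr i l) (+ tr l i))
  where
  infixl 1 _⟨≡⟩_
  _⟨≡⟩_ : ∀ {A : Set} {a b c : A} → a ≡ b → b ≡ c → a ≡ c
  _⟨≡⟩_ = ≡.trans
  lin : ∀ a b → a ≡ a ℤ.+ b ℤ.- b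
  lin = ℤ-solve-∀
  lin′ : ∀ p k → + 2 ℤ.* p ℤ.+ + 1 ℤ.- k ≡ + 2 ℤ.* p ℤ.- k ℤ.+ + 1
  lin′ = ℤ-solve-∀
  rearr : ∀ l s k → l ℕ.+ (s ℕ.+ k) ≡ l ℕ.+ s ℕ.+ k
  rearr = ℕ-solve-∀
  rearr′ : ∀ i p k → suc i ℕ.+ p ℕ.+ k ≡ 1 ℕ.+ p ℕ.+ (i ℕ.+ k)
  rearr′ = ℕ-solve-∀
  rearr″ : ∀ l p → 1 ℕ.+ p ℕ.+ (l ℕ.+ p) ≡ l ℕ.+ (2 ℕ.* p ℕ.+ 1)
  rearr″ = ℕ-solve-∀
  next-sum : tr (suc i) l ℕ.+ tr l i ≡ 2 ℕ.* tr i l ℕ.+ 1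
  next-sum = ℕP.+-cancelˡ-≡ l _ _ (≡.trans (rearr l (tr (suc i) l) (tr l i)) (≡.trans (≡.cong (ℕ._+ tr l i) (tr-step i l))
    (≡.trans (rearr′ i (tr i l) (tr l i)) (≡.trans (≡.cong (1 ℕ.+ tr i l ℕ.+_) (≡.sym (tr-diff i l))) (rearr″ l (tr i l))))))

-- Theta functions of level three

-- On pairs (t(m), t(m - 1)) `levelMap` is m ↦ m + 1 and `swapMap` is m ↦ -m, while `φ₀`, `φ₁`, `φ₂`
-- are m ↦ 3m, 3m + 1, -3m - 1, all taken with the weights of T. `cubeMap` replaces X and Y by their
-- cubes, and `θ-map` carries T to `θ₁`. `ρ-map` keeps x - y and triples x + y up to its
-- translation: it is q ↦ q³ with z fixed, divided by q once for each unit of weight.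
levelMap swapMap cubeMap φ₀ φ₁ φ₂ θ-map ρ-map : Affine
levelMap = record { a = + 2 ; b = -[1+ 0 ] ; c = + 1 ; d = + 0 ; e = + 1 ; f = + 0 ; det≢0 = _ }
swapMap = record { a = + 0 ; b = + 1 ; c = + 1 ; d = + 0 ; e = + 0 ; f = + 0 ; det≢0 = _ }
cubeMap = record { a = + 3 ; b = + 0 ; c = + 0 ; d = + 3 ; e = + 0 ; f = + 0 ; det≢0 = _ }
φ₀ = record { a = + 6 ; b = + 3 ; c = + 3 ; d = + 6 ; e = + 0 ; f = + 0 ; det≢0 = _ }
φ₁ = record { a = + 9 ; b = + 0 ; c = + 6 ; d = + 3 ; e = + 1 ; f = + 0 ; det≢0 = _ }
φ₂ = record { a = + 6 ; b = + 3 ; c = + 9 ; d = + 0 ; e = + 0 ; f = + 1 ; det≢0 = _ }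
θ-map = record { a = + 4 ; b = -[1+ 0 ] ; c = + 1 ; d = + 2 ; e = + 1 ; f = + 0 ; det≢0 = _ }
ρ-map = record { a = + 2 ; b = + 1 ; c = + 1 ; d = + 2 ; e = -[1+ 0 ] ; f = -[1+ 0 ] ; det≢0 = _ }

pos-linear : ∀ m n p k → + (m ℕ.* p ℕ.+ n ℕ.* k) ≡ + m ℤ.* + p ℤ.+ + n ℤ.* + k
pos-linear m n p k = ≡.cong₂ ℤ._+_ (ℤP.pos-* m p) (ℤP.pos-* n k)

pos-affine : ∀ m p c → + (m ℕ.* p ℕ.+ c) ≡ + m ℤ.* + p ℤ.+ + c
pos-affine m p c = ≡.cong (λ s → s ℤ.+ + c) (ℤP.pos-* m p)

module _ (X Y : ℕ → ℕ → ℕ) (grows : ∀ i l → tr i l ℕ.+ tr l i ℕ.≤ X (tr i l) (tr l i) ℕ.+ Y (tr i l) (tr l i)) where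
  exponents : Exponents
  exponents = record
    { x = λ i l → X (tr i l) (tr l i) ; y = λ i l → Y (tr i l) (tr l i)
    ; x-inv = λ _ _ → ≡.refl ; y-inv = λ _ _ → ≡.refl
    ; growthˡ = λ i l → ℕP.≤-trans (tr-degˡ i l) (ℕP.+-monoʳ-≤ l (grows i l))
    ; growthʳ = λ i l → ℕP.≤-trans (tr-degʳ i l) (ℕP.+-monoʳ-≤ i (grows i l)) }

private
  m≤n′ : ∀ m {n o} → m ℕ.+ o ≡ n → m ℕ.≤ n
  m≤n′ m {o = o} e = ≡.subst (m ℕ.≤_) e (ℕP.m≤m+n m o)

-- In terms of z and q the terms of Ψ, θ₁, θ₂ are z^r q^(r²/6) with r = 3m, 3m + 1, -3m - 1, the
-- last two multiplied by q^(1/3) to make the exponents of X and Y integral. Those of t₀, t₁, t₂ are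
-- z^r q^(r²/2) for the same r.
Ψ-exp θ₁-exp θ₂-exp t₀-exp t₁-exp t₂-exp : Exponents
Ψ-exp = exponents (λ p k → 3 ℕ.* p) (λ p k → 3 ℕ.* k) (λ i l → m≤n′ _ (lin (tr i l) (tr l i)))
  where
  lin : ∀ p k → p ℕ.+ k ℕ.+ (2 ℕ.* p ℕ.+ 2 ℕ.* k) ≡ 3 ℕ.* p ℕ.+ 3 ℕ.* k
  lin = ℕ-solve-∀
θ₁-exp = exponents (λ p k → 4 ℕ.* p ℕ.+ 1 ℕ.∸ k) (λ p k → p ℕ.+ 2 ℕ.* k)
  (λ i l → ℕP.≤-trans (m≤n′ _ (lin (tr i l) (tr l i))) (ℕP.m≤n+m _ (4 ℕ.* tr i l ℕ.+ 1 ℕ.∸ tr l i)))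
  where
  lin : ∀ p k → p ℕ.+ k ℕ.+ k ≡ p ℕ.+ 2 ℕ.* k
  lin = ℕ-solve-∀
θ₂-exp = exponents (λ p k → p ℕ.+ 2 ℕ.* k) (λ p k → 4 ℕ.* p ℕ.+ 1 ℕ.∸ k)
  (λ i l → ℕP.≤-trans (m≤n′ _ (lin (tr i l) (tr l i))) (ℕP.m≤m+n _ (4 ℕ.* tr i l ℕ.+ 1 ℕ.∸ tr l i)))
  where
  lin : ∀ p k → p ℕ.+ k ℕ.+ k ≡ p ℕ.+ 2 ℕ.* k
  lin = ℕ-solve-∀
t₀-exp = exponents (λ p k → 6 ℕ.* p ℕ.+ 3 ℕ.* k) (λ p k → 3 ℕ.* p ℕ.+ 6 ℕ.* k) (λ i l → m≤n′ _ (lin (tr i l) (tr l i)))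
  where
  lin : ∀ p k → p ℕ.+ k ℕ.+ (8 ℕ.* p ℕ.+ 8 ℕ.* k) ≡ 6 ℕ.* p ℕ.+ 3 ℕ.* k ℕ.+ (3 ℕ.* p ℕ.+ 6 ℕ.* k)
  lin = ℕ-solve-∀
t₁-exp = exponents (λ p k → 9 ℕ.* p ℕ.+ 1) (λ p k → 6 ℕ.* p ℕ.+ 3 ℕ.* k) (λ i l → m≤n′ _ (lin (tr i l) (tr l i)))
  where
  lin : ∀ p k → p ℕ.+ k ℕ.+ (14 ℕ.* p ℕ.+ 2 ℕ.* k ℕ.+ 1) ≡ 9 ℕ.* p ℕ.+ 1 ℕ.+ (6 ℕ.* p ℕ.+ 3 ℕ.* k)
  lin = ℕ-solve-∀
t₂-exp = exponents (λ p k → 6 ℕ.* p ℕ.+ 3 ℕ.* k) (λ p k → 9 ℕ.* p ℕ.+ 1) (λ i l → m≤n′ _ (lin (tr i l) (tr l i)))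
  where
  lin : ∀ p k → p ℕ.+ k ℕ.+ (14 ℕ.* p ℕ.+ 2 ℕ.* k ℕ.+ 1) ≡ 6 ℕ.* p ℕ.+ 3 ℕ.* k ℕ.+ (9 ℕ.* p ℕ.+ 1)
  lin = ℕ-solve-∀

θ₁-x : ∀ i l → + Exponents.x θ₁-exp i l ≡ + 4 ℤ.* + tr i l ℤ.+ + 1 ℤ.- + tr l i
θ₁-x i l = ≡.trans (≡.sym (ℤP.⊖-≥ (tr-opposite-≤ i l))) (≡.trans (≡.sym (ℤP.m-n≡m⊖n (4 ℕ.* tr i l ℕ.+ 1) (tr l i))) (≡.cong (λ s → s ℤ.- + tr l i) (pos-affine 4 (tr i l) 1)))

θ₁-y : ∀ i l → + Exponents.y θ₁-exp i l ≡ + tr i l ℤ.+ + 2 ℤ.* + tr l i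
θ₁-y i l = ≡.cong (λ s → + tr i l ℤ.+ s) (ℤP.pos-* 2 (tr l i))

module ThetaFunctions (K : CommutativeRing 0ℓ 0ℓ) where
  open CommutativeRing K hiding (zero)
  open Transports K public
  open SetoidReasoning setoid

  Ψ θ₁ θ₂ t₀ t₁ t₂ : Ser²
  Ψ = family Ψ-exp
  θ₁ = family θ₁-exp
  θ₂ = family θ₂-exp
  t₀ = family t₀-exp
  t₁ = family t₁-exp
  t₂ = family t₂-exp

  -- The cut at 3N + 1 leaves 3 (2N + 1) terms, that is, complete triples m = 3m′ - 1, 3m′, 3m′ + 1.
  -- The first member of the triples runs through `t₂-exp` backwards, hence `reversed`.
  T-trisection : T SR.≈ t₀ SR.+ t₁ SR.+ t₂
  T-trisection = ≊-all λ N i j l → begin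
    T i j                                        ≈⟨ family-partial thetaExponents (suc (thrice N)) i j (bound N l) ⟩
    partial thetaExponents (suc (thrice N)) i j  ≡⟨ ≡.cong (λ n → SF.∑ₐ n (λ _ b → μ b (suc (thrice N))) i j) (≡.trans (≡.cong suc (ℕP.+-suc (thrice N) (thrice N))) (≡.cong (λ n → suc (suc n)) (≡.sym (thrice-+ N N)))) ⟩
    SF.∑ₐ (suc (suc (thrice (N ℕ.+ N)))) (λ _ b → μ b (suc (thrice N))) i j  ≈⟨ group (N ℕ.+ N) (λ b → μ b (suc (thrice N))) i j ⟩
    SF.∑ₐ (N ℕ.+ N) (λ _ b → μ (thrice b) (suc (thrice N)) SR.+ (μ (suc (thrice b)) (suc (thrice N)) SR.+ μ (suc (suc (thrice b))) (suc (thrice N)))) i j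
      ≈⟨ SF.∑ₐ-cong (N ℕ.+ N) (λ a b _ → SR.+-cong (e₂ b N) (SR.+-cong (e₀ b N) (e₁ b N))) i j ⟩
    SF.∑ₐ (N ℕ.+ N) (λ _ b → term (reversed t₂-exp) b N SR.+ (term t₀-exp b N SR.+ term t₁-exp b N)) i j
      ≈⟨ SR.trans (SF.∑ₐ-+ (N ℕ.+ N) _ _) (SR.+-congˡ (SF.∑ₐ-+ (N ℕ.+ N) _ _)) i j ⟩
    partial (reversed t₂-exp) N i j + (partial t₀-exp N i j + partial t₁-exp N i j)
      ≈⟨ +-cong (trans (sym (family-partial (reversed t₂-exp) N i j l)) (family-reversed t₂-exp i j)) (sym (+-cong (family-partial t₀-exp N i j l) (family-partial t₁-exp N i j l))) ⟩
    t₂ i j + (t₀ i j + t₁ i j)                   ≈⟨ +-comm _ _ ⟩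
    t₀ i j + t₁ i j + t₂ i j                     ∎
    where
    bound : ∀ N {n} → n ℕ.< N → n ℕ.< suc (thrice N)
    bound N l = ℕP.≤-trans l (ℕP.≤-trans (ℕP.≤-trans (ℕP.m≤n*m N 3) (ℕP.≤-reflexive (≡.sym (thrice-* N)))) (ℕP.n≤1+n _))
    group : ∀ n (f : ℕ → Ser²) → SF.∑ₐ (suc (suc (thrice n))) (λ _ b → f b) SR.≈ SF.∑ₐ n (λ _ b → f (thrice b) SR.+ (f (suc (thrice b)) SR.+ f (suc (suc (thrice b)))))
    group zero f = SR.refl
    group (suc n) f = SR.trans (SR.+-congˡ (SR.+-congˡ (SR.+-congˡ (group n (λ b → f (suc (suc (suc b)))))))) (SR.sym (SR.trans (SR.+-assoc _ _ _) (SR.+-congˡ (SR.+-assoc _ _ _))))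
    e₀ : ∀ b N → μ (suc (thrice b)) (suc (thrice N)) SR.≈ term t₀-exp b N
    e₀ b N = SR.reflexive (≡.cong₂ (mono 1#) (tr-thrice b N) (≡.trans (tr-thrice N b) (ℕP.+-comm (6 ℕ.* tr N b) _)))
    e₁ : ∀ b N → μ (suc (suc (thrice b))) (suc (thrice N)) SR.≈ term t₁-exp b N
    e₁ b N = SR.reflexive (≡.cong₂ (mono 1#) (tr-suc-thrice b N) (≡.trans (tr-left (thrice b) (thrice N)) (tr-thrice b N)))
    e₂ : ∀ b N → μ (thrice b) (suc (thrice N)) SR.≈ term (reversed t₂-exp) b N
    e₂ b N = SR.reflexive (≡.cong₂ (mono 1#) (≡.trans (tr-left (thrice N) (thrice b)) (tr-thrice N b)) (tr-suc-thrice N b))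

  T→Ψ : Transport cubeMap 0 T Ψ
  T→Ψ = transport-family thetaExponents Ψ-exp λ i l → ≡.trans (ℤP.pos-* 3 (tr i l)) (lin (+ tr i l) (+ tr l i)) , ≡.trans (ℤP.pos-* 3 (tr l i)) (lin′ (+ tr i l) (+ tr l i))
    where
    lin : ∀ p k → + 3 ℤ.* p ≡ + 3 ℤ.* p ℤ.+ + 0 ℤ.* k ℤ.+ + 0 ℤ.* + 0
    lin = ℤ-solve-∀
    lin′ : ∀ p k → + 3 ℤ.* k ≡ + 0 ℤ.* p ℤ.+ + 3 ℤ.* k ℤ.+ + 0 ℤ.* + 0
    lin′ = ℤ-solve-∀

  T→t₀ : Transport φ₀ 0 T t₀
  T→t₀ = transport-family thetaExponents t₀-exp λ i l → ≡.trans (pos-linear 6 3 (tr i l) (tr l i)) (lin (+ tr i l) (+ tr l i)) , ≡.trans (pos-linear 3 6 (tr i l) (tr l i)) (lin′ (+ tr i l) (+ tr l i))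
    where
    lin : ∀ p k → + 6 ℤ.* p ℤ.+ + 3 ℤ.* k ≡ + 6 ℤ.* p ℤ.+ + 3 ℤ.* k ℤ.+ + 0 ℤ.* + 0
    lin = ℤ-solve-∀
    lin′ : ∀ p k → + 3 ℤ.* p ℤ.+ + 6 ℤ.* k ≡ + 3 ℤ.* p ℤ.+ + 6 ℤ.* k ℤ.+ + 0 ℤ.* + 0
    lin′ = ℤ-solve-∀

  T→t₁ : Transport φ₁ 1 T t₁
  T→t₁ = transport-family thetaExponents t₁-exp λ i l → ≡.trans (pos-affine 9 (tr i l) 1) (lin (+ tr i l) (+ tr l i)) , ≡.trans (pos-linear 6 3 (tr i l) (tr l i)) (lin′ (+ tr i l) (+ tr l i))
    where
    lin : ∀ p k → + 9 ℤ.* p ℤ.+ + 1 ≡ + 9 ℤ.* p ℤ.+ + 0 ℤ.* k ℤ.+ + 1 ℤ.* + 1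
    lin = ℤ-solve-∀
    lin′ : ∀ p k → + 6 ℤ.* p ℤ.+ + 3 ℤ.* k ≡ + 6 ℤ.* p ℤ.+ + 3 ℤ.* k ℤ.+ + 0 ℤ.* + 1
    lin′ = ℤ-solve-∀

  T→t₂ : Transport φ₂ 1 T t₂
  T→t₂ = transport-family thetaExponents t₂-exp λ i l → ≡.trans (pos-linear 6 3 (tr i l) (tr l i)) (lin′ (+ tr i l) (+ tr l i)) , ≡.trans (pos-affine 9 (tr i l) 1) (lin (+ tr i l) (+ tr l i))
    where
    lin : ∀ p k → + 9 ℤ.* p ℤ.+ + 1 ≡ + 9 ℤ.* p ℤ.+ + 0 ℤ.* k ℤ.+ + 1 ℤ.* + 1
    lin = ℤ-solve-∀
    lin′ : ∀ p k → + 6 ℤ.* p ℤ.+ + 3 ℤ.* k ≡ + 6 ℤ.* p ℤ.+ + 3 ℤ.* k ℤ.+ + 0 ℤ.* + 1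
    lin′ = ℤ-solve-∀

  T→θ₁ : Transport θ-map 1 T θ₁
  T→θ₁ = transport-family thetaExponents θ₁-exp λ i l → ≡.trans (θ₁-x i l) (lin (+ tr i l) (+ tr l i)) , ≡.trans (θ₁-y i l) (lin′ (+ tr i l) (+ tr l i))
    where
    lin : ∀ p k → + 4 ℤ.* p ℤ.+ + 1 ℤ.- k ≡ + 4 ℤ.* p ℤ.+ -[1+ 0 ] ℤ.* k ℤ.+ + 1 ℤ.* + 1
    lin = ℤ-solve-∀
    lin′ : ∀ p k → p ℤ.+ + 2 ℤ.* k ≡ + 1 ℤ.* p ℤ.+ + 2 ℤ.* k ℤ.+ + 0 ℤ.* + 1
    lin′ = ℤ-solve-∀

  θ₁→θ₂ : Transport swapMap 0 θ₁ θ₂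
  θ₁→θ₂ = transport-family θ₁-exp θ₂-exp λ i l → lin (+ Exponents.x θ₁-exp i l) (+ Exponents.y θ₁-exp i l)
    where
    lin₁ : ∀ x y → y ≡ + 0 ℤ.* x ℤ.+ + 1 ℤ.* y ℤ.+ + 0 ℤ.* + 0
    lin₁ = ℤ-solve-∀
    lin₂ : ∀ x y → x ≡ + 1 ℤ.* x ℤ.+ + 0 ℤ.* y ℤ.+ + 0 ℤ.* + 0
    lin₂ = ℤ-solve-∀
    lin : ∀ x y → (y ≡ + 0 ℤ.* x ℤ.+ + 1 ℤ.* y ℤ.+ + 0 ℤ.* + 0) × (x ≡ + 1 ℤ.* x ℤ.+ + 0 ℤ.* y ℤ.+ + 0 ℤ.* + 0)
    lin x y = lin₁ x y , lin₂ x y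

  T→T : Transport swapMap 0 T T
  T→T = transport-≈ SR.refl (family-reversed thetaExponents) (transport-family {swapMap} {0} thetaExponents (reversed thetaExponents)
    λ i l → lin₁ (+ tr i l) (+ tr l i) , lin₂ (+ tr i l) (+ tr l i))
    where
    lin₁ : ∀ x y → y ≡ + 0 ℤ.* x ℤ.+ + 1 ℤ.* y ℤ.+ + 0 ℤ.* + 0
    lin₁ = ℤ-solve-∀
    lin₂ : ∀ x y → x ≡ + 1 ℤ.* x ℤ.+ + 0 ℤ.* y ℤ.+ + 0 ℤ.* + 0
    lin₂ = ℤ-solve-∀

  Ψ→t₀ : Transport ρ-map 0 Ψ t₀
  Ψ→t₀ = transport-family Ψ-exp t₀-exp λ i l →
    ≡.trans (pos-linear 6 3 (tr i l) (tr l i)) (≡.trans (lin (+ tr i l) (+ tr l i)) (≡.cong₂ (λ x y → + 2 ℤ.* x ℤ.+ + 1 ℤ.* y ℤ.+ -[1+ 0 ] ℤ.* + 0) (≡.sym (ℤP.pos-* 3 (tr i l))) (≡.sym (ℤP.pos-* 3 (tr l i))))) ,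
    ≡.trans (pos-linear 3 6 (tr i l) (tr l i)) (≡.trans (lin′ (+ tr i l) (+ tr l i)) (≡.cong₂ (λ x y → + 1 ℤ.* x ℤ.+ + 2 ℤ.* y ℤ.+ -[1+ 0 ] ℤ.* + 0) (≡.sym (ℤP.pos-* 3 (tr i l))) (≡.sym (ℤP.pos-* 3 (tr l i)))))
    where
    lin : ∀ p k → + 6 ℤ.* p ℤ.+ + 3 ℤ.* k ≡ + 2 ℤ.* (+ 3 ℤ.* p) ℤ.+ + 1 ℤ.* (+ 3 ℤ.* k) ℤ.+ -[1+ 0 ] ℤ.* + 0
    lin = ℤ-solve-∀
    lin′ : ∀ p k → + 3 ℤ.* p ℤ.+ + 6 ℤ.* k ≡ + 1 ℤ.* (+ 3 ℤ.* p) ℤ.+ + 2 ℤ.* (+ 3 ℤ.* k) ℤ.+ -[1+ 0 ] ℤ.* + 0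
    lin′ = ℤ-solve-∀

  θ₁→t₁ : Transport ρ-map 1 θ₁ t₁
  θ₁→t₁ = transport-family θ₁-exp t₁-exp λ i l →
    ≡.trans (pos-affine 9 (tr i l) 1) (≡.trans (lin (+ tr i l) (+ tr l i)) (≡.cong₂ (λ x y → + 2 ℤ.* x ℤ.+ + 1 ℤ.* y ℤ.+ -[1+ 0 ] ℤ.* + 1) (≡.sym (θ₁-x i l)) (≡.sym (θ₁-y i l)))) ,
    ≡.trans (pos-linear 6 3 (tr i l) (tr l i)) (≡.trans (lin′ (+ tr i l) (+ tr l i)) (≡.cong₂ (λ x y → + 1 ℤ.* x ℤ.+ + 2 ℤ.* y ℤ.+ -[1+ 0 ] ℤ.* + 1) (≡.sym (θ₁-x i l)) (≡.sym (θ₁-y i l))))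
    where
    lin : ∀ p k → + 9 ℤ.* p ℤ.+ + 1 ≡ + 2 ℤ.* (+ 4 ℤ.* p ℤ.+ + 1 ℤ.- k) ℤ.+ + 1 ℤ.* (p ℤ.+ + 2 ℤ.* k) ℤ.+ -[1+ 0 ] ℤ.* + 1
    lin = ℤ-solve-∀
    lin′ : ∀ p k → + 6 ℤ.* p ℤ.+ + 3 ℤ.* k ≡ + 1 ℤ.* (+ 4 ℤ.* p ℤ.+ + 1 ℤ.- k) ℤ.+ + 2 ℤ.* (p ℤ.+ + 2 ℤ.* k) ℤ.+ -[1+ 0 ] ℤ.* + 1
    lin′ = ℤ-solve-∀

  θ₂→t₂ : Transport ρ-map 1 θ₂ t₂
  θ₂→t₂ = transport-family θ₂-exp t₂-exp λ i l →
    ≡.trans (pos-linear 6 3 (tr i l) (tr l i)) (≡.trans (lin (+ tr i l) (+ tr l i)) (≡.cong₂ (λ x y → + 2 ℤ.* y ℤ.+ + 1 ℤ.* x ℤ.+ -[1+ 0 ] ℤ.* + 1) (≡.sym (θ₁-x i l)) (≡.sym (θ₁-y i l)))) ,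
    ≡.trans (pos-affine 9 (tr i l) 1) (≡.trans (lin′ (+ tr i l) (+ tr l i)) (≡.cong₂ (λ x y → + 1 ℤ.* y ℤ.+ + 2 ℤ.* x ℤ.+ -[1+ 0 ] ℤ.* + 1) (≡.sym (θ₁-x i l)) (≡.sym (θ₁-y i l))))
    where
    lin : ∀ p k → + 6 ℤ.* p ℤ.+ + 3 ℤ.* k ≡ + 2 ℤ.* (p ℤ.+ + 2 ℤ.* k) ℤ.+ + 1 ℤ.* (+ 4 ℤ.* p ℤ.+ + 1 ℤ.- k) ℤ.+ -[1+ 0 ] ℤ.* + 1
    lin = ℤ-solve-∀
    lin′ : ∀ p k → + 9 ℤ.* p ℤ.+ + 1 ≡ + 1 ℤ.* (p ℤ.+ + 2 ℤ.* k) ℤ.+ + 2 ℤ.* (+ 4 ℤ.* p ℤ.+ + 1 ℤ.- k) ℤ.+ -[1+ 0 ] ℤ.* + 1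
    lin′ = ℤ-solve-∀

-- The grading modulo three

data ℤ₃ : Set where
  0₃ 1₃ 2₃ : ℤ₃

suc₃ pred₃ : ℤ₃ → ℤ₃
suc₃ 0₃ = 1₃
suc₃ 1₃ = 2₃
suc₃ 2₃ = 0₃
pred₃ 0₃ = 2₃
pred₃ 1₃ = 0₃
pred₃ 2₃ = 1₃

infixl 6 _+₃_
_+₃_ : ℤ₃ → ℤ₃ → ℤ₃
0₃ +₃ b = b
1₃ +₃ b = suc₃ b
2₃ +₃ b = suc₃ (suc₃ b)

_≟₃_ : (a b : ℤ₃) → Dec (a ≡ b)
0₃ ≟₃ 0₃ = yes ≡.refl
0₃ ≟₃ 1₃ = no λ ()
0₃ ≟₃ 2₃ = no λ ()
1₃ ≟₃ 0₃ = no λ ()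
1₃ ≟₃ 1₃ = yes ≡.refl
1₃ ≟₃ 2₃ = no λ ()
2₃ ≟₃ 0₃ = no λ ()
2₃ ≟₃ 1₃ = no λ ()
2₃ ≟₃ 2₃ = yes ≡.refl

suc₃³ : ∀ b → suc₃ (suc₃ (suc₃ b)) ≡ b
suc₃³ 0₃ = ≡.refl
suc₃³ 1₃ = ≡.refl
suc₃³ 2₃ = ≡.refl

suc₃-+₃ : ∀ a b → suc₃ a +₃ b ≡ suc₃ (a +₃ b)
suc₃-+₃ 0₃ b = ≡.refl
suc₃-+₃ 1₃ b = ≡.refl
suc₃-+₃ 2₃ b = ≡.sym (suc₃³ b)

res : ℕ → ℤ₃
res zero = 0₃
res (suc n) = suc₃ (res n)

res-+ : ∀ m n → res (m ℕ.+ n) ≡ res m +₃ res n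
res-+ zero n = ≡.refl
res-+ (suc m) n = ≡.trans (≡.cong suc₃ (res-+ m n)) (≡.sym (suc₃-+₃ (res m) (res n)))

res-3*+ : ∀ m r → res (3 ℕ.* m ℕ.+ r) ≡ res r
res-3*+ zero r = ≡.refl
res-3*+ (suc m) r = ≡.trans (≡.cong (λ s → res (s ℕ.+ r)) (ℕP.*-suc 3 m)) (≡.trans (suc₃³ _) (res-3*+ m r))

-- Modulo 3 the number i + 2j is i - j, the exponent of z.
grade : ℕ → ℕ → ℤ₃
grade i j = res (i ℕ.+ (j ℕ.+ j))

grade-+ : ∀ i i′ j j′ → grade (i ℕ.+ i′) (j ℕ.+ j′) ≡ grade i j +₃ grade i′ j′
grade-+ i i′ j j′ = ≡.trans (≡.cong res (lin i i′ j j′)) (res-+ (i ℕ.+ (j ℕ.+ j)) _)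
  where
  lin : ∀ i i′ j j′ → i ℕ.+ i′ ℕ.+ (j ℕ.+ j′ ℕ.+ (j ℕ.+ j′)) ≡ i ℕ.+ (j ℕ.+ j) ℕ.+ (i′ ℕ.+ (j′ ℕ.+ j′))
  lin = ℕ-solve-∀

grade-diagonal : ∀ n → grade n n ≡ 0₃
grade-diagonal n = ≡.trans (≡.cong res (lin n)) (res-3*+ n 0)
  where
  lin : ∀ n → n ℕ.+ (n ℕ.+ n) ≡ 3 ℕ.* n ℕ.+ 0
  lin = ℕ-solve-∀

grade-below : ∀ n → grade (suc n) n ≡ 1₃
grade-below n = ≡.cong suc₃ (grade-diagonal n)

grade-above : ∀ n → grade n (suc n) ≡ 2₃
grade-above n = ≡.trans (grade-+ 0 n 1 n) (≡.cong (2₃ +₃_) (grade-diagonal n))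

θ₁-sum : ∀ i l → Exponents.x θ₁-exp i l ℕ.+ tr l i ≡ 4 ℕ.* tr i l ℕ.+ 1
θ₁-sum i l = ℕP.m∸n+n≡m (tr-opposite-≤ i l)

module Gradings (K : CommutativeRing 0ℓ 0ℓ) where
  open CommutativeRing K hiding (zero)
  open ThetaFunctions K public
  open SetoidReasoning setoid

  Graded : ℤ₃ → Ser² → Set
  Graded r F = ∀ i j → grade i j ≢ r → F i j ≈ 0#

  graded-+ : ∀ {r F G} → Graded r F → Graded r G → Graded r (F SR.+ G)
  graded-+ p q i j ne = trans (+-cong (p i j ne) (q i j ne)) (+-identityˡ 0#)

  graded-0 : ∀ {r} → Graded r SR.0#
  graded-0 _ _ _ = refl

  graded-* : ∀ {r s F G} → Graded r F → Graded s G → Graded (r +₃ s) (F SR.* G)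
  graded-* {r} {s} {F} {G} p q I J ne = *-vanish F G I J h
    where
    h : ∀ i i′ j j′ → i ℕ.+ i′ ≡ I → j ℕ.+ j′ ≡ J → F i j ≈ 0# ⊎ G i′ j′ ≈ 0#
    h i i′ j j′ ≡.refl ≡.refl with grade i j ≟₃ r | grade i′ j′ ≟₃ s
    ... | no ne₁ | _ = inj₁ (p i j ne₁)
    ... | yes _ | no ne₂ = inj₂ (q i′ j′ ne₂)
    ... | yes e₁ | yes e₂ = ⊥-elim (ne (≡.trans (grade-+ i i′ j j′) (≡.cong₂ _+₃_ e₁ e₂)))

  graded-≈ : ∀ {r F G} → F SR.≈ G → Graded r F → Graded r G
  graded-≈ e p i j ne = trans (sym (e i j)) (p i j ne)

  graded-mono : ∀ {r} c i j → grade i j ≡ r → Graded r (mono c i j)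
  graded-mono c i j e I J ne = mono-off c i j I J (λ { ≡.refl ≡.refl → ne e })

  graded-ι : ∀ g → Graded 0₃ (ι g)
  graded-ι g zero zero ne = ⊥-elim (ne ≡.refl)
  graded-ι g zero (suc j) ne = refl
  graded-ι g (suc i) zero ne = refl
  graded-ι g (suc i) (suc j) ne = graded-ι (P.tl g) i j (λ e → ne (≡.trans (grade-+ 1 i 1 j) e))

  graded-family : ∀ {r} E → (∀ i l → grade (Exponents.x E i l) (Exponents.y E i l) ≡ r) → Graded r (family E)
  graded-family {r} E h i j ne = sum-zero (i ℕ.+ j ℕ.+ (i ℕ.+ j)) (λ b → term E b (i ℕ.+ j)) (λ b → graded-mono 1# (Exponents.x E b (i ℕ.+ j)) (Exponents.y E b (i ℕ.+ j)) (h b (i ℕ.+ j)) i j ne)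
    where
    sum-zero : ∀ n (f : ℕ → Ser²) → (∀ b → f b i j ≈ 0#) → SF.∑ₐ n (λ _ b → f b) i j ≈ 0#
    sum-zero zero f z = z 0
    sum-zero (suc n) f z = trans (+-cong (z 0) (sum-zero n (λ b → f (suc b)) (λ b → z (suc b)))) (+-identityˡ 0#)

  three : {A : Set} → A → A → A → ℤ₃ → A
  three a b c 0₃ = a
  three a b c 1₃ = b
  three a b c 2₃ = c

  Homogeneous : (ℤ₃ → Ser²) → Set
  Homogeneous F = ∀ r → Graded r (F r)

  homogeneous : ∀ {F₀ F₁ F₂} → Graded 0₃ F₀ → Graded 1₃ F₁ → Graded 2₃ F₂ → Homogeneous (three F₀ F₁ F₂)
  homogeneous f₀ f₁ f₂ 0₃ = f₀
  homogeneous f₀ f₁ f₂ 1₃ = f₁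
  homogeneous f₀ f₁ f₂ 2₃ = f₂

  total : (ℤ₃ → Ser²) → Ser²
  total F = F 0₃ SR.+ F 1₃ SR.+ F 2₃

  total-at : ∀ F → Homogeneous F → ∀ i j → total F i j ≈ F (grade i j) i j
  total-at F h i j with grade i j in eq
  ... | 0₃ = trans (+-cong (trans (+-congˡ (h 1₃ i j (λ e → case (≡.trans (≡.sym eq) e)))) (+-identityʳ _)) (h 2₃ i j (λ e → case′ (≡.trans (≡.sym eq) e)))) (+-identityʳ _)
    where
    case : 0₃ ≢ 1₃
    case ()
    case′ : 0₃ ≢ 2₃
    case′ ()
  ... | 1₃ = trans (+-cong (trans (+-congʳ (h 0₃ i j (λ e → case (≡.trans (≡.sym eq) e)))) (+-identityˡ _)) (h 2₃ i j (λ e → case′ (≡.trans (≡.sym eq) e)))) (+-identityʳ _)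
    where
    case : 1₃ ≢ 0₃
    case ()
    case′ : 1₃ ≢ 2₃
    case′ ()
  ... | 2₃ = trans (+-congʳ (trans (+-cong (h 0₃ i j (λ e → case (≡.trans (≡.sym eq) e))) (h 1₃ i j (λ e → case′ (≡.trans (≡.sym eq) e)))) (+-identityˡ 0#))) (+-identityˡ _)
    where
    case : 2₃ ≢ 0₃
    case ()
    case′ : 2₃ ≢ 1₃
    case′ ()

  components : ∀ {N} F G → Homogeneous F → Homogeneous G → total F ≊[ N ] total G → ∀ r → F r ≊[ N ] G r
  components F G hF hG e r i j l with grade i j ≟₃ r
  ... | yes ≡.refl = trans (sym (total-at F hF i j)) (trans (e i j l) (total-at G hG i j))
  ... | no ne = trans (hF r i j ne) (sym (hG r i j ne))

  Ψ-graded : Graded 0₃ Ψ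
  Ψ-graded = graded-family Ψ-exp λ i l → ≡.trans (≡.cong res (lin (tr i l) (tr l i))) (res-3*+ (tr i l ℕ.+ 2 ℕ.* tr l i) 0)
    where
    lin : ∀ p k → 3 ℕ.* p ℕ.+ (3 ℕ.* k ℕ.+ 3 ℕ.* k) ≡ 3 ℕ.* (p ℕ.+ 2 ℕ.* k) ℕ.+ 0
    lin = ℕ-solve-∀

  θ₁-graded : Graded 1₃ θ₁
  θ₁-graded = graded-family θ₁-exp λ i l → ≡.trans (≡.cong res (ℕP.+-cancelʳ-≡ (tr l i) _ _ (lin₀ i l))) (res-3*+ (2 ℕ.* tr i l ℕ.+ tr l i) 1)
    where
    rearr : ∀ x p k → x ℕ.+ (p ℕ.+ 2 ℕ.* k ℕ.+ (p ℕ.+ 2 ℕ.* k)) ℕ.+ k ≡ x ℕ.+ k ℕ.+ (2 ℕ.* p ℕ.+ 4 ℕ.* k)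
    rearr = ℕ-solve-∀
    lin : ∀ p k → 4 ℕ.* p ℕ.+ 1 ℕ.+ (2 ℕ.* p ℕ.+ 4 ℕ.* k) ≡ 3 ℕ.* (2 ℕ.* p ℕ.+ k) ℕ.+ 1 ℕ.+ k
    lin = ℕ-solve-∀
    lin₀ : ∀ i l → _ ≡ _
    lin₀ i l = ≡.trans (rearr (Exponents.x θ₁-exp i l) (tr i l) (tr l i)) (≡.trans (≡.cong (ℕ._+ (2 ℕ.* tr i l ℕ.+ 4 ℕ.* tr l i)) (θ₁-sum i l)) (lin (tr i l) (tr l i)))

  θ₂-graded : Graded 2₃ θ₂
  θ₂-graded = graded-family θ₂-exp λ i l → ≡.trans (≡.cong res (ℕP.+-cancelʳ-≡ (2 ℕ.* tr l i) (tr i l ℕ.+ 2 ℕ.* tr l i ℕ.+ (Exponents.x θ₁-exp i l ℕ.+ Exponents.x θ₁-exp i l)) (3 ℕ.* (3 ℕ.* tr i l) ℕ.+ 2) (lin₀ i l))) (res-3*+ (3 ℕ.* tr i l) 2)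
    where
    rearr : ∀ x p k → p ℕ.+ 2 ℕ.* k ℕ.+ (x ℕ.+ x) ℕ.+ 2 ℕ.* k ≡ 2 ℕ.* (x ℕ.+ k) ℕ.+ (p ℕ.+ 2 ℕ.* k)
    rearr = ℕ-solve-∀
    lin : ∀ p k → 2 ℕ.* (4 ℕ.* p ℕ.+ 1) ℕ.+ (p ℕ.+ 2 ℕ.* k) ≡ 3 ℕ.* (3 ℕ.* p) ℕ.+ 2 ℕ.+ 2 ℕ.* k
    lin = ℕ-solve-∀
    lin₀ : ∀ i l → _ ≡ _
    lin₀ i l = ≡.trans (rearr (Exponents.x θ₁-exp i l) (tr i l) (tr l i)) (≡.trans (≡.cong (λ s → 2 ℕ.* s ℕ.+ (tr i l ℕ.+ 2 ℕ.* tr l i)) (θ₁-sum i l)) (lin (tr i l) (tr l i)))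

  t₀-graded : Graded 0₃ t₀
  t₀-graded = graded-family t₀-exp λ i l → ≡.trans (≡.cong res (lin (tr i l) (tr l i))) (res-3*+ (4 ℕ.* tr i l ℕ.+ 5 ℕ.* tr l i) 0)
    where
    lin : ∀ p k → 6 ℕ.* p ℕ.+ 3 ℕ.* k ℕ.+ (3 ℕ.* p ℕ.+ 6 ℕ.* k ℕ.+ (3 ℕ.* p ℕ.+ 6 ℕ.* k)) ≡ 3 ℕ.* (4 ℕ.* p ℕ.+ 5 ℕ.* k) ℕ.+ 0
    lin = ℕ-solve-∀

  t₁-graded : Graded 1₃ t₁
  t₁-graded = graded-family t₁-exp λ i l → ≡.trans (≡.cong res (lin (tr i l) (tr l i))) (res-3*+ (7 ℕ.* tr i l ℕ.+ 2 ℕ.* tr l i) 1)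
    where
    lin : ∀ p k → 9 ℕ.* p ℕ.+ 1 ℕ.+ (6 ℕ.* p ℕ.+ 3 ℕ.* k ℕ.+ (6 ℕ.* p ℕ.+ 3 ℕ.* k)) ≡ 3 ℕ.* (7 ℕ.* p ℕ.+ 2 ℕ.* k) ℕ.+ 1
    lin = ℕ-solve-∀

  t₂-graded : Graded 2₃ t₂
  t₂-graded = graded-family t₂-exp λ i l → ≡.trans (≡.cong res (lin (tr i l) (tr l i))) (res-3*+ (8 ℕ.* tr i l ℕ.+ tr l i) 2)
    where
    lin : ∀ p k → 6 ℕ.* p ℕ.+ 3 ℕ.* k ℕ.+ (9 ℕ.* p ℕ.+ 1 ℕ.+ (9 ℕ.* p ℕ.+ 1)) ≡ 3 ℕ.* (8 ℕ.* p ℕ.+ k) ℕ.+ 2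
    lin = ℕ-solve-∀

  -- The coefficients of z and of 1/z, read along the two diagonals next to the main one. Together
  -- with `δ` they determine a series of level three.
  δ⁺ δ⁻ : Ser² → P.Ser
  δ⁺ F n = F (suc n) n
  δ⁻ F n = F n (suc n)

  δ⁺-ι* : ∀ g F → δ⁺ (ι g SR.* F) P.≋ P.mul g (δ⁺ F)
  δ⁺-ι* g F zero = ι*-suc0 g F 0
  δ⁺-ι* g F (suc n) = trans (ι*-suc g F (suc n) n) (+-congˡ (δ⁺-ι* (P.tl g) F n))

  δ⁻-ι* : ∀ g F → δ⁻ (ι g SR.* F) P.≋ P.mul g (δ⁻ F)
  δ⁻-ι* g F zero = ι*-0 g F 1
  δ⁻-ι* g F (suc n) = trans (ι*-suc g F n (suc n)) (+-congˡ (δ⁻-ι* (P.tl g) F n))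

  family-at : ∀ E I J → (∀ i l → Exponents.x E i l ≡ I → Exponents.y E i l ≡ J → i ≡ l) →
    family E I J ≈ mono 1# (Exponents.x E 0 0) (Exponents.y E 0 0) I J
  family-at E I J h = go (I ℕ.+ J)
    where
    open Exponents E
    off : ∀ b N → b ≢ N → term E b N I J ≈ 0#
    off b N ne = mono-off 1# (x b N) (y b N) I J (λ e e′ → ne (h b N e e′))
    go : ∀ N → partial E N I J ≈ mono 1# (x 0 0) (y 0 0) I J
    go zero = refl
    go (suc N) rewrite ℕP.+-suc N N = begin
      (term E 0 (suc N) SR.+ SF.∑ₐ (suc (N ℕ.+ N)) (λ a b → term E (suc b) (suc N))) I J
        ≈⟨ +-cong (off 0 (suc N) (λ ())) (SF.∑ₐ-last (N ℕ.+ N) (λ a b → term E (suc b) (suc N)) I J) ⟩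
      0# + (SF.∑ₐ (N ℕ.+ N) (λ a b → term E (suc b) (suc N)) I J + term E (suc (suc (N ℕ.+ N))) (suc N) I J)
        ≈⟨ trans (+-identityˡ _) (+-cong (SF.∑ₐ-cong (N ℕ.+ N) (λ a b _ → term-inv E b N) I J)
             (off (suc (suc (N ℕ.+ N))) (suc N) (λ e → ℕP.<⇒≢ (s≤s (ℕP.m≤m+n N N)) (≡.sym (ℕP.suc-injective e))))) ⟩
      partial E N I J + 0#   ≈⟨ +-identityʳ _ ⟩
      partial E N I J        ≈⟨ go N ⟩
      mono 1# (x 0 0) (y 0 0) I J ∎

  -- The exponent of z in Ψ is 3m, so the diagonal meets only m = 0. With the two lemmas below and
  -- the grading, Ψ, θ₁, θ₂ form a basis dual to `δ`, `δ⁺`, `δ⁻`.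
  δ-Ψ : δ Ψ P.≋ P.1ₛ
  δ-Ψ n = trans (family-at Ψ-exp n n inj) (at n)
    where
    inj : ∀ i l → 3 ℕ.* tr i l ≡ n → 3 ℕ.* tr l i ≡ n → i ≡ l
    inj i l e e′ = ℕP.+-cancelʳ-≡ (tr l i) i l (≡.trans (≡.sym (tr-diff i l)) (≡.cong (l ℕ.+_) (ℕP.*-cancelˡ-≡ _ _ 3 (≡.trans e (≡.sym e′)))))
    at : ∀ n → mono 1# 0 0 n n ≈ P.1ₛ n
    at zero = refl
    at (suc n) = refl

  δ⁺-θ₁ : δ⁺ θ₁ P.≋ P.1ₛ
  δ⁺-θ₁ n = trans (family-at θ₁-exp (suc n) n inj) (at n)
    where
    lin : ∀ p k → suc (p ℕ.+ 2 ℕ.* k) ℕ.+ k ≡ p ℕ.+ 1 ℕ.+ 3 ℕ.* k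
    lin = ℕ-solve-∀
    lin′ : ∀ p → 4 ℕ.* p ℕ.+ 1 ≡ p ℕ.+ 1 ℕ.+ 3 ℕ.* p
    lin′ = ℕ-solve-∀
    inj : ∀ i l → Exponents.x θ₁-exp i l ≡ suc n → tr i l ℕ.+ 2 ℕ.* tr l i ≡ n → i ≡ l
    inj i l e e′ = ℕP.+-cancelʳ-≡ (tr l i) i l (≡.trans (≡.sym (tr-diff i l)) (≡.cong (l ℕ.+_) (≡.sym
      (ℕP.*-cancelˡ-≡ _ _ 3 (ℕP.+-cancelˡ-≡ (tr i l ℕ.+ 1) _ _ (≡.trans (≡.sym (lin (tr i l) (tr l i)))
        (≡.trans (≡.cong (λ s → s ℕ.+ tr l i) (≡.trans (≡.cong suc e′) (≡.sym e))) (≡.trans (θ₁-sum i l) (lin′ (tr i l))))))))))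
    at : ∀ n → mono 1# 1 0 (suc n) n ≈ P.1ₛ n
    at zero = refl
    at (suc n) = refl

  δ⁻-θ₂ : δ⁻ θ₂ P.≋ P.1ₛ
  δ⁻-θ₂ n = trans (sym (transport-coefficient {swapMap} {0} {θ₁} {θ₂} {suc n} {n} {n} {suc n} θ₁→θ₂ (lin₁ (+ suc n) (+ n) , lin₂ (+ suc n) (+ n)))) (δ⁺-θ₁ n)
    where
    lin₁ : ∀ x y → y ≡ + 0 ℤ.* x ℤ.+ + 1 ℤ.* y ℤ.+ + 0 ℤ.* + 0
    lin₁ = ℤ-solve-∀
    lin₂ : ∀ x y → x ≡ + 1 ℤ.* x ℤ.+ + 0 ℤ.* y ℤ.+ + 0 ℤ.* + 0
    lin₂ = ℤ-solve-∀

-- The cube of the theta function in the level three basis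

module Decomposition (K : CommutativeRing 0ℓ 0ℓ) where
  open CommutativeRing K hiding (zero)
  open Gradings K public
  open SetoidReasoning setoid

  T-level : Transport levelMap 1 T T
  T-level = transport-family-shifted thetaExponents λ i l →
    ≡.trans (tr-next i l) (lin (+ tr i l) (+ tr l i)) , ≡.trans (≡.cong +_ (tr-left i l)) (lin′ (+ tr i l) (+ tr l i))
    where
    lin : ∀ p k → + 2 ℤ.* p ℤ.- k ℤ.+ + 1 ≡ + 2 ℤ.* p ℤ.+ -[1+ 0 ] ℤ.* k ℤ.+ + 1 ℤ.* + 1
    lin = ℤ-solve-∀
    lin′ : ∀ p k → p ≡ + 1 ℤ.* p ℤ.+ + 0 ℤ.* k ℤ.+ + 0 ℤ.* + 1
    lin′ = ℤ-solve-∀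

  Ψ-level : Transport levelMap 3 Ψ Ψ
  Ψ-level = transport-family-shifted Ψ-exp λ i l →
    ≡.trans (≡.trans (ℤP.pos-* 3 (tr (suc i) l)) (≡.cong (λ s → + 3 ℤ.* s) (tr-next i l)))
      (≡.trans (lin (+ tr i l) (+ tr l i)) (≡.cong₂ (λ x y → + 2 ℤ.* x ℤ.+ -[1+ 0 ] ℤ.* y ℤ.+ + 1 ℤ.* + 3) (≡.sym (ℤP.pos-* 3 (tr i l))) (≡.sym (ℤP.pos-* 3 (tr l i))))) ,
    ≡.trans (≡.cong (λ s → + (3 ℕ.* s)) (tr-left i l)) (lin′ (+ (3 ℕ.* tr i l)) (+ (3 ℕ.* tr l i)))
    where
    lin : ∀ p k → + 3 ℤ.* (+ 2 ℤ.* p ℤ.- k ℤ.+ + 1) ≡ + 2 ℤ.* (+ 3 ℤ.* p) ℤ.+ -[1+ 0 ] ℤ.* (+ 3 ℤ.* k) ℤ.+ + 1 ℤ.* + 3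
    lin = ℤ-solve-∀
    lin′ : ∀ p k → p ≡ + 1 ℤ.* p ℤ.+ + 0 ℤ.* k ℤ.+ + 0 ℤ.* + 3
    lin′ = ℤ-solve-∀

  θ₁-level : Transport levelMap 3 θ₁ θ₁
  θ₁-level = transport-family-shifted θ₁-exp λ i l →
    ≡.trans (θ₁-x (suc i) l) (≡.trans (≡.cong₂ (λ s t → + 4 ℤ.* s ℤ.+ + 1 ℤ.- t) (tr-next i l) (≡.cong +_ (tr-left i l)))
      (≡.trans (lin (+ tr i l) (+ tr l i)) (≡.cong₂ (λ x y → + 2 ℤ.* x ℤ.+ -[1+ 0 ] ℤ.* y ℤ.+ + 1 ℤ.* + 3) (≡.sym (θ₁-x i l)) (≡.sym (θ₁-y i l))))) ,
    ≡.trans (θ₁-y (suc i) l) (≡.trans (≡.cong₂ (λ s t → s ℤ.+ + 2 ℤ.* t) (tr-next i l) (≡.cong +_ (tr-left i l)))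
      (≡.trans (lin′ (+ tr i l) (+ tr l i)) (≡.cong₂ (λ x y → + 1 ℤ.* x ℤ.+ + 0 ℤ.* y ℤ.+ + 0 ℤ.* + 3) (≡.sym (θ₁-x i l)) (≡.sym (θ₁-y i l)))))
    where
    lin : ∀ p k → + 4 ℤ.* (+ 2 ℤ.* p ℤ.- k ℤ.+ + 1) ℤ.+ + 1 ℤ.- p ≡ + 2 ℤ.* (+ 4 ℤ.* p ℤ.+ + 1 ℤ.- k) ℤ.+ -[1+ 0 ] ℤ.* (p ℤ.+ + 2 ℤ.* k) ℤ.+ + 1 ℤ.* + 3
    lin = ℤ-solve-∀
    lin′ : ∀ p k → + 2 ℤ.* p ℤ.- k ℤ.+ + 1 ℤ.+ + 2 ℤ.* p ≡ + 1 ℤ.* (+ 4 ℤ.* p ℤ.+ + 1 ℤ.- k) ℤ.+ + 0 ℤ.* (p ℤ.+ + 2 ℤ.* k) ℤ.+ + 0 ℤ.* + 3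
    lin′ = ℤ-solve-∀

  θ₂-level : Transport levelMap 3 θ₂ θ₂
  θ₂-level = transport-≈ (family-reversed θ₂-exp) (family-reversed θ₂-exp) (transport-family-shifted (reversed θ₂-exp) λ i l →
    ≡.trans (θ₂-x (suc i) l) (≡.trans (≡.cong₂ (λ s t → t ℤ.+ + 2 ℤ.* s) (tr-next i l) (≡.cong +_ (tr-left i l)))
      (≡.trans (lin (+ tr i l) (+ tr l i)) (≡.cong₂ (λ x y → + 2 ℤ.* x ℤ.+ -[1+ 0 ] ℤ.* y ℤ.+ + 1 ℤ.* + 3) (≡.sym (θ₂-x i l)) (≡.sym (θ₁-x l i))))) ,
    ≡.trans (θ₁-x l (suc i)) (≡.trans (≡.cong₂ (λ s t → + 4 ℤ.* t ℤ.+ + 1 ℤ.- s) (tr-next i l) (≡.cong +_ (tr-left i l)))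
      (≡.trans (lin′ (+ tr i l) (+ tr l i)) (≡.cong₂ (λ x y → + 1 ℤ.* x ℤ.+ + 0 ℤ.* y ℤ.+ + 0 ℤ.* + 3) (≡.sym (θ₂-x i l)) (≡.sym (θ₁-x l i))))))
    where
    θ₂-x : ∀ i l → + (tr l i ℕ.+ 2 ℕ.* tr i l) ≡ + tr l i ℤ.+ + 2 ℤ.* + tr i l
    θ₂-x i l = θ₁-y l i
    lin : ∀ p k → p ℤ.+ + 2 ℤ.* (+ 2 ℤ.* p ℤ.- k ℤ.+ + 1) ≡ + 2 ℤ.* (k ℤ.+ + 2 ℤ.* p) ℤ.+ -[1+ 0 ] ℤ.* (+ 4 ℤ.* k ℤ.+ + 1 ℤ.- p) ℤ.+ + 1 ℤ.* + 3
    lin = ℤ-solve-∀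
    lin′ : ∀ p k → + 4 ℤ.* p ℤ.+ + 1 ℤ.- (+ 2 ℤ.* p ℤ.- k ℤ.+ + 1) ≡ + 1 ℤ.* (k ℤ.+ + 2 ℤ.* p) ℤ.+ + 0 ℤ.* (+ 4 ℤ.* k ℤ.+ + 1 ℤ.- p) ℤ.+ + 0 ℤ.* + 3
    lin′ = ℤ-solve-∀

  ι-level : ∀ g → Transport levelMap 0 (ι g) (ι g)
  ι-level g = transport-ι (λ n → n) g g (spread-self g) λ n → lin (+ n) , lin′ (+ n)
    where
    lin : ∀ n → n ≡ + 2 ℤ.* n ℤ.+ -[1+ 0 ] ℤ.* n ℤ.+ + 1 ℤ.* + 0
    lin = ℤ-solve-∀
    lin′ : ∀ n → n ≡ + 1 ℤ.* n ℤ.+ + 0 ℤ.* n ℤ.+ + 0 ℤ.* + 0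
    lin′ = ℤ-solve-∀

  -- The map changes i - j by 3, and in the direction of the three central diagonals it lowers the
  -- degree: below them the preimage is smaller, above them the image. Descent on the degree ends on
  -- a central diagonal or at a monomial without partner, whose coefficient is zero.
  level-unique : ∀ F → Transport levelMap 3 F F → (∀ n → F n n ≈ 0#) → (∀ n → F (suc n) n ≈ 0#) → (∀ n → F n (suc n) ≈ 0#) → F SR.≈ SR.0#
  level-unique F t d₀ d₊ d₋ i j = go (suc (i ℕ.+ j)) i j ℕP.≤-refl
    where
    level-eq : ∀ p k I J → Maps levelMap 3 p k I J → I ℕ.+ k ≡ 2 ℕ.* p ℕ.+ 3 × J ≡ p
    level-eq p k I J (e , e′) =
      ℤP.+-injective (≡.trans (≡.cong (λ s → s ℤ.+ + k) e) (≡.trans (lin (+ p) (+ k)) (≡.cong (λ s → s ℤ.+ + 3) (≡.sym (ℤP.pos-* 2 p))))) ,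
      ℤP.+-injective (≡.trans e′ (lin′ (+ p) (+ k)))
      where
      lin : ∀ p k → + 2 ℤ.* p ℤ.+ -[1+ 0 ] ℤ.* k ℤ.+ + 1 ℤ.* + 3 ℤ.+ k ≡ + 2 ℤ.* p ℤ.+ + 3
      lin = ℤ-solve-∀
      lin′ : ∀ p k → + 1 ℤ.* p ℤ.+ + 0 ℤ.* k ℤ.+ + 0 ℤ.* + 3 ≡ p
      lin′ = ℤ-solve-∀
    smaller : ∀ {x p} k → x ℕ.+ k ≡ 2 ℕ.* p ℕ.+ 3 → suc (suc p) ℕ.≤ k → x ℕ.< k
    smaller {x} {p} k e le = ℕP.+-cancelʳ-< k x k (≡.subst (ℕ._< k ℕ.+ k) (≡.sym e) (≡.subst (ℕ._≤ k ℕ.+ k) (lin p) (ℕP.+-mono-≤ le le)))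
      where
      lin : ∀ p → suc (suc p) ℕ.+ suc (suc p) ≡ suc (2 ℕ.* p ℕ.+ 3)
      lin = ℕ-solve-∀
    data Compare (i j : ℕ) : Set where
      diagonal : i ≡ j → Compare i j
      one-below : i ≡ suc j → Compare i j
      one-above : j ≡ suc i → Compare i j
      below : suc (suc j) ℕ.≤ i → Compare i j
      above : suc (suc i) ℕ.≤ j → Compare i j
    compare : ∀ i j → Compare i j
    compare zero zero = diagonal ≡.refl
    compare zero (suc zero) = one-above ≡.refl
    compare zero (suc (suc j)) = above (s≤s (s≤s z≤n))
    compare (suc zero) zero = one-below ≡.refl
    compare (suc (suc i)) zero = below (s≤s (s≤s z≤n))
    compare (suc i) (suc j) with compare i j
    ... | diagonal e = diagonal (≡.cong suc e)
    ... | one-below e = one-below (≡.cong suc e)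
    ... | one-above e = one-above (≡.cong suc e)
    ... | below l = below (s≤s l)
    ... | above l = above (s≤s l)
    go : ∀ s i j → i ℕ.+ j ℕ.< s → F i j ≈ 0#
    go (suc s) i j l with compare i j
    ... | diagonal ≡.refl = d₀ i
    ... | one-below ≡.refl = d₊ j
    ... | one-above ≡.refl = d₋ i
    ... | below le with transport-target t i j
    ...   | inj₁ z = z
    ...   | inj₂ (a , b , m , e) with e₁ , ≡.refl ← level-eq a b i j m =
      trans (sym e) (go s a b (ℕP.≤-trans (ℕP.+-monoʳ-< a (smaller i (≡.trans (ℕP.+-comm b i) e₁) le)) (ℕP.≤-trans (ℕP.≤-reflexive (ℕP.+-comm a i)) (ℕP.≤-pred l))))
    go (suc s) i j l | above le with transport-source t i j
    ...   | inj₁ z = z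
    ...   | inj₂ (A , B , m , e) with e₁ , ≡.refl ← level-eq i j A B m =
      trans e (go s A B (ℕP.≤-trans (ℕP.+-monoˡ-< B (smaller j e₁ le)) (ℕP.≤-trans (ℕP.≤-reflexive (ℕP.+-comm j B)) (ℕP.≤-pred l))))

  T³ : Ser²
  T³ = T SR.* T SR.* T

  -- Expanding T³ shows that `a` is the theta series of the form m² + mn + n², the first cubic theta
  -- function; `c` is the third one without its factor q^(1/3).
  a c : P.Ser
  a = δ T³
  c = δ⁺ T³

  δ-graded-zero : ∀ {r} F → Graded r F → r ≢ 0₃ → δ F P.≋ P.0ₛ
  δ-graded-zero F h ne n = h n n (λ e → ne (≡.trans (≡.sym e) (grade-diagonal n)))

  δ⁺-graded-zero : ∀ {r} F → Graded r F → r ≢ 1₃ → δ⁺ F P.≋ P.0ₛ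
  δ⁺-graded-zero F h ne n = h (suc n) n (λ e → ne (≡.trans (≡.sym e) (grade-below n)))

  δ⁻-graded-zero : ∀ {r} F → Graded r F → r ≢ 2₃ → δ⁻ F P.≋ P.0ₛ
  δ⁻-graded-zero F h ne n = h n (suc n) (λ e → ne (≡.trans (≡.sym e) (grade-above n)))

  c-swapped : δ⁻ T³ P.≋ c
  c-swapped n = sym (transport-coefficient {swapMap} {0} {T³} {T³} {suc n} {n} {n} {suc n}
    (transport-* {v = 0} {0} (transport-* {v = 0} {0} T→T T→T) T→T) (lin₁ (+ suc n) (+ n) , lin₂ (+ suc n) (+ n)))
    where
    lin₁ : ∀ x y → y ≡ + 0 ℤ.* x ℤ.+ + 1 ℤ.* y ℤ.+ + 0 ℤ.* + 0
    lin₁ = ℤ-solve-∀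
    lin₂ : ∀ x y → x ≡ + 1 ℤ.* x ℤ.+ + 0 ℤ.* y ℤ.+ + 0 ℤ.* + 0
    lin₂ = ℤ-solve-∀

  ιaΨ-graded : Graded 0₃ (ι a SR.* Ψ)
  ιaΨ-graded = graded-* {0₃} {0₃} (graded-ι a) Ψ-graded
  ιcθ₁-graded : Graded 1₃ (ι c SR.* θ₁)
  ιcθ₁-graded = graded-* {0₃} {1₃} (graded-ι c) θ₁-graded
  ιcθ₂-graded : Graded 2₃ (ι c SR.* θ₂)
  ιcθ₂-graded = graded-* {0₃} {2₃} (graded-ι c) θ₂-graded

  -- Both sides transform with weight 3 under the shift of the index, so only three diagonals have
  -- to be compared, and on each of them the grading leaves a single summand on the right.
  T³-decomposition : T³ SR.≈ ι a SR.* Ψ SR.+ ι c SR.* θ₁ SR.+ ι c SR.* θ₂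
  T³-decomposition i j = begin
    T³ i j                         ≈⟨ SI.solve 2 (λ x y → x SI.:= x SI.:- y SI.:+ y) SR.refl T³ R i j ⟩
    (T³ SR.- R) i j + R i j        ≈⟨ +-congʳ (level-unique (T³ SR.- R) level d₀ d₊ d₋ i j) ⟩
    0# + R i j                     ≈⟨ +-identityˡ _ ⟩
    R i j                          ∎
    where
    R : Ser²
    R = ι a SR.* Ψ SR.+ ι c SR.* θ₁ SR.+ ι c SR.* θ₂
    level : Transport levelMap 3 (T³ SR.- R) (T³ SR.- R)
    level = transport-+ (transport-* {v = 2} {1} (transport-* {v = 1} {1} T-level T-level) T-level)
      (transport-neg (transport-+ (transport-+ (transport-* {v = 0} {3} (ι-level a) Ψ-level) (transport-* {v = 0} {3} (ι-level c) θ₁-level)) (transport-* {v = 0} {3} (ι-level c) θ₂-level)))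
    cancel : ∀ {x y z w} → y ≈ x → z ≈ 0# → w ≈ 0# → x + - (y + z + w) ≈ 0#
    cancel p q r = trans (+-congˡ (-‿cong (trans (+-cong (trans (+-cong p q) (+-identityʳ _)) r) (+-identityʳ _)))) (-‿inverseʳ _)
    cancel₁ : ∀ {x y z w} → z ≈ x → y ≈ 0# → w ≈ 0# → x + - (y + z + w) ≈ 0#
    cancel₁ p q r = trans (+-congˡ (-‿cong (trans (+-cong (trans (+-cong q p) (+-identityˡ _)) r) (+-identityʳ _)))) (-‿inverseʳ _)
    cancel₂ : ∀ {x y z w} → w ≈ x → y ≈ 0# → z ≈ 0# → x + - (y + z + w) ≈ 0#
    cancel₂ p q r = trans (+-congˡ (-‿cong (trans (+-cong (trans (+-cong q r) (+-identityˡ _)) p) (+-identityˡ _)))) (-‿inverseʳ _)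
    d₀ : ∀ n → (T³ SR.- R) n n ≈ 0#
    d₀ n = cancel (trans (δ-ι* a Ψ n) (trans (P.mul-cong {a} {a} (λ _ → refl) δ-Ψ n) (PR.*-identityʳ a n)))
      (δ-graded-zero (ι c SR.* θ₁) ιcθ₁-graded (λ ()) n) (δ-graded-zero (ι c SR.* θ₂) ιcθ₂-graded (λ ()) n)
    d₊ : ∀ n → (T³ SR.- R) (suc n) n ≈ 0#
    d₊ n = cancel₁ (trans (δ⁺-ι* c θ₁ n) (trans (P.mul-cong {c} {c} (λ _ → refl) δ⁺-θ₁ n) (PR.*-identityʳ c n)))
      (δ⁺-graded-zero (ι a SR.* Ψ) ιaΨ-graded (λ ()) n) (δ⁺-graded-zero (ι c SR.* θ₂) ιcθ₂-graded (λ ()) n)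
    d₋ : ∀ n → (T³ SR.- R) n (suc n) ≈ 0#
    d₋ n = cancel₂ (trans (δ⁻-ι* c θ₂ n) (trans (P.mul-cong {c} {c} (λ _ → refl) δ⁻-θ₂ n) (trans (PR.*-identityʳ c n) (sym (c-swapped n)))))
      (δ⁻-graded-zero (ι a SR.* Ψ) ιaΨ-graded (λ ()) n) (δ⁻-graded-zero (ι c SR.* θ₁) ιcθ₁-graded (λ ()) n)

zero-map : ∀ {L : Affine} → Maps L 0 0 0 0 0
zero-map {L} = lin a b e , lin c d f
  where
  open Affine L
  lin : ∀ a b e → + 0 ≡ a ℤ.* + 0 ℤ.+ b ℤ.* + 0 ℤ.+ e ℤ.* + 0
  lin = ℤ-solve-∀

-- Product formulas

module Products (K : CommutativeRing 0ℓ 0ℓ) where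
  open CommutativeRing K hiding (zero)
  open Decomposition K public
  open SetoidReasoning setoid

  open CubicForms S.seriesRing public

  Norm-≊ : ∀ {N f f′ g g′ h h′} → f ≊[ N ] f′ → g ≊[ N ] g′ → h ≊[ N ] h′ → Norm f g h ≊[ N ] Norm f′ g′ h′
  Norm-≊ {N} {f} {f′} {g} {g′} {h} {h′} p q r =
    ≊-+ {F = f SR.* f SR.* f SR.+ g SR.* g SR.* g SR.+ h SR.* h SR.* h} {f′ SR.* f′ SR.* f′ SR.+ g′ SR.* g′ SR.* g′ SR.+ h′ SR.* h′ SR.* h′}
      (≊-+ {F = f SR.* f SR.* f SR.+ g SR.* g SR.* g} {f′ SR.* f′ SR.* f′ SR.+ g′ SR.* g′ SR.* g′}
        (≊-+ {F = f SR.* f SR.* f} {f′ SR.* f′ SR.* f′} (cube f f′ p) (cube g g′ q)) (cube h h′ r))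
      (≊-neg {F = SI.int (+ 3) SR.* (f SR.* g SR.* h)} {SI.int (+ 3) SR.* (f′ SR.* g′ SR.* h′)}
        (≊-* {F = SI.int (+ 3)} {SI.int (+ 3)} {f SR.* g SR.* h} {f′ SR.* g′ SR.* h′} (λ _ _ _ → refl)
          (≊-* {F = f SR.* g} {f′ SR.* g′} {h} {h′} (≊-* {F = f} {f′} {g} {g′} p q) r)))
    where
    cube : ∀ f f′ → f ≊[ N ] f′ → f SR.* f SR.* f ≊[ N ] f′ SR.* f′ SR.* f′
    cube f f′ p = ≊-* {F = f SR.* f} {f′ SR.* f′} {f} {f′} (≊-* {F = f} {f′} {f} {f′} p p) p

  xm ym : ℕ → Ser²
  xm j = mono 1# (suc j) j
  ym j = mono 1# j (suc j)

  -- The parts of degree r modulo 3 of  Π_{j<N} (1 + xm j) Π_{j<M} (1 + ym j).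
  partsX : ℕ → ℤ₃ → Ser²
  partsX zero = three SR.1# SR.0# SR.0#
  partsX (suc N) r = partsX N r SR.+ xm N SR.* partsX N (pred₃ r)

  parts : ℕ → ℕ → ℤ₃ → Ser²
  parts N zero = partsX N
  parts N (suc M) r = parts N M r SR.+ ym M SR.* parts N M (suc₃ r)

  parts-graded : ∀ N M → Homogeneous (parts N M)
  parts-graded zero zero 0₃ = graded-≈ mono-1 (graded-mono 1# 0 0 ≡.refl)
  parts-graded zero zero 1₃ = graded-0
  parts-graded zero zero 2₃ = graded-0
  parts-graded (suc N) zero r = graded-+ {F = partsX N r} (parts-graded N zero r)
    (≡.subst (λ s → Graded s (xm N SR.* partsX N (pred₃ r))) (up r) (graded-* {1₃} {pred₃ r} (graded-mono 1# (suc N) N (grade-below N)) (parts-graded N zero (pred₃ r))))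
    where
    up : ∀ r → 1₃ +₃ pred₃ r ≡ r
    up 0₃ = ≡.refl
    up 1₃ = ≡.refl
    up 2₃ = ≡.refl
  parts-graded N (suc M) r = graded-+ {F = parts N M r} (parts-graded N M r)
    (≡.subst (λ s → Graded s (ym M SR.* parts N M (suc₃ r))) (suc₃³ r) (graded-* {2₃} {suc₃ r} (graded-mono 1# M (suc M) (grade-above M)) (parts-graded N M (suc₃ r))))

  parts-total : ∀ N M → total (parts N M) SR.≈ SF.∏ N Xfactor SR.* SF.∏ M Yfactor
  parts-total zero zero = SI.solve 0 (SI.con (+ 1) SI.:+ SI.con (+ 0) SI.:+ SI.con (+ 0) SI.:= SI.con (+ 1) SI.:* SI.con (+ 1)) SR.refl
  parts-total (suc N) zero = SR.trans
    (SI.solve 4 (λ x f g h → f SI.:+ x SI.:* h SI.:+ (g SI.:+ x SI.:* f) SI.:+ (h SI.:+ x SI.:* g) SI.:= (SI.con (+ 1) SI.:+ x) SI.:* (f SI.:+ g SI.:+ h)) SR.refl (xm N) (parts N 0 0₃) (parts N 0 1₃) (parts N 0 2₃))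
    (SR.trans (SR.*-congˡ (parts-total N zero)) (SR.sym (SR.*-assoc _ _ _)))
  parts-total N (suc M) = SR.trans
    (SI.solve 4 (λ x f g h → f SI.:+ x SI.:* g SI.:+ (g SI.:+ x SI.:* h) SI.:+ (h SI.:+ x SI.:* f) SI.:= (SI.con (+ 1) SI.:+ x) SI.:* (f SI.:+ g SI.:+ h)) SR.refl (ym M) (parts N M 0₃) (parts N M 1₃) (parts N M 2₃))
    (SR.trans (SR.*-congˡ (parts-total N M)) (swap-left (Yfactor M) (SF.∏ N Xfactor) (SF.∏ M Yfactor)))

  X³factor Y³factor : ℕ → Ser²
  X³factor j = SR.1# SR.+ mono 1# (3 ℕ.* suc j) (3 ℕ.* j)
  Y³factor j = SR.1# SR.+ mono 1# (3 ℕ.* j) (3 ℕ.* suc j)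

  mono-cubed : ∀ i j → mono 1# i j SR.* mono 1# i j SR.* mono 1# i j SR.≈ mono 1# (3 ℕ.* i) (3 ℕ.* j)
  mono-cubed i j = SR.trans (SR.*-congʳ (mono-mul 1# 1# i i j j)) (SR.trans (mono-mul (1# * 1#) 1# (i ℕ.+ i) i (j ℕ.+ j) j)
    (SR.trans (mono-cong (i ℕ.+ i ℕ.+ i) (j ℕ.+ j ℕ.+ j) (trans (*-identityʳ _) (*-identityʳ _))) (SR.reflexive (≡.cong₂ (mono 1#) (lin i) (lin j)))))
    where
    lin : ∀ i → i ℕ.+ i ℕ.+ i ≡ 3 ℕ.* i
    lin = ℕ-solve-∀

  -- The norm is multiplicative, and 1 + c t as well as 1 + c t² has norm 1 + c³. Classically this
  -- is the product of the three conjugates under z ↦ ωz.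
  parts-norm : ∀ N M → Norm (parts N M 0₃) (parts N M 1₃) (parts N M 2₃) SR.≈ SF.∏ N X³factor SR.* SF.∏ M Y³factor
  parts-norm zero zero = SR.trans Norm-1 (SR.sym (SR.*-identityˡ _))
  parts-norm (suc N) zero = SR.trans (Norm-step (xm N) (parts N 0 0₃) (parts N 0 1₃) (parts N 0 2₃))
    (SR.trans (SR.*-cong (SR.+-congˡ (mono-cubed (suc N) N)) (parts-norm N zero)) (SR.sym (SR.*-assoc _ _ _)))
  parts-norm N (suc M) = SR.trans (Norm-step′ (ym M) (parts N M 0₃) (parts N M 1₃) (parts N M 2₃))
    (SR.trans (SR.*-cong (SR.+-congˡ (mono-cubed M (suc M))) (parts-norm N M))
      (swap-left (Y³factor M) (SF.∏ N X³factor) (SF.∏ M Y³factor)))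

  module _ {L : Affine} where

    transport-1 : Maps L 0 0 0 0 0 → Transport L 0 SR.1# SR.1#
    transport-1 r = transport-≈ mono-1 mono-1 (transport-mono 1# r)

    transport-∏ : ∀ N {f g} → Maps L 0 0 0 0 0 → (∀ j → Transport L 0 (f j) (g j)) → Transport L 0 (SF.∏ N f) (SF.∏ N g)
    transport-∏ zero r h = transport-1 r
    transport-∏ (suc N) r h = transport-* {v = 0} {0} (h N) (transport-∏ N r h)

    -- The hypothesis that degrees do not drop is what carries a bound across: a target coefficient
    -- of degree below `N` then comes from a source coefficient of degree below `N`.
    transport-≊ : ∀ {v F F′ G G′ N} → (∀ p k I J → Maps L v p k I J → p ℕ.+ k ℕ.≤ I ℕ.+ J) →
      Transport L v F F′ → Transport L v G G′ → F ≊[ N ] G → F′ ≊[ N ] G′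
    transport-≊ {v} {F} {F′} {G} {G′} {N} expands t u e I J l = difference-zero (F′ I J) (G′ I J) (vanishes (transport-target (transport-+ t (transport-neg u)) I J))
      where
      difference-zero : ∀ x y → x + - y ≈ 0# → x ≈ y
      difference-zero x y p = trans (sym (+-identityʳ x)) (trans (+-congˡ (sym (-‿inverseˡ y))) (trans (sym (+-assoc _ _ _)) (trans (+-congʳ p) (+-identityˡ y))))
      vanishes : _ → F′ I J + - G′ I J ≈ 0#
      vanishes (inj₁ z) = z
      vanishes (inj₂ (p , k , m , q)) = trans (sym q) (trans (+-congʳ (e p k (ℕP.≤-<-trans (expands p k I J m) l))) (-‿inverseʳ _))

    transport-product : ∀ {v F′ e′ A B N} (xI xJ yI yJ : ℕ → ℕ) → (∀ p k I J → Maps L v p k I J → p ℕ.+ k ℕ.≤ I ℕ.+ J) →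
      Transport L v T F′ → Transport L 0 (ι euler) (ι e′) → Maps L 0 0 0 0 0 → Maps L v 0 0 A B →
      (∀ j → Maps L 0 (suc j) j (xI j) (xJ j)) → (∀ j → Maps L 0 j (suc j) (yI j) (yJ j)) →
      F′ ≊[ N ] ι e′ SR.* (SF.∏ N (λ j → SR.1# SR.+ mono 1# (xI j) (xJ j)) SR.* SF.∏ N (λ j → SR.1# SR.+ mono 1# (yI j) (yJ j))) SR.* mono 1# A B
    transport-product {N = N} xI xJ yI yJ expands t u r₀ r mx my = transport-≊ expands t
      (transport-* {v = 0} (transport-* {v = 0} {0} u (transport-* {v = 0} {0}
        (transport-∏ N {Xfactor} r₀ (λ j → transport-+ {F = SR.1#} {SR.1#} {mono 1# (suc j) j} (transport-1 r₀) (transport-mono 1# (mx j))))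
        (transport-∏ N {Yfactor} r₀ (λ j → transport-+ {F = SR.1#} {SR.1#} {mono 1# j (suc j)} (transport-1 r₀) (transport-mono 1# (my j))))))
        (transport-mono {i = 0} {0} 1# r))
      (λ i j l → trans (triple-product N i j l) (sym (SR.trans (SR.*-congˡ mono-1) (SR.*-identityʳ (ι euler SR.* G N)) i j)))

  euler₃ euler₉ : P.Ser
  euler₃ = P.V euler
  euler₉ = P.V euler₃

  G³ : ℕ → Ser²
  G³ N = SF.∏ N X³factor SR.* SF.∏ N Y³factor

  Ψ-product : ∀ N → Ψ ≊[ N ] ι euler₃ SR.* G³ N
  Ψ-product N i j l = trans (transport-product {cubeMap} {0} {Ψ} {euler₃} {0} {0} {N} (λ j → 3 ℕ.* suc j) (λ j → 3 ℕ.* j) (λ j → 3 ℕ.* j) (λ j → 3 ℕ.* suc j)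
      expands T→Ψ (transport-ι (λ n → 3 ℕ.* n) euler euler₃ (spread-V euler (λ n → n) euler (spread-self euler)) (λ n → maps n n)) (zero-map {cubeMap}) (zero-map {cubeMap})
      (λ j → maps (suc j) j) (λ j → maps j (suc j)) i j l)
    (SR.trans (SR.*-congˡ mono-1) (SR.*-identityʳ _) i j)
    where
    maps : ∀ p k → Maps cubeMap 0 p k (3 ℕ.* p) (3 ℕ.* k)
    maps p k = ≡.trans (ℤP.pos-* 3 p) (lin (+ p) (+ k)) , ≡.trans (ℤP.pos-* 3 k) (lin′ (+ p) (+ k))
      where
      lin : ∀ p k → + 3 ℤ.* p ≡ + 3 ℤ.* p ℤ.+ + 0 ℤ.* k ℤ.+ + 0 ℤ.* + 0
      lin = ℤ-solve-∀
      lin′ : ∀ p k → + 3 ℤ.* k ≡ + 0 ℤ.* p ℤ.+ + 3 ℤ.* k ℤ.+ + 0 ℤ.* + 0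
      lin′ = ℤ-solve-∀
    expands : ∀ p k I J → Maps cubeMap 0 p k I J → p ℕ.+ k ℕ.≤ I ℕ.+ J
    expands p k I J m with ≡.refl , ≡.refl ← Maps-functional cubeMap {0} {p} {k} m (maps p k) = ℕP.+-mono-≤ (ℕP.m≤n*m p 3) (ℕP.m≤n*m k 3)

  -- Up to any degree the `t` are the graded parts of a finite triple product, scaled by (q;q).
  -- Their norm is (q;q)³ times the same product in X³ and Y³, and that is the product of Ψ.
  norm-identity : ι euler₃ SR.* Norm t₀ t₁ t₂ SR.≈ ι euler SR.* ι euler SR.* ι euler SR.* Ψ
  norm-identity = ≊-all λ N i j l → begin
    (ι euler₃ SR.* Norm t₀ t₁ t₂) i j
      ≈⟨ ≊-* {F = ι euler₃} {ι euler₃} {Norm t₀ t₁ t₂} {Norm (F N 0₃) (F N 1₃) (F N 2₃)} (λ _ _ _ → refl)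
           (Norm-≊ {N} {t₀} {F N 0₃} {t₁} {F N 1₃} {t₂} {F N 2₃} (part N 0₃) (part N 1₃) (part N 2₃)) i j l ⟩
    (ι euler₃ SR.* Norm (F N 0₃) (F N 1₃) (F N 2₃)) i j
      ≈⟨ SR.*-congˡ (SR.trans (Norm-scale (ι euler) (parts N N 0₃) (parts N N 1₃) (parts N N 2₃)) (SR.*-congˡ (parts-norm N N))) i j ⟩
    (ι euler₃ SR.* (ι euler SR.* ι euler SR.* ι euler SR.* G³ N)) i j
      ≈⟨ swap-left (ι euler₃) (ι euler SR.* ι euler SR.* ι euler) (G³ N) i j ⟩
    (ι euler SR.* ι euler SR.* ι euler SR.* (ι euler₃ SR.* G³ N)) i j
      ≈⟨ ≊-* {F = ι euler SR.* ι euler SR.* ι euler} {ι euler SR.* ι euler SR.* ι euler} {ι euler₃ SR.* G³ N} {Ψ} (λ _ _ _ → refl) (λ i j l → sym (Ψ-product N i j l)) i j l ⟩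
    (ι euler SR.* ι euler SR.* ι euler SR.* Ψ) i j ∎
    where
    F : ℕ → ℤ₃ → Ser²
    F N r = ι euler SR.* parts N N r
    part : ∀ N r → three t₀ t₁ t₂ r ≊[ N ] F N r
    part N = components (three t₀ t₁ t₂) (F N) (homogeneous t₀-graded t₁-graded t₂-graded) (λ r → graded-* {0₃} {r} (graded-ι euler) (parts-graded N N r))
      λ i j l → trans (sym (T-trisection i j)) (trans (triple-product N i j l)
        (SR.trans (SR.*-congˡ (SR.sym (parts-total N N))) (SI.solve 4 (λ e f g h → e SI.:* (f SI.:+ g SI.:+ h) SI.:= e SI.:* f SI.:+ e SI.:* g SI.:+ e SI.:* h) SR.refl (ι euler) (parts N N 0₃) (parts N N 1₃) (parts N N 2₃)) i j))

  private
    φ₀-maps : ∀ p k → Maps φ₀ 0 p k (6 ℕ.* p ℕ.+ 3 ℕ.* k) (3 ℕ.* p ℕ.+ 6 ℕ.* k)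
    φ₀-maps p k = ≡.trans (pos-linear 6 3 p k) (lin (+ p) (+ k)) , ≡.trans (pos-linear 3 6 p k) (lin′ (+ p) (+ k))
      where
      lin : ∀ p k → + 6 ℤ.* p ℤ.+ + 3 ℤ.* k ≡ + 6 ℤ.* p ℤ.+ + 3 ℤ.* k ℤ.+ + 0 ℤ.* + 0
      lin = ℤ-solve-∀
      lin′ : ∀ p k → + 3 ℤ.* p ℤ.+ + 6 ℤ.* k ≡ + 3 ℤ.* p ℤ.+ + 6 ℤ.* k ℤ.+ + 0 ℤ.* + 0
      lin′ = ℤ-solve-∀

    φ₁-maps : ∀ v p k → Maps φ₁ v p k (9 ℕ.* p ℕ.+ v) (6 ℕ.* p ℕ.+ 3 ℕ.* k)
    φ₁-maps v p k = ≡.trans (pos-affine 9 p v) (lin (+ p) (+ k) (+ v)) , ≡.trans (pos-linear 6 3 p k) (lin′ (+ p) (+ k) (+ v))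
      where
      lin : ∀ p k v → + 9 ℤ.* p ℤ.+ v ≡ + 9 ℤ.* p ℤ.+ + 0 ℤ.* k ℤ.+ + 1 ℤ.* v
      lin = ℤ-solve-∀
      lin′ : ∀ p k v → + 6 ℤ.* p ℤ.+ + 3 ℤ.* k ≡ + 6 ℤ.* p ℤ.+ + 3 ℤ.* k ℤ.+ + 0 ℤ.* v
      lin′ = ℤ-solve-∀

    φ₂-maps : ∀ v p k → Maps φ₂ v p k (6 ℕ.* p ℕ.+ 3 ℕ.* k) (9 ℕ.* p ℕ.+ v)
    φ₂-maps v p k = ≡.trans (pos-linear 6 3 p k) (lin′ (+ p) (+ k) (+ v)) , ≡.trans (pos-affine 9 p v) (lin (+ p) (+ k) (+ v))
      where
      lin : ∀ p k v → + 9 ℤ.* p ℤ.+ v ≡ + 9 ℤ.* p ℤ.+ + 0 ℤ.* k ℤ.+ + 1 ℤ.* v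
      lin = ℤ-solve-∀
      lin′ : ∀ p k v → + 6 ℤ.* p ℤ.+ + 3 ℤ.* k ≡ + 6 ℤ.* p ℤ.+ + 3 ℤ.* k ℤ.+ + 0 ℤ.* v
      lin′ = ℤ-solve-∀

    maps-to : ∀ {L v p k I J I′ J′} → Maps L v p k I J → I ≡ I′ → J ≡ J′ → Maps L v p k I′ J′
    maps-to m ≡.refl ≡.refl = m

    ninefold : ∀ {L} → (∀ n → Maps L 0 n n (9 ℕ.* n) (9 ℕ.* n)) → Transport L 0 (ι euler) (ι euler₉)
    ninefold {L} r = transport-ι (λ n → 3 ℕ.* (3 ℕ.* n)) euler euler₉ (spread-V euler₃ _ euler (spread-V euler (λ n → n) euler (spread-self euler)))
      λ n → maps-to {L} {0} {n} {n} (r n) (lin n) (lin n)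
      where
      lin : ∀ n → 9 ℕ.* n ≡ 3 ℕ.* (3 ℕ.* n)
      lin = ℕ-solve-∀

    thrice-lin : ∀ (f : ℕ → ℕ) {m} j → f (3 ℕ.* j) ≡ m → f (thrice j) ≡ m
    thrice-lin f j e = ≡.trans (≡.cong f (thrice-* j)) e

    ∏-thrice : ∀ N f → SF.∏ (thrice N) f SR.≈ SF.∏ N (λ j → f (suc (suc (thrice j)))) SR.* SF.∏ N (λ j → f (suc (thrice j))) SR.* SF.∏ N (λ j → f (thrice j))
    ∏-thrice zero f = SI.solve 0 (SI.con (+ 1) SI.:= SI.con (+ 1) SI.:* SI.con (+ 1) SI.:* SI.con (+ 1)) SR.refl
    ∏-thrice (suc N) f = SR.trans (SR.*-congˡ (SR.*-congˡ (SR.*-congˡ (∏-thrice N f))))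
      (SI.solve 6 (λ a b c x y z → a SI.:* (b SI.:* (c SI.:* (x SI.:* y SI.:* z))) SI.:= a SI.:* x SI.:* (b SI.:* y) SI.:* (c SI.:* z)) SR.refl
        (f (suc (suc (thrice N)))) (f (suc (thrice N))) (f (thrice N)) (SF.∏ N (λ j → f (suc (suc (thrice j))))) (SF.∏ N (λ j → f (suc (thrice j)))) (SF.∏ N (λ j → f (thrice j))))

    Xa Ya : (ℕ → ℕ) → ℕ → Ser²
    Xa s N = SF.∏ N (λ j → X³factor (s j))
    Ya s N = SF.∏ N (λ j → Y³factor (s j))

    s₀ s₁ s₂ : ℕ → ℕ
    s₀ j = thrice j
    s₁ j = suc (thrice j)
    s₂ j = suc (suc (thrice j))

    t₀-product : ∀ N → t₀ ≊[ N ] ι euler₉ SR.* (Xa s₁ N SR.* Ya s₁ N) SR.* mono 1# 0 0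
    t₀-product N = transport-product {φ₀} {0} {t₀} {euler₉} {0} {0} {N} _ _ _ _ expands T→t₀ (ninefold λ n → maps-to {φ₀} {0} {n} {n} (φ₀-maps n n) (lin₁ n) (lin₂ n)) (zero-map {φ₀}) (zero-map {φ₀})
      (λ j → maps-to {φ₀} {0} {suc j} {j} (φ₀-maps (suc j) j) (≡.sym (thrice-lin (λ t → 3 ℕ.* suc (suc t)) j (e₁ j))) (≡.sym (thrice-lin (λ t → 3 ℕ.* suc t) j (e₂ j))))
      (λ j → maps-to {φ₀} {0} {j} {suc j} (φ₀-maps j (suc j)) (≡.sym (thrice-lin (λ t → 3 ℕ.* suc t) j (e₃ j))) (≡.sym (thrice-lin (λ t → 3 ℕ.* suc (suc t)) j (e₄ j))))
      where
      lin₁ : ∀ n → 6 ℕ.* n ℕ.+ 3 ℕ.* n ≡ 9 ℕ.* n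
      lin₁ = ℕ-solve-∀
      lin₂ : ∀ n → 3 ℕ.* n ℕ.+ 6 ℕ.* n ≡ 9 ℕ.* n
      lin₂ = ℕ-solve-∀
      e₁ : ∀ j → 3 ℕ.* suc (suc (3 ℕ.* j)) ≡ 6 ℕ.* suc j ℕ.+ 3 ℕ.* j
      e₁ = ℕ-solve-∀
      e₂ : ∀ j → 3 ℕ.* suc (3 ℕ.* j) ≡ 3 ℕ.* suc j ℕ.+ 6 ℕ.* j
      e₂ = ℕ-solve-∀
      e₃ : ∀ j → 3 ℕ.* suc (3 ℕ.* j) ≡ 6 ℕ.* j ℕ.+ 3 ℕ.* suc j
      e₃ = ℕ-solve-∀
      e₄ : ∀ j → 3 ℕ.* suc (suc (3 ℕ.* j)) ≡ 3 ℕ.* j ℕ.+ 6 ℕ.* suc j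
      e₄ = ℕ-solve-∀
      expands : ∀ p k I J → Maps φ₀ 0 p k I J → p ℕ.+ k ℕ.≤ I ℕ.+ J
      expands p k I J m with ≡.refl , ≡.refl ← Maps-functional φ₀ {0} {p} {k} m (φ₀-maps p k) =
        ℕP.+-mono-≤ (ℕP.≤-trans (ℕP.m≤n*m p 6) (ℕP.m≤m+n _ _)) (ℕP.≤-trans (ℕP.m≤n*m k 6) (ℕP.m≤n+m _ (3 ℕ.* p)))

    t₁-product : ∀ N → t₁ ≊[ N ] ι euler₉ SR.* (Xa s₂ N SR.* Ya s₀ N) SR.* mono 1# 1 0
    t₁-product N = transport-product {φ₁} {1} {t₁} {euler₉} {1} {0} {N} _ _ _ _ expands T→t₁ (ninefold λ n → maps-to {φ₁} {0} {n} {n} (φ₁-maps 0 n n) (ℕP.+-identityʳ (9 ℕ.* n)) (lin₂ n)) (zero-map {φ₁}) (φ₁-maps 1 0 0)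
      (λ j → maps-to {φ₁} {0} {suc j} {j} (φ₁-maps 0 (suc j) j) (≡.sym (thrice-lin (λ t → 3 ℕ.* suc (suc (suc t))) j (e₁ j))) (≡.sym (thrice-lin (λ t → 3 ℕ.* suc (suc t)) j (e₂ j))))
      (λ j → maps-to {φ₁} {0} {j} {suc j} (φ₁-maps 0 j (suc j)) (≡.sym (thrice-lin (λ t → 3 ℕ.* t) j (e₃ j))) (≡.sym (thrice-lin (λ t → 3 ℕ.* suc t) j (e₄ j))))
      where
      lin₂ : ∀ n → 6 ℕ.* n ℕ.+ 3 ℕ.* n ≡ 9 ℕ.* n
      lin₂ = ℕ-solve-∀
      e₁ : ∀ j → 3 ℕ.* suc (suc (suc (3 ℕ.* j))) ≡ 9 ℕ.* suc j ℕ.+ 0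
      e₁ = ℕ-solve-∀
      e₂ : ∀ j → 3 ℕ.* suc (suc (3 ℕ.* j)) ≡ 6 ℕ.* suc j ℕ.+ 3 ℕ.* j
      e₂ = ℕ-solve-∀
      e₃ : ∀ j → 3 ℕ.* (3 ℕ.* j) ≡ 9 ℕ.* j ℕ.+ 0
      e₃ = ℕ-solve-∀
      e₄ : ∀ j → 3 ℕ.* suc (3 ℕ.* j) ≡ 6 ℕ.* j ℕ.+ 3 ℕ.* suc j
      e₄ = ℕ-solve-∀
      expands : ∀ p k I J → Maps φ₁ 1 p k I J → p ℕ.+ k ℕ.≤ I ℕ.+ J
      expands p k I J m with ≡.refl , ≡.refl ← Maps-functional φ₁ {1} {p} {k} m (φ₁-maps 1 p k) =
        ℕP.+-mono-≤ (ℕP.≤-trans (ℕP.m≤n*m p 9) (ℕP.m≤m+n _ _)) (ℕP.≤-trans (ℕP.m≤n*m k 3) (ℕP.m≤n+m _ (6 ℕ.* p)))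

    t₂-product : ∀ N → t₂ ≊[ N ] ι euler₉ SR.* (Ya s₂ N SR.* Xa s₀ N) SR.* mono 1# 0 1
    t₂-product N = transport-product {φ₂} {1} {t₂} {euler₉} {0} {1} {N} _ _ _ _ expands T→t₂ (ninefold λ n → maps-to {φ₂} {0} {n} {n} (φ₂-maps 0 n n) (lin₂ n) (ℕP.+-identityʳ (9 ℕ.* n))) (zero-map {φ₂}) (φ₂-maps 1 0 0)
      (λ j → maps-to {φ₂} {0} {suc j} {j} (φ₂-maps 0 (suc j) j) (≡.sym (thrice-lin (λ t → 3 ℕ.* suc (suc t)) j (e₂ j))) (≡.sym (thrice-lin (λ t → 3 ℕ.* suc (suc (suc t))) j (e₁ j))))
      (λ j → maps-to {φ₂} {0} {j} {suc j} (φ₂-maps 0 j (suc j)) (≡.sym (thrice-lin (λ t → 3 ℕ.* suc t) j (e₄ j))) (≡.sym (thrice-lin (λ t → 3 ℕ.* t) j (e₃ j))))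
      where
      lin₂ : ∀ n → 6 ℕ.* n ℕ.+ 3 ℕ.* n ≡ 9 ℕ.* n
      lin₂ = ℕ-solve-∀
      e₁ : ∀ j → 3 ℕ.* suc (suc (suc (3 ℕ.* j))) ≡ 9 ℕ.* suc j ℕ.+ 0
      e₁ = ℕ-solve-∀
      e₂ : ∀ j → 3 ℕ.* suc (suc (3 ℕ.* j)) ≡ 6 ℕ.* suc j ℕ.+ 3 ℕ.* j
      e₂ = ℕ-solve-∀
      e₃ : ∀ j → 3 ℕ.* (3 ℕ.* j) ≡ 9 ℕ.* j ℕ.+ 0
      e₃ = ℕ-solve-∀
      e₄ : ∀ j → 3 ℕ.* suc (3 ℕ.* j) ≡ 6 ℕ.* j ℕ.+ 3 ℕ.* suc j
      e₄ = ℕ-solve-∀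
      expands : ∀ p k I J → Maps φ₂ 1 p k I J → p ℕ.+ k ℕ.≤ I ℕ.+ J
      expands p k I J m with ≡.refl , ≡.refl ← Maps-functional φ₂ {1} {p} {k} m (φ₂-maps 1 p k) =
        ℕP.≤-trans (ℕP.≤-reflexive (ℕP.+-comm p k)) (ℕP.+-mono-≤ (ℕP.≤-trans (ℕP.m≤n*m k 3) (ℕP.m≤n+m _ (6 ℕ.* p))) (ℕP.≤-trans (ℕP.m≤n*m p 9) (ℕP.m≤m+n _ _)))

  -- The images of the triple product under `φ₀`, `φ₁`, `φ₂` consist of the factors of Ψ, separated
  -- by the residue of the index modulo 3; together they use each factor once. The monomial XY is
  -- the product of the leading terms X of `t₁` and Y of `t₂`.
  product-identity : ι euler₃ SR.* (t₀ SR.* t₁ SR.* t₂) SR.≈ mono 1# 1 1 SR.* (ι euler₉ SR.* ι euler₉ SR.* ι euler₉) SR.* Ψ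
  product-identity = ≊-all λ N i j l → begin
    (ι euler₃ SR.* (t₀ SR.* t₁ SR.* t₂)) i j
      ≈⟨ ≊-* {F = ι euler₃} {ι euler₃} {t₀ SR.* t₁ SR.* t₂} {B₀ N SR.* B₁ N SR.* B₂ N} (λ _ _ _ → refl)
          (≊-* {F = t₀ SR.* t₁} {B₀ N SR.* B₁ N} {t₂} {B₂ N} (≊-* {F = t₀} {B₀ N} {t₁} {B₁ N} (t₀-product N) (t₁-product N)) (t₂-product N)) i j l ⟩
    (ι euler₃ SR.* (B₀ N SR.* B₁ N SR.* B₂ N)) i j
      ≈⟨ SR.*-congˡ {ι euler₃} (SR.*-congʳ {B₂ N} (SR.*-congʳ {B₁ N} (SR.*-congˡ {ι euler₉ SR.* (Xa s₁ N SR.* Ya s₁ N)} mono-1))) i j ⟩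
    (ι euler₃ SR.* (ι euler₉ SR.* (Xa s₁ N SR.* Ya s₁ N) SR.* SR.1# SR.* B₁ N SR.* B₂ N)) i j
      ≈⟨ SI.solve 10 (λ e n x₁ y₁ x₂ y₀ m y₂ x₀ m′ →
           e SI.:* (n SI.:* (x₁ SI.:* y₁) SI.:* SI.con (+ 1) SI.:* (n SI.:* (x₂ SI.:* y₀) SI.:* m) SI.:* (n SI.:* (y₂ SI.:* x₀) SI.:* m′)) SI.:=
           m SI.:* m′ SI.:* (n SI.:* n SI.:* n) SI.:* (e SI.:* (x₂ SI.:* x₁ SI.:* x₀ SI.:* (y₂ SI.:* y₁ SI.:* y₀)))) SR.refl
           (ι euler₃) (ι euler₉) (Xa s₁ N) (Ya s₁ N) (Xa s₂ N) (Ya s₀ N) (mono 1# 1 0) (Ya s₂ N) (Xa s₀ N) (mono 1# 0 1) i j ⟩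
    (mono 1# 1 0 SR.* mono 1# 0 1 SR.* n³ SR.* (ι euler₃ SR.* (Xa s₂ N SR.* Xa s₁ N SR.* Xa s₀ N SR.* (Ya s₂ N SR.* Ya s₁ N SR.* Ya s₀ N)))) i j
      ≈⟨ SR.*-cong (SR.*-congʳ {n³} (SR.trans (mono-mul 1# 1# 1 0 0 1) (mono-cong 1 1 (*-identityˡ 1#))))
           (SR.*-congˡ {ι euler₃} (SR.*-cong (SR.sym (∏-thrice N X³factor)) (SR.sym (∏-thrice N Y³factor)))) i j ⟩
    (mono 1# 1 1 SR.* n³ SR.* (ι euler₃ SR.* G³ (thrice N))) i j
      ≈⟨ ≊-* {F = mono 1# 1 1 SR.* n³} {mono 1# 1 1 SR.* n³} {ι euler₃ SR.* G³ (thrice N)} {Ψ} (λ _ _ _ → refl)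
           (λ i j l → sym (Ψ-product (thrice N) i j (ℕP.≤-trans l (ℕP.≤-trans (ℕP.m≤n*m N 3) (ℕP.≤-reflexive (≡.sym (thrice-* N))))))) i j l ⟩
    (mono 1# 1 1 SR.* n³ SR.* Ψ) i j ∎
    where
    n³ : Ser²
    n³ = ι euler₉ SR.* ι euler₉ SR.* ι euler₉
    B₀ B₁ B₂ : ℕ → Ser²
    B₀ N = ι euler₉ SR.* (Xa s₁ N SR.* Ya s₁ N) SR.* mono 1# 0 0
    B₁ N = ι euler₉ SR.* (Xa s₂ N SR.* Ya s₀ N) SR.* mono 1# 1 0
    B₂ N = ι euler₉ SR.* (Ya s₂ N SR.* Xa s₀ N) SR.* mono 1# 0 1

-- Diagonal parts of cubic expressions in the theta functions

module ThetaConstants (K : CommutativeRing 0ℓ 0ℓ) where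
  open CommutativeRing K hiding (zero)
  open Products K public
  open SetoidReasoning setoid
  module PI = Integers P.seriesRing

  module PC = CubicForms P.seriesRing
  open PC using () renaming (cubed to cube) public

  -- Only four cubic monomials in Ψ, θ₁, θ₂ have grade 0. The remaining one, the cube of `θ₂`, has
  -- the same diagonal as that of `θ₁` by symmetry.
  α γ κ′ : P.Ser
  α = δ (cubed Ψ)
  γ = δ (cubed θ₁)
  κ′ = δ (Ψ SR.* θ₁ SR.* θ₂)

  cubeMap-diagonal : ∀ F F′ → Transport cubeMap 0 F F′ → δ F′ P.≋ P.V (δ F)
  cubeMap-diagonal F F′ t n = by (P.mod3 n)
    where
    lin : ∀ n → + 3 ℤ.* n ≡ + 3 ℤ.* n ℤ.+ + 0 ℤ.* n ℤ.+ + 0 ℤ.* + 0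
    lin = ℤ-solve-∀
    lin′ : ∀ n → + 3 ℤ.* n ≡ + 0 ℤ.* n ℤ.+ + 3 ℤ.* n ℤ.+ + 0 ℤ.* + 0
    lin′ = ℤ-solve-∀
    lin″ : ∀ p k → + 3 ℤ.* p ℤ.+ + 0 ℤ.* k ℤ.+ + 0 ℤ.* + 0 ≡ + 3 ℤ.* p
    lin″ = ℤ-solve-∀
    zero-off : ∀ n → res n ≢ 0₃ → F′ n n ≈ 0#
    zero-off n ne with transport-target t n n
    ... | inj₁ z = z
    ... | inj₂ (p , k , (e , _) , _) = ⊥-elim (ne (≡.trans (≡.cong res {n} {3 ℕ.* p ℕ.+ 0}
            (ℤP.+-injective (≡.trans e (≡.trans (lin″ (+ p) (+ k)) (≡.trans (≡.sym (ℤP.pos-* 3 p)) (≡.cong +_ (≡.sym (ℕP.+-identityʳ (3 ℕ.* p))))))))) (res-3*+ p 0)))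
    by : ∀ {n} → P.Mod3 n → F′ n n ≈ P.V (δ F) n
    by (P.rem0 k) = trans (sym (transport-coefficient {cubeMap} {0} {a = k} {k} {3 ℕ.* k} {3 ℕ.* k} t (≡.trans (ℤP.pos-* 3 k) (lin (+ k)) , ≡.trans (ℤP.pos-* 3 k) (lin′ (+ k)))))
      (reflexive (≡.sym (P.V-at (δ F) k)))
    by (P.rem1 k) = trans (zero-off (suc (3 ℕ.* k)) (λ e → one (≡.trans (≡.sym (≡.cong suc₃ (≡.trans (≡.cong res (≡.sym (ℕP.+-identityʳ (3 ℕ.* k)))) (res-3*+ k 0)))) e))) (reflexive (≡.sym (P.V-at1 (δ F) k)))
      where
      one : 1₃ ≢ 0₃
      one ()
    by (P.rem2 k) = trans (zero-off (suc (suc (3 ℕ.* k))) (λ e → two (≡.trans (≡.sym (≡.cong (λ r → suc₃ (suc₃ r)) (≡.trans (≡.cong res (≡.sym (ℕP.+-identityʳ (3 ℕ.* k)))) (res-3*+ k 0)))) e))) (reflexive (≡.sym (P.V-at2 (δ F) k)))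
      where
      two : 2₃ ≢ 0₃
      two ()

  α-V : α P.≋ P.V a
  α-V = cubeMap-diagonal T³ (cubed Ψ) (transport-* {v = 0} {0} (transport-* {v = 0} {0} T→Ψ T→Ψ) T→Ψ)

  q^-shift : ∀ m f n → P.mul (P.q^ m) f (m ℕ.+ n) ≈ f n
  q^-shift zero f n = trans (P.mon0-mul 1# f n) (*-identityˡ _)
  q^-shift (suc m) f n = trans (P.shift-mul-suc 1# m f (m ℕ.+ n)) (q^-shift m f n)

  q^-low : ∀ m f n → n ℕ.< m → P.mul (P.q^ m) f n ≈ 0#
  q^-low (suc m) f zero l = zeroˡ _
  q^-low (suc m) f (suc n) (s≤s l) = trans (P.shift-mul-suc 1# m f n) (q^-low m f n l)

  res-3* : ∀ k → res (3 ℕ.* k) ≡ 0₃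
  res-3* k = ≡.trans (≡.cong res (≡.sym (ℕP.+-identityʳ (3 ℕ.* k)))) (res-3*+ k 0)

  -- Solving for an image (n, n) at weight 3 forces k = p + 1 and n = 3p + 2. Hence the diagonal
  -- `δ⁻` at the source and the factor q².
  θ-map-diagonal : ∀ F F′ → Transport θ-map 3 F F′ → δ F′ P.≋ P.mul (P.q^ 2) (P.V (δ⁻ F))
  θ-map-diagonal F F′ t n = by n
    where
    solution : ∀ p k n → Maps θ-map 3 p k n n → n ≡ 3 ℕ.* p ℕ.+ 2
    solution p k n (e , e′) = ℤP.+-injective (≡.trans (three-times _ _ (≡.trans (lin₁ (+ n)) (≡.trans (≡.cong₂ (λ x y → + 2 ℤ.* x ℤ.+ y) e e′) (lin₂ (+ p) (+ k))))) (≡.cong (λ s → s ℤ.+ + 2) (≡.sym (ℤP.pos-* 3 p))))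
      where
      three-times : ∀ x y → + 3 ℤ.* x ≡ + 3 ℤ.* y → x ≡ y
      three-times x y = ℤP.*-cancelˡ-≡ (+ 3) x y
      lin₁ : ∀ n → + 3 ℤ.* n ≡ + 2 ℤ.* n ℤ.+ n
      lin₁ = ℤ-solve-∀
      lin₂ : ∀ p k → + 2 ℤ.* (+ 4 ℤ.* p ℤ.+ -[1+ 0 ] ℤ.* k ℤ.+ + 1 ℤ.* + 3) ℤ.+ (+ 1 ℤ.* p ℤ.+ + 2 ℤ.* k ℤ.+ + 0 ℤ.* + 3) ≡ + 3 ℤ.* (+ 3 ℤ.* p ℤ.+ + 2)
      lin₂ = ℤ-solve-∀
    zero-off : ∀ n → res n ≢ 2₃ → F′ n n ≈ 0#
    zero-off n ne with transport-target t n n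
    ... | inj₁ z = z
    ... | inj₂ (p , k , m , _) = ⊥-elim (ne (≡.trans (≡.cong res (solution p k n m)) (res-3*+ p 2)))
    at : ∀ {n} → P.Mod3 n → F′ (suc (suc n)) (suc (suc n)) ≈ P.V (δ⁻ F) n
    at (P.rem0 p) = trans (sym (transport-coefficient {θ-map} {3} {a = p} {suc p} {suc (suc (3 ℕ.* p))} {suc (suc (3 ℕ.* p))} t
        (≡.trans (≡.cong (λ s → + 2 ℤ.+ s) (ℤP.pos-* 3 p)) (lin (+ p)) , ≡.trans (≡.cong (λ s → + 2 ℤ.+ s) (ℤP.pos-* 3 p)) (lin′ (+ p)))))
      (reflexive (≡.sym (P.V-at (δ⁻ F) p)))
      where
      lin : ∀ p → + 2 ℤ.+ + 3 ℤ.* p ≡ + 4 ℤ.* p ℤ.+ -[1+ 0 ] ℤ.* (+ 1 ℤ.+ p) ℤ.+ + 1 ℤ.* + 3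
      lin = ℤ-solve-∀
      lin′ : ∀ p → + 2 ℤ.+ + 3 ℤ.* p ≡ + 1 ℤ.* p ℤ.+ + 2 ℤ.* (+ 1 ℤ.+ p) ℤ.+ + 0 ℤ.* + 3
      lin′ = ℤ-solve-∀
    at (P.rem1 p) = trans (zero-off (suc (suc (suc (3 ℕ.* p)))) (λ e → no0 (≡.trans (≡.cong (λ r → suc₃ (suc₃ (suc₃ r))) (≡.sym (res-3* p))) e))) (reflexive (≡.sym (P.V-at1 (δ⁻ F) p)))
      where
      no0 : 0₃ ≢ 2₃
      no0 ()
    at (P.rem2 p) = trans (zero-off (suc (suc (suc (suc (3 ℕ.* p))))) (λ e → no1 (≡.trans (≡.cong (λ r → suc₃ (suc₃ (suc₃ (suc₃ r)))) (≡.sym (res-3* p))) e))) (reflexive (≡.sym (P.V-at2 (δ⁻ F) p)))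
      where
      no1 : 1₃ ≢ 2₃
      no1 ()
    by : ∀ n → F′ n n ≈ P.mul (P.q^ 2) (P.V (δ⁻ F)) n
    by zero = trans (zero-off 0 (λ ())) (sym (q^-low 2 (P.V (δ⁻ F)) 0 (s≤s z≤n)))
    by (suc zero) = trans (zero-off 1 (λ ())) (sym (q^-low 2 (P.V (δ⁻ F)) 1 (s≤s (s≤s z≤n))))
    by (suc (suc n)) = trans (at (P.mod3 n)) (sym (q^-shift 2 (P.V (δ⁻ F)) n))

  γ-V : γ PR.≈ P.q^ 2 PR.* P.V c
  γ-V = PR.trans (θ-map-diagonal T³ (cubed θ₁) (transport-* {v = 2} {1} (transport-* {v = 1} {1} T→θ₁ T→θ₁) T→θ₁)) (PR.*-congˡ {P.q^ 2} (P.V-cong c-swapped))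

  ρ-map-diagonal : ∀ F F′ → Transport ρ-map 2 F F′ → ∀ p → F (suc p) (suc p) ≈ F′ (suc (3 ℕ.* p)) (suc (3 ℕ.* p))
  ρ-map-diagonal F F′ t p = transport-coefficient {ρ-map} {2} {a = suc p} {suc p} {suc (3 ℕ.* p)} {suc (3 ℕ.* p)} t
    (≡.trans (≡.cong (λ s → + 1 ℤ.+ s) (ℤP.pos-* 3 p)) (lin (+ p)) , ≡.trans (≡.cong (λ s → + 1 ℤ.+ s) (ℤP.pos-* 3 p)) (lin′ (+ p)))
    where
    lin : ∀ p → + 1 ℤ.+ + 3 ℤ.* p ≡ + 2 ℤ.* (+ 1 ℤ.+ p) ℤ.+ + 1 ℤ.* (+ 1 ℤ.+ p) ℤ.+ -[1+ 0 ] ℤ.* + 2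
    lin = ℤ-solve-∀
    lin′ : ∀ p → + 1 ℤ.+ + 3 ℤ.* p ≡ + 1 ℤ.* (+ 1 ℤ.+ p) ℤ.+ + 2 ℤ.* (+ 1 ℤ.+ p) ℤ.+ -[1+ 0 ] ℤ.* + 2
    lin′ = ℤ-solve-∀

  -- The images of the diagonal under φ₀, φ₁, φ₂ (with shifts 0, 3, 3) have exponents divisible by 3.
  φ-diagonal : ∀ F₀ F₀′ F₁ F₁′ F₂ F₂′ → Transport φ₀ 0 F₀ F₀′ → Transport φ₁ 3 F₁ F₁′ → Transport φ₂ 3 F₂ F₂′ →
    ∀ n → res n ≢ 0₃ → F₀′ n n + F₁′ n n + F₂′ n n ≈ 0#
  φ-diagonal F₀ F₀′ F₁ F₁′ F₂ F₂′ u₀ u₁ u₂ n ne = trans (+-cong (trans (+-cong (off u₀ m₀) (off u₁ m₁)) (+-identityˡ 0#)) (off u₂ m₂)) (+-identityˡ 0#)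
    where
    off : ∀ {L v F F′} → Transport L v F F′ → (∀ p k → Maps L v p k n n → res n ≡ 0₃) → F′ n n ≈ 0#
    off t m with transport-target t n n
    ... | inj₁ z = z
    ... | inj₂ (p , k , r , _) = ⊥-elim (ne (m p k r))
    triple : ∀ m → + n ≡ + 3 ℤ.* + m → res n ≡ 0₃
    triple m e = ≡.trans (≡.cong res (ℤP.+-injective (≡.trans e (≡.sym (ℤP.pos-* 3 m))))) (res-3* m)
    m₀ : ∀ p k → Maps φ₀ 0 p k n n → res n ≡ 0₃
    m₀ p k (e , _) = triple (2 ℕ.* p ℕ.+ k) (≡.trans e (≡.trans (lin (+ p) (+ k)) (≡.cong (λ s → + 3 ℤ.* (s ℤ.+ + k)) (≡.sym (ℤP.pos-* 2 p)))))
      where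
      lin : ∀ p k → + 6 ℤ.* p ℤ.+ + 3 ℤ.* k ℤ.+ + 0 ℤ.* + 0 ≡ + 3 ℤ.* (+ 2 ℤ.* p ℤ.+ k)
      lin = ℤ-solve-∀
    nine : ∀ p k → + 9 ℤ.* p ℤ.+ + 0 ℤ.* k ℤ.+ + 1 ℤ.* + 3 ≡ + 3 ℤ.* (+ 3 ℤ.* p ℤ.+ + 1)
    nine = ℤ-solve-∀
    m₁ : ∀ p k → Maps φ₁ 3 p k n n → res n ≡ 0₃
    m₁ p k (e , _) = triple (3 ℕ.* p ℕ.+ 1) (≡.trans e (≡.trans (nine (+ p) (+ k)) (≡.cong (λ s → + 3 ℤ.* (s ℤ.+ + 1)) (≡.sym (ℤP.pos-* 3 p)))))
    m₂ : ∀ p k → Maps φ₂ 3 p k n n → res n ≡ 0₃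
    m₂ p k (_ , e) = triple (3 ℕ.* p ℕ.+ 1) (≡.trans e (≡.trans (nine (+ p) (+ k)) (≡.cong (λ s → + 3 ℤ.* (s ℤ.+ + 1)) (≡.sym (ℤP.pos-* 3 p)))))

  ι-nat : ∀ n → ι (PI.nat n) SR.≈ SI.nat n
  ι-nat zero = ι-0
  ι-nat (suc zero) = ι-1
  ι-nat (suc (suc n)) = SR.trans (ι-+ P.1ₛ (PI.nat (suc n))) (SR.+-cong ι-1 (ι-nat (suc n)))

  ι-cancel : ∀ e F G → e 0 ≈ 1# → ι e SR.* F SR.≈ ι e SR.* G → F SR.≈ G
  ι-cancel e F G e₀ = S.mul-cancel (ι e) F G λ x → P.mul-regular (ι e 0) x (P.unit-regular e₀)

  ι-cube : ∀ f → ι f SR.* ι f SR.* ι f SR.≈ ι (cube f)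
  ι-cube f = SR.sym (SR.trans (ι-mul (f PR.* f) f) (SR.*-congʳ (ι-mul f f)))

  euler-0 : euler 0 ≈ 1#
  euler-0 = fq-0 0

  -- The quotients (q³;q³)³/(q;q) and (q;q)³/(q³;q³) enter through their defining products, which
  -- avoids inverses of series over a general ring.
  module _ {κ : P.Ser} (κ-product : euler PR.* κ PR.≈ cube euler₃) {b : P.Ser} (b-product : euler₃ PR.* b PR.≈ cube euler) where

    y : P.Ser
    y = P.q^ 1 PR.* P.V κ

    y-product : euler₃ PR.* y PR.≈ P.q^ 1 PR.* cube euler₉
    y-product = PR.trans (PC.swap-left euler₃ (P.q^ 1) (P.V κ))
      (PR.*-congˡ (PR.trans (PR.sym (P.V-mul euler κ)) (PR.trans (P.V-cong κ-product) (PR.trans (P.V-mul (euler₃ PR.* euler₃) euler₃) (PR.*-congʳ (P.V-mul euler₃ euler₃))))))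

    t-norm : Norm t₀ t₁ t₂ SR.≈ ι b SR.* Ψ
    t-norm = ι-cancel euler₃ (Norm t₀ t₁ t₂) (ι b SR.* Ψ) euler-0
      (SR.trans norm-identity (SR.trans (SR.*-congʳ (SR.trans (ι-cube euler) (SR.trans (ι-cong (PR.sym b-product)) (ι-mul euler₃ b)))) (SR.*-assoc _ _ _)))

    t-product : t₀ SR.* t₁ SR.* t₂ SR.≈ ι y SR.* Ψ
    t-product = ι-cancel euler₃ (t₀ SR.* t₁ SR.* t₂) (ι y SR.* Ψ) euler-0
      (SR.trans product-identity (SR.trans (SR.*-congʳ (SR.trans (SR.*-cong (SR.sym (ι-mon 1# 1)) (ι-cube euler₉)) (SR.trans (SR.sym (ι-mul (P.q^ 1) (cube euler₉))) (SR.trans (ι-cong (PR.sym y-product)) (ι-mul euler₃ y))))) (SR.*-assoc _ _ _)))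

    private
      graded-product : ∀ {r s t F G H} → Graded r F → Graded s G → Graded t H → Graded (r +₃ s +₃ t) (F SR.* G SR.* H)
      graded-product {r} {s} {t} p q u = graded-* {r +₃ s} {t} (graded-* {r} {s} p q) u

      module _ {f g h} (gf : Graded 0₃ f) (gg : Graded 1₃ g) (gh : Graded 2₃ h) where
        C₁-graded : Graded 1₃ (C₁ f g h)
        C₁-graded = graded-+ {F = x SR.+ x} (graded-+ {F = x} gx gx) gx
          where
          x = f SR.* f SR.* g SR.+ g SR.* g SR.* h SR.+ h SR.* h SR.* f
          gx : Graded 1₃ x
          gx = graded-+ {F = f SR.* f SR.* g SR.+ g SR.* g SR.* h} (graded-+ {F = f SR.* f SR.* g} (graded-product {0₃} {0₃} {1₃} gf gf gg) (graded-product {1₃} {1₃} {2₃} gg gg gh)) (graded-product {2₃} {2₃} {0₃} gh gh gf)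
        C₂-graded : Graded 2₃ (C₂ f g h)
        C₂-graded = graded-+ {F = x SR.+ x} (graded-+ {F = x} gx gx) gx
          where
          x = f SR.* f SR.* h SR.+ h SR.* h SR.* g SR.+ g SR.* g SR.* f
          gx : Graded 2₃ x
          gx = graded-+ {F = f SR.* f SR.* h SR.+ h SR.* h SR.* g} (graded-+ {F = f SR.* f SR.* h} (graded-product {0₃} {0₃} {2₃} gf gf gh) (graded-product {2₃} {2₃} {1₃} gh gh gg)) (graded-product {1₃} {1₃} {0₃} gg gg gf)
        C₀-graded : Graded 0₃ (C₀ f g h)
        C₀-graded = graded-+ {F = f SR.* f SR.* f SR.+ g SR.* g SR.* g SR.+ h SR.* h SR.* h}
          (graded-+ {F = f SR.* f SR.* f SR.+ g SR.* g SR.* g} (graded-+ {F = f SR.* f SR.* f} (graded-product {0₃} {0₃} {0₃} gf gf gf) (graded-product {1₃} {1₃} {1₃} gg gg gg)) (graded-product {2₃} {2₃} {2₃} gh gh gh))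
          (graded-* {0₃} {0₃} (graded-≈ (ι-nat 6) (graded-ι (PI.nat 6))) (graded-product {0₃} {1₃} {2₃} gf gg gh))

      g₀ g₁ g₂ : Ser²
      g₀ = ι a SR.* Ψ
      g₁ = ι c SR.* θ₁
      g₂ = ι c SR.* θ₂

      -- T³ has two homogeneous decompositions, one from the level three basis and one from cubing
      -- the trisection; the grading makes them agree part by part.
      g-components : ∀ r → three g₀ g₁ g₂ r SR.≈ three (C₀ t₀ t₁ t₂) (C₁ t₀ t₁ t₂) (C₂ t₀ t₁ t₂) r
      g-components r = ≊-all λ N → components {N} (three g₀ g₁ g₂) (three (C₀ t₀ t₁ t₂) (C₁ t₀ t₁ t₂) (C₂ t₀ t₁ t₂))
        (homogeneous ιaΨ-graded ιcθ₁-graded ιcθ₂-graded)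
        (homogeneous (C₀-graded t₀-graded t₁-graded t₂-graded) (C₁-graded t₀-graded t₁-graded t₂-graded) (C₂-graded t₀-graded t₁-graded t₂-graded))
        (≊-of (SR.trans (SR.sym T³-decomposition) (SR.trans (SR.*-cong (SR.*-cong T-trisection T-trisection) T-trisection) (cube-components t₀ t₁ t₂)))) r

    δ-ι*Ψ : ∀ f → δ (ι f SR.* Ψ) P.≋ f
    δ-ι*Ψ f n = trans (δ-ι* f Ψ n) (trans (P.mul-cong {f} {f} (λ _ → refl) δ-Ψ n) (PR.*-identityʳ f n))

    a-value : a PR.≈ b PR.+ PI.int (+ 9) PR.* y
    a-value n = begin
      a n                                                        ≈⟨ δ-ι*Ψ a n ⟨
      g₀ n n                                                     ≈⟨ g-components 0₃ n n ⟩
      C₀ t₀ t₁ t₂ n n                                            ≈⟨ C₀-Norm t₀ t₁ t₂ n n ⟩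
      (Norm t₀ t₁ t₂ SR.+ SI.int (+ 9) SR.* (t₀ SR.* t₁ SR.* t₂)) n n
        ≈⟨ SR.+-cong t-norm (SR.trans (SR.*-cong (SR.sym (ι-nat 9)) t-product) (SR.trans (SR.sym (SR.*-assoc _ _ _)) (SR.*-congʳ (SR.sym (ι-mul (PI.nat 9) y))))) n n ⟩
      (ι b SR.* Ψ) n n + (ι (PI.nat 9 PR.* y) SR.* Ψ) n n        ≈⟨ +-cong (δ-ι*Ψ b n) (δ-ι*Ψ (PI.nat 9 PR.* y) n) ⟩
      b n + (PI.nat 9 PR.* y) n                                  ∎

    -- The series b + 3y is the diagonal of t₀³ + t₁³ + t₂³, and each of these cubes meets the
    -- diagonal only at exponents divisible by 3.
    b+3y-support : ∀ n → res n ≢ 0₃ → (b PR.+ PI.int (+ 3) PR.* y) n ≈ 0#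
    b+3y-support n ne = begin
      b n + (PI.nat 3 PR.* y) n                                  ≈⟨ +-cong (δ-ι*Ψ b n) (δ-ι*Ψ (PI.nat 3 PR.* y) n) ⟨
      (ι b SR.* Ψ) n n + (ι (PI.nat 3 PR.* y) SR.* Ψ) n n
        ≈⟨ SR.+-cong t-norm (SR.trans (SR.*-cong (SR.sym (ι-nat 3)) t-product) (SR.trans (SR.sym (SR.*-assoc _ _ _)) (SR.*-congʳ (SR.sym (ι-mul (PI.nat 3) y))))) n n ⟨
      (Norm t₀ t₁ t₂ SR.+ SI.int (+ 3) SR.* (t₀ SR.* t₁ SR.* t₂)) n n
        ≈⟨ Norm-cubes t₀ t₁ t₂ n n ⟩
      cubed t₀ n n + cubed t₁ n n + cubed t₂ n n
        ≈⟨ φ-diagonal T³ (cubed t₀) T³ (cubed t₁) T³ (cubed t₂) (transport-* {v = 0} {0} (transport-* {v = 0} {0} T→t₀ T→t₀) T→t₀)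
             (transport-* {v = 2} {1} (transport-* {v = 1} {1} T→t₁ T→t₁) T→t₁) (transport-* {v = 2} {1} (transport-* {v = 1} {1} T→t₂ T→t₂) T→t₂) n ne ⟩
      0#                                                         ∎

    -- `ρ-map` turns Ψ θ₁ θ₂ into t₀ t₁ t₂ with weight 2, so the coefficient of κ′ at p + 1 is that
    -- of y at 3p + 1. There y is q κ(q³).
    κ′-value : κ′ PR.≈ P.q^ 1 PR.* κ
    κ′-value zero = trans (trans (*-congʳ (trans (*-congˡ (θ₁-graded 0 0 (λ ()))) (zeroʳ _))) (zeroˡ _)) (sym (q^-low 1 κ 0 (s≤s z≤n)))
    κ′-value (suc p) = begin
      κ′ (suc p)                                 ≈⟨ ρ-map-diagonal (Ψ SR.* θ₁ SR.* θ₂) (t₀ SR.* t₁ SR.* t₂) (transport-* {v = 1} {1} (transport-* {v = 0} {1} Ψ→t₀ θ₁→t₁) θ₂→t₂) p ⟩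
      (t₀ SR.* t₁ SR.* t₂) (suc (3 ℕ.* p)) (suc (3 ℕ.* p))  ≈⟨ t-product (suc (3 ℕ.* p)) (suc (3 ℕ.* p)) ⟩
      (ι y SR.* Ψ) (suc (3 ℕ.* p)) (suc (3 ℕ.* p))          ≈⟨ δ-ι*Ψ y (suc (3 ℕ.* p)) ⟩
      y (suc (3 ℕ.* p))                          ≈⟨ q^-shift 1 (P.V κ) (3 ℕ.* p) ⟩
      P.V κ (3 ℕ.* p)                            ≡⟨ P.V-at κ p ⟩
      κ p                                        ≈⟨ q^-shift 1 κ p ⟨
      P.mul (P.q^ 1) κ (suc p)                   ∎

    private
      g-norm : Norm g₀ g₁ g₂ SR.≈ cubed (ι b SR.* Ψ)
      g-norm = SR.trans (Norm-cong {g₀} {C₀ t₀ t₁ t₂} {g₁} {C₁ t₀ t₁ t₂} {g₂} {C₂ t₀ t₁ t₂} (g-components 0₃) (g-components 1₃) (g-components 2₃))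
        (SR.trans (norm-components t₀ t₁ t₂) (SR.*-cong (SR.*-cong t-norm t-norm) t-norm))

      cube-scaled : ∀ f F → cubed (ι f SR.* F) SR.≈ ι (cube f) SR.* cubed F
      cube-scaled f F = SR.trans (cubed-* (ι f) F) (SR.*-congʳ (ι-cube f))

      δ-g₀g₁g₂ : δ (g₀ SR.* g₁ SR.* g₂) P.≋ a PR.* c PR.* c PR.* κ′
      δ-g₀g₁g₂ n = trans (SR.trans (collect-factors (ι a) (ι c) Ψ θ₁ θ₂)
          (SR.*-congʳ (SR.sym (SR.trans (ι-mul (a PR.* c) c) (SR.*-congʳ (ι-mul a c))))) n n) (δ-ι* (a PR.* c PR.* c) (Ψ SR.* θ₁ SR.* θ₂) n)

      δ-b : δ (cubed (ι b SR.* Ψ)) P.≋ cube b PR.* α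
      δ-b n = trans (cube-scaled b Ψ n n) (δ-ι* (cube b) (cubed Ψ) n)

    δ-θ₂³ : δ (cubed θ₂) P.≋ γ
    δ-θ₂³ n = sym (transport-coefficient {swapMap} {0} {a = n} {n} {n} {n} (transport-* {v = 0} {0} (transport-* {v = 0} {0} θ₁→θ₂ θ₁→θ₂) θ₁→θ₂) (lin₁ (+ n) , lin₂ (+ n)))
      where
      lin₁ : ∀ x → x ≡ + 0 ℤ.* x ℤ.+ + 1 ℤ.* x ℤ.+ + 0 ℤ.* + 0
      lin₁ = ℤ-solve-∀
      lin₂ : ∀ x → x ≡ + 1 ℤ.* x ℤ.+ + 0 ℤ.* x ℤ.+ + 0 ℤ.* + 0
      lin₂ = ℤ-solve-∀

    -- The norm of T³ in two ways: as the cube of the norm of T, which is b Ψ, and directly from its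
    -- components in the level three basis.
    norm-relation : cube b PR.* α PR.≈ cube a PR.* α PR.+ PI.int (+ 2) PR.* (cube c PR.* γ) PR.- PI.int (+ 3) PR.* (a PR.* c PR.* c PR.* κ′)
    norm-relation = PR.trans (λ n → trans (sym (δ-b n)) (trans (sym (g-norm n n)) (step n)))
      (PI.solve 3 (λ x y z → x PI.:+ y PI.:+ y PI.:- PI.con (+ 3) PI.:* z PI.:= x PI.:+ PI.con (+ 2) PI.:* y PI.:- PI.con (+ 3) PI.:* z) PR.refl (cube a PR.* α) (cube c PR.* γ) (a PR.* c PR.* c PR.* κ′))
      where
      step : ∀ n → Norm g₀ g₁ g₂ n n ≈ (cube a PR.* α PR.+ cube c PR.* γ PR.+ cube c PR.* γ PR.- PI.int (+ 3) PR.* (a PR.* c PR.* c PR.* κ′)) n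
      step n = +-cong (+-cong (+-cong (trans (cube-scaled a Ψ n n) (δ-ι* (cube a) (cubed Ψ) n)) (trans (cube-scaled c θ₁ n n) (δ-ι* (cube c) (cubed θ₁) n)))
          (trans (cube-scaled c θ₂ n n) (trans (δ-ι* (cube c) (cubed θ₂) n) (P.mul-cong {cube c} {cube c} (λ _ → refl) δ-θ₂³ n))))
        (-‿cong (trans (SR.*-congʳ (SR.sym (ι-nat 3)) n n) (trans (δ-ι* (PI.nat 3) (g₀ SR.* g₁ SR.* g₂) n) (P.mul-cong {PI.nat 3} {PI.nat 3} (λ _ → refl) δ-g₀g₁g₂ n))))

    -- The part of grade 0 of (g₀ + g₁ + g₂)³ is the norm plus 9 g₀ g₁ g₂. The norm is known from
    -- the trisection, so no cubes of `a` or `c` appear.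
    δ-T⁹ : δ (cubed T³) PR.≈ cube b PR.* α PR.+ PI.int (+ 9) PR.* (a PR.* c PR.* c PR.* κ′)
    δ-T⁹ n = begin
      cubed T³ n n
        ≈⟨ SR.trans (SR.*-cong (SR.*-cong T³-decomposition T³-decomposition) T³-decomposition) (SR.trans (cube-components g₀ g₁ g₂)
             (SR.+-congʳ (SR.+-congʳ (C₀-Norm g₀ g₁ g₂)))) n n ⟩
      Norm g₀ g₁ g₂ n n + (SI.nat 9 SR.* (g₀ SR.* g₁ SR.* g₂)) n n + C₁ g₀ g₁ g₂ n n + C₂ g₀ g₁ g₂ n n
        ≈⟨ +-cong (+-cong (+-cong (trans (g-norm n n) (δ-b n))
             (trans (SR.*-congʳ (SR.sym (ι-nat 9)) n n) (trans (δ-ι* (PI.nat 9) (g₀ SR.* g₁ SR.* g₂) n) (P.mul-cong {PI.nat 9} {PI.nat 9} (λ _ → refl) δ-g₀g₁g₂ n))))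
             (δ-graded-zero (C₁ g₀ g₁ g₂) (C₁-graded ιaΨ-graded ιcθ₁-graded ιcθ₂-graded) (λ ()) n))
             (δ-graded-zero (C₂ g₀ g₁ g₂) (C₂-graded ιaΨ-graded ιcθ₁-graded ιcθ₂-graded) (λ ()) n) ⟩
      (cube b PR.* α PR.+ PI.int (+ 9) PR.* (a PR.* c PR.* c PR.* κ′)) n + 0# + 0#
        ≈⟨ trans (+-identityʳ _) (+-identityʳ _) ⟩
      (cube b PR.* α PR.+ PI.int (+ 9) PR.* (a PR.* c PR.* c PR.* κ′)) n ∎

-- Frobenius partitions

quot : ∀ {m} k → Fin (m ℕ.* k) → ℕ
quot {m} k i = toℕ (proj₁ (remQuot {m} k i))

quot-↑ˡ : ∀ m k (i : Fin k) → quot {suc m} k (i ↑ˡ (m ℕ.* k)) ≡ 0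
quot-↑ˡ m k i rewrite FinP.splitAt-↑ˡ k i (m ℕ.* k) = ≡.refl

quot-↑ʳ : ∀ m k (i : Fin (m ℕ.* k)) → quot {suc m} k (k ↑ʳ i) ≡ suc (quot {m} k i)
quot-↑ʳ m k i rewrite FinP.splitAt-↑ʳ k (m ℕ.* k) i = ≡.refl

∑Fin : ∀ {m} → (Fin m → ℕ) → ℕ
∑Fin {zero} f = 0
∑Fin {suc m} f = f Fin.zero ℕ.+ ∑Fin (f ∘ Fin.suc)

sum-allFin : ∀ {m} (f : Fin m → ℕ) → sum (map f (allFin m)) ≡ ∑Fin f
sum-allFin {m} f = go m (λ i → i) f
  where
  go : ∀ {A : Set} m (g : Fin m → A) (f : A → ℕ) → sum (map f (tabulate g)) ≡ ∑Fin (f ∘ g)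
  go zero g f = ≡.refl
  go (suc m) g f = ≡.cong (f (g Fin.zero) ℕ.+_) (go m (g ∘ Fin.suc) f)

∑Fin-cong : ∀ {m} {f g : Fin m → ℕ} → (∀ i → f i ≡ g i) → ∑Fin f ≡ ∑Fin g
∑Fin-cong {zero} p = ≡.refl
∑Fin-cong {suc m} p = ≡.cong₂ ℕ._+_ (p Fin.zero) (∑Fin-cong (λ i → p (Fin.suc i)))

∑Fin-+ : ∀ {m} (f g : Fin m → ℕ) → ∑Fin (λ i → f i ℕ.+ g i) ≡ ∑Fin f ℕ.+ ∑Fin g
∑Fin-+ {zero} f g = ≡.refl
∑Fin-+ {suc m} f g = ≡.trans (≡.cong (f Fin.zero ℕ.+ g Fin.zero ℕ.+_) (∑Fin-+ (f ∘ Fin.suc) (g ∘ Fin.suc))) (lin (f Fin.zero) (g Fin.zero) (∑Fin (f ∘ Fin.suc)) (∑Fin (g ∘ Fin.suc)))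
  where
  lin : ∀ a b c d → a ℕ.+ b ℕ.+ (c ℕ.+ d) ≡ a ℕ.+ c ℕ.+ (b ℕ.+ d)
  lin = ℕ-solve-∀

weight : ∀ {m} → (Fin m → ℕ) → Vec Bool m → ℕ
weight w S = ∑Fin (λ i → if lookup S i then w i else 0)

weight-suc : ∀ {m} (w : Fin m → ℕ) S → weight (λ i → suc (w i)) S ≡ weight (λ _ → 1) S ℕ.+ weight w S
weight-suc w S = ≡.trans (∑Fin-cong (λ i → each (lookup S i) (w i))) (∑Fin-+ (λ i → if lookup S i then 1 else 0) (λ i → if lookup S i then w i else 0))
  where
  each : ∀ b n → (if b then suc n else 0) ≡ (if b then 1 else 0) ℕ.+ (if b then n else 0)
  each true n = ≡.refl
  each false n = ≡.refl

module CommutativeRingPowers (R : CommutativeRing 0ℓ 0ℓ) where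
  open CommutativeRing R hiding (zero)
  open Integers R
  open CubicForms R

  ninth : Carrier → Carrier
  ninth x = cubed (cubed x)

  power : ℕ → Carrier → Carrier
  power zero x = 1#
  power (suc n) x = x * power n x

  power-9 : ∀ x → power 9 x ≈ ninth x
  power-9 = solve 1 (λ x → x :* (x :* (x :* (x :* (x :* (x :* (x :* (x :* (x :* con (+ 1))))))))) := let c = x :* x :* x in c :* c :* c) refl

  ninth-* : ∀ x y → ninth (x * y) ≈ ninth x * ninth y
  ninth-* x y = trans (cubed-cong (cubed-* x y)) (cubed-* (cubed x) (cubed y))

  ninth-1 : ninth 1# ≈ 1#
  ninth-1 = solve 0 (let c = con (+ 1) :* con (+ 1) :* con (+ 1) in c :* c :* c := con (+ 1)) refl

module Partitions (K : CommutativeRing 0ℓ 0ℓ) where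
  open CommutativeRing K hiding (zero)
  open ThetaConstants K public
  open CommutativeRingPowers S.seriesRing public
  open SetoidReasoning setoid
  module KI = Integers K

  module _ (R : CommutativeRing 0ℓ 0ℓ) where
    private module R = CommutativeRing R

    ∑ₗ : {A : Set} → List A → (A → R.Carrier) → R.Carrier
    ∑ₗ [] f = R.0#
    ∑ₗ (x ∷ xs) f = f x R.+ ∑ₗ xs f

    ∑ₗ-++ : {A : Set} (xs ys : List A) (f : A → R.Carrier) → ∑ₗ (xs ++ ys) f R.≈ ∑ₗ xs f R.+ ∑ₗ ys f
    ∑ₗ-++ [] ys f = R.sym (R.+-identityˡ _)
    ∑ₗ-++ (x ∷ xs) ys f = R.trans (R.+-congˡ (∑ₗ-++ xs ys f)) (R.sym (R.+-assoc _ _ _))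

    ∑ₗ-map : {A B : Set} (g : A → B) (xs : List A) (f : B → R.Carrier) → ∑ₗ (map g xs) f R.≈ ∑ₗ xs (λ x → f (g x))
    ∑ₗ-map g [] f = R.refl
    ∑ₗ-map g (x ∷ xs) f = R.+-congˡ (∑ₗ-map g xs f)

    ∑ₗ-cong : {A : Set} (xs : List A) {f g : A → R.Carrier} → (∀ x → f x R.≈ g x) → ∑ₗ xs f R.≈ ∑ₗ xs g
    ∑ₗ-cong [] p = R.refl
    ∑ₗ-cong (x ∷ xs) p = R.+-cong (p x) (∑ₗ-cong xs p)

    ∑ₗ-*ˡ : {A : Set} (xs : List A) (f : A → R.Carrier) (c : R.Carrier) → c R.* ∑ₗ xs f R.≈ ∑ₗ xs (λ x → c R.* f x)
    ∑ₗ-*ˡ [] f c = R.zeroʳ c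
    ∑ₗ-*ˡ (x ∷ xs) f c = R.trans (R.distribˡ _ _ _) (R.+-congˡ (∑ₗ-*ˡ xs f c))

    ∑ₗ-product : {A B : Set} (xs : List A) (ys : List B) (f : A → R.Carrier) (g : B → R.Carrier) →
      ∑ₗ (cartesianProduct xs ys) (λ p → f (proj₁ p) R.* g (proj₂ p)) R.≈ ∑ₗ xs f R.* ∑ₗ ys g
    ∑ₗ-product [] ys f g = R.sym (R.zeroˡ _)
    ∑ₗ-product (x ∷ xs) ys f g = R.trans (∑ₗ-++ (map (x ,_) ys) (cartesianProduct xs ys) _)
      (R.trans (R.+-cong (R.trans (∑ₗ-map (x ,_) ys _) (R.sym (∑ₗ-*ˡ ys g (f x)))) (∑ₗ-product xs ys f g)) (R.sym (R.distribʳ _ _ _)))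

    ∑ₗ-rows : ∀ m (f : Vec Bool (suc m) → R.Carrier) → ∑ₗ (allRows (suc m)) f R.≈ ∑ₗ (allRows m) (λ v → f (false ∷ v) R.+ f (true ∷ v))
    ∑ₗ-rows m f = go (allRows m)
      where
      go : ∀ vs → ∑ₗ (concatMap (λ v → (false ∷ v) ∷ (true ∷ v) ∷ []) vs) f R.≈ ∑ₗ vs (λ v → f (false ∷ v) R.+ f (true ∷ v))
      go [] = R.refl
      go (v ∷ vs) = R.trans (R.+-congˡ (R.+-congˡ (go vs))) (R.sym (R.+-assoc _ _ _))

  count : {A : Set} (b : A → Bool) (xs : List A) → KI.nat (length (filter (λ x → b x BoolP.≟ true) xs)) ≈ ∑ₗ K xs (λ x → if b x then 1# else 0#)
  count b [] = refl
  count b (x ∷ xs) with b x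
  ... | true = trans (KI.nat-suc (length (filter (λ x → b x BoolP.≟ true) xs))) (+-congˡ (count b xs))
  ... | false = trans (count b xs) (sym (+-identityˡ _))

  ∏Fin : ∀ {m} → (Fin m → Ser²) → Ser²
  ∏Fin {zero} f = SR.1#
  ∏Fin {suc m} f = f Fin.zero SR.* ∏Fin (f ∘ Fin.suc)

  ∏Fin-cong : ∀ {m} {f g : Fin m → Ser²} → (∀ i → f i SR.≈ g i) → ∏Fin f SR.≈ ∏Fin g
  ∏Fin-cong {zero} p = SR.refl
  ∏Fin-cong {suc m} p = SR.*-cong (p Fin.zero) (∏Fin-cong (λ i → p (Fin.suc i)))

  ∏Fin-+ : ∀ a b (f : Fin (a ℕ.+ b) → Ser²) → ∏Fin f SR.≈ ∏Fin (λ i → f (i ↑ˡ b)) SR.* ∏Fin (λ i → f (a ↑ʳ i))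
  ∏Fin-+ zero b f = SR.sym (SR.*-identityˡ _)
  ∏Fin-+ (suc a) b f = SR.trans (SR.*-congˡ (∏Fin-+ a b (f ∘ Fin.suc))) (SR.sym (SR.*-assoc _ _ _))

  ∏Fin-const : ∀ m x → ∏Fin {m} (λ _ → x) SR.≈ power m x
  ∏Fin-const zero x = SR.refl
  ∏Fin-const (suc m) x = SR.*-congˡ (∏Fin-const m x)

  ∏-front : ∀ n f → SF.∏ (suc n) f SR.≈ f 0 SR.* SF.∏ n (λ j → f (suc j))
  ∏-front zero f = SR.refl
  ∏-front (suc n) f = SR.trans (SR.*-congˡ (∏-front n f)) (swap-left (f (suc n)) (f 0) (SF.∏ n (λ j → f (suc j))))

  ∏Fin-quot : ∀ m k (f : ℕ → Ser²) → ∏Fin {m ℕ.* k} (λ i → f (quot {m} k i)) SR.≈ SF.∏ m (λ j → power k (f j))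
  ∏Fin-quot zero k f = SR.refl
  ∏Fin-quot (suc m) k f = SR.trans (∏Fin-+ k (m ℕ.* k) (λ i → f (quot {suc m} k i)))
    (SR.trans (SR.*-cong (SR.trans (∏Fin-cong (λ i → SR.reflexive (≡.cong f (quot-↑ˡ m k i)))) (∏Fin-const k (f 0)))
        (SR.trans (∏Fin-cong (λ i → SR.reflexive (≡.cong f (quot-↑ʳ m k i)))) (∏Fin-quot m k (λ j → f (suc j)))))
      (SR.sym (∏-front m (λ j → power k (f j)))))

  ∏-ninth : ∀ n f → SF.∏ n (λ j → power 9 (f j)) SR.≈ ninth (SF.∏ n f)
  ∏-ninth zero f = SR.sym ninth-1
  ∏-ninth (suc n) f = SR.trans (SR.*-cong (power-9 (f n)) (∏-ninth n f)) (SR.sym (ninth-* (f n) (SF.∏ n f)))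

  -- A row is a set of entries, that is, the choice of 1 or of the monomial in each factor.
  rows-product : ∀ m (x y : Fin m → ℕ) → ∑ₗ S.seriesRing (allRows m) (λ v → mono 1# (weight x v) (weight y v)) SR.≈ ∏Fin (λ i → SR.1# SR.+ mono 1# (x i) (y i))
  rows-product zero x y = SR.trans (SR.+-identityʳ _) mono-1
  rows-product (suc m) x y = SR.trans (∑ₗ-rows S.seriesRing m (λ v → mono 1# (weight x v) (weight y v)))
    (SR.trans (∑ₗ-cong S.seriesRing (allRows m) {λ v → mono 1# (weight x (false ∷ v)) (weight y (false ∷ v)) SR.+ mono 1# (weight x (true ∷ v)) (weight y (true ∷ v))} {λ v → head SR.* f v} split)
      (SR.trans (SR.sym (∑ₗ-*ˡ S.seriesRing (allRows m) f head)) (SR.*-congˡ (rows-product m x′ y′))))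
    where
    x′ y′ : Fin m → ℕ
    x′ = x ∘ Fin.suc
    y′ = y ∘ Fin.suc
    f : Vec Bool m → Ser²
    f v = mono 1# (weight x′ v) (weight y′ v)
    head : Ser²
    head = SR.1# SR.+ mono 1# (x Fin.zero) (y Fin.zero)
    split : ∀ v → mono 1# (weight x (false ∷ v)) (weight y (false ∷ v)) SR.+ mono 1# (weight x (true ∷ v)) (weight y (true ∷ v)) SR.≈ head SR.* f v
    split v = SR.sym (SR.trans (SR.distribʳ _ _ _) (SR.+-cong (SR.*-identityˡ _)
      (SR.trans (mono-mul 1# 1# (x Fin.zero) (weight x′ v) (y Fin.zero) (weight y′ v)) (mono-cong (x Fin.zero ℕ.+ weight x′ v) (y Fin.zero ℕ.+ weight y′ v) (*-identityˡ 1#)))))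

  module _ (n : ℕ) where
    private
      q : Fin (suc n ℕ.* 9) → ℕ
      q = quot {suc n} 9

      -- An entry ℓ is recorded as X^(ℓ+1) Y^ℓ in the upper row and as X^ℓ Y^(ℓ+1) in the lower one,
      -- which matches `Xfactor ℓ` and `Yfactor ℓ`.
      upper lower : Row 9 n → Ser²
      upper v = mono 1# (weight (λ i → suc (q i)) v) (weight q v)
      lower v = mono 1# (weight q v) (weight (λ i → suc (q i)) v)

      len : Row 9 n → ℕ
      len v = weight {suc n ℕ.* 9} (λ _ → 1) v

      rowLen-weight : (v : Row 9 n) → rowLen {suc n ℕ.* 9} v ≡ len v
      rowLen-weight v = sum-allFin {suc n ℕ.* 9} (λ i → if lookup v i then 1 else 0)

      rowVal-weight : ∀ v → rowVal 9 n v ≡ weight q v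
      rowVal-weight v = sum-allFin {suc n ℕ.* 9} (λ i → if lookup v i then q i else 0)

      -- X^{len S + val S + val T} Y^{val S + len T + val T} lies on the diagonal at (n, n) iff (S, T) is a symbol of weight n.
      diagonal-iff : ∀ lS vS lT vT (d : Dec (lS ≡ lT)) (d′ : Dec (lS ℕ.+ vS ℕ.+ vT ≡ n)) →
        mono 1# (lS ℕ.+ vS ℕ.+ vT) (vS ℕ.+ (lT ℕ.+ vT)) n n ≈ (if does d ∧ does d′ then 1# else 0#)
      diagonal-iff lS vS lT vT (yes ≡.refl) (yes e) = trans (reflexive (≡.cong₂ (λ I J → mono 1# I J n n) e (≡.trans (lin lS vS vT) e))) (mono-at 1# n n)
        where
        lin : ∀ l v w → v ℕ.+ (l ℕ.+ w) ≡ l ℕ.+ v ℕ.+ w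
        lin = ℕ-solve-∀
      diagonal-iff lS vS lT vT (yes ≡.refl) (no ne) = mono-off 1# (lS ℕ.+ vS ℕ.+ vT) (vS ℕ.+ (lT ℕ.+ vT)) n n (λ e _ → ne e)
      diagonal-iff lS vS lT vT (no ne) _ = mono-off 1# (lS ℕ.+ vS ℕ.+ vT) (vS ℕ.+ (lT ℕ.+ vT)) n n (λ e e′ →
            ne (ℕP.+-cancelʳ-≡ (vS ℕ.+ vT) lS lT (≡.trans (≡.sym (ℕP.+-assoc lS vS vT)) (≡.trans e (≡.trans (≡.sym e′) (lin lT vS vT))))))
        where
        lin : ∀ l v w → v ℕ.+ (l ℕ.+ w) ≡ l ℕ.+ (v ℕ.+ w)
        lin = ℕ-solve-∀

      pair-term : ∀ (p : Row 9 n × Row 9 n) → (if isCFP 9 n p then 1# else 0#) ≈ (upper (proj₁ p) SR.* lower (proj₂ p)) n n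
      pair-term (s , t) = sym (trans (trans (mono-mul 1# 1# (weight (λ i → suc (q i)) s) (weight q t) (weight q s) (weight (λ i → suc (q i)) t) n n)
          (mono-cong (weight (λ i → suc (q i)) s ℕ.+ weight q t) (weight q s ℕ.+ weight (λ i → suc (q i)) t) (*-identityˡ 1#) n n))
        (trans (reflexive (≡.cong₂ (λ I J → mono 1# I J n n) (≡.cong (ℕ._+ weight q t) (weight-suc q s)) (≡.cong (weight q s ℕ.+_) (weight-suc q t))))
          (trans (diagonal-iff (len s) (weight q s) (len t) (weight q t) (len s ℕP.≟ len t) (len s ℕ.+ weight q s ℕ.+ weight q t ℕP.≟ n))
            (reflexive (≡.cong₂ (λ b c → if b ∧ c then 1# else 0#)
              (≡.cong₂ (λ a b → does (a ℕP.≟ b)) (≡.sym (rowLen-weight s)) (≡.sym (rowLen-weight t)))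
              (≡.cong (λ a → does (a ℕP.≟ n)) (≡.cong₂ ℕ._+_ (≡.cong₂ ℕ._+_ (≡.sym (rowLen-weight s)) (≡.sym (rowVal-weight s))) (≡.sym (rowVal-weight t)))))))))

    -- Each value 0, ..., n occurs in nine colours, so each factor of `G (suc n)` occurs nine times.
    cφ-product : KI.nat (cφ 9 n) ≈ ninth (G (suc n)) n n
    cφ-product = begin
      KI.nat (cφ 9 n)
        ≈⟨ count (isCFP 9 n) (cartesianProduct rows rows) ⟩
      ∑ₗ K (cartesianProduct rows rows) (λ p → if isCFP 9 n p then 1# else 0#)
        ≈⟨ ∑ₗ-cong K (cartesianProduct rows rows) pair-term ⟩
      ∑ₗ K (cartesianProduct rows rows) (λ p → (upper (proj₁ p) SR.* lower (proj₂ p)) n n)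
        ≈⟨ at-nn (cartesianProduct rows rows) (λ p → upper (proj₁ p) SR.* lower (proj₂ p)) ⟩
      ∑ₗ S.seriesRing (cartesianProduct rows rows) (λ p → upper (proj₁ p) SR.* lower (proj₂ p)) n n
        ≈⟨ SR.trans (∑ₗ-product S.seriesRing rows rows upper lower) (SR.*-cong
             (SR.trans (rows-product (suc n ℕ.* 9) (λ i → suc (q i)) q) (SR.trans (∏Fin-quot (suc n) 9 Xfactor) (∏-ninth (suc n) Xfactor)))
             (SR.trans (rows-product (suc n ℕ.* 9) q (λ i → suc (q i))) (SR.trans (∏Fin-quot (suc n) 9 Yfactor) (∏-ninth (suc n) Yfactor)))) n n ⟩
      (ninth (SF.∏ (suc n) Xfactor) SR.* ninth (SF.∏ (suc n) Yfactor)) n n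
        ≈⟨ ninth-* (SF.∏ (suc n) Xfactor) (SF.∏ (suc n) Yfactor) n n ⟨
      ninth (G (suc n)) n n ∎
      where
      rows : List (Row 9 n)
      rows = allRows (suc n ℕ.* 9)
      at-nn : {A : Set} (xs : List A) (f : A → Ser²) → ∑ₗ K xs (λ x → f x n n) ≈ ∑ₗ S.seriesRing xs f n n
      at-nn [] f = refl
      at-nn (x ∷ xs) f = +-congˡ (at-nn xs f)

  factor-low : ∀ {N} i j F → N ℕ.≤ i ℕ.+ j → (SR.1# SR.+ mono 1# i j) SR.* F ≊[ N ] F
  factor-low {N} i j F le I J l = trans (SR.trans (SR.distribʳ F SR.1# (mono 1# i j)) (SR.+-cong (SR.*-identityˡ F) (SR.*-comm (mono 1# i j) F)) I J)
    (trans (+-congˡ (*-mono-low {0} {N} F 1# i j (λ _ _ ()) le I J l)) (+-identityʳ _))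

  G-step : ∀ M → G (suc M) ≊[ suc (M ℕ.+ M) ] G M
  G-step M i j l = trans (regroup i j) (trans (factor-low (suc M) M (Yfactor M SR.* G M) ℕP.≤-refl i j l) (factor-low M (suc M) (G M) (ℕP.≤-reflexive (≡.sym (ℕP.+-suc M M))) i j l))
    where
    regroup : G (suc M) SR.≈ Xfactor M SR.* (Yfactor M SR.* G M)
    regroup = SR.trans (SR.*-assoc _ _ _) (SR.*-congˡ (swap-left (SF.∏ M Xfactor) (Yfactor M) (SF.∏ M Yfactor)))

  G-stable : ∀ d M → G (d ℕ.+ M) ≊[ suc (M ℕ.+ M) ] G M
  G-stable zero M i j l = refl
  G-stable (suc d) M i j l = trans (G-step (d ℕ.+ M) i j (ℕP.≤-trans l (s≤s (ℕP.+-mono-≤ (ℕP.m≤n+m M d) (ℕP.m≤n+m M d))))) (G-stable d M i j l)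

  ninth-≊ : ∀ {N F F′} → F ≊[ N ] F′ → ninth F ≊[ N ] ninth F′
  ninth-≊ {N} {F} {F′} p = cubed-≊ (cubed F) (cubed F′) (cubed-≊ F F′ p)
    where
    cubed-≊ : ∀ F F′ → F ≊[ N ] F′ → cubed F ≊[ N ] cubed F′
    cubed-≊ F F′ p = ≊-* {F = F SR.* F} {F′ SR.* F′} {F} {F′} (≊-* {F = F} {F′} {F} {F′} p p) p

  CΦ : P.Ser
  CΦ n = KI.nat (cφ 9 n)

  -- The coefficients of `CΦ` are computed from products `G` of different lengths. In the degrees
  -- that matter these agree with the longest one, so a single length serves for the whole
  -- convolution.
  CΦ-theta : cube (cube euler) PR.* CΦ PR.≈ δ (ninth T)
  CΦ-theta n = sym (begin
    ninth T n n                                      ≈⟨ ninth-≊ {suc (n ℕ.+ n)} {T} {ι euler SR.* G (suc n)} T-G n n ℕP.≤-refl ⟩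
    ninth (ι euler SR.* G (suc n)) n n               ≈⟨ SR.trans (ninth-* (ι euler) (G (suc n))) (SR.*-congʳ (SR.trans (cubed-cong (ι-cube euler)) (ι-cube (cube euler)))) n n ⟩
    (ι (cube (cube euler)) SR.* ninth (G (suc n))) n n  ≈⟨ δ-ι* (cube (cube euler)) (ninth (G (suc n))) n ⟩
    P.mul (cube (cube euler)) (δ (ninth (G (suc n)))) n  ≈⟨ P.mul-cong[] {suc n} {cube (cube euler)} {cube (cube euler)} (λ _ _ → refl) coefficients n ℕP.≤-refl ⟩
    P.mul (cube (cube euler)) CΦ n                   ∎)
    where
    -- The triple product is exact below degree 2n + 1 when it has 2n + 1 factors of each kind; by
    -- `G-stable` those beyond n + 1 do not matter in these degrees.
    T-G : T ≊[ suc (n ℕ.+ n) ] ι euler SR.* G (suc n)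
    T-G i j l = trans (triple-product (n ℕ.+ suc n) i j (ℕP.≤-trans l (ℕP.≤-reflexive (≡.sym (ℕP.+-suc n n)))))
      (≊-* {F = ι euler} {ι euler} {G (n ℕ.+ suc n)} {G (suc n)} (λ _ _ _ → refl) (≊-≤ {F = G (n ℕ.+ suc n)} {G (suc n)} (s≤s (ℕP.≤-trans (ℕP.+-mono-≤ (ℕP.n≤1+n n) (ℕP.n≤1+n n)) ℕP.≤-refl)) (G-stable n (suc n))) i j l)
    coefficients : δ (ninth (G (suc n))) P.≋[ suc n ] CΦ
    coefficients k (s≤s k≤n) = trans (ninth-≊ {suc (k ℕ.+ k)} {G (suc n)} {G (suc k)}
        (≡.subst (λ m → G m ≊[ suc (k ℕ.+ k) ] G (suc k)) (≡.trans (ℕP.+-suc (n ℕ.∸ k) k) (≡.cong suc (ℕP.m∸n+n≡m k≤n)))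
          (≊-≤ {F = G (n ℕ.∸ k ℕ.+ suc k)} {G (suc k)} (s≤s (ℕP.+-mono-≤ (ℕP.n≤1+n k) (ℕP.n≤1+n k))) (G-stable (n ℕ.∸ k) (suc k)))) k k ℕP.≤-refl)
      (sym (cφ-product k))

-- Eta quotients of level nine

-- With a(q) = u + 6 y and b(q) = u - 3 y one has u = a(q³), 3 y = c(q³) and 3 y n = (c(q)/3)³.
module LevelNineForms (R : CommutativeRing 0ℓ 0ℓ) where
  open CommutativeRing R hiding (zero)
  open Integers R
  open CubicForms R

  nForm : Carrier → Carrier → Carrier
  nForm u y = u * u + int (+ 3) * (u * y) + int (+ 9) * (y * y)

  bForm aForm : Carrier → Carrier → Carrier
  bForm u y = u - int (+ 3) * y
  aForm u y = u + int (+ 6) * y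

  private
    nP bP aP : ∀ {n} → (u y : Polynomial n) → Polynomial n
    nP u y = u :* u :+ con (+ 3) :* (u :* y) :+ con (+ 9) :* (y :* y)
    bP u y = u :- con (+ 3) :* y
    aP u y = u :+ con (+ 6) :* y

  b-n : ∀ u y → bForm u y * nForm u y ≈ cubed u - int (+ 27) * cubed y
  b-n = solve 2 (λ u y → bP u y :* nP u y := u :* u :* u :- con (+ 27) :* (y :* y :* y)) refl

  a-cubed : ∀ u y → cubed (bForm u y) + int (+ 27) * (y * nForm u y) ≈ cubed (aForm u y)
  a-cubed = solve 2 (λ u y → bP u y :* bP u y :* bP u y :+ con (+ 27) :* (y :* nP u y) := aP u y :* aP u y :* aP u y) refl

  Norm-scaled : ∀ e u y → Norm (e * u) (- (int (+ 3) * (e * y))) 0# ≈ cubed e * (cubed u - int (+ 27) * cubed y)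
  Norm-scaled = solve 3 (λ e u y → let f = e :* u ; g = :- (con (+ 3) :* (e :* y)) ; h = con (+ 0) in
    f :* f :* f :+ g :* g :* g :+ h :* h :* h :- con (+ 3) :* (f :* g :* h) := e :* e :* e :* (u :* u :* u :- con (+ 27) :* (y :* y :* y))) refl

  cubes-difference : ∀ x y → (x * x + x * y + y * y) * (x - y) ≈ cubed x - cubed y
  cubes-difference = solve 2 (λ x y → (x :* x :+ x :* y :+ y :* y) :* (x :- y) := x :* x :* x :- y :* y :* y) refl

  b-from-u : ∀ b y → b ≈ bForm (b + int (+ 3) * y) y
  b-from-u = solve 2 (λ b y → b := bP (b :+ con (+ 3) :* y) y) refl

  a-from-b : ∀ b y → b + int (+ 9) * y ≈ aForm (b + int (+ 3) * y) y
  a-from-b = solve 2 (λ b y → b :+ con (+ 9) :* y := aP (b :+ con (+ 3) :* y) y) refl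

  norm-step : ∀ s c₁ c₂ D N v →
    s * s * s * ((1# + cubed c₂) * ((1# + cubed c₁) * N)) * (D * v) ≈ (1# + cubed c₂) * ((1# + cubed c₁) * (D * (N * v))) * cubed s
  norm-step = solve 6 (λ s c₁ c₂ D N v → s :* s :* s :* ((con (+ 1) :+ c₂ :* c₂ :* c₂) :* ((con (+ 1) :+ c₁ :* c₁ :* c₁) :* N)) :* (D :* v) :=
    (con (+ 1) :+ c₂ :* c₂ :* c₂) :* ((con (+ 1) :+ c₁ :* c₁ :* c₁) :* (D :* (N :* v))) :* (s :* s :* s)) refl

  total-step₁ : ∀ c f g h → f + c * h + (g + c * f) + (h + c * g) ≈ (1# + c) * (f + g + h)
  total-step₁ = solve 4 (λ c f g h → f :+ c :* h :+ (g :+ c :* f) :+ (h :+ c :* g) := (con (+ 1) :+ c) :* (f :+ g :+ h)) refl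

  total-step₂ : ∀ c f g h → f + c * g + (g + c * h) + (h + c * f) ≈ (1# + c) * (f + g + h)
  total-step₂ = solve 4 (λ c f g h → f :+ c :* g :+ (g :+ c :* h) :+ (h :+ c :* f) := (con (+ 1) :+ c) :* (f :+ g :+ h)) refl

  total-scale : ∀ s f g h → s * f + s * g + s * h ≈ s * (f + g + h)
  total-scale = solve 4 (λ s f g h → s :* f :+ s :* g :+ s :* h := s :* (f :+ g :+ h)) refl

  total-1 : 1# + 0# + 0# ≈ 1#
  total-1 = solve 0 (con (+ 1) :+ con (+ 0) :+ con (+ 0) := con (+ 1)) refl

  regroup-steps : ∀ A B D s v w → B * (A * (D * (v * cubed w))) * cubed s ≈ (D * (B * (A * v))) * cubed (s * w)
  regroup-steps = solve 6 (λ A B D s v w → B :* (A :* (D :* (v :* (w :* w :* w)))) :* (s :* s :* s) := (D :* (B :* (A :* v))) :* ((s :* w) :* (s :* w) :* (s :* w))) refl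

  split-b : ∀ e b y → e * b ≈ e * (b + int (+ 3) * y) + - (int (+ 3) * (e * y)) + 0#
  split-b = solve 3 (λ e b y → e :* b := e :* (b :+ con (+ 3) :* y) :+ (:- (con (+ 3) :* (e :* y))) :+ con (+ 0)) refl

  neg-cubed : ∀ x → 1# + cubed (- x) ≈ 1# - cubed x
  neg-cubed = solve 1 (λ x → con (+ 1) :+ (:- x) :* (:- x) :* (:- x) := con (+ 1) :- x :* x :* x) refl

-- Series in q by residues of exponents, and the norm of the Euler product

module Eta (K : CommutativeRing 0ℓ 0ℓ) where
  open CommutativeRing K hiding (zero)
  open Partitions K public
  open SetoidReasoning setoid
  module PL = LevelNineForms P.seriesRing
  open PC using () renaming (Norm to PNorm) public

  PGraded : ℤ₃ → P.Ser → Set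
  PGraded r f = ∀ n → res n ≢ r → f n ≈ 0#

  PHomogeneous : (ℤ₃ → P.Ser) → Set
  PHomogeneous f = ∀ r → PGraded r (f r)

  P-total : (ℤ₃ → P.Ser) → P.Ser
  P-total f = f 0₃ PR.+ f 1₃ PR.+ f 2₃

  Pgraded-+ : ∀ {r f g} → PGraded r f → PGraded r g → PGraded r (f PR.+ g)
  Pgraded-+ p q n ne = trans (+-cong (p n ne) (q n ne)) (+-identityˡ 0#)

  Pgraded-neg : ∀ {r f} → PGraded r f → PGraded r (PR.- f)
  Pgraded-neg p n ne = trans (-‿cong (p n ne)) (Algebra.Properties.Ring.-0#≈0# ring)

  Pgraded-* : ∀ {r s f g} → PGraded r f → PGraded s g → PGraded (r +₃ s) (f PR.* g)
  Pgraded-* {r} {s} {f} {g} p q n ne = P.mul-vanish f g n h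
    where
    h : ∀ i j → i ℕ.+ j ≡ n → f i ≈ 0# ⊎ g j ≈ 0#
    h i j ≡.refl with res i ≟₃ r | res j ≟₃ s
    ... | no ne₁ | _ = inj₁ (p i ne₁)
    ... | yes _ | no ne₂ = inj₂ (q j ne₂)
    ... | yes e₁ | yes e₂ = ⊥-elim (ne (≡.trans (res-+ i j) (≡.cong₂ _+₃_ e₁ e₂)))

  Pgraded-mon : ∀ {r} c i → res i ≡ r → PGraded r (P.mon c i)
  Pgraded-mon c i e n ne = reflexive (P.mon-off c i n (λ { ≡.refl → ne e }))

  Pgraded-1 : PGraded 0₃ PR.1#
  Pgraded-1 zero ne = ⊥-elim (ne ≡.refl)
  Pgraded-1 (suc n) ne = refl

  Pgraded-V : ∀ f → PGraded 0₃ (P.V f)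
  Pgraded-V f n ne with P.mod3 n
  ... | P.rem0 k = ⊥-elim (ne (res-3* k))
  ... | P.rem1 k = reflexive (P.V-at1 f k)
  ... | P.rem2 k = reflexive (P.V-at2 f k)

  Pgraded-nat : ∀ n → PGraded 0₃ (PI.nat n)
  Pgraded-nat zero i ne = refl
  Pgraded-nat (suc zero) = Pgraded-1
  Pgraded-nat (suc (suc n)) = Pgraded-+ {f = PR.1#} {PI.nat (suc n)} Pgraded-1 (Pgraded-nat (suc n))

  P-total-at : ∀ f → PHomogeneous f → ∀ n → P-total f n ≈ f (res n) n
  P-total-at f h n = go (res n) ≡.refl
    where
    off : ∀ r s → res n ≡ s → r ≢ s → f r n ≈ 0#
    off r s e ne = h r n (λ e′ → ne (≡.trans (≡.sym e′) e))
    go : ∀ r → res n ≡ r → P-total f n ≈ f r n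
    go 0₃ e = trans (+-cong (trans (+-congˡ (off 1₃ 0₃ e (λ ()))) (+-identityʳ _)) (off 2₃ 0₃ e (λ ()))) (+-identityʳ _)
    go 1₃ e = trans (+-cong (trans (+-congʳ (off 0₃ 1₃ e (λ ()))) (+-identityˡ _)) (off 2₃ 1₃ e (λ ()))) (+-identityʳ _)
    go 2₃ e = trans (+-congʳ (trans (+-cong (off 0₃ 2₃ e (λ ())) (off 1₃ 2₃ e (λ ()))) (+-identityˡ 0#))) (+-identityˡ _)

  P-components : ∀ {N} f g → PHomogeneous f → PHomogeneous g → P-total f P.≋[ N ] P-total g → ∀ r → f r P.≋[ N ] g r
  P-components f g hf hg e r n l with res n ≟₃ r
  ... | yes ≡.refl = trans (sym (P-total-at f hf n)) (trans (e n l) (P-total-at g hg n))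
  ... | no ne = trans (hf r n ne) (sym (hg r n ne))

  component : ℤ₃ → P.Ser → P.Ser
  component r f n with res n ≟₃ r
  ... | yes _ = f n
  ... | no _ = 0#

  component-graded : ∀ f → PHomogeneous (λ r → component r f)
  component-graded f r n ne with res n ≟₃ r
  ... | yes e = ⊥-elim (ne e)
  ... | no _ = refl

  component-total : ∀ f → P-total (λ r → component r f) P.≋ f
  component-total f n = trans (P-total-at (λ r → component r f) (component-graded f) n) same
    where
    same : component (res n) f n ≈ f n
    same with res n ≟₃ res n
    ... | yes _ = refl
    ... | no ne = ⊥-elim (ne ≡.refl)

  three-homogeneous : ∀ {f₀ f₁ f₂} → PGraded 0₃ f₀ → PGraded 1₃ f₁ → PGraded 2₃ f₂ → PHomogeneous (three f₀ f₁ f₂)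
  three-homogeneous p₀ p₁ p₂ 0₃ = p₀
  three-homogeneous p₀ p₁ p₂ 1₃ = p₁
  three-homogeneous p₀ p₁ p₂ 2₃ = p₂

  one-minus : ℕ → P.Ser
  one-minus m = PR.1# PR.+ PR.- P.q^ m

  -- The residue parts of the product of 1 - q^m over m ≤ 3N, built three factors at a time: the
  -- exponents 1 and 2 modulo 3 rotate the parts, and the third factor acts as a scalar.
  qparts : ℕ → ℤ₃ → P.Ser
  qparts₁ qparts₂ : ℕ → ℤ₃ → P.Ser
  qparts zero = three PR.1# PR.0# PR.0#
  qparts (suc N) r = one-minus (suc (suc (suc (thrice N)))) PR.* qparts₂ N r
  qparts₁ N r = qparts N r PR.+ PR.- P.q^ (suc (thrice N)) PR.* qparts N (pred₃ r)
  qparts₂ N r = qparts₁ N r PR.+ PR.- P.q^ (suc (suc (thrice N))) PR.* qparts₁ N (suc₃ r)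

  res-thrice : ∀ N → res (thrice N) ≡ 0₃
  res-thrice N = ≡.trans (≡.cong res (thrice-* N)) (res-3* N)

  qparts-graded : ∀ N → PHomogeneous (qparts N)
  qparts₁-graded : ∀ N → PHomogeneous (qparts₁ N)
  qparts₂-graded : ∀ N → PHomogeneous (qparts₂ N)
  qparts-graded zero = three-homogeneous Pgraded-1 (λ _ _ → refl) (λ _ _ → refl)
  qparts-graded (suc N) r = Pgraded-* {0₃} {r} (Pgraded-+ {f = PR.1#} {PR.- P.q^ m} Pgraded-1 (Pgraded-neg {f = P.q^ m} (Pgraded-mon 1# m (≡.trans (suc₃³ _) (res-thrice N))))) (qparts₂-graded N r)
    where m = suc (suc (suc (thrice N)))
  qparts₁-graded N r = Pgraded-+ {f = qparts N r} (qparts-graded N r)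
    (≡.subst (λ s → PGraded s (PR.- P.q^ (suc (thrice N)) PR.* qparts N (pred₃ r))) (up r)
      (Pgraded-* {1₃} {pred₃ r} (Pgraded-neg {f = P.q^ (suc (thrice N))} (Pgraded-mon 1# (suc (thrice N)) (≡.cong suc₃ (res-thrice N)))) (qparts-graded N (pred₃ r))))
    where
    up : ∀ r → 1₃ +₃ pred₃ r ≡ r
    up 0₃ = ≡.refl
    up 1₃ = ≡.refl
    up 2₃ = ≡.refl
  qparts₂-graded N r = Pgraded-+ {f = qparts₁ N r} (qparts₁-graded N r)
    (≡.subst (λ s → PGraded s (PR.- P.q^ (suc (suc (thrice N))) PR.* qparts₁ N (suc₃ r))) (suc₃³ r)
      (Pgraded-* {2₃} {suc₃ r} (Pgraded-neg {f = P.q^ (suc (suc (thrice N)))} (Pgraded-mon 1# (suc (suc (thrice N))) (≡.cong (λ s → suc₃ (suc₃ s)) (res-thrice N)))) (qparts₁-graded N (suc₃ r))))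

  qparts-total : ∀ N → P-total (qparts N) PR.≈ fq (thrice N)
  qparts-total zero = PL.total-1
  qparts-total (suc N) = PR.trans (PL.total-scale (one-minus (suc (suc (suc (thrice N))))) (qparts₂ N 0₃) (qparts₂ N 1₃) (qparts₂ N 2₃)) (PR.*-congˡ
    (PR.trans (PL.total-step₂ (PR.- P.q^ (suc (suc (thrice N)))) (qparts₁ N 0₃) (qparts₁ N 1₃) (qparts₁ N 2₃)) (PR.*-congˡ
      (PR.trans (PL.total-step₁ (PR.- P.q^ (suc (thrice N))) (qparts N 0₃) (qparts N 1₃) (qparts N 2₃)) (PR.*-congˡ (qparts-total N))))))

  V-one-minus : ∀ m → P.V (one-minus m) PR.≈ one-minus (3 ℕ.* m)
  V-one-minus m = PR.trans (P.V-+ PR.1# (PR.- P.q^ m)) (PR.+-cong P.V-1 (PR.trans (P.V-neg (P.q^ m)) (PR.-‿cong (P.V-mon 1# m))))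

  one-minus-cubed : ∀ m → PR.1# PR.+ cube (PR.- P.q^ m) PR.≈ P.V (one-minus m)
  one-minus-cubed m = PR.trans (PL.neg-cubed (P.q^ m)) (PR.trans (PR.+-congˡ (PR.-‿cong (PR.trans (PR.*-congʳ (P.mon-mul 1# 1# m m))
    (PR.trans (P.mon-mul (1# * 1#) 1# (m ℕ.+ m) m) (PR.trans (P.mon-cong (m ℕ.+ m ℕ.+ m) (trans (*-identityʳ _) (*-identityʳ _))) (PR.reflexive (≡.cong P.q^ (lin m)))))))) (PR.sym (V-one-minus m)))
    where
    lin : ∀ m → m ℕ.+ m ℕ.+ m ≡ 3 ℕ.* m
    lin = ℕ-solve-∀

  -- A factor with m prime to 3 has norm 1 - q^(3m), a factor with 3 dividing m is a scalar and
  -- contributes its cube. The extra product in q⁹ on the left supplies the missing factors 1 -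
  -- q^(3m) with 3 dividing m.
  qparts-norm : ∀ N → PNorm (qparts N 0₃) (qparts N 1₃) (qparts N 2₃) PR.* P.V (P.V (fq N)) PR.≈ P.V (fq (thrice N)) PR.* cube (P.V (fq N))
  qparts-norm zero = PR.trans (PR.*-cong PC.Norm-1 (PR.trans (P.V-cong P.V-1) P.V-1)) (PR.sym (PR.*-cong P.V-1 (PR.trans (PC.cubed-cong P.V-1) (PR.trans (PR.*-identityʳ _) (PR.*-identityʳ _)))))
  qparts-norm (suc N) = PR.trans (PR.*-cong
      (PR.trans (PC.Norm-scale s (qparts₂ N 0₃) (qparts₂ N 1₃) (qparts₂ N 2₃)) (PR.*-congˡ (PR.trans (PC.Norm-step′ c₂ (qparts₁ N 0₃) (qparts₁ N 1₃) (qparts₁ N 2₃))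
        (PR.*-congˡ (PC.Norm-step c₁ (qparts N 0₃) (qparts N 1₃) (qparts N 2₃))))))
      (PR.trans (P.V-cong (P.V-mul (one-minus (suc N)) (fq N))) (P.V-mul (P.V (one-minus (suc N))) (P.V (fq N)))))
    (PR.trans (PL.norm-step s c₁ c₂ (P.V (P.V (one-minus (suc N)))) M (P.V (P.V (fq N))))
    (PR.trans (PR.*-congʳ (PR.*-cong (one-minus-cubed (suc (suc (thrice N)))) (PR.*-cong (one-minus-cubed (suc (thrice N))) (PR.*-cong (P.V-cong (PR.trans (V-one-minus (suc N)) (PR.reflexive s-eq))) (qparts-norm N)))))
    (PR.trans (PL.regroup-steps (P.V (one-minus (suc (thrice N)))) (P.V (one-minus (suc (suc (thrice N))))) (P.V s) s (P.V (fq (thrice N))) (P.V (fq N)))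
    (PR.*-cong (PR.sym (PR.trans (P.V-mul s (fq (suc (suc (thrice N))))) (PR.*-congˡ (PR.trans (P.V-mul (one-minus (suc (suc (thrice N)))) (fq (suc (thrice N)))) (PR.*-congˡ (P.V-mul (one-minus (suc (thrice N))) (fq (thrice N))))))))
      (PC.cubed-cong (PR.sym (PR.trans (P.V-mul (one-minus (suc N)) (fq N)) (PR.*-congʳ (PR.trans (V-one-minus (suc N)) (PR.reflexive s-eq))))))))))
    where
    s c₁ c₂ M : P.Ser
    s = one-minus (suc (suc (suc (thrice N))))
    c₁ = PR.- P.q^ (suc (thrice N))
    c₂ = PR.- P.q^ (suc (suc (thrice N)))
    M = PNorm (qparts N 0₃) (qparts N 1₃) (qparts N 2₃)
    s-eq : one-minus (3 ℕ.* suc N) ≡ s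
    s-eq = ≡.cong one-minus (≡.trans (ℕP.*-suc 3 N) (≡.cong (λ t → suc (suc (suc t))) (≡.sym (thrice-* N))))

  ep : ℤ₃ → P.Ser
  ep r = component r euler

  PNorm-≋[] : ∀ {N f f′ g g′ h h′} → f P.≋[ N ] f′ → g P.≋[ N ] g′ → h P.≋[ N ] h′ → PNorm f g h P.≋[ N ] PNorm f′ g′ h′
  PNorm-≋[] {N} {f} {f′} {g} {g′} {h} {h′} p q r n l = +-cong (+-cong (+-cong (cubeN f f′ p n l) (cubeN g g′ q n l)) (cubeN h h′ r n l))
    (-‿cong (P.mul-cong[] {N} {PI.int (+ 3)} {PI.int (+ 3)} {f PR.* g PR.* h} {f′ PR.* g′ PR.* h′} (λ _ _ → refl) (P.mul-cong[] {N} {f PR.* g} {f′ PR.* g′} {h} {h′} (P.mul-cong[] {N} {f} {f′} {g} {g′} p q) r) n l))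
    where
    cubeN : ∀ f f′ → f P.≋[ N ] f′ → cube f P.≋[ N ] cube f′
    cubeN f f′ p = P.mul-cong[] {N} {f PR.* f} {f′ PR.* f′} {f} {f′} (P.mul-cong[] {N} {f} {f′} {f} {f′} p p) p

  euler-norm : PNorm (ep 0₃) (ep 1₃) (ep 2₃) PR.* euler₉ PR.≈ euler₃ PR.* cube euler₃
  euler-norm n = begin
    (PNorm (ep 0₃) (ep 1₃) (ep 2₃) PR.* euler₉) n
      ≈⟨ P.mul-cong[] {N} {PNorm (ep 0₃) (ep 1₃) (ep 2₃)} {PNorm (qparts N 0₃) (qparts N 1₃) (qparts N 2₃)} {euler₉} {P.V (P.V (fq N))}
           (PNorm-≋[] {N} {ep 0₃} {qparts N 0₃} {ep 1₃} {qparts N 1₃} {ep 2₃} {qparts N 2₃} (close 0₃) (close 1₃) (close 2₃)) (P.V-cong[] {N} (P.V-cong[] {N} near)) n ℕP.≤-refl ⟩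
    (PNorm (qparts N 0₃) (qparts N 1₃) (qparts N 2₃) PR.* P.V (P.V (fq N))) n      ≈⟨ qparts-norm N n ⟩
    (P.V (fq (thrice N)) PR.* cube (P.V (fq N))) n
      ≈⟨ P.mul-cong[] {N} {P.V (fq (thrice N))} {euler₃} {cube (P.V (fq N))} {cube euler₃} (P.V-cong[] {N} (λ i l → sym (near₃ i l)))
           (P.mul-cong[] {N} {P.V (fq N) PR.* P.V (fq N)} {euler₃ PR.* euler₃} (P.mul-cong[] {N} {P.V (fq N)} {euler₃} (P.V-cong[] {N} (λ i l → sym (near i l))) (P.V-cong[] {N} (λ i l → sym (near i l)))) (P.V-cong[] {N} (λ i l → sym (near i l)))) n ℕP.≤-refl ⟩
    (euler₃ PR.* cube euler₃) n ∎
    where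
    N : ℕ
    N = suc n
    near : euler P.≋[ N ] fq N
    near i l = euler-fq N i (ℕP.m<n⇒m<1+n l)
    near₃ : euler P.≋[ N ] fq (thrice N)
    near₃ i l = euler-fq (thrice N) i (ℕP.m<n⇒m<1+n (ℕP.≤-trans l (ℕP.≤-trans (ℕP.m≤n*m N 3) (ℕP.≤-reflexive (≡.sym (thrice-* N))))))
    close : ∀ r → ep r P.≋[ N ] qparts N r
    close = P-components {N} ep (qparts N) (component-graded euler) (qparts-graded N) (λ i l → trans (component-total euler i) (trans (near₃ i l) (sym (qparts-total N i))))

module EtaForms (R : CommutativeRing 0ℓ 0ℓ) where
  open CommutativeRing R hiding (zero)
  open Integers R
  open CubicForms R
  open LevelNineForms R

  -- Here w = c(q³) and v = κ(q³); the hypothesis comes from the norm of T³.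
  c-equation : ∀ κ v w c q u → let a = u + int (+ 6) * (q * v) in
    int (+ 27) * (cubed κ * u) + int (+ 2) * (cubed c * (q * w)) ≈ int (+ 3) * (a * c * c * κ) →
    int (+ 3) * (a * (κ * (c + int (+ 3) * κ))) * (c - int (+ 3) * κ) ≈ int (+ 2) * (q * (cubed c * w - cubed (int (+ 3) * κ) * (int (+ 3) * v)))
  c-equation κ v w c q u e = trans (trans (lhs κ v c q u) (+-congʳ (sym e))) (rhs κ v w c q u)
    where
    lhs : ∀ κ v c q u → let a = u + int (+ 6) * (q * v) in
      int (+ 3) * (a * (κ * (c + int (+ 3) * κ))) * (c - int (+ 3) * κ) ≈ int (+ 3) * (a * c * c * κ) - int (+ 27) * (a * cubed κ)
    lhs = solve 5 (λ κ v c q u → let a = u :+ con (+ 6) :* (q :* v) in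
      con (+ 3) :* (a :* (κ :* (c :+ con (+ 3) :* κ))) :* (c :- con (+ 3) :* κ) := con (+ 3) :* (a :* c :* c :* κ) :- con (+ 27) :* (a :* (κ :* κ :* κ))) refl
    rhs : ∀ κ v w c q u → int (+ 27) * (cubed κ * u) + int (+ 2) * (cubed c * (q * w)) - int (+ 27) * ((u + int (+ 6) * (q * v)) * cubed κ) ≈
      int (+ 2) * (q * (cubed c * w - cubed (int (+ 3) * κ) * (int (+ 3) * v)))
    rhs = solve 6 (λ κ v w c q u → let t = con (+ 3) :* κ in
      con (+ 27) :* (κ :* κ :* κ :* u) :+ con (+ 2) :* (c :* c :* c :* (q :* w)) :- con (+ 27) :* ((u :+ con (+ 6) :* (q :* v)) :* (κ :* κ :* κ)) :=
      con (+ 2) :* (q :* (c :* c :* c :* w :- t :* t :* t :* (con (+ 3) :* v)))) refl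

  -- Here A, B, k are the cubes of a, b, κ. Replacing a³ by b³ + 27 q κ³ cancels b³ u, and
  -- everything that is left contains q.
  norm-relation-reduced : ∀ B A k u q c w κ a → A ≈ B + int (+ 27) * (q * k) →
    B * u ≈ A * u + int (+ 2) * (c * (q * q * w)) - int (+ 3) * (a * (q * κ)) →
    q * (int (+ 27) * (k * u) + int (+ 2) * (c * (q * w))) ≈ q * (int (+ 3) * (a * κ))
  norm-relation-reduced B A k u q c w κ a p e = trans (sym (+-identityʳ _)) (trans (+-congˡ (sym (-‿inverseʳ (B * u)))) (trans (+-congˡ (+-congˡ (-‿cong (trans e (+-congʳ (+-congʳ (*-congʳ p))))))) (fin B k u q c w κ a)))
    where
    fin : ∀ B k u q c w κ a → q * (int (+ 27) * (k * u) + int (+ 2) * (c * (q * w))) + (B * u + - ((B + int (+ 27) * (q * k)) * u + int (+ 2) * (c * (q * q * w)) - int (+ 3) * (a * (q * κ)))) ≈ q * (int (+ 3) * (a * κ))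
    fin = solve 8 (λ B k u q c w κ a → q :* (con (+ 27) :* (k :* u) :+ con (+ 2) :* (c :* (q :* w))) :+ (B :* u :+ :- ((B :+ con (+ 27) :* (q :* k)) :* u :+ con (+ 2) :* (c :* (q :* q :* w)) :- con (+ 3) :* (a :* (q :* κ)))) := q :* (con (+ 3) :* (a :* κ))) refl

  eta₁ : ∀ e e₃ b κ q → e₃ * b ≈ cubed e → e * κ ≈ cubed e₃ → cubed e * (e₃ * (b * (q * cubed κ))) ≈ cubed e * (q * cubed (cubed e₃))
  eta₁ e e₃ b κ q p r = trans (l e e₃ b κ q) (trans (*-cong p (*-congˡ (cubed-cong r))) refl)
    where
    l : ∀ e e₃ b κ q → cubed e * (e₃ * (b * (q * cubed κ))) ≈ e₃ * b * (q * cubed (e * κ))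
    l = solve 5 (λ e e₃ b κ q → let t = e :* κ in e :* e :* e :* (e₃ :* (b :* (q :* (κ :* κ :* κ)))) := e₃ :* b :* (q :* (t :* t :* t))) refl

  eta₂ : ∀ e₃ e₉ y B q → e₃ * y ≈ q * cubed e₉ → e₉ * B ≈ cubed e₃ → cubed e₉ * (e₃ * (y * cubed B)) ≈ cubed e₉ * (q * cubed (cubed e₃))
  eta₂ e₃ e₉ y B q p r = trans (l e₃ e₉ y B) (trans (*-cong p (cubed-cong r)) (m q (cubed e₉) (cubed (cubed e₃))))
    where
    l : ∀ e₃ e₉ y B → cubed e₉ * (e₃ * (y * cubed B)) ≈ e₃ * y * cubed (e₉ * B)
    l = solve 4 (λ e₃ e₉ y B → let t = e₉ :* B in e₉ :* e₉ :* e₉ :* (e₃ :* (y :* (B :* B :* B))) := e₃ :* y :* (t :* t :* t)) refl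
    m : ∀ q x z → q * x * z ≈ x * (q * z)
    m = solve 3 (λ q x z → q :* x :* z := x :* (q :* z)) refl

  theta-value : ∀ B u a κ q k → k ≈ q * cubed κ → B * u + int (+ 9) * (a * (int (+ 3) * κ) * (int (+ 3) * κ) * (q * κ)) ≈ B * u + int (+ 81) * (a * k)
  theta-value B u a κ q k p = +-congˡ (trans (l a κ q) (*-congˡ (*-congˡ (sym p))))
    where
    l : ∀ a κ q → int (+ 9) * (a * (int (+ 3) * κ) * (int (+ 3) * κ) * (q * κ)) ≈ int (+ 81) * (a * (q * cubed κ))
    l = solve 3 (λ a κ q → con (+ 9) :* (a :* (con (+ 3) :* κ) :* (con (+ 3) :* κ) :* (q :* κ)) := con (+ 81) :* (a :* (q :* (κ :* κ :* κ)))) refl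

-- The cubic theta functions and the diagonal of the ninth power

module LevelNine (K : CommutativeRing 0ℓ 0ℓ) (nat-regular : ∀ n → Series.Regular K (Integers.nat K (suc n)))
    (κ b : Series.Ser K)
    (κ-product : CommutativeRing._≈_ (Series.seriesRing K) (CommutativeRing._*_ (Series.seriesRing K) (Bivariate.euler K) κ)
                   (CubicForms.cubed (Series.seriesRing K) (Series.V K (Bivariate.euler K))))
    (b-product : CommutativeRing._≈_ (Series.seriesRing K) (CommutativeRing._*_ (Series.seriesRing K) (Series.V K (Bivariate.euler K)) b)
                   (CubicForms.cubed (Series.seriesRing K) (Bivariate.euler K))) where
  open CommutativeRing K hiding (zero)
  open Eta K public
  open SetoidReasoning PR.setoid
  module PE = EtaForms P.seriesRing

  y′ u n : P.Ser
  y′ = P.q^ 1 PR.* P.V κ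
  u = b PR.+ PI.int (+ 3) PR.* y′
  n = PL.nForm u y′

  times-1 : ∀ {x z} → x ≈ 1# → x * z ≈ z
  times-1 p = trans (*-congʳ p) (*-identityˡ _)

  cube-0 : ∀ f → f 0 ≈ 1# → cube f 0 ≈ 1#
  cube-0 f p = trans (times-1 (trans (times-1 p) p)) p

  κ-0 : κ 0 ≈ 1#
  κ-0 = trans (sym (times-1 euler-0)) (trans (κ-product 0) (cube-0 euler₃ euler-0))

  b-0 : b 0 ≈ 1#
  b-0 = trans (sym (times-1 euler-0)) (trans (b-product 0) (cube-0 euler euler-0))

  y-0 : y′ 0 ≈ 0#
  y-0 = zeroˡ _

  u-0 : u 0 ≈ 1#
  u-0 = trans (+-cong b-0 (trans (*-congˡ y-0) (zeroʳ _))) (+-identityʳ _)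

  -- Since `u` is supported on multiples of 3 it is F(q³); `F-a` will identify F with `a`.
  F : P.Ser
  F k = u (3 ℕ.* k)

  V-F : P.V F PR.≈ u
  V-F m with P.mod3 m
  ... | P.rem0 k = reflexive (P.V-at F k)
  ... | P.rem1 k = trans (reflexive (P.V-at1 F k)) (sym (b+3y-support κ-product b-product (suc (3 ℕ.* k)) (λ e → absurd (≡.trans (≡.cong suc₃ (≡.sym (res-3* k))) e))))
    where
    absurd : 1₃ ≢ 0₃
    absurd ()
  ... | P.rem2 k = trans (reflexive (P.V-at2 F k)) (sym (b+3y-support κ-product b-product (suc (suc (3 ℕ.* k))) (λ e → absurd (≡.trans (≡.cong (λ s → suc₃ (suc₃ s)) (≡.sym (res-3* k))) e))))
    where
    absurd : 2₃ ≢ 0₃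
    absurd ()

  u-graded : PGraded 0₃ u
  u-graded = b+3y-support κ-product b-product

  y-graded : PGraded 1₃ y′
  y-graded = Pgraded-* {1₃} {0₃} {P.q^ 1} {P.V κ} (Pgraded-mon 1# 1 ≡.refl) (Pgraded-V κ)

  private
    Pgraded-product : ∀ {r s t f g h} → PGraded r f → PGraded s g → PGraded t h → PGraded (r +₃ s +₃ t) (f PR.* g PR.* h)
    Pgraded-product {r} {s} {t} {f} {g} {h} p q w = Pgraded-* {r +₃ s} {t} {f PR.* g} {h} (Pgraded-* {r} {s} {f} {g} p q) w

    thrice-graded : ∀ {r} x y z → PGraded r x → PGraded r y → PGraded r z → PGraded r (PC.thrice-of (x PR.+ y PR.+ z))
    thrice-graded x y z p q w = Pgraded-+ {f = s PR.+ s} {s} (Pgraded-+ {f = s} {s} gs gs) gs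
      where
      s = x PR.+ y PR.+ z
      gs = Pgraded-+ {f = x PR.+ y} {z} (Pgraded-+ {f = x} {y} p q) w

    cube-parts : PHomogeneous (three (PC.C₀ (ep 0₃) (ep 1₃) (ep 2₃)) (PC.C₁ (ep 0₃) (ep 1₃) (ep 2₃)) (PC.C₂ (ep 0₃) (ep 1₃) (ep 2₃)))
    cube-parts = three-homogeneous
      (Pgraded-+ {f = cube f PR.+ cube g PR.+ cube h} {PI.int (+ 6) PR.* (f PR.* g PR.* h)}
        (Pgraded-+ {f = cube f PR.+ cube g} {cube h} (Pgraded-+ {f = cube f} {cube g} (Pgraded-product {0₃} {0₃} {0₃} {f} {f} {f} gf gf gf) (Pgraded-product {1₃} {1₃} {1₃} {g} {g} {g} gg gg gg)) (Pgraded-product {2₃} {2₃} {2₃} {h} {h} {h} gh gh gh))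
        (Pgraded-* {0₃} {0₃} {PI.int (+ 6)} {f PR.* g PR.* h} (Pgraded-nat 6) (Pgraded-product {0₃} {1₃} {2₃} {f} {g} {h} gf gg gh)))
      (thrice-graded (f PR.* f PR.* g) (g PR.* g PR.* h) (h PR.* h PR.* f) (Pgraded-product {0₃} {0₃} {1₃} {f} {f} {g} gf gf gg) (Pgraded-product {1₃} {1₃} {2₃} {g} {g} {h} gg gg gh) (Pgraded-product {2₃} {2₃} {0₃} {h} {h} {f} gh gh gf))
      (thrice-graded (f PR.* f PR.* h) (h PR.* h PR.* g) (g PR.* g PR.* f) (Pgraded-product {0₃} {0₃} {2₃} {f} {f} {h} gf gf gh) (Pgraded-product {2₃} {2₃} {1₃} {h} {h} {g} gh gh gg) (Pgraded-product {1₃} {1₃} {0₃} {g} {g} {f} gg gg gf))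
      where
      f g h : P.Ser
      f = ep 0₃
      g = ep 1₃
      h = ep 2₃
      gf = component-graded euler 0₃
      gg = component-graded euler 1₃
      gh = component-graded euler 2₃

    -- (q;q)³ equals (q³;q³) (u - 3y) with `u` and `y` each in one residue class. This reads off the
    -- parts of the cube of (q;q); the third one is zero.
    euler-cube-parts : ∀ r → three (PC.C₀ (ep 0₃) (ep 1₃) (ep 2₃)) (PC.C₁ (ep 0₃) (ep 1₃) (ep 2₃)) (PC.C₂ (ep 0₃) (ep 1₃) (ep 2₃)) r PR.≈
      three (euler₃ PR.* u) (PR.- (PI.int (+ 3) PR.* (euler₃ PR.* y′))) PR.0# r
    euler-cube-parts r m = P-components {suc m} _ (three (euler₃ PR.* u) (PR.- (PI.int (+ 3) PR.* (euler₃ PR.* y′))) PR.0#) cube-parts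
      (three-homogeneous (Pgraded-* {0₃} {0₃} {euler₃} {u} (Pgraded-V euler) u-graded)
        (Pgraded-neg {f = PI.int (+ 3) PR.* (euler₃ PR.* y′)} (Pgraded-* {0₃} {1₃} {PI.int (+ 3)} {euler₃ PR.* y′} (Pgraded-nat 3) (Pgraded-* {0₃} {1₃} {euler₃} {y′} (Pgraded-V euler) y-graded))) (λ _ _ → refl))
      (λ i _ → PR.trans (PR.sym (PC.cube-components (ep 0₃) (ep 1₃) (ep 2₃))) (PR.trans (PC.cubed-cong (component-total euler)) (PR.trans (PR.sym b-product) (PL.split-b euler₃ b y′))) i) r m ℕP.≤-refl

  V-cube : ∀ f → P.V (cube f) PR.≈ cube (P.V f)
  V-cube f = PR.trans (P.V-mul (f PR.* f) f) (PR.*-congʳ (P.V-mul f f))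

  V-b-product : euler₉ PR.* P.V b PR.≈ cube euler₃
  V-b-product = PR.trans (PR.sym (P.V-mul euler₃ b)) (PR.trans (P.V-cong b-product) (V-cube euler))

  cancel-unit : ∀ f {g h} → f 0 ≈ 1# → f PR.* g PR.≈ f PR.* h → g PR.≈ h
  cancel-unit f {g} {h} p = P.mul-cancel f g h (P.unit-regular p)

  -- The norm of (q;q)³ over the series in q³, on one side from its two nonzero parts, on the other
  -- as the cube of the norm of (q;q). The common Euler products are cancelled at the end.
  V-b-cubed : cube (P.V b) PR.≈ cube u PR.- PI.int (+ 27) PR.* cube y′
  V-b-cubed = PR.sym (cancel-unit (cube euler₉) (cube-0 euler₉ euler-0) (cancel-unit (cube euler₃) (cube-0 euler₃ euler-0) (begin
    cube euler₃ PR.* (cube euler₉ PR.* (cube u PR.- PI.int (+ 27) PR.* cube y′))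
      ≈⟨ PC.swap-left (cube euler₃) (cube euler₉) _ ⟩
    cube euler₉ PR.* (cube euler₃ PR.* (cube u PR.- PI.int (+ 27) PR.* cube y′))
      ≈⟨ PR.*-congˡ (PR.trans (PR.sym (PL.Norm-scaled euler₃ u y′)) (PR.trans (PC.Norm-cong (PR.sym (euler-cube-parts 0₃)) (PR.sym (euler-cube-parts 1₃)) (PR.sym (euler-cube-parts 2₃))) (PC.norm-components (ep 0₃) (ep 1₃) (ep 2₃)))) ⟩
    cube euler₉ PR.* cube (PNorm (ep 0₃) (ep 1₃) (ep 2₃))
      ≈⟨ PR.trans (PR.*-comm _ _) (PR.trans (PR.sym (PC.cubed-* (PNorm (ep 0₃) (ep 1₃) (ep 2₃)) euler₉)) (PR.trans (PC.cubed-cong euler-norm) (PC.cubed-* euler₃ (cube euler₃)))) ⟩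
    cube euler₃ PR.* cube (cube euler₃)
      ≈⟨ PR.*-congˡ (PR.trans (PC.cubed-cong (PR.sym V-b-product)) (PC.cubed-* euler₉ (P.V b))) ⟩
    cube euler₃ PR.* (cube euler₉ PR.* cube (P.V b)) ∎)))

  b-form : b PR.≈ PL.bForm u y′
  b-form = PL.b-from-u b y′

  b-n-product : b PR.* n PR.≈ cube (P.V b)
  b-n-product = PR.trans (PR.*-congʳ b-form) (PR.trans (PL.b-n u y′) (PR.sym V-b-cubed))

  private
    y-b-n : euler₃ PR.* (y′ PR.* cube (P.V b)) PR.≈ P.q^ 1 PR.* cube (cube euler₃)
    y-b-n = cancel-unit (cube euler₉) (cube-0 euler₉ euler-0) (PE.eta₂ euler₃ euler₉ y′ (P.V b) (P.q^ 1) (y-product κ-product b-product) V-b-product)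

  -- As quotients of Euler products b q κ³ and y b(q³)³ are both q (q³;q³)⁸. Writing b(q³)³ as b n
  -- allows b to be cancelled.
  κ-cubed : P.q^ 1 PR.* cube κ PR.≈ y′ PR.* n
  κ-cubed = cancel-unit b b-0 (cancel-unit euler₃ euler-0 (begin
    euler₃ PR.* (b PR.* (P.q^ 1 PR.* cube κ))   ≈⟨ cancel-unit (cube euler) (cube-0 euler euler-0) (PE.eta₁ euler euler₃ b κ (P.q^ 1) b-product κ-product) ⟩
    P.q^ 1 PR.* cube (cube euler₃)              ≈⟨ y-b-n ⟨
    euler₃ PR.* (y′ PR.* cube (P.V b))          ≈⟨ PR.*-congˡ (PR.trans (PR.*-congˡ (PR.sym b-n-product)) (PC.swap-left y′ b n)) ⟩
    euler₃ PR.* (b PR.* (y′ PR.* n))            ∎))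

  -- q (q³;q³)⁸
  eighth-power : ∀ f → euler₃ PR.* f PR.≈ cube (cube euler₃) → P.q^ 1 PR.* f PR.≈ b PR.* (y′ PR.* n)
  eighth-power f p = cancel-unit euler₃ euler-0 (begin
    euler₃ PR.* (P.q^ 1 PR.* f)          ≈⟨ PC.swap-left euler₃ (P.q^ 1) f ⟩
    P.q^ 1 PR.* (euler₃ PR.* f)          ≈⟨ PR.*-congˡ p ⟩
    P.q^ 1 PR.* cube (cube euler₃)       ≈⟨ y-b-n ⟨
    euler₃ PR.* (y′ PR.* cube (P.V b))   ≈⟨ PR.*-congˡ (PR.trans (PR.*-congˡ (PR.sym b-n-product)) (PC.swap-left y′ b n)) ⟩
    euler₃ PR.* (b PR.* (y′ PR.* n))     ∎)

  V-nat : ∀ m → P.V (PI.nat m) PR.≈ PI.nat m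
  V-nat zero = P.V-0
  V-nat (suc zero) = P.V-1
  V-nat (suc (suc m)) = PR.trans (P.V-+ PR.1# (PI.nat (suc m))) (PR.+-cong P.V-1 (V-nat (suc m)))

  y-cubed : cube y′ PR.≈ P.V (P.q^ 1 PR.* cube κ)
  y-cubed = PR.trans (PC.cubed-* (P.q^ 1) (P.V κ)) (PR.trans (PR.*-cong q-cubed (PR.sym (V-cube κ))) (PR.trans (PR.*-congʳ (PR.sym (P.V-mon 1# 1))) (PR.sym (P.V-mul (P.q^ 1) (cube κ)))))
    where
    q-cubed : cube (P.q^ 1) PR.≈ P.q^ 3
    q-cubed = PR.trans (PR.*-congʳ (P.mon-mul 1# 1# 1 1)) (PR.trans (P.mon-mul (1# * 1#) 1# 2 1) (P.mon-cong 3 (trans (*-identityʳ _) (*-identityʳ _))))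

  aF : P.Ser
  aF = PL.aForm u y′

  a-form : a PR.≈ aF
  a-form = PR.trans (a-value κ-product b-product) (PL.a-from-b b y′)

  aF-0 : aF 0 ≈ 1#
  aF-0 = trans (+-cong u-0 (trans (*-congˡ y-0) (zeroʳ _))) (+-identityʳ _)

  -- After `V` the left side is u³, which `V-b-cubed` splits into b(q³)³ + 27 y³. Undoing `V` gives
  -- b³ + 27 q κ³, and in terms of u and y this is a³: the cubic identity of the Borweins.
  F-cubed : cube F PR.≈ cube aF
  F-cubed = PR.trans (P.V-injective (begin
    P.V (cube F)                                          ≈⟨ PR.trans (V-cube F) (PC.cubed-cong V-F) ⟩
    cube u                                                ≈⟨ rearrange (cube u) (PI.int (+ 27) PR.* cube y′) ⟩
    cube u PR.- PI.int (+ 27) PR.* cube y′ PR.+ PI.int (+ 27) PR.* cube y′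
      ≈⟨ PR.+-cong (PR.trans (PR.sym V-b-cubed) (PR.sym (V-cube b))) (PR.trans (PR.*-cong (PR.sym (V-nat 27)) y-cubed) (PR.sym (P.V-mul (PI.nat 27) (P.q^ 1 PR.* cube κ)))) ⟩
    P.V (cube b) PR.+ P.V (PI.int (+ 27) PR.* (P.q^ 1 PR.* cube κ)) ≈⟨ P.V-+ (cube b) (PI.int (+ 27) PR.* (P.q^ 1 PR.* cube κ)) ⟨
    P.V (cube b PR.+ PI.int (+ 27) PR.* (P.q^ 1 PR.* cube κ)) ∎))
    (PR.trans (PR.+-cong (PC.cubed-cong b-form) (PR.*-congˡ κ-cubed)) (PL.a-cubed u y′))
    where
    rearrange : ∀ x z → x PR.≈ x PR.- z PR.+ z
    rearrange x z = PR.sym (PR.trans (PR.+-assoc _ _ _) (PR.trans (PR.+-congˡ (PR.-‿inverseˡ z)) (PR.+-identityʳ x)))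

  Regular-≈ : ∀ {x z} → x ≈ z → P.Regular z → P.Regular x
  Regular-≈ p r w e = r w (trans (*-congʳ (sym p)) e)

  difference-zero : ∀ {f g} → f PR.- g PR.≈ PR.0# → f PR.≈ g
  difference-zero {f} {g} p = PR.trans (PR.sym (PR.+-identityʳ f)) (PR.trans (PR.+-congˡ (PR.sym (PR.-‿inverseˡ g))) (PR.trans (PR.sym (PR.+-assoc _ _ _)) (PR.trans (PR.+-congʳ p) (PR.+-identityˡ g))))

  -- Cube roots with constant term 1 are unique: the cofactor of F - a in F³ - a³ has constant term
  -- 3, which is regular.
  F-a : F PR.≈ aF
  F-a = difference-zero (P.mul-regular (F PR.* F PR.+ F PR.* aF PR.+ aF PR.* aF) (F PR.- aF) (Regular-≈ three-at (nat-regular 2))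
    (PR.trans (PL.cubes-difference F aF) (PR.trans (PR.+-congʳ F-cubed) (PR.-‿inverseʳ (cube aF)))))
    where
    three-at : F 0 * F 0 + F 0 * aF 0 + aF 0 * aF 0 ≈ 1# + (1# + 1#)
    three-at = trans (+-cong (+-cong (trans (times-1 u-0) u-0) (trans (times-1 u-0) aF-0)) (trans (times-1 aF-0) aF-0)) (+-assoc 1# 1# 1#)

  V-aF : P.V aF PR.≈ u
  V-aF = PR.trans (P.V-cong (PR.sym F-a)) V-F

  α-u : α PR.≈ u
  α-u = PR.trans α-V (PR.trans (P.V-cong a-form) V-aF)

  c-0 : c 0 ≈ 1# + (1# + 1#)
  c-0 = compute (T 0 0) (T 1 0) refl (trans (+-identityˡ _) (+-identityˡ _))
    where
    compute : ∀ t s → t ≈ 1# → s ≈ 1# → t * t * s + (t * s + s * t) * t ≈ 1# + (1# + 1#)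
    compute t s p r = +-cong (trans (times-1 (trans (times-1 p) p)) r) (trans (*-congˡ p) (trans (*-identityʳ _) (+-cong (trans (times-1 p) r) (trans (times-1 r) p))))

  c-relation : PI.int (+ 27) PR.* (cube κ PR.* u) PR.+ PI.int (+ 2) PR.* (cube c PR.* (P.q^ 1 PR.* P.V c)) PR.≈ PI.int (+ 3) PR.* (aF PR.* c PR.* c PR.* κ)
  c-relation m = trans (sym (q^-shift 1 _ m)) (trans (reduced (suc m)) (q^-shift 1 _ m))
    where
    q² : P.q^ 2 PR.≈ P.q^ 1 PR.* P.q^ 1
    q² = PR.sym (PR.trans (P.mon-mul 1# 1# 1 1) (P.mon-cong 2 (*-identityˡ 1#)))
    reduced : P.q^ 1 PR.* (PI.int (+ 27) PR.* (cube κ PR.* u) PR.+ PI.int (+ 2) PR.* (cube c PR.* (P.q^ 1 PR.* P.V c))) PR.≈ P.q^ 1 PR.* (PI.int (+ 3) PR.* (aF PR.* c PR.* c PR.* κ))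
    reduced = PE.norm-relation-reduced (cube b) (cube aF) (cube κ) u (P.q^ 1) (cube c) (P.V c) κ (aF PR.* c PR.* c)
      (PR.trans (PR.sym (PL.a-cubed u y′)) (PR.+-cong (PC.cubed-cong (PR.sym b-form)) (PR.*-congˡ (PR.sym κ-cubed))))
      (PR.trans (PR.*-congˡ (PR.sym α-u)) (PR.trans (norm-relation κ-product b-product) (PR.+-cong (PR.+-cong (PR.*-cong (PC.cubed-cong a-form) α-u)
        (PR.*-congˡ (PR.*-congˡ (PR.trans γ-V (PR.*-congʳ q²))))) (PR.-‿cong (PR.*-congˡ (PR.*-cong (PR.*-congʳ (PR.*-congʳ a-form)) (κ′-value κ-product b-product)))))))

  -- The series 3κ solves the same equation as `c`. In the difference of the two equations the terms
  -- with c(q³) carry a factor q, so agreement below N gives agreement below N + 1; the cofactor of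
  -- c - 3κ has constant term 18.
  c-value : c PR.≈ PI.int (+ 3) PR.* κ
  c-value = λ m → go (suc m) m ℕP.≤-refl
    where
    c₀ Φ : P.Ser
    c₀ = PI.int (+ 3) PR.* κ
    Φ = PI.int (+ 3) PR.* (aF PR.* (κ PR.* (c PR.+ c₀)))
    V-c₀ : P.V c₀ PR.≈ PI.int (+ 3) PR.* P.V κ
    V-c₀ = PR.trans (P.V-mul (PI.nat 3) κ) (PR.*-congʳ (V-nat 3))
    equation : Φ PR.* (c PR.- c₀) PR.≈ PI.int (+ 2) PR.* (P.q^ 1 PR.* (cube c PR.* P.V c PR.- cube c₀ PR.* P.V c₀))
    equation = PR.trans (PE.c-equation κ (P.V κ) (P.V c) c (P.q^ 1) u c-relation) (PR.*-congˡ (PR.*-congˡ (PR.+-congˡ (PR.-‿cong (PR.*-congˡ (PR.sym V-c₀))))))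
    Φ-0 : Φ 0 ≈ KI.nat 18
    Φ-0 = trans (*-congˡ (trans (times-1 aF-0) (trans (times-1 κ-0) (+-cong c-0 (*-congˡ κ-0)))))
      (KI.solve 0 (KI.con (+ 3) KI.:* (KI.con (+ 3) KI.:+ KI.con (+ 3) KI.:* KI.con (+ 1)) KI.:= KI.con (+ 18)) refl)
    go : ∀ N → c P.≋[ N ] c₀
    go zero m ()
    go (suc N) = λ m l → zero-diff (P.mul-regular[] Φ (c PR.- c₀) (Regular-≈ Φ-0 (nat-regular 17)) (suc N) small m l)
      where
      zero-diff : ∀ {x z} → x - z ≈ 0# → x ≈ z
      zero-diff {x} {z} p = trans (sym (+-identityʳ x)) (trans (+-congˡ (sym (-‿inverseˡ z))) (trans (sym (+-assoc _ _ _)) (trans (+-congʳ p) (+-identityˡ z))))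
      cubes : cube c P.≋[ N ] cube c₀
      cubes = P.mul-cong[] {N} {c PR.* c} {c₀ PR.* c₀} {c} {c₀} (P.mul-cong[] {N} {c} {c₀} {c} {c₀} (go N) (go N)) (go N)
      inner : (cube c PR.* P.V c PR.- cube c₀ PR.* P.V c₀) P.≋[ N ] PR.0#
      inner m l = trans (+-congʳ (P.mul-cong[] {N} {cube c} {cube c₀} {P.V c} {P.V c₀} cubes (P.V-cong[] {N} {c} {c₀} (go N)) m l)) (-‿inverseʳ _)
      shifted : (P.q^ 1 PR.* (cube c PR.* P.V c PR.- cube c₀ PR.* P.V c₀)) P.≋[ suc N ] PR.0#
      shifted zero l = zeroˡ _
      shifted (suc m) (s≤s l) = trans (q^-shift 1 (cube c PR.* P.V c PR.- cube c₀ PR.* P.V c₀) m) (inner m l)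
      small : Φ PR.* (c PR.- c₀) P.≋[ suc N ] PR.0#
      small m l = trans (equation m) (trans (P.mul-cong[] {suc N} {PI.int (+ 2)} {PI.int (+ 2)} (λ _ _ → refl) shifted m l) (PR.zeroʳ (PI.int (+ 2)) m))

  CΦ-value : cube (cube euler) PR.* CΦ PR.≈ cube b PR.* u PR.+ PI.int (+ 81) PR.* (aF PR.* (y′ PR.* n))
  CΦ-value = begin
    cube (cube euler) PR.* CΦ       ≈⟨ CΦ-theta ⟩
    δ (ninth T)                     ≈⟨ δ-T⁹ κ-product b-product ⟩
    cube b PR.* α PR.+ PI.int (+ 9) PR.* (a PR.* c PR.* c PR.* κ′)
      ≈⟨ PR.+-cong (PR.*-congˡ α-u) (PR.*-congˡ (PR.*-cong (PR.*-cong (PR.*-cong a-form c-value) c-value) (κ′-value κ-product b-product))) ⟩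
    cube b PR.* u PR.+ PI.int (+ 9) PR.* (aF PR.* (PI.int (+ 3) PR.* κ) PR.* (PI.int (+ 3) PR.* κ) PR.* (P.q^ 1 PR.* κ))
      ≈⟨ PE.theta-value (cube b) u aF κ (P.q^ 1) (y′ PR.* n) (PR.sym κ-cubed) ⟩
    cube b PR.* u PR.+ PI.int (+ 81) PR.* (aF PR.* (y′ PR.* n)) ∎

-- Lambert series

module LambertForms (R : CommutativeRing 0ℓ 0ℓ) where
  open CommutativeRing R hiding (zero)
  open Integers R

  geometric-product : ∀ x y u v w → (1# - x) * u ≈ x → (1# - y) * v ≈ y → (1# - x * y) * w ≈ x * y →
    (1# - x) * ((1# - y) * ((1# - x * y) * (u * v))) ≈ (1# - x) * ((1# - y) * ((1# - x * y) * (w * (1# + u + v))))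
  geometric-product x y u v w p q r = trans (l₁ x y u v) (trans (*-congˡ (*-cong p q)) (trans (l₂ x y) (trans (sym (*-cong r (+-congˡ (+-cong (*-congˡ p) (*-congˡ q))))) (l₃ x y u v w))))
    where
    l₁ : ∀ x y u v → (1# - x) * ((1# - y) * ((1# - x * y) * (u * v))) ≈ (1# - x * y) * (((1# - x) * u) * ((1# - y) * v))
    l₁ = solve 4 (λ x y u v → let o = con (+ 1) in (o :- x) :* ((o :- y) :* ((o :- x :* y) :* (u :* v))) := (o :- x :* y) :* (((o :- x) :* u) :* ((o :- y) :* v))) refl
    l₂ : ∀ x y → (1# - x * y) * (x * y) ≈ x * y * ((1# - x) * (1# - y) + ((1# - y) * x + (1# - x) * y))
    l₂ = solve 2 (λ x y → let o = con (+ 1) in (o :- x :* y) :* (x :* y) := x :* y :* ((o :- x) :* (o :- y) :+ ((o :- y) :* x :+ (o :- x) :* y))) refl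
    l₃ : ∀ x y u v w → (1# - x * y) * w * ((1# - x) * (1# - y) + ((1# - y) * ((1# - x) * u) + (1# - x) * ((1# - y) * v))) ≈ (1# - x) * ((1# - y) * ((1# - x * y) * (w * (1# + u + v))))
    l₃ = solve 5 (λ x y u v w → let o = con (+ 1) in (o :- x :* y) :* w :* ((o :- x) :* (o :- y) :+ ((o :- y) :* ((o :- x) :* u) :+ (o :- x) :* ((o :- y) :* v))) := (o :- x) :* ((o :- y) :* ((o :- x :* y) :* (w :* (o :+ u :+ v))))) refl

  geometric-derivative : ∀ m x u Du → (1# - x) * u ≈ x → - (m * x) * u + (1# - x) * Du ≈ m * x → (1# - x) * Du ≈ (1# - x) * (m * (u * (1# + u)))
  geometric-derivative m x u Du p q = trans (l₁ m x u Du) (trans (+-congʳ q) (trans (trans (l₂ m x u) (*-congˡ (*-congʳ (sym p)))) (l₃ m x u)))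
    where
    l₁ : ∀ m x u Du → (1# - x) * Du ≈ - (m * x) * u + (1# - x) * Du + m * x * u
    l₁ = solve 4 (λ m x u d → (con (+ 1) :- x) :* d := :- (m :* x) :* u :+ (con (+ 1) :- x) :* d :+ m :* x :* u) refl
    l₂ : ∀ m x u → m * x + m * x * u ≈ m * (x * (1# + u))
    l₂ = solve 3 (λ m x u → m :* x :+ m :* x :* u := m :* (x :* (con (+ 1) :+ u))) refl
    l₃ : ∀ m x u → m * ((1# - x) * u * (1# + u)) ≈ (1# - x) * (m * (u * (1# + u)))
    l₃ = solve 3 (λ m x u → m :* ((con (+ 1) :- x) :* u :* (con (+ 1) :+ u)) := (con (+ 1) :- x) :* (m :* (u :* (con (+ 1) :+ u)))) refl

  log-derivative-step : ∀ m x u s f → (1# - x) * u ≈ x → - (m * x) * f + (1# - x) * (- s * f) ≈ - (s + m * u) * ((1# - x) * f)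
  log-derivative-step m x u s f p = trans (+-congʳ (*-congʳ (-‿cong (*-congˡ (sym p))))) (l m x u s f)
    where
    l : ∀ m x u s f → - (m * ((1# - x) * u)) * f + (1# - x) * (- s * f) ≈ - (s + m * u) * ((1# - x) * f)
    l = solve 5 (λ m x u s f → :- (m :* ((con (+ 1) :- x) :* u)) :* f :+ (con (+ 1) :- x) :* (:- s :* f) := :- (s :+ m :* u) :* ((con (+ 1) :- x) :* f)) refl

  -- With d = Σ m² u_m², l = Σ_{m<n} m n u_m u_n, l′ = Σ_{m<n} f(m, n - m) u_m u_n and f(m, n) = m² + m n + n².
  combine : ∀ d l l′ p → int (+ 3) * d + int (+ 2) * (l′ + int (+ 2) * l) ≈ p + int (+ 2) * l′ → int (+ 2) * (d + int (+ 2) * l) + d ≈ p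
  combine d l l′ p e = trans (l₁ d l l′) (trans (+-congʳ e) (l₂ p l′))
    where
    l₁ : ∀ d l l′ → int (+ 2) * (d + int (+ 2) * l) + d ≈ int (+ 3) * d + int (+ 2) * (l′ + int (+ 2) * l) - int (+ 2) * l′
    l₁ = solve 3 (λ d l l′ → con (+ 2) :* (d :+ con (+ 2) :* l) :+ d := con (+ 3) :* d :+ con (+ 2) :* (l′ :+ con (+ 2) :* l) :- con (+ 2) :* l′) refl
    l₂ : ∀ p l′ → p + int (+ 2) * l′ - int (+ 2) * l′ ≈ p
    l₂ = solve 2 (λ p l′ → p :+ con (+ 2) :* l′ :- con (+ 2) :* l′ := p) refl

  conclude : ∀ e2 d de s₁ s₂ s₃ p → int (+ 2) * e2 + d ≈ p → d + s₂ ≈ de → int (+ 6) * p + int (+ 6) * s₂ ≈ int (+ 5) * s₃ + s₁ →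
    int (+ 12) * e2 + int (+ 6) * de ≈ int (+ 5) * s₃ + s₁
  conclude e2 d de s₁ s₂ s₃ p x y z = trans (+-congˡ (*-congˡ (sym y))) (trans (l e2 d s₂) (trans (+-congʳ (*-congˡ x)) z))
    where
    l : ∀ e2 d s₂ → int (+ 12) * e2 + int (+ 6) * (d + s₂) ≈ int (+ 6) * (int (+ 2) * e2 + d) + int (+ 6) * s₂
    l = solve 3 (λ e2 d s₂ → con (+ 12) :* e2 :+ con (+ 6) :* (d :+ s₂) := con (+ 6) :* (con (+ 2) :* e2 :+ d) :+ con (+ 6) :* s₂) refl

  pair-square : ∀ m n u v → m * u * (n * v) ≈ m * n * (u * v)
  pair-square = solve 4 (λ m n u v → m :* u :* (n :* v) := m :* n :* (u :* v)) refl

  twice : ∀ x → x + x ≈ int (+ 2) * x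
  twice = solve 1 (λ x → x :+ x := con (+ 2) :* x) refl

  expand-1+ : ∀ f w x y → f * (w * (1# + x + y)) ≈ w * f + (w * (f * x) + w * (f * y))
  expand-1+ = solve 4 (λ f w x y → f :* (w :* (con (+ 1) :+ x :+ y)) := w :* f :+ (w :* (f :* x) :+ w :* (f :* y))) refl

  square-term : ∀ m u → m * (m * (u * (1# + u))) ≈ m * m * (u * u) + m * m * u
  square-term = solve 2 (λ m u → m :* (m :* (u :* (con (+ 1) :+ u))) := m :* m :* (u :* u) :+ m :* m :* u) refl

  cubic-term : ∀ p n u → int (+ 6) * p + int (+ 6) * (n * n) ≈ int (+ 5) * (n * n * n) + n →
    int (+ 6) * (u * p) + int (+ 6) * (n * n * u) ≈ int (+ 5) * (n * n * n * u) + n * u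
  cubic-term p n u e = trans (l p n u) (trans (*-congʳ e) (r n u))
    where
    l : ∀ p n u → int (+ 6) * (u * p) + int (+ 6) * (n * n * u) ≈ (int (+ 6) * p + int (+ 6) * (n * n)) * u
    l = solve 3 (λ p n u → con (+ 6) :* (u :* p) :+ con (+ 6) :* (n :* n :* u) := (con (+ 6) :* p :+ con (+ 6) :* (n :* n)) :* u) refl
    r : ∀ n u → (int (+ 5) * (n * n * n) + n) * u ≈ int (+ 5) * (n * n * n * u) + n * u
    r = solve 2 (λ n u → (con (+ 5) :* (n :* n :* n) :+ n) :* u := con (+ 5) :* (n :* n :* n :* u) :+ n :* u) refl

∑ℕ : ℕ → (ℕ → ℕ) → ℕ
∑ℕ zero f = 0
∑ℕ (suc n) f = ∑ℕ n f ℕ.+ f n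

-- This weight is chosen because passing from (m, n) to (m, n - m) lowers it by exactly 2mn, the
-- weight with which u_m u_n enters E² for m < n.
form : ℕ → ℕ → ℕ
form m n = m ℕ.* m ℕ.+ m ℕ.* n ℕ.+ n ℕ.* n

-- With n = b + 1 the summand is n² - mn + m², so the sum follows from those of m and m². The
-- negative term is moved to the other side to stay in ℕ.
form-sum : ∀ b → 6 ℕ.* ∑ℕ b (λ a → form (suc a) (b ℕ.∸ a)) ℕ.+ 6 ℕ.* (suc b ℕ.* suc b) ≡ 5 ℕ.* (suc b ℕ.* suc b ℕ.* suc b) ℕ.+ suc b
form-sum b = ℕP.+-cancelʳ-≡ (3 ℕ.* (suc b ℕ.* (b ℕ.* suc b))) _ _ (≡.trans (≡.cong (λ s → P ℕ.+ 6 ℕ.* (suc b ℕ.* suc b) ℕ.+ 3 ℕ.* (suc b ℕ.* s)) (≡.sym (s₁ b)))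
  (≡.trans (l₁ (∑ℕ b (λ a → form (suc a) (b ℕ.∸ a))) (suc b) (∑ℕ b suc)) (≡.trans (≡.cong (λ s → 6 ℕ.* s ℕ.+ 6 ℕ.* (suc b ℕ.* suc b)) (total b ℕP.≤-refl)) (≡.trans (l₂ (b ℕ.* (suc b ℕ.* suc b)) (∑ℕ b (λ a → suc a ℕ.* suc a)) (suc b))
  (≡.trans (≡.cong (λ s → 6 ℕ.* (b ℕ.* (suc b ℕ.* suc b)) ℕ.+ s ℕ.+ 6 ℕ.* (suc b ℕ.* suc b)) (s₂ b)) (l₃ b))))))
  where
  P = 6 ℕ.* ∑ℕ b (λ a → form (suc a) (b ℕ.∸ a))
  s₁ : ∀ b → 2 ℕ.* ∑ℕ b suc ≡ b ℕ.* suc b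
  s₁ zero = ≡.refl
  s₁ (suc b) = ≡.trans (ℕP.*-distribˡ-+ 2 (∑ℕ b suc) (suc b)) (≡.trans (≡.cong (ℕ._+ 2 ℕ.* suc b) (s₁ b)) (l b))
    where
    l : ∀ b → b ℕ.* suc b ℕ.+ 2 ℕ.* suc b ≡ suc b ℕ.* suc (suc b)
    l = ℕ-solve-∀
  s₂ : ∀ b → 6 ℕ.* ∑ℕ b (λ a → suc a ℕ.* suc a) ≡ b ℕ.* suc b ℕ.* (2 ℕ.* b ℕ.+ 1)
  s₂ zero = ≡.refl
  s₂ (suc b) = ≡.trans (ℕP.*-distribˡ-+ 6 (∑ℕ b (λ a → suc a ℕ.* suc a)) (suc b ℕ.* suc b)) (≡.trans (≡.cong (ℕ._+ 6 ℕ.* (suc b ℕ.* suc b)) (s₂ b)) (l b))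
    where
    l : ∀ b → b ℕ.* suc b ℕ.* (2 ℕ.* b ℕ.+ 1) ℕ.+ 6 ℕ.* (suc b ℕ.* suc b) ≡ suc b ℕ.* suc (suc b) ℕ.* (2 ℕ.* suc b ℕ.+ 1)
    l = ℕ-solve-∀
  each : ∀ a → a ℕ.≤ b → form (suc a) (b ℕ.∸ a) ℕ.+ suc b ℕ.* suc a ≡ suc b ℕ.* suc b ℕ.+ suc a ℕ.* suc a
  each a le = ≡.trans (≡.cong (λ s → form (suc a) (b ℕ.∸ a) ℕ.+ suc s ℕ.* suc a) (≡.sym (ℕP.m∸n+n≡m le))) (≡.trans (l a (b ℕ.∸ a)) (≡.cong (λ s → suc s ℕ.* suc s ℕ.+ suc a ℕ.* suc a) (ℕP.m∸n+n≡m le)))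
    where
    l : ∀ a d → suc a ℕ.* suc a ℕ.+ suc a ℕ.* d ℕ.+ d ℕ.* d ℕ.+ suc (d ℕ.+ a) ℕ.* suc a ≡ suc (d ℕ.+ a) ℕ.* suc (d ℕ.+ a) ℕ.+ suc a ℕ.* suc a
    l = ℕ-solve-∀
  total : ∀ c → c ℕ.≤ b → ∑ℕ c (λ a → form (suc a) (b ℕ.∸ a)) ℕ.+ suc b ℕ.* ∑ℕ c suc ≡ c ℕ.* (suc b ℕ.* suc b) ℕ.+ ∑ℕ c (λ a → suc a ℕ.* suc a)
  total zero le = ℕP.*-zeroʳ (suc b)
  total (suc c) le = ≡.trans (l (∑ℕ c (λ a → form (suc a) (b ℕ.∸ a))) (form (suc c) (b ℕ.∸ c)) (suc b) (∑ℕ c suc) (suc c))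
    (≡.trans (≡.cong₂ ℕ._+_ (total c (ℕP.<⇒≤ le)) (each c (ℕP.<⇒≤ le))) (l′ c (suc b ℕ.* suc b) (∑ℕ c (λ a → suc a ℕ.* suc a)) (suc c ℕ.* suc c)))
    where
    l : ∀ p f n s m → p ℕ.+ f ℕ.+ n ℕ.* (s ℕ.+ m) ≡ p ℕ.+ n ℕ.* s ℕ.+ (f ℕ.+ n ℕ.* m)
    l = ℕ-solve-∀
    l′ : ∀ c n s m → c ℕ.* n ℕ.+ s ℕ.+ (n ℕ.+ m) ≡ suc c ℕ.* n ℕ.+ (s ℕ.+ m)
    l′ = ℕ-solve-∀
  l₁ : ∀ p n s → 6 ℕ.* p ℕ.+ 6 ℕ.* (n ℕ.* n) ℕ.+ 3 ℕ.* (n ℕ.* (2 ℕ.* s)) ≡ 6 ℕ.* (p ℕ.+ n ℕ.* s) ℕ.+ 6 ℕ.* (n ℕ.* n)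
  l₁ = ℕ-solve-∀
  l₂ : ∀ x s n → 6 ℕ.* (x ℕ.+ s) ℕ.+ 6 ℕ.* (n ℕ.* n) ≡ 6 ℕ.* x ℕ.+ 6 ℕ.* s ℕ.+ 6 ℕ.* (n ℕ.* n)
  l₂ = ℕ-solve-∀
  l₃ : ∀ b → 6 ℕ.* (b ℕ.* (suc b ℕ.* suc b)) ℕ.+ b ℕ.* suc b ℕ.* (2 ℕ.* b ℕ.+ 1) ℕ.+ 6 ℕ.* (suc b ℕ.* suc b) ≡
    5 ℕ.* (suc b ℕ.* suc b ℕ.* suc b) ℕ.+ suc b ℕ.+ 3 ℕ.* (suc b ℕ.* (b ℕ.* suc b))
  l₃ = ℕ-solve-∀

module Lambert (K : CommutativeRing 0ℓ 0ℓ) where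
  open CommutativeRing K hiding (zero)
  open ThetaConstants K public
  open SetoidReasoning setoid
  module KI = Integers K
  module LF = LambertForms P.seriesRing

  -- U k = q^{k+1} / (1 - q^{k+1})
  U : ℕ → P.Ser
  U k zero = 0#
  U k (suc n) = if does (suc k ∣? suc n) then 1# else 0#

  U-yes : ∀ k n → suc k ∣ suc n → U k (suc n) ≡ 1#
  U-yes k n d rewrite dec-true (suc k ∣? suc n) d = ≡.refl

  U-no : ∀ k n → (suc k ∣ suc n → ⊥) → U k (suc n) ≡ 0#
  U-no k n d rewrite dec-false (suc k ∣? suc n) d = ≡.refl

  U-low : ∀ k → U k P.≋[ suc k ] PR.0#
  U-low k zero l = refl
  U-low k (suc n) l = reflexive (U-no k n (λ d → ℕP.<⇒≱ l (∣⇒≤ d)))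

  1-q^ : ℕ → P.Ser
  1-q^ m = PR.1# PR.- P.q^ m

  U-geometric : ∀ k → 1-q^ (suc k) PR.* U k PR.≈ P.q^ (suc k)
  U-geometric k n = trans (trans (PR.distribʳ (U k) PR.1# (PR.- P.q^ m) n) (+-cong (PR.*-identityˡ (U k) n) (sym (Algebra.Properties.Ring.-‿distribˡ-* PR.ring (P.q^ m) (U k) n)))) (by (n ℕP.<? m))
    where
    m : ℕ
    m = suc k
    subtract-zero : ∀ {x z} → x ≈ 0# → z + - x ≈ z
    subtract-zero p = trans (+-congˡ (trans (-‿cong p) (Algebra.Properties.Ring.-0#≈0# ring))) (+-identityʳ _)
    by : Dec (n ℕ.< m) → U k n + - (P.q^ m PR.* U k) n ≈ P.q^ m n
    by (yes l) = trans (subtract-zero (q^-low m (U k) n l)) (trans (U-low k n l) (reflexive (≡.sym (P.mon-off 1# m n (λ e → ℕP.<⇒≢ l (≡.sym e))))))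
    by (no ge) = ≡.subst (λ n → U k n + - (P.q^ m PR.* U k) n ≈ P.q^ m n) (ℕP.m+[n∸m]≡n (ℕP.≮⇒≥ ge)) (above (n ℕ.∸ m))
      where
      above : ∀ d → U k (m ℕ.+ d) + - (P.q^ m PR.* U k) (m ℕ.+ d) ≈ P.q^ m (m ℕ.+ d)
      above zero = trans (subtract-zero (q^-shift m (U k) 0)) (≡.subst (λ s → U k s ≈ P.q^ m s) (≡.sym (ℕP.+-identityʳ m)) (reflexive (≡.trans (U-yes k k ∣-refl) (≡.sym (P.mon-diag 1# m)))))
      above (suc d) = trans (+-cong (same (suc k ∣? suc d)) (-‿cong (q^-shift m (U k) (suc d)))) (trans (-‿inverseʳ _) (reflexive (≡.sym (P.mon-off 1# m (m ℕ.+ suc d) (λ e → ℕP.<⇒≢ (ℕP.m<m+n m (s≤s z≤n)) e)))))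
        where
        same : Dec (suc k ∣ suc d) → U k (m ℕ.+ suc d) ≈ U k (suc d)
        same (yes p) = reflexive (≡.trans (U-yes k (k ℕ.+ suc d) (∣m∣n⇒∣m+n ∣-refl p)) (≡.sym (U-yes k d p)))
        same (no p) = reflexive (≡.trans (U-no k (k ℕ.+ suc d) (λ e → p (∣m+n∣m⇒∣n e ∣-refl))) (≡.sym (U-no k d p)))

  1-q^-regular : ∀ k → P.Regular (1-q^ (suc k) 0)
  1-q^-regular k = P.unit-regular (trans (+-congˡ (Algebra.Properties.Ring.-0#≈0# ring)) (+-identityʳ _))

  U-product : ∀ a b → U a PR.* U b PR.≈ U (suc (a ℕ.+ b)) PR.* (PR.1# PR.+ U a PR.+ U b)
  U-product a b = cancel′ (LF.geometric-product (P.q^ (suc a)) (P.q^ (suc b)) (U a) (U b) (U (suc (a ℕ.+ b))) (U-geometric a) (U-geometric b)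
      (PR.trans (PR.*-congʳ (PR.+-congˡ (PR.-‿cong q-sum))) (PR.trans (U-geometric (suc (a ℕ.+ b))) (PR.sym q-sum))))
    where
    q-sum : P.q^ (suc a) PR.* P.q^ (suc b) PR.≈ P.q^ (suc (suc (a ℕ.+ b)))
    q-sum = PR.trans (P.mon-mul 1# 1# (suc a) (suc b)) (PR.trans (P.mon-cong (suc a ℕ.+ suc b) (*-identityˡ 1#)) (PR.reflexive (≡.cong (λ s → P.q^ (suc s)) (ℕP.+-suc a b))))
    cancel : ∀ k {f g} → 1-q^ (suc k) PR.* f PR.≈ 1-q^ (suc k) PR.* g → f PR.≈ g
    cancel k {f} {g} = P.mul-cancel (1-q^ (suc k)) f g (1-q^-regular k)
    cancel′ : ∀ {f g} → (1-q^ (suc a) PR.* (1-q^ (suc b) PR.* ((PR.1# PR.- P.q^ (suc a) PR.* P.q^ (suc b)) PR.* f))) PR.≈ (1-q^ (suc a) PR.* (1-q^ (suc b) PR.* ((PR.1# PR.- P.q^ (suc a) PR.* P.q^ (suc b)) PR.* g))) → f PR.≈ g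
    cancel′ {f} {g} e = (P.mul-cancel (PR.1# PR.- P.q^ (suc a) PR.* P.q^ (suc b)) f g (P.unit-regular (trans (+-congˡ (trans (-‿cong (zeroˡ _)) (Algebra.Properties.Ring.-0#≈0# ring))) (+-identityʳ _))) (cancel b (cancel a e)))

  nat-coefficient : ∀ m f n → (PI.nat m PR.* f) n ≈ KI.nat m * f n
  nat-coefficient m f n = trans (P.mul-cong {PI.nat m} {P.mon (KI.nat m) 0} {f} {f} (constant m) (λ _ → refl) n) (P.mon0-mul (KI.nat m) f n)
    where
    constant : ∀ m → PI.nat m PR.≈ P.mon (KI.nat m) 0
    constant zero zero = refl
    constant zero (suc i) = refl
    constant (suc zero) zero = refl
    constant (suc zero) (suc i) = refl
    constant (suc (suc m)) zero = +-congˡ (constant (suc m) 0)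
    constant (suc (suc m)) (suc i) = trans (+-identityˡ _) (constant (suc m) (suc i))

  D-q^ : ∀ m → P.D (P.q^ m) PR.≈ PI.nat m PR.* P.q^ m
  D-q^ m n = trans (go (m ℕP.≟ n)) (sym (nat-coefficient m (P.q^ m) n))
    where
    go : Dec (m ≡ n) → P.D (P.q^ m) n ≈ KI.nat m * P.q^ m n
    go (yes ≡.refl) = refl
    go (no ne) = trans (*-congˡ z) (trans (zeroʳ _) (sym (trans (*-congˡ z) (zeroʳ _))))
      where z = reflexive (P.mon-off 1# m n ne)

  D-1 : P.D PR.1# PR.≈ PR.0#
  D-1 zero = zeroˡ _
  D-1 (suc n) = zeroʳ _

  D-1-q^ : ∀ m → P.D (1-q^ m) PR.≈ PR.- (PI.nat m PR.* P.q^ m)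
  D-1-q^ m = PR.trans (P.D-+ PR.1# (PR.- P.q^ m)) (PR.trans (PR.+-cong D-1 (PR.trans (P.D-neg (P.q^ m)) (PR.-‿cong (D-q^ m)))) (PR.+-identityˡ _))

  D-U : ∀ k → P.D (U k) PR.≈ PI.nat (suc k) PR.* (U k PR.* (PR.1# PR.+ U k))
  D-U k = P.mul-cancel (1-q^ (suc k)) _ _ (1-q^-regular k) (LF.geometric-derivative (PI.nat (suc k)) (P.q^ (suc k)) (U k) (P.D (U k)) (U-geometric k)
    (PR.trans (PR.+-congʳ (PR.*-congʳ (PR.sym (D-1-q^ (suc k))))) (PR.trans (PR.sym (P.D-mul (1-q^ (suc k)) (U k))) (PR.trans (P.D-cong (U-geometric k)) (D-q^ (suc k))))))

  ∑ : ℕ → (ℕ → P.Ser) → P.Ser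
  ∑ zero f = PR.0#
  ∑ (suc N) f = ∑ N f PR.+ f N

  ∑-cong : ∀ N {f g} → (∀ k → k ℕ.< N → f k PR.≈ g k) → ∑ N f PR.≈ ∑ N g
  ∑-cong zero p = PR.refl
  ∑-cong (suc N) p = PR.+-cong (∑-cong N (λ k l → p k (ℕP.m<n⇒m<1+n l))) (p N ℕP.≤-refl)

  ∑-+ : ∀ N f g → ∑ N (λ k → f k PR.+ g k) PR.≈ ∑ N f PR.+ ∑ N g
  ∑-+ zero f g = PR.sym (PR.+-identityˡ _)
  ∑-+ (suc N) f g = PR.trans (PR.+-congʳ (∑-+ N f g)) (Series.interchange P.seriesRing (∑ N f) (∑ N g) (f N) (g N))

  ∑-*ˡ : ∀ N f c → c PR.* ∑ N f PR.≈ ∑ N (λ k → c PR.* f k)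
  ∑-*ˡ zero f c = PR.zeroʳ c
  ∑-*ˡ (suc N) f c = PR.trans (PR.distribˡ c (∑ N f) (f N)) (PR.+-congʳ (∑-*ˡ N f c))

  ∑-*ʳ : ∀ N f c → ∑ N f PR.* c PR.≈ ∑ N (λ k → f k PR.* c)
  ∑-*ʳ N f c = PR.trans (PR.*-comm _ c) (PR.trans (∑-*ˡ N f c) (∑-cong N (λ k _ → PR.*-comm c (f k))))

  ∑-D : ∀ N f → P.D (∑ N f) PR.≈ ∑ N (λ k → P.D (f k))
  ∑-D zero f n = zeroʳ _
  ∑-D (suc N) f = PR.trans (P.D-+ (∑ N f) (f N)) (PR.+-congʳ (∑-D N f))

  ∑-front : ∀ N f → ∑ (suc N) f PR.≈ f 0 PR.+ ∑ N (λ k → f (suc k))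
  ∑-front zero f = PR.+-comm _ _
  ∑-front (suc N) f = PR.trans (PR.+-congʳ (∑-front N f)) (PR.+-assoc _ _ _)

  ∑-extend : ∀ {M} N L f → (∀ k → N ℕ.≤ k → f k P.≋[ M ] PR.0#) → N ℕ.≤ L → ∑ N f P.≋[ M ] ∑ L f
  ∑-extend {M} N L f z le = ≡.subst (λ L → ∑ N f P.≋[ M ] ∑ L f) (ℕP.m∸n+n≡m le) (go (L ℕ.∸ N))
    where
    go : ∀ d → ∑ N f P.≋[ M ] ∑ (d ℕ.+ N) f
    go zero n l = refl
    go (suc d) n l = trans (go d n l) (sym (trans (+-congˡ (z (d ℕ.+ N) (ℕP.m≤n+m N d) n l)) (+-identityʳ _)))

  ∑-low : ∀ {M} N f → (∀ k → f k P.≋[ M ] PR.0#) → ∑ N f P.≋[ M ] PR.0#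
  ∑-low zero f z n l = refl
  ∑-low (suc N) f z n l = trans (+-cong (∑-low N f z n l) (z N n l)) (+-identityˡ 0#)

  -- Σ_{m ≥ 1} w(m) q^m / (1 - q^m)
  L : (ℕ → ℕ) → P.Ser
  L w n = ∑ n (λ k → PI.nat (w (suc k)) PR.* U k) n

  *-low : ∀ {M} f g → g P.≋[ M ] PR.0# → f PR.* g P.≋[ M ] PR.0#
  *-low {M} f g z n l = trans (P.mul-cong[] {M} {f} {f} {g} {PR.0#} (λ _ _ → refl) z n l) (PR.zeroʳ f n)

  ≋-≤ : ∀ {M N f g} → M ℕ.≤ N → f P.≋[ N ] g → f P.≋[ M ] g
  ≋-≤ le p n l = p n (ℕP.≤-trans l le)

  U-low′ : ∀ {M} k → M ℕ.≤ suc k → U k P.≋[ M ] PR.0#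
  U-low′ k le = ≋-≤ {f = U k} {PR.0#} le (U-low k)

  L-∑ : ∀ w N → L w P.≋[ N ] ∑ N (λ k → PI.nat (w (suc k)) PR.* U k)
  L-∑ w N n l = ∑-extend {suc n} n N (λ k → PI.nat (w (suc k)) PR.* U k) (λ k le → *-low {suc n} (PI.nat (w (suc k))) (U k) (U-low′ k (s≤s le))) (ℕP.<⇒≤ l) n ℕP.≤-refl

  square-split : ∀ N (h : ℕ → ℕ → P.Ser) → ∑ N (λ b → ∑ N (λ a → h a b)) PR.≈ ∑ N (λ b → h b b) PR.+ ∑ N (λ b → ∑ b (λ a → h a b PR.+ h b a))
  square-split zero h = PR.sym (PR.+-identityˡ _)
  square-split (suc N) h = PR.trans (PR.+-congʳ (∑-+ N (λ b → ∑ N (λ a → h a b)) (λ b → h N b)))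
    (PR.trans (PR.+-congʳ (PR.+-congʳ (square-split N h))) (PR.trans (regroup _ _ (∑ N (λ b → h N b)) (∑ N (λ a → h a N)) (h N N)) (PR.+-congˡ (PR.+-congˡ (PR.sym (∑-+ N (λ a → h a N) (λ a → h N a)))))))
    where
    regroup : ∀ d s x y z → d PR.+ s PR.+ x PR.+ (y PR.+ z) PR.≈ d PR.+ z PR.+ (s PR.+ (y PR.+ x))
    regroup = PI.solve 5 (λ d s x y z → d PI.:+ s PI.:+ x PI.:+ (y PI.:+ z) PI.:= d PI.:+ z PI.:+ (s PI.:+ (y PI.:+ x))) PR.refl

  -- The part of the rectangle outside the triangle has a + b ≥ N, where `h` vanishes to the
  -- required order.
  triangle-square : ∀ {M} N N′ (h : ℕ → ℕ → P.Ser) → N ℕ.≤ N′ → (∀ a b → N ℕ.≤ a ℕ.+ b → h a b P.≋[ M ] PR.0#) →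
    ∑ N (λ n → PF.∑ₐ n h) P.≋[ M ] ∑ N (λ b → ∑ N′ (λ a → h a b))
  triangle-square zero N′ h le z n l = refl
  triangle-square {M} (suc N) N′ h le z n l = begin
    ∑ (suc N) (λ n → PF.∑ₐ n h) n                                          ≈⟨ columns N n ⟩
    ∑ (suc N) (λ a → h a 0) n + ∑ N (λ n → PF.∑ₐ n (λ a b → h a (suc b))) n
      ≈⟨ +-cong (∑-extend {M} (suc N) N′ (λ a → h a 0) (λ a le → z a 0 (ℕP.≤-trans le (ℕP.≤-reflexive (≡.sym (ℕP.+-identityʳ a))))) le n l)
           (triangle-square {M} N N′ (λ a b → h a (suc b)) (ℕP.≤-trans (ℕP.n≤1+n N) le) (λ a b le → z a (suc b) (ℕP.≤-trans (s≤s le) (ℕP.≤-reflexive (≡.sym (ℕP.+-suc a b))))) n l) ⟩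
    ∑ N′ (λ a → h a 0) n + ∑ N (λ b → ∑ N′ (λ a → h a (suc b))) n           ≈⟨ ∑-front N (λ b → ∑ N′ (λ a → h a b)) n ⟨
    ∑ (suc N) (λ b → ∑ N′ (λ a → h a b)) n                                 ∎
    where
    columns : ∀ N → ∑ (suc N) (λ n → PF.∑ₐ n h) PR.≈ ∑ (suc N) (λ a → h a 0) PR.+ ∑ N (λ n → PF.∑ₐ n (λ a b → h a (suc b)))
    columns zero = PR.sym (PR.+-identityʳ _)
    columns (suc N) = PR.trans (PR.+-congʳ (columns N)) (Series.interchange P.seriesRing _ _ _ _)

  ∑ₐ-∑ : ∀ n h → PF.∑ₐ n h PR.≈ ∑ (suc n) (λ a → h a (n ℕ.∸ a))
  ∑ₐ-∑ zero h = PR.sym (PR.+-identityˡ _)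
  ∑ₐ-∑ (suc n) h = PR.trans (PF.∑ₐ-last n h) (PR.trans (PR.+-congʳ (∑ₐ-∑ n (λ a b → h (suc a) b))) (PR.trans (PR.+-comm _ _) (PR.sym (∑-front (suc n) (λ a → h a (suc n ℕ.∸ a))))))

  ∑ₐ-swap : ∀ n h → PF.∑ₐ n h PR.≈ PF.∑ₐ n (λ a b → h b a)
  ∑ₐ-swap zero h = PR.refl
  ∑ₐ-swap (suc n) h = PR.trans (PR.+-congˡ (∑ₐ-swap n (λ a b → h a (suc b)))) (PR.trans (PR.+-comm _ _) (PR.sym (PF.∑ₐ-last n (λ a b → h b a))))

  PI-nat-∑ : ∀ n f → PI.nat (∑ℕ n f) PR.≈ ∑ n (λ k → PI.nat (f k))
  PI-nat-∑ zero f = PR.refl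
  PI-nat-∑ (suc n) f = PR.trans (PI.nat-+ (∑ℕ n f) (f n)) (PR.+-congʳ (PI-nat-∑ n f))

form-sym : ∀ m n → form m n ≡ form n m
form-sym = lin
  where
  lin : ∀ m n → m ℕ.* m ℕ.+ m ℕ.* n ℕ.+ n ℕ.* n ≡ n ℕ.* n ℕ.+ n ℕ.* m ℕ.+ m ℕ.* m
  lin = ℕ-solve-∀

form-shift : ∀ a b → a ℕ.≤ b → form (suc a) (suc b) ≡ form (suc a) (b ℕ.∸ a) ℕ.+ 2 ℕ.* (suc a ℕ.* suc b)
form-shift a b le = ≡.trans (≡.cong (λ s → form (suc a) (suc s)) (≡.sym (ℕP.m∸n+n≡m le))) (≡.trans (lin a (b ℕ.∸ a)) (≡.cong (λ s → form (suc a) (b ℕ.∸ a) ℕ.+ 2 ℕ.* (suc a ℕ.* suc s)) (ℕP.m∸n+n≡m le)))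
  where
  lin : ∀ a d → suc a ℕ.* suc a ℕ.+ suc a ℕ.* suc (d ℕ.+ a) ℕ.+ suc (d ℕ.+ a) ℕ.* suc (d ℕ.+ a) ≡
    suc a ℕ.* suc a ℕ.+ suc a ℕ.* d ℕ.+ d ℕ.* d ℕ.+ 2 ℕ.* (suc a ℕ.* suc (d ℕ.+ a))
  lin = ℕ-solve-∀

-- The convolution identity for divisor sums

module Convolution (K : CommutativeRing 0ℓ 0ℓ) where
  open CommutativeRing K hiding (zero)
  open Lambert K public
  open SetoidReasoning setoid
  module KF = LambertForms K

  E S₂ S₃ : P.Ser
  E = L (λ m → m)
  S₂ = L (λ m → m ℕ.* m)
  S₃ = L (λ m → m ℕ.* m ℕ.* m)

  D-nat* : ∀ m f → P.D (PI.nat m PR.* f) PR.≈ PI.nat m PR.* P.D f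
  D-nat* m f n = begin
    KI.nat n * (PI.nat m PR.* f) n       ≈⟨ *-congˡ (nat-coefficient m f n) ⟩
    KI.nat n * (KI.nat m * f n)          ≈⟨ trans (sym (*-assoc _ _ _)) (trans (*-congʳ (*-comm _ _)) (*-assoc _ _ _)) ⟩
    KI.nat m * (KI.nat n * f n)          ≈⟨ nat-coefficient m (P.D f) n ⟨
    (PI.nat m PR.* P.D f) n              ∎

  private
    w : ℕ → P.Ser
    w k = PI.nat (suc k)

    wU : ℕ → P.Ser
    wU k = w k PR.* U k

    -- Indices are shifted: a and b stand for m = a + 1 and n = b + 1, so `b ∸ a` is n - m for a ≤
    -- b.
    pair weighted reduced : ℕ → ℕ → P.Ser
    pair a b = w a PR.* w b PR.* (U a PR.* U b)
    weighted a b = PI.nat (form (suc a) (suc b)) PR.* (U a PR.* U b)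
    reduced a b = PI.nat (form (suc a) (b ℕ.∸ a)) PR.* (U a PR.* U b)

    row P′ : ℕ → P.Ser
    row b = ∑ b (λ a → reduced a b)
    P′ b = U b PR.* PI.nat (∑ℕ b (λ a → form (suc a) (b ℕ.∸ a)))

    diag low low′ pp : ℕ → P.Ser
    diag M = ∑ M (λ b → pair b b)
    low M = ∑ M (λ b → ∑ b (λ a → pair a b))
    low′ M = ∑ M row
    pp M = ∑ M P′

    pair-sym : ∀ a b → pair b a PR.≈ pair a b
    pair-sym a b = PR.*-cong (PR.*-comm _ _) (PR.*-comm _ _)

    double : ∀ M (f : ℕ → ℕ → P.Ser) → ∑ M (λ b → ∑ b (λ a → PI.int (+ 2) PR.* f a b)) PR.≈ PI.int (+ 2) PR.* ∑ M (λ b → ∑ b (λ a → f a b))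
    double M f = PR.trans (∑-cong M (λ b _ → PR.sym (∑-*ˡ b (λ a → f a b) (PI.int (+ 2))))) (PR.sym (∑-*ˡ M (λ b → ∑ b (λ a → f a b)) (PI.int (+ 2))))

    E-square : ∀ M → E PR.* E P.≋[ M ] diag M PR.+ PI.int (+ 2) PR.* low M
    E-square M n l = trans (P.mul-cong[] {M} {E} {∑ M wU} {E} {∑ M wU} (L-∑ (λ m → m) M) (L-∑ (λ m → m) M) n l)
      (PR.trans (∑-*ʳ-then) (PR.trans (square-split M pair) (PR.+-congˡ (PR.trans (∑-cong M (λ b _ → ∑-cong b (λ a _ → PR.trans (PR.+-congˡ (pair-sym a b)) (LF.twice (pair a b))))) (double M pair)))) n)
      where
      ∑-*ʳ-then : ∑ M wU PR.* ∑ M wU PR.≈ ∑ M (λ b → ∑ M (λ a → pair a b))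
      ∑-*ʳ-then = PR.trans (∑-*ˡ M wU (∑ M wU)) (∑-cong M (λ b _ → PR.trans (∑-*ʳ M wU (wU b)) (∑-cong M (λ a _ → LF.pair-square (w a) (w b) (U a) (U b)))))

    weighted-square : ∀ M → ∑ M (λ b → ∑ M (λ a → weighted a b)) PR.≈ PI.int (+ 3) PR.* diag M PR.+ PI.int (+ 2) PR.* (low′ M PR.+ PI.int (+ 2) PR.* low M)
    weighted-square M = PR.trans (square-split M weighted) (PR.+-cong
      (PR.trans (∑-cong M (λ b _ → on-diagonal b)) (PR.sym (∑-*ˡ M (λ b → pair b b) (PI.int (+ 3)))))
      (PR.trans (∑-cong M (λ b _ → ∑-cong b (λ a l → PR.trans (PR.+-congˡ (weighted-sym a b)) (PR.trans (LF.twice (weighted a b)) (PR.*-congˡ (split a b (ℕP.<⇒≤ l)))))))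
        (PR.trans (double M (λ a b → reduced a b PR.+ PI.int (+ 2) PR.* pair a b)) (PR.*-congˡ (PR.trans (∑-cong M (λ b _ → ∑-+ b (λ a → reduced a b) (λ a → PI.int (+ 2) PR.* pair a b)))
          (PR.trans (∑-+ M row (λ b → ∑ b (λ a → PI.int (+ 2) PR.* pair a b))) (PR.+-congˡ (double M pair))))))))
      where
      weighted-sym : ∀ a b → weighted b a PR.≈ weighted a b
      weighted-sym a b = PR.*-cong (PR.reflexive (≡.cong PI.nat (form-sym (suc b) (suc a)))) (PR.*-comm _ _)
      on-diagonal : ∀ b → weighted b b PR.≈ PI.int (+ 3) PR.* pair b b
      on-diagonal b = PR.trans (PR.*-congʳ (PR.trans (PR.reflexive (≡.cong PI.nat (lin (suc b)))) (PR.trans (PI.nat-* 3 (suc b ℕ.* suc b)) (PR.*-congˡ (PI.nat-* (suc b) (suc b)))))) (PR.*-assoc _ _ _)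
        where
        lin : ∀ m → m ℕ.* m ℕ.+ m ℕ.* m ℕ.+ m ℕ.* m ≡ 3 ℕ.* (m ℕ.* m)
        lin = ℕ-solve-∀
      split : ∀ a b → a ℕ.≤ b → weighted a b PR.≈ reduced a b PR.+ PI.int (+ 2) PR.* pair a b
      split a b le = PR.trans (PR.*-congʳ (PR.trans (PR.reflexive (≡.cong PI.nat (form-shift a b le))) (PR.trans (PI.nat-+ (form (suc a) (b ℕ.∸ a)) (2 ℕ.* (suc a ℕ.* suc b)))
          (PR.+-congˡ (PR.trans (PI.nat-* 2 (suc a ℕ.* suc b)) (PR.*-congˡ (PI.nat-* (suc a) (suc b))))))))
        (PR.trans (PR.distribʳ _ _ _) (PR.+-congˡ (PR.*-assoc _ _ _)))

    -- On m + k = N the product u_m u_k is u_N (1 + u_m + u_k). The constant 1 yields the single sum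
    -- `P′`; the other two terms are equal by symmetry of the form and yield `row` twice.
    antidiagonal : ∀ n → PF.∑ₐ n weighted PR.≈ P′ (suc n) PR.+ PI.int (+ 2) PR.* row (suc n)
    antidiagonal n = PR.trans (PF.∑ₐ-cong n expand) (PR.trans (PF.∑ₐ-+ n _ _) (PR.+-cong
        (PR.trans (PR.sym (PF.∑ₐ-*ˡ n (U (suc n)) (λ a b → PI.nat (form (suc a) (suc b))))) (PR.*-congˡ (PR.trans (∑ₐ-∑ n _) (PR.trans (∑-cong (suc n) (λ a l → PR.reflexive (≡.cong (λ s → PI.nat (form (suc a) s)) (≡.sym (ℕP.+-∸-assoc 1 (ℕP.≤-pred l)))))) (PR.sym (PI-nat-∑ (suc n) _))))))
        (PR.trans (PF.∑ₐ-+ n _ _) (PR.trans (PR.+-cong first (PR.trans (∑ₐ-swap n _) (PR.trans (PF.∑ₐ-cong n (λ a b _ → PR.*-congˡ (PR.*-congʳ (PR.reflexive (≡.cong PI.nat (form-sym (suc b) (suc a))))))) first))) (LF.twice (row (suc n)))))))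
      where
      expand : ∀ a b → a ℕ.+ b ≡ n → weighted a b PR.≈ U (suc n) PR.* PI.nat (form (suc a) (suc b)) PR.+
        (U (suc n) PR.* (PI.nat (form (suc a) (suc b)) PR.* U a) PR.+ U (suc n) PR.* (PI.nat (form (suc a) (suc b)) PR.* U b))
      expand a b ≡.refl = PR.trans (PR.*-congˡ (U-product a b)) (LF.expand-1+ (PI.nat (form (suc a) (suc b))) (U (suc (a ℕ.+ b))) (U a) (U b))
      first : PF.∑ₐ n (λ a b → U (suc n) PR.* (PI.nat (form (suc a) (suc b)) PR.* U a)) PR.≈ row (suc n)
      first = PR.trans (∑ₐ-∑ n _) (∑-cong (suc n) (λ a l → PR.trans (PC.swap-left (U (suc n)) (PI.nat (form (suc a) (suc (n ℕ.∸ a)))) (U a))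
        (PR.*-cong (PR.reflexive (≡.cong (λ s → PI.nat (form (suc a) s)) (≡.sym (ℕP.+-∸-assoc 1 (ℕP.≤-pred l))))) (PR.*-comm _ _))))

    weighted-triangle : ∀ M → ∑ M (λ n → PF.∑ₐ n weighted) P.≋[ M ] pp M PR.+ PI.int (+ 2) PR.* low′ M
    weighted-triangle M n l = begin
      ∑ M (λ n → PF.∑ₐ n weighted) n                 ≈⟨ ∑-cong M (λ n _ → antidiagonal n) n ⟩
      ∑ M (λ n → x (suc n)) n                        ≈⟨ trans (+-congʳ x-0) (+-identityˡ _) ⟨
      x 0 n + ∑ M (λ n → x (suc n)) n                ≈⟨ ∑-front M x n ⟨
      ∑ M x n + x M n                                ≈⟨ trans (+-congˡ x-M) (+-identityʳ _) ⟩
      ∑ M x n                                        ≈⟨ PR.trans (∑-+ M P′ (λ b → PI.int (+ 2) PR.* row b)) (PR.+-congˡ (PR.sym (∑-*ˡ M row (PI.int (+ 2))))) n ⟩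
      (pp M PR.+ PI.int (+ 2) PR.* low′ M) n         ∎
      where
      x : ℕ → P.Ser
      x b = P′ b PR.+ PI.int (+ 2) PR.* row b
      x-0 : x 0 n ≈ 0#
      x-0 = trans (+-cong (PR.zeroʳ (U 0) n) (PR.zeroʳ (PI.int (+ 2)) n)) (+-identityˡ 0#)
      U-M : U M P.≋[ M ] PR.0#
      U-M = U-low′ M (ℕP.n≤1+n M)
      low-factor : ∀ g f → f P.≋[ M ] PR.0# → f PR.* g P.≋[ M ] PR.0#
      low-factor g f z n l = trans (PR.*-comm f g n) (*-low {M} g f z n l)
      x-M : x M n ≈ 0#
      x-M = trans (+-cong (low-factor (PI.nat (∑ℕ M (λ a → form (suc a) (M ℕ.∸ a)))) (U M) U-M n l)
        (*-low {M} (PI.int (+ 2)) (row M) (∑-low M (λ a → reduced a M) (λ a → *-low {M} (PI.nat (form (suc a) (M ℕ.∸ a))) (U a PR.* U M) (*-low {M} (U a) (U M) U-M))) n l)) (+-identityˡ 0#)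

    weighted-low : ∀ M a b → M ℕ.≤ a ℕ.+ b → weighted a b P.≋[ M ] PR.0#
    weighted-low M a b le = *-low {M} (PI.nat (form (suc a) (suc b))) (U a PR.* U b) (λ n l → P.mul-vanish (U a) (U b) n (split n l))
      where
      split : ∀ n → n ℕ.< M → ∀ i j → i ℕ.+ j ≡ n → U a i ≈ 0# ⊎ U b j ≈ 0#
      split n l i j ≡.refl with i ℕP.<? suc a
      ... | yes li = inj₁ (U-low a i li)
      ... | no gi = inj₂ (U-low b j (s≤s (ℕP.<⇒≤ (ℕP.+-cancelˡ-< a j b (ℕP.≤-trans (s≤s (ℕP.+-monoˡ-≤ j (ℕP.<⇒≤ (ℕP.≮⇒≥ gi)))) (ℕP.≤-trans l le))))))

    D-E : ∀ M → P.D E P.≋[ M ] diag M PR.+ S₂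
    D-E M n l = begin
      P.D E n                                      ≈⟨ *-congˡ (L-∑ (λ m → m) M n l) ⟩
      P.D (∑ M wU) n                               ≈⟨ PR.trans (∑-D M wU) (PR.trans (∑-cong M (λ k _ → PR.trans (D-nat* (suc k) (U k)) (PR.trans (PR.*-congˡ (D-U k)) (LF.square-term (w k) (U k))))) (∑-+ M _ _)) n ⟩
      diag M n + ∑ M (λ k → w k PR.* w k PR.* U k) n  ≈⟨ +-congˡ (∑-cong M (λ k _ → PR.*-congʳ {U k} (PI.nat-* (suc k) (suc k))) n) ⟨
      diag M n + ∑ M (λ k → PI.nat (suc k ℕ.* suc k) PR.* U k) n  ≈⟨ +-congˡ (L-∑ (λ m → m ℕ.* m) M n l) ⟨
      diag M n + S₂ n                              ∎

    pp-value : ∀ M → PI.int (+ 6) PR.* pp M PR.+ PI.int (+ 6) PR.* S₂ P.≋[ M ] PI.int (+ 5) PR.* S₃ PR.+ E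
    pp-value M n l = begin
      (PI.int (+ 6) PR.* pp M PR.+ PI.int (+ 6) PR.* S₂) n
        ≈⟨ +-congˡ (P.mul-cong[] {M} {PI.int (+ 6)} {PI.int (+ 6)} {S₂} {∑ M s₂} (λ _ _ → refl) (λ i l → trans (L-∑ (λ m → m ℕ.* m) M i l) (∑-cong M (λ k _ → PR.*-congʳ {U k} (PI.nat-* (suc k) (suc k))) i)) n l) ⟩
      (PI.int (+ 6) PR.* pp M PR.+ PI.int (+ 6) PR.* ∑ M s₂) n
        ≈⟨ PR.trans (PR.+-cong (∑-*ˡ M P′ (PI.int (+ 6))) (∑-*ˡ M s₂ (PI.int (+ 6)))) (PR.trans (PR.sym (∑-+ M _ _)) (PR.trans (∑-cong M (λ k _ → LF.cubic-term (PI.nat (∑ℕ k (λ a → form (suc a) (k ℕ.∸ a)))) (w k) (U k) (cast k))) (PR.trans (∑-+ M _ _) (PR.+-congʳ (PR.sym (∑-*ˡ M s₃ (PI.int (+ 5)))))))) n ⟩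
      (PI.int (+ 5) PR.* ∑ M s₃ PR.+ ∑ M wU) n
        ≈⟨ +-cong (P.mul-cong[] {M} {PI.int (+ 5)} {PI.int (+ 5)} {∑ M s₃} {S₃} (λ _ _ → refl) (λ i l → trans (∑-cong M (λ k _ → PR.*-congʳ {U k} (PR.sym (PR.trans (PI.nat-* (suc k ℕ.* suc k) (suc k)) (PR.*-congʳ (PI.nat-* (suc k) (suc k)))))) i) (sym (L-∑ (λ m → m ℕ.* m ℕ.* m) M i l))) n l) (sym (L-∑ (λ m → m) M n l)) ⟩
      (PI.int (+ 5) PR.* S₃ PR.+ E) n ∎
      where
      s₂ s₃ : ℕ → P.Ser
      s₂ k = w k PR.* w k PR.* U k
      s₃ k = w k PR.* w k PR.* w k PR.* U k
      cast : ∀ k → PI.int (+ 6) PR.* PI.nat (∑ℕ k (λ a → form (suc a) (k ℕ.∸ a))) PR.+ PI.int (+ 6) PR.* (w k PR.* w k) PR.≈ PI.int (+ 5) PR.* (w k PR.* w k PR.* w k) PR.+ w k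
      cast k = PR.trans (PR.sym (PR.trans (PI.nat-+ (6 ℕ.* Σf) (6 ℕ.* (suc k ℕ.* suc k))) (PR.+-cong (PI.nat-* 6 Σf) (PR.trans (PI.nat-* 6 (suc k ℕ.* suc k)) (PR.*-congˡ (PI.nat-* (suc k) (suc k)))))))
        (PR.trans (PR.reflexive (≡.cong PI.nat (form-sum k))) (PR.trans (PI.nat-+ (5 ℕ.* (suc k ℕ.* suc k ℕ.* suc k)) (suc k)) (PR.+-congʳ (PR.trans (PI.nat-* 5 (suc k ℕ.* suc k ℕ.* suc k)) (PR.*-congˡ (PR.trans (PI.nat-* (suc k ℕ.* suc k) (suc k)) (PR.*-congʳ (PI.nat-* (suc k) (suc k)))))))))
        where
        Σf : ℕ
        Σf = ∑ℕ k (λ a → form (suc a) (k ℕ.∸ a))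

  -- The double sum of f(m, k) u_m u_k is evaluated over a square and along antidiagonals. The terms
  -- f(m, n - m) u_m u_n with m < n occur twice in either evaluation and cancel, which leaves E²,
  -- the squares u_m² and single Lambert series; the squares are absorbed by D E.
  σ-convolution : PI.int (+ 12) PR.* (E PR.* E) PR.+ PI.int (+ 6) PR.* P.D E PR.≈ PI.int (+ 5) PR.* S₃ PR.+ E
  σ-convolution n = trans (+-cong (nat-coefficient 12 (E PR.* E) n) (nat-coefficient 6 (P.D E) n))
    (trans (KF.conclude ((E PR.* E) n) (diag M n) (P.D E n) (E n) (S₂ n) (S₃ n) (pp M n) e₁ e₂ e₃) (+-congʳ (sym (nat-coefficient 5 S₃ n))))
    where
    M : ℕ
    M = suc n
    e₀ : KI.nat 3 * diag M n + KI.nat 2 * (low′ M n + KI.nat 2 * low M n) ≈ pp M n + KI.nat 2 * low′ M n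
    e₀ = begin
      KI.nat 3 * diag M n + KI.nat 2 * (low′ M n + KI.nat 2 * low M n)
        ≈⟨ +-cong (nat-coefficient 3 (diag M) n) (trans (nat-coefficient 2 (low′ M PR.+ PI.int (+ 2) PR.* low M) n) (*-congˡ (+-congˡ (nat-coefficient 2 (low M) n)))) ⟨
      (PI.int (+ 3) PR.* diag M PR.+ PI.int (+ 2) PR.* (low′ M PR.+ PI.int (+ 2) PR.* low M)) n   ≈⟨ weighted-square M n ⟨
      ∑ M (λ b → ∑ M (λ a → weighted a b)) n        ≈⟨ triangle-square {M} M M weighted ℕP.≤-refl (weighted-low M) n ℕP.≤-refl ⟨
      ∑ M (λ n → PF.∑ₐ n weighted) n                ≈⟨ weighted-triangle M n ℕP.≤-refl ⟩
      (pp M PR.+ PI.int (+ 2) PR.* low′ M) n        ≈⟨ +-congˡ (nat-coefficient 2 (low′ M) n) ⟩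
      pp M n + KI.nat 2 * low′ M n                  ∎
    e₁ : KI.nat 2 * (E PR.* E) n + diag M n ≈ pp M n
    e₁ = trans (+-congʳ (*-congˡ (trans (E-square M n ℕP.≤-refl) (+-congˡ (nat-coefficient 2 (low M) n))))) (KF.combine (diag M n) (low M n) (low′ M n) (pp M n) e₀)
    e₂ : diag M n + S₂ n ≈ P.D E n
    e₂ = sym (D-E M n ℕP.≤-refl)
    e₃ : KI.nat 6 * pp M n + KI.nat 6 * S₂ n ≈ KI.nat 5 * S₃ n + E n
    e₃ = trans (sym (+-cong (nat-coefficient 6 (pp M) n) (nat-coefficient 6 S₂ n))) (trans (pp-value M n ℕP.≤-refl) (+-congʳ (nat-coefficient 5 S₃ n)))

  D-fq : ∀ N → P.D (fq N) PR.≈ PR.- ∑ N (λ k → PI.nat (suc k) PR.* U k) PR.* fq N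
  D-fq zero = PR.trans D-1 (PR.sym (PR.trans (PR.*-identityʳ _) (Algebra.Properties.Ring.-0#≈0# PR.ring)))
  D-fq (suc N) = PR.trans (P.D-mul (1-q^ (suc N)) (fq N)) (PR.trans (PR.+-cong (PR.*-congʳ {fq N} (D-1-q^ (suc N))) (PR.*-congˡ {1-q^ (suc N)} (D-fq N)))
    (LF.log-derivative-step (PI.nat (suc N)) (P.q^ (suc N)) (U N) (∑ N (λ k → PI.nat (suc k) PR.* U k)) (fq N) (U-geometric N)))

  D-euler : P.D euler PR.≈ PR.- (E PR.* euler)
  D-euler n = begin
    P.D euler n                                    ≈⟨ *-congˡ (euler-fq (suc n) n (ℕP.m<n⇒m<1+n ℕP.≤-refl)) ⟩
    P.D (fq (suc n)) n                             ≈⟨ D-fq (suc n) n ⟩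
    (PR.- ∑ (suc n) wU PR.* fq (suc n)) n          ≈⟨ Algebra.Properties.Ring.-‿distribˡ-* PR.ring (∑ (suc n) wU) (fq (suc n)) n ⟨
    - (∑ (suc n) wU PR.* fq (suc n)) n             ≈⟨ -‿cong (P.mul-cong[] {suc n} {∑ (suc n) wU} {E} {fq (suc n)} {euler} (λ i l → sym (L-∑ (λ m → m) (suc n) i l)) (λ i l → sym (euler-fq (suc n) i (ℕP.m<n⇒m<1+n l))) n ℕP.≤-refl) ⟩
    - (E PR.* euler) n                             ∎

-- Eisenstein series of weight four

module WeightFourForms (R : CommutativeRing 0ℓ 0ℓ) where
  open CommutativeRing R hiding (zero)
  open Integers R
  open CubicForms R
  open LevelNineForms R

  private
    nP bP aP : ∀ {m} → (u y : Polynomial m) → Polynomial m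
    nP u y = u :* u :+ con (+ 3) :* (u :* y) :+ con (+ 9) :* (y :* y)
    bP u y = u :- con (+ 3) :* y
    aP u y = u :+ con (+ 6) :* y
    ^4 : ∀ {m} → Polynomial m → Polynomial m
    ^4 x = x :* x :* (x :* x)

  fourth : Carrier → Carrier
  fourth x = x * x * (x * x)

  -- Logarithmic differentiation without division, here and in the next three lemmas: the common
  -- factor stays on both sides and is cancelled later, where its constant term is known.
  log-b : ∀ E E₃ e e₃ b Db De De₃ → e₃ * b ≈ cubed e → De ≈ - (E * e) → De₃ ≈ - (int (+ 3) * (E₃ * e₃)) →
    De₃ * b + e₃ * Db ≈ De * e * e + e * De * e + e * e * De → e₃ * Db ≈ e₃ * (int (+ 3) * (E₃ - E) * b)
  log-b E E₃ e e₃ b Db De De₃ p r s t = trans (l₁ E₃ e₃ b Db) (trans (+-congʳ (trans (+-congʳ (*-congʳ (sym s))) (trans t (+-cong (+-cong (*-congʳ (*-congʳ r)) (*-congʳ (*-congˡ r))) (*-congˡ r)))))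
    (trans (l₂ E e (int (+ 3) * (E₃ * e₃) * b)) (trans (+-congʳ (-‿cong (*-congˡ (*-congˡ (sym p))))) (l₃ E E₃ e₃ b))))
    where
    l₁ : ∀ E₃ e₃ b Db → e₃ * Db ≈ - (int (+ 3) * (E₃ * e₃)) * b + e₃ * Db + int (+ 3) * (E₃ * e₃) * b
    l₁ = solve 4 (λ E₃ e₃ b d → e₃ :* d := :- (con (+ 3) :* (E₃ :* e₃)) :* b :+ e₃ :* d :+ con (+ 3) :* (E₃ :* e₃) :* b) refl
    l₂ : ∀ E e z → - (E * e) * e * e + e * - (E * e) * e + e * e * - (E * e) + z ≈ - (int (+ 3) * (E * cubed e)) + z
    l₂ = solve 3 (λ E e z → :- (E :* e) :* e :* e :+ e :* (:- (E :* e)) :* e :+ e :* e :* (:- (E :* e)) :+ z := :- (con (+ 3) :* (E :* (e :* e :* e))) :+ z) refl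
    l₃ : ∀ E E₃ e₃ b → - (int (+ 3) * (E * (e₃ * b))) + int (+ 3) * (E₃ * e₃) * b ≈ e₃ * (int (+ 3) * (E₃ - E) * b)
    l₃ = solve 4 (λ E E₃ e₃ b → :- (con (+ 3) :* (E :* (e₃ :* b))) :+ con (+ 3) :* (E₃ :* e₃) :* b := e₃ :* (con (+ 3) :* (E₃ :- E) :* b)) refl

  log-y : ∀ E₃ E₉ e₃ e₉ q y Dy De₃ De₉ → e₃ * y ≈ q * cubed e₉ → De₃ ≈ - (int (+ 3) * (E₃ * e₃)) → De₉ ≈ - (int (+ 9) * (E₉ * e₉)) →
    De₃ * y + e₃ * Dy ≈ q * cubed e₉ + q * (De₉ * e₉ * e₉ + e₉ * De₉ * e₉ + e₉ * e₉ * De₉) → e₃ * Dy ≈ e₃ * ((1# - int (+ 27) * E₉ + int (+ 3) * E₃) * y)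
  log-y E₃ E₉ e₃ e₉ q y Dy De₃ De₉ p r s t = trans (l₁ E₃ e₃ y Dy) (trans (+-congʳ (trans (+-congʳ (*-congʳ (sym r))) (trans t (+-congˡ (*-congˡ (+-cong (+-cong (*-congʳ (*-congʳ s)) (*-congʳ (*-congˡ s))) (*-congˡ s)))))))
    (trans (l₂ E₉ e₉ q (int (+ 3) * (E₃ * e₃) * y)) (trans (+-congʳ (*-congʳ (sym p))) (l₃ E₃ E₉ e₃ y))))
    where
    l₁ : ∀ E₃ e₃ b Db → e₃ * Db ≈ - (int (+ 3) * (E₃ * e₃)) * b + e₃ * Db + int (+ 3) * (E₃ * e₃) * b
    l₁ = solve 4 (λ E₃ e₃ b d → e₃ :* d := :- (con (+ 3) :* (E₃ :* e₃)) :* b :+ e₃ :* d :+ con (+ 3) :* (E₃ :* e₃) :* b) refl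
    l₂ : ∀ E e q z → q * cubed e + q * (- (int (+ 9) * (E * e)) * e * e + e * - (int (+ 9) * (E * e)) * e + e * e * - (int (+ 9) * (E * e))) + z ≈ q * cubed e * (1# - int (+ 27) * E) + z
    l₂ = solve 4 (λ E e q z → let d = :- (con (+ 9) :* (E :* e)) in q :* (e :* e :* e) :+ q :* (d :* e :* e :+ e :* d :* e :+ e :* e :* d) :+ z := q :* (e :* e :* e) :* (con (+ 1) :- con (+ 27) :* E) :+ z) refl
    l₃ : ∀ E₃ E₉ e₃ y → e₃ * y * (1# - int (+ 27) * E₉) + int (+ 3) * (E₃ * e₃) * y ≈ e₃ * ((1# - int (+ 27) * E₉ + int (+ 3) * E₃) * y)
    l₃ = solve 4 (λ E₃ E₉ e₃ y → e₃ :* y :* (con (+ 1) :- con (+ 27) :* E₉) :+ con (+ 3) :* (E₃ :* e₃) :* y := e₃ :* ((con (+ 1) :- con (+ 27) :* E₉ :+ con (+ 3) :* E₃) :* y)) refl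

  log-B : ∀ E₃ E₉ e₃ e₉ B DB De₃ De₉ → e₉ * B ≈ cubed e₃ → De₃ ≈ - (int (+ 3) * (E₃ * e₃)) → De₉ ≈ - (int (+ 9) * (E₉ * e₉)) →
    De₉ * B + e₉ * DB ≈ De₃ * e₃ * e₃ + e₃ * De₃ * e₃ + e₃ * e₃ * De₃ → e₉ * DB ≈ e₉ * (int (+ 9) * (E₉ - E₃) * B)
  log-B E₃ E₉ e₃ e₉ B DB De₃ De₉ p r s t = trans (l₁ E₉ e₉ B DB) (trans (+-congʳ (trans (+-congʳ (*-congʳ (sym s))) (trans t (+-cong (+-cong (*-congʳ (*-congʳ r)) (*-congʳ (*-congˡ r))) (*-congˡ r)))))
    (trans (l₂ E₃ e₃ (int (+ 9) * (E₉ * e₉) * B)) (trans (+-congʳ (-‿cong (*-congˡ (*-congˡ (sym p))))) (l₃ E₃ E₉ e₉ B))))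
    where
    l₁ : ∀ E₃ e₃ b Db → e₃ * Db ≈ - (int (+ 9) * (E₃ * e₃)) * b + e₃ * Db + int (+ 9) * (E₃ * e₃) * b
    l₁ = solve 4 (λ E₃ e₃ b d → e₃ :* d := :- (con (+ 9) :* (E₃ :* e₃)) :* b :+ e₃ :* d :+ con (+ 9) :* (E₃ :* e₃) :* b) refl
    l₂ : ∀ E e z → - (int (+ 3) * (E * e)) * e * e + e * - (int (+ 3) * (E * e)) * e + e * e * - (int (+ 3) * (E * e)) + z ≈ - (int (+ 9) * (E * cubed e)) + z
    l₂ = solve 3 (λ E e z → let d = :- (con (+ 3) :* (E :* e)) in d :* e :* e :+ e :* d :* e :+ e :* e :* d :+ z := :- (con (+ 9) :* (E :* (e :* e :* e))) :+ z) refl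
    l₃ : ∀ E₃ E₉ e₉ B → - (int (+ 9) * (E₃ * (e₉ * B))) + int (+ 9) * (E₉ * e₉) * B ≈ e₉ * (int (+ 9) * (E₉ - E₃) * B)
    l₃ = solve 4 (λ E₃ E₉ e₉ B → :- (con (+ 9) :* (E₃ :* (e₉ :* B))) :+ con (+ 9) :* (E₉ :* e₉) :* B := e₉ :* (con (+ 9) :* (E₉ :- E₃) :* B)) refl

  log-n : ∀ E E₃ E₉ b n B Db Dn DB → b * n ≈ cubed B → Db ≈ int (+ 3) * (E₃ - E) * b → DB ≈ int (+ 9) * (E₉ - E₃) * B →
    Db * n + b * Dn ≈ DB * B * B + B * DB * B + B * B * DB → b * Dn ≈ b * ((int (+ 27) * (E₉ - E₃) - int (+ 3) * (E₃ - E)) * n)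
  log-n E E₃ E₉ b n B Db Dn DB p r s t = trans (l₁ E E₃ b n Dn) (trans (+-congʳ (trans (+-congʳ (*-congʳ (sym r))) (trans t (+-cong (+-cong (*-congʳ (*-congʳ s)) (*-congʳ (*-congˡ s))) (*-congˡ s)))))
    (trans (l₂ E₃ E₉ B (int (+ 3) * (E₃ - E) * b * n)) (trans (+-congʳ (*-congˡ (sym p))) (l₃ E E₃ E₉ b n))))
    where
    l₁ : ∀ E E₃ b n Dn → b * Dn ≈ int (+ 3) * (E₃ - E) * b * n + b * Dn - int (+ 3) * (E₃ - E) * b * n
    l₁ = solve 5 (λ E E₃ b n d → b :* d := con (+ 3) :* (E₃ :- E) :* b :* n :+ b :* d :- con (+ 3) :* (E₃ :- E) :* b :* n) refl
    l₂ : ∀ E₃ E₉ B z → int (+ 9) * (E₉ - E₃) * B * B * B + B * (int (+ 9) * (E₉ - E₃) * B) * B + B * B * (int (+ 9) * (E₉ - E₃) * B) - z ≈ int (+ 27) * (E₉ - E₃) * cubed B - z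
    l₂ = solve 4 (λ E₃ E₉ B z → let d = con (+ 9) :* (E₉ :- E₃) :* B in d :* B :* B :+ B :* d :* B :+ B :* B :* d :- z := con (+ 27) :* (E₉ :- E₃) :* (B :* B :* B) :- z) refl
    l₃ : ∀ E E₃ E₉ b n → int (+ 27) * (E₉ - E₃) * (b * n) - int (+ 3) * (E₃ - E) * b * n ≈ b * ((int (+ 27) * (E₉ - E₃) - int (+ 3) * (E₃ - E)) * n)
    l₃ = solve 5 (λ E E₃ E₉ b n → con (+ 27) :* (E₉ :- E₃) :* (b :* n) :- con (+ 3) :* (E₃ :- E) :* b :* n := b :* ((con (+ 27) :* (E₉ :- E₃) :- con (+ 3) :* (E₃ :- E)) :* n)) refl

  -- With E₂ = 1 - 24E this is (3 E₂(q³) - E₂(q))/2, and `WForm` is (9 E₂(q⁹) - E₂(q))/8: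
  -- combinations of E₂ that are true modular forms of weight two.
  MForm : Carrier → Carrier → Carrier
  MForm E E₃ = 1# + int (+ 12) * E - int (+ 36) * E₃

  WForm : Carrier → Carrier → Carrier
  WForm E E₉ = 1# + int (+ 3) * E - int (+ 27) * E₉

  n-in-b : ∀ b y → nForm (b + int (+ 3) * y) y ≈ b * b + int (+ 9) * (b * y) + int (+ 27) * (y * y)
  n-in-b = solve 2 (λ b y → nP (b :+ con (+ 3) :* y) y := b :* b :+ con (+ 9) :* (b :* y) :+ con (+ 27) :* (y :* y)) refl

  -- The hypothesis equates two derivatives of n, one from n as a quadratic form in b and y, one
  -- from n as the quotient b(q³)³/b.
  n-M : ∀ E E₃ E₉ b y → let X = int (+ 3) * (E₃ - E) * b ; Y = (1# - int (+ 27) * E₉ + int (+ 3) * E₃) * y ; n = b * b + int (+ 9) * (b * y) + int (+ 27) * (y * y) in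
    X * b + b * X + int (+ 9) * (X * y + b * Y) + int (+ 27) * (Y * y + y * Y) ≈ (int (+ 27) * (E₉ - E₃) - int (+ 3) * (E₃ - E)) * n →
    n * MForm E E₃ ≈ (b + int (+ 9) * y) * (b + int (+ 9) * y) * WForm E E₉
  n-M E E₃ E₉ b y e = trans (l E E₃ E₉ b y) (trans (+-congˡ (trans (+-congˡ (-‿cong e)) (-‿inverseʳ _))) (+-identityʳ _))
    where
    l : ∀ E E₃ E₉ b y → let X = int (+ 3) * (E₃ - E) * b ; Y = (1# - int (+ 27) * E₉ + int (+ 3) * E₃) * y ; n = b * b + int (+ 9) * (b * y) + int (+ 27) * (y * y) in
      n * MForm E E₃ ≈ (b + int (+ 9) * y) * (b + int (+ 9) * y) * WForm E E₉ + ((int (+ 27) * (E₉ - E₃) - int (+ 3) * (E₃ - E)) * n - (X * b + b * X + int (+ 9) * (X * y + b * Y) + int (+ 27) * (Y * y + y * Y)))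
    l = solve 5 (λ E E₃ E₉ b y → let X = con (+ 3) :* (E₃ :- E) :* b ; Y = (con (+ 1) :- con (+ 27) :* E₉ :+ con (+ 3) :* E₃) :* y ; n = b :* b :+ con (+ 9) :* (b :* y) :+ con (+ 27) :* (y :* y) in
      n :* (con (+ 1) :+ con (+ 12) :* E :- con (+ 36) :* E₃) := (b :+ con (+ 9) :* y) :* (b :+ con (+ 9) :* y) :* (con (+ 1) :+ con (+ 3) :* E :- con (+ 27) :* E₉) :+ ((con (+ 27) :* (E₉ :- E₃) :- con (+ 3) :* (E₃ :- E)) :* n :- (X :* b :+ b :* X :+ con (+ 9) :* (X :* y :+ b :* Y) :+ con (+ 27) :* (Y :* y :+ y :* Y)))) refl

  -- Two parallel linear relations, 3 M(q³) = 4W - M and 3u² = 4n - a², are linked by the hypothesis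
  -- n M = a² W.
  M-descent : ∀ E E₃ E₉ u y → nForm u y * MForm E E₃ ≈ aForm u y * aForm u y * WForm E E₉ →
    int (+ 3) * (aForm u y * aForm u y * MForm E₃ E₉) ≈ int (+ 3) * (u * u * MForm E E₃)
  M-descent E E₃ E₉ u y e = trans (l E E₃ E₉ (aForm u y * aForm u y)) (trans (+-congʳ (*-congˡ (sym e))) (r u y (MForm E E₃)))
    where
    l : ∀ E E₃ E₉ s → int (+ 3) * (s * MForm E₃ E₉) ≈ int (+ 4) * (s * WForm E E₉) - s * MForm E E₃
    l = solve 4 (λ E E₃ E₉ s → con (+ 3) :* (s :* (con (+ 1) :+ con (+ 12) :* E₃ :- con (+ 36) :* E₉)) := con (+ 4) :* (s :* (con (+ 1) :+ con (+ 3) :* E :- con (+ 27) :* E₉)) :- s :* (con (+ 1) :+ con (+ 12) :* E :- con (+ 36) :* E₃)) refl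
    r : ∀ u y M → int (+ 4) * (nForm u y * M) - aForm u y * aForm u y * M ≈ int (+ 3) * (u * u * M)
    r = solve 3 (λ u y M → con (+ 4) :* (nP u y :* M) :- aP u y :* aP u y :* M := con (+ 3) :* (u :* u :* M)) refl

  descent-difference : ∀ s t VM M → s * VM ≈ t * M → s * (VM - t) ≈ t * (M - s)
  descent-difference s t VM M e = trans (distribˡ s VM (- t)) (trans (+-congʳ e) (l s t M))
    where
    l : ∀ s t M → t * M + s * - t ≈ t * (M - s)
    l = solve 3 (λ s t M → t :* M :+ s :* (:- t) := t :* (M :- s)) refl

  -- Ramanujan's E₄ = E₂² - 12 D E₂ with E₂ = 1 - 24 E.
  Q-from-E : ∀ E DE S → int (+ 12) * (E * E) + int (+ 6) * DE ≈ int (+ 5) * S + E → 1# + int (+ 240) * S ≈ 1# - int (+ 48) * E + int (+ 576) * (E * E) + int (+ 288) * DE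
  Q-from-E E DE S e = trans (l E S) (trans (+-congˡ (*-congˡ (sym e))) (r E DE))
    where
    l : ∀ E S → 1# + int (+ 240) * S ≈ 1# - int (+ 48) * E + int (+ 48) * (int (+ 5) * S + E)
    l = solve 2 (λ E S → con (+ 1) :+ con (+ 240) :* S := con (+ 1) :- con (+ 48) :* E :+ con (+ 48) :* (con (+ 5) :* S :+ E)) refl
    r : ∀ E DE → 1# - int (+ 48) * E + int (+ 48) * (int (+ 12) * (E * E) + int (+ 6) * DE) ≈ 1# - int (+ 48) * E + int (+ 576) * (E * E) + int (+ 288) * DE
    r = solve 2 (λ E DE → con (+ 1) :- con (+ 48) :* E :+ con (+ 48) :* (con (+ 12) :* (E :* E) :+ con (+ 6) :* DE) := con (+ 1) :- con (+ 48) :* E :+ con (+ 576) :* (E :* E) :+ con (+ 288) :* DE) refl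

  -- The factor 9 is chosen so that E₂² - 9 E₂(q³)² contains the factor E₂ - 3 E₂(q³) = -2M, and the
  -- derivatives combine to 24 D M. What remains of E₂ then assembles to -8M².
  Q-difference : ∀ E E₃ DE VDE a z → MForm E E₃ ≈ a * a → int (+ 12) * DE - int (+ 36) * (int (+ 3) * VDE) ≈ int (+ 2) * (a * a * (int (+ 3) * (E₃ - E)) + int (+ 9) * (a * z)) →
    (1# - int (+ 48) * E + int (+ 576) * (E * E) + int (+ 288) * DE) - int (+ 9) * (1# - int (+ 48) * E₃ + int (+ 576) * (E₃ * E₃) + int (+ 288) * VDE) ≈ int (+ 432) * (a * z) - int (+ 8) * fourth a
  Q-difference E E₃ DE VDE a z p e = trans (l E E₃ DE VDE) (trans (+-congˡ (*-congˡ (trans e (*-congˡ (+-congʳ (*-congʳ (sym p))))))) (trans (r E E₃ (a * z)) (+-congˡ (-‿cong (*-congˡ (*-cong p p))))))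
    where
    l : ∀ E E₃ DE VDE → (1# - int (+ 48) * E + int (+ 576) * (E * E) + int (+ 288) * DE) - int (+ 9) * (1# - int (+ 48) * E₃ + int (+ 576) * (E₃ * E₃) + int (+ 288) * VDE) ≈
      (int (+ 576) * (E * E) - int (+ 48) * E + int (+ 432) * E₃ - int (+ 5184) * (E₃ * E₃) - int (+ 8)) + int (+ 24) * (int (+ 12) * DE - int (+ 36) * (int (+ 3) * VDE))
    l = solve 4 (λ E E₃ D V → (con (+ 1) :- con (+ 48) :* E :+ con (+ 576) :* (E :* E) :+ con (+ 288) :* D) :- con (+ 9) :* (con (+ 1) :- con (+ 48) :* E₃ :+ con (+ 576) :* (E₃ :* E₃) :+ con (+ 288) :* V) :=
      (con (+ 576) :* (E :* E) :- con (+ 48) :* E :+ con (+ 432) :* E₃ :- con (+ 5184) :* (E₃ :* E₃) :- con (+ 8)) :+ con (+ 24) :* (con (+ 12) :* D :- con (+ 36) :* (con (+ 3) :* V))) refl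
    r : ∀ E E₃ z → (int (+ 576) * (E * E) - int (+ 48) * E + int (+ 432) * E₃ - int (+ 5184) * (E₃ * E₃) - int (+ 8)) + int (+ 24) * (int (+ 2) * (MForm E E₃ * (int (+ 3) * (E₃ - E)) + int (+ 9) * z)) ≈
      int (+ 432) * z - int (+ 8) * (MForm E E₃ * MForm E E₃)
    r = solve 3 (λ E E₃ z → let M = con (+ 1) :+ con (+ 12) :* E :- con (+ 36) :* E₃ in
      (con (+ 576) :* (E :* E) :- con (+ 48) :* E :+ con (+ 432) :* E₃ :- con (+ 5184) :* (E₃ :* E₃) :- con (+ 8)) :+ con (+ 24) :* (con (+ 2) :* (M :* (con (+ 3) :* (E₃ :- E)) :+ con (+ 9) :* z)) := con (+ 432) :* z :- con (+ 8) :* (M :* M)) refl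

  D-a : ∀ E E₃ E₉ b y n → WForm E E₉ ≈ n → int (+ 3) * (E₃ - E) * b + int (+ 9) * ((1# - int (+ 27) * E₉ + int (+ 3) * E₃) * y) ≈ int (+ 3) * (E₃ - E) * (b + int (+ 9) * y) + int (+ 9) * (y * n)
  D-a E E₃ E₉ b y n p = trans (l E E₃ E₉ b y) (+-congˡ (*-congˡ (*-congˡ p)))
    where
    l : ∀ E E₃ E₉ b y → int (+ 3) * (E₃ - E) * b + int (+ 9) * ((1# - int (+ 27) * E₉ + int (+ 3) * E₃) * y) ≈ int (+ 3) * (E₃ - E) * (b + int (+ 9) * y) + int (+ 9) * (y * WForm E E₉)
    l = solve 5 (λ E E₃ E₉ b y → con (+ 3) :* (E₃ :- E) :* b :+ con (+ 9) :* ((con (+ 1) :- con (+ 27) :* E₉ :+ con (+ 3) :* E₃) :* y) := con (+ 3) :* (E₃ :- E) :* (b :+ con (+ 9) :* y) :+ con (+ 9) :* (y :* (con (+ 1) :+ con (+ 3) :* E :- con (+ 27) :* E₉))) refl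

  a-Da : ∀ a X z → (X * a + int (+ 9) * z) * a + a * (X * a + int (+ 9) * z) ≈ int (+ 2) * (a * a * X + int (+ 9) * (a * z))
  a-Da = solve 3 (λ a X z → (X :* a :+ con (+ 9) :* z) :* a :+ a :* (X :* a :+ con (+ 9) :* z) := con (+ 2) :* (a :* a :* X :+ con (+ 9) :* (a :* z))) refl

  -- As q c³ = 27 y n, this is a (a³ + 8 q c³), the expression of E₄ by cubic theta functions.
  -- `VGForm` is its image under q ↦ q³.
  GForm : Carrier → Carrier → Carrier
  GForm u y = fourth (aForm u y) + int (+ 216) * (aForm u y * (y * nForm u y))

  VGForm : Carrier → Carrier → Carrier
  VGForm u y = fourth u + int (+ 216) * (u * cubed y)

  G-difference : ∀ u y → GForm u y - int (+ 9) * VGForm u y ≈ int (+ 432) * (aForm u y * (y * nForm u y)) - int (+ 8) * fourth (aForm u y)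
  G-difference = solve 2 (λ u y → ^4 (aP u y) :+ con (+ 216) :* (aP u y :* (y :* nP u y)) :- con (+ 9) :* (^4 u :+ con (+ 216) :* (u :* (y :* y :* y))) := con (+ 432) :* (aP u y :* (y :* nP u y)) :- con (+ 8) :* ^4 (aP u y)) refl

  -- The effect of `V` is known on `a` and on `y n`, not on `u` itself. Rewriting E₄(q³) in these
  -- makes a second application possible, which gives E₄(q⁹).
  VG-in-a : ∀ u y → VGForm u y ≈ fourth (aForm u y) - int (+ 24) * (aForm u y * (y * nForm u y))
  VG-in-a = solve 2 (λ u y → ^4 u :+ con (+ 216) :* (u :* (y :* y :* y)) := ^4 (aP u y) :- con (+ 24) :* (aP u y :* (y :* nP u y))) refl

  R-difference : ∀ Q G VQ VG z → Q - int (+ 9) * VQ ≈ z → G - int (+ 9) * VG ≈ z → Q - G ≈ int (+ 9) * (VQ - VG)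
  R-difference Q G VQ VG z p r = trans (l Q G VQ VG) (trans (+-congʳ (+-cong p (-‿cong r))) (trans (+-congʳ (-‿inverseʳ z)) (+-identityˡ _)))
    where
    l : ∀ Q G VQ VG → Q - G ≈ (Q - int (+ 9) * VQ) - (G - int (+ 9) * VG) + int (+ 9) * (VQ - VG)
    l = solve 4 (λ Q G VQ VG → Q :- G := (Q :- con (+ 9) :* VQ) :- (G :- con (+ 9) :* VG) :+ con (+ 9) :* (VQ :- VG)) refl

  -- The terms of `GForm` sorted by the power of `y` modulo 3, hence by the residue of the exponent
  -- of q.
  G₀ G₁ G₂ : Carrier → Carrier → Carrier
  G₀ u y = fourth u + int (+ 6696) * (u * cubed y)
  G₁ u y = int (+ 240) * (u * u * u * y + int (+ 54) * (cubed y * y))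
  G₂ u y = int (+ 240) * (int (+ 9) * (u * u * (y * y)))

  G-components : ∀ u y → GForm u y ≈ G₀ u y + G₁ u y + G₂ u y
  G-components = solve 2 (λ u y → ^4 (aP u y) :+ con (+ 216) :* (aP u y :* (y :* nP u y)) :=
    ^4 u :+ con (+ 6696) :* (u :* (y :* y :* y)) :+ con (+ 240) :* (u :* u :* u :* y :+ con (+ 54) :* (y :* y :* y :* y)) :+ con (+ 240) :* (con (+ 9) :* (u :* u :* (y :* y)))) refl

  eisenstein-combination : ∀ u y → let b = bForm u y ; n = nForm u y ; a = aForm u y in
    int (+ 81) * GForm u y - int (+ 84) * VGForm u y + int (+ 243) * (fourth u - int (+ 24) * (u * cubed y)) - int (+ 3) * (G₁ u y - G₂ u y) ≈
    int (+ 240) * (cubed b * u + int (+ 81) * (a * (y * n)) + int (+ 6) * (b * (y * n)))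
  eisenstein-combination = solve 2 (λ u y → let b = bP u y ; n = nP u y ; a = aP u y in
    con (+ 81) :* (^4 (aP u y) :+ con (+ 216) :* (aP u y :* (y :* nP u y))) :- con (+ 84) :* (^4 u :+ con (+ 216) :* (u :* (y :* y :* y))) :+ con (+ 243) :* (^4 u :- con (+ 24) :* (u :* (y :* y :* y)))
      :- con (+ 3) :* (con (+ 240) :* (u :* u :* u :* y :+ con (+ 54) :* (y :* y :* y :* y)) :- con (+ 240) :* (con (+ 9) :* (u :* u :* (y :* y)))) :=
    con (+ 240) :* (b :* b :* b :* u :+ con (+ 81) :* (a :* (y :* n)) :+ con (+ 6) :* (b :* (y :* n)))) refl

  eta-combination : ∀ u y → let b = bForm u y ; n = nForm u y ; a = aForm u y in
    cubed b * u + int (+ 81) * (a * (y * n)) ≈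
    int (+ 324) * (b * (y * n)) + int (+ 19683) * fourth y - int (+ 240) * (cubed b * y) - int (+ 1458) * (b * b * (y * y)) + fourth b
  eta-combination = solve 2 (λ u y → let b = bP u y ; n = nP u y ; a = aP u y in
    b :* b :* b :* u :+ con (+ 81) :* (a :* (y :* n)) :=
    con (+ 324) :* (b :* (y :* n)) :+ con (+ 19683) :* ^4 y :- con (+ 240) :* (b :* b :* b :* y) :- con (+ 1458) :* (b :* b :* (y :* y)) :+ ^4 b) refl

-- Logarithmic derivatives and the evaluation of E₄

module WeightFour (K : CommutativeRing 0ℓ 0ℓ) (nat-regular : ∀ n → Series.Regular K (Integers.nat K (suc n)))
    (κ b : Series.Ser K)
    (κ-product : CommutativeRing._≈_ (Series.seriesRing K) (CommutativeRing._*_ (Series.seriesRing K) (Bivariate.euler K) κ)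
                   (CubicForms.cubed (Series.seriesRing K) (Series.V K (Bivariate.euler K))))
    (b-product : CommutativeRing._≈_ (Series.seriesRing K) (CommutativeRing._*_ (Series.seriesRing K) (Series.V K (Bivariate.euler K)) b)
                   (CubicForms.cubed (Series.seriesRing K) (Bivariate.euler K))) where
  open CommutativeRing K hiding (zero)
  open LevelNine K nat-regular κ b κ-product b-product public
  module CV = Convolution K
  module PW = WeightFourForms P.seriesRing
  open SetoidReasoning PR.setoid

  E E₃ E₉ : P.Ser
  E = CV.E
  E₃ = P.V E
  E₉ = P.V E₃

  V-nat* : ∀ m f → P.V (PI.nat m PR.* f) PR.≈ PI.nat m PR.* P.V f
  V-nat* m f = PR.trans (P.V-mul (PI.nat m) f) (PR.*-congʳ (V-nat m))

  D-V : ∀ f → P.D (P.V f) PR.≈ PI.nat 3 PR.* P.V (P.D f)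
  D-V f = PR.trans (P.D-V f) (PR.trans (P.V-cong (λ m → sym (CV.nat-coefficient 3 (P.D f) m))) (V-nat* 3 (P.D f)))

  D-cube : ∀ f → P.D (cube f) PR.≈ P.D f PR.* f PR.* f PR.+ f PR.* P.D f PR.* f PR.+ f PR.* f PR.* P.D f
  D-cube f = PR.trans (P.D-mul (f PR.* f) f) (PR.+-congʳ (PR.trans (PR.*-congʳ (P.D-mul f f)) (PR.distribʳ _ _ _)))

  D-euler₃ : P.D euler₃ PR.≈ PR.- (PI.int (+ 3) PR.* (E₃ PR.* euler₃))
  D-euler₃ = PR.trans (D-V euler) (PR.trans (PR.*-congˡ (PR.trans (P.V-cong CV.D-euler) (PR.trans (P.V-neg (E PR.* euler)) (PR.-‿cong (P.V-mul E euler))))) (PR.sym (Algebra.Properties.Ring.-‿distribʳ-* PR.ring _ _)))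

  D-euler₉ : P.D euler₉ PR.≈ PR.- (PI.int (+ 9) PR.* (E₉ PR.* euler₉))
  D-euler₉ = PR.trans (D-V euler₃) (PR.trans (PR.*-congˡ (PR.trans (P.V-cong D-euler₃) (PR.trans (P.V-neg (PI.nat 3 PR.* (E₃ PR.* euler₃))) (PR.-‿cong (PR.trans (V-nat* 3 (E₃ PR.* euler₃)) (PR.*-congˡ (P.V-mul E₃ euler₃)))))))
    (PI.solve 1 (λ z → PI.con (+ 3) PI.:* PI.:- (PI.con (+ 3) PI.:* z) PI.:= PI.:- (PI.con (+ 9) PI.:* z)) PR.refl (E₉ PR.* euler₉)))

  X Y : P.Ser
  X = PI.int (+ 3) PR.* (E₃ PR.- E)
  Y = PR.1# PR.- PI.int (+ 27) PR.* E₉ PR.+ PI.int (+ 3) PR.* E₃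

  D-b : P.D b PR.≈ X PR.* b
  D-b = cancel-unit euler₃ euler-0 (PW.log-b E E₃ euler euler₃ b (P.D b) (P.D euler) (P.D euler₃) b-product CV.D-euler D-euler₃
    (PR.trans (PR.sym (P.D-mul euler₃ b)) (PR.trans (P.D-cong b-product) (D-cube euler))))

  D-y : P.D y′ PR.≈ Y PR.* y′
  D-y = cancel-unit euler₃ euler-0 (PW.log-y E₃ E₉ euler₃ euler₉ (P.q^ 1) y′ (P.D y′) (P.D euler₃) (P.D euler₉) (y-product κ-product b-product) D-euler₃ D-euler₉
    (PR.trans (PR.sym (P.D-mul euler₃ y′)) (PR.trans (P.D-cong (y-product κ-product b-product)) (PR.trans (P.D-mul (P.q^ 1) (cube euler₉)) (PR.+-cong (PR.*-congʳ (PR.trans (CV.D-q^ 1) (PR.*-identityˡ _))) (PR.*-congˡ (D-cube euler₉)))))))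

  D-Vb : P.D (P.V b) PR.≈ PI.int (+ 9) PR.* (E₉ PR.- E₃) PR.* P.V b
  D-Vb = cancel-unit euler₉ euler-0 (PW.log-B E₃ E₉ euler₃ euler₉ (P.V b) (P.D (P.V b)) (P.D euler₃) (P.D euler₉) V-b-product D-euler₃ D-euler₉
    (PR.trans (PR.sym (P.D-mul euler₉ (P.V b))) (PR.trans (P.D-cong V-b-product) (D-cube euler₃))))

  D-n : P.D n PR.≈ (PI.int (+ 27) PR.* (E₉ PR.- E₃) PR.- X) PR.* n
  D-n = cancel-unit b b-0 (PW.log-n E E₃ E₉ b n (P.V b) (P.D b) (P.D n) (P.D (P.V b)) b-n-product D-b D-Vb
    (PR.trans (PR.sym (P.D-mul b n)) (PR.trans (P.D-cong b-n-product) (D-cube (P.V b)))))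

  n-b : n PR.≈ b PR.* b PR.+ PI.int (+ 9) PR.* (b PR.* y′) PR.+ PI.int (+ 27) PR.* (y′ PR.* y′)
  n-b = PW.n-in-b b y′

  aF-b : aF PR.≈ b PR.+ PI.int (+ 9) PR.* y′
  aF-b = PR.sym (PL.a-from-b b y′)

  D-nat* : ∀ m f → P.D (PI.nat m PR.* f) PR.≈ PI.nat m PR.* P.D f
  D-nat* = CV.D-nat*

  M W : P.Ser
  M = PW.MForm E E₃
  W = PW.WForm E E₉

  n-M : n PR.* M PR.≈ aF PR.* aF PR.* W
  n-M = PR.trans (PR.*-congʳ n-b) (PR.trans (PW.n-M E E₃ E₉ b y′ differentiated) (PR.*-congʳ (PR.*-cong (PR.sym aF-b) (PR.sym aF-b))))
    where
    differentiated : X PR.* b PR.* b PR.+ b PR.* (X PR.* b) PR.+ PI.int (+ 9) PR.* (X PR.* b PR.* y′ PR.+ b PR.* (Y PR.* y′)) PR.+ PI.int (+ 27) PR.* (Y PR.* y′ PR.* y′ PR.+ y′ PR.* (Y PR.* y′)) PR.≈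
      (PI.int (+ 27) PR.* (E₉ PR.- E₃) PR.- X) PR.* (b PR.* b PR.+ PI.int (+ 9) PR.* (b PR.* y′) PR.+ PI.int (+ 27) PR.* (y′ PR.* y′))
    differentiated = begin
      X PR.* b PR.* b PR.+ b PR.* (X PR.* b) PR.+ PI.int (+ 9) PR.* (X PR.* b PR.* y′ PR.+ b PR.* (Y PR.* y′)) PR.+ PI.int (+ 27) PR.* (Y PR.* y′ PR.* y′ PR.+ y′ PR.* (Y PR.* y′))
        ≈⟨ PR.+-cong (PR.+-cong (PR.+-cong (PR.*-congʳ D-b) (PR.*-congˡ D-b)) (PR.*-congˡ (PR.+-cong (PR.*-congʳ D-b) (PR.*-congˡ D-y)))) (PR.*-congˡ (PR.+-cong (PR.*-congʳ D-y) (PR.*-congˡ D-y))) ⟨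
      P.D b PR.* b PR.+ b PR.* P.D b PR.+ PI.int (+ 9) PR.* (P.D b PR.* y′ PR.+ b PR.* P.D y′) PR.+ PI.int (+ 27) PR.* (P.D y′ PR.* y′ PR.+ y′ PR.* P.D y′)
        ≈⟨ PR.+-cong (PR.+-cong (P.D-mul b b) (PR.trans (D-nat* 9 (b PR.* y′)) (PR.*-congˡ (P.D-mul b y′)))) (PR.trans (D-nat* 27 (y′ PR.* y′)) (PR.*-congˡ (P.D-mul y′ y′))) ⟨
      P.D (b PR.* b) PR.+ P.D (PI.int (+ 9) PR.* (b PR.* y′)) PR.+ P.D (PI.int (+ 27) PR.* (y′ PR.* y′))
        ≈⟨ PR.trans (P.D-+ (b PR.* b PR.+ PI.int (+ 9) PR.* (b PR.* y′)) (PI.int (+ 27) PR.* (y′ PR.* y′))) (PR.+-congʳ (P.D-+ (b PR.* b) (PI.int (+ 9) PR.* (b PR.* y′)))) ⟨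
      P.D (b PR.* b PR.+ PI.int (+ 9) PR.* (b PR.* y′) PR.+ PI.int (+ 27) PR.* (y′ PR.* y′))
        ≈⟨ PR.trans (P.D-cong (PR.sym n-b)) (PR.trans D-n (PR.*-congˡ n-b)) ⟩
      (PI.int (+ 27) PR.* (E₉ PR.- E₃) PR.- X) PR.* (b PR.* b PR.+ PI.int (+ 9) PR.* (b PR.* y′) PR.+ PI.int (+ 27) PR.* (y′ PR.* y′)) ∎

  nat-cancel : ∀ m {f g} → PI.nat (suc m) PR.* f PR.≈ PI.nat (suc m) PR.* g → f PR.≈ g
  nat-cancel m {f} {g} e = P.mul-cancel (PI.nat (suc m)) f g (Regular-≈ (nat-0 (suc m)) (nat-regular m)) e
    where
    nat-0 : ∀ m → PI.nat m 0 ≈ KI.nat m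
    nat-0 zero = refl
    nat-0 (suc zero) = refl
    nat-0 (suc (suc m)) = +-congˡ (nat-0 (suc m))

  V-M : P.V M PR.≈ PW.MForm E₃ E₉
  V-M = PR.trans (P.V-+ (PR.1# PR.+ PI.int (+ 12) PR.* E) (PR.- (PI.int (+ 36) PR.* E₃))) (PR.+-cong
    (PR.trans (P.V-+ PR.1# (PI.int (+ 12) PR.* E)) (PR.+-cong P.V-1 (V-nat* 12 E))) (PR.trans (P.V-neg (PI.int (+ 36) PR.* E₃)) (PR.-‿cong (V-nat* 36 E₃))))

  V-square : ∀ f g → P.V f PR.≈ g → P.V (f PR.* f) PR.≈ g PR.* g
  V-square f g p = PR.trans (P.V-mul f f) (PR.*-cong p p)

  -- V raises the order of vanishing, so an equation  s d = t V d  with s a unit forces d = 0.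
  V-order : ∀ N f → f P.≋[ suc N ] PR.0# → P.V f P.≋[ suc (suc N) ] PR.0#
  V-order N f z m l with P.mod3 m
  ... | P.rem0 zero = z 0 (s≤s z≤n)
  ... | P.rem0 (suc k) = trans (reflexive (P.V-at f (suc k))) (z (suc k) (ℕP.≤-trans (s≤s (s≤s (ℕP.m≤m+n k (suc k ℕ.+ 0)))) (ℕP.≤-pred (ℕP.≤-trans (ℕP.+-monoʳ-≤ 1 (smaller k)) l))))
    where
    smaller : ∀ k → suc (suc (k ℕ.+ (suc k ℕ.+ 0))) ℕ.≤ 3 ℕ.* suc k
    smaller k = ≡.subst (suc (suc (k ℕ.+ (suc k ℕ.+ 0))) ℕ.≤_) (l₀ k) (ℕP.m≤m+n _ k)
      where
      l₀ : ∀ k → suc (suc (k ℕ.+ (suc k ℕ.+ 0))) ℕ.+ k ≡ 3 ℕ.* suc k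
      l₀ = ℕ-solve-∀
  ... | P.rem1 k = reflexive (P.V-at1 f k)
  ... | P.rem2 k = reflexive (P.V-at2 f k)

  V-descent : ∀ s t d → s 0 ≈ 1# → d 0 ≈ 0# → s PR.* d PR.≈ t PR.* P.V d → d PR.≈ PR.0#
  V-descent s t d s₀ d₀ e m = go m m ℕP.≤-refl
    where
    go : ∀ N → d P.≋[ suc N ] PR.0#
    go zero zero l = d₀
    go zero (suc m) (s≤s ())
    go (suc N) = P.mul-regular[] s d (P.unit-regular s₀) (suc (suc N))
      (λ m l → trans (e m) (CV.*-low {suc (suc N)} t (P.V d) (V-order N d (go N)) m l))

  M-0 : M 0 ≈ 1#
  M-0 = trans (+-cong (trans (+-congˡ (zeroʳ _)) (+-identityʳ _)) (trans (-‿cong (zeroʳ _)) (Algebra.Properties.Ring.-0#≈0# ring))) (+-identityʳ _)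

  square-0 : ∀ f → f 0 ≈ 1# → (f PR.* f) 0 ≈ 1#
  square-0 f p = trans (times-1 p) p

  minus-0 : ∀ {x z} → x ≈ 1# → z ≈ 1# → x + - z ≈ 0#
  minus-0 p r = trans (+-cong p (-‿cong r)) (-‿inverseʳ 1#)

  -- By `M-descent` the quotient M/a² is unchanged by q ↦ q³, so it is constant; without division
  -- this is `V-descent` for the difference.
  M-value : M PR.≈ aF PR.* aF
  M-value = difference-zero (V-descent (u PR.* u) (aF PR.* aF) (M PR.- aF PR.* aF) (square-0 u u-0) (minus-0 M-0 (square-0 aF aF-0))
    (PR.sym (PR.trans (PR.*-congˡ (PR.trans (P.V-+ M (PR.- (aF PR.* aF))) (PR.+-cong V-M (PR.trans (P.V-neg (aF PR.* aF)) (PR.-‿cong (V-square aF u V-aF))))))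
      (PW.descent-difference (aF PR.* aF) (u PR.* u) (PW.MForm E₃ E₉) M (nat-cancel 2 (PW.M-descent E E₃ E₉ u y′ n-M))))))

  W-value : W PR.≈ n
  W-value = cancel-unit (aF PR.* aF) (square-0 aF aF-0) (PR.trans (PR.sym n-M) (PR.trans (PR.*-congˡ M-value) (PR.*-comm _ _)))

  Q : P.Ser
  Q = PR.1# PR.+ PI.int (+ 240) PR.* CV.S₃

  Q-E : Q PR.≈ PR.1# PR.- PI.int (+ 48) PR.* E PR.+ PI.int (+ 576) PR.* (E PR.* E) PR.+ PI.int (+ 288) PR.* P.D E
  Q-E = PW.Q-from-E E (P.D E) CV.S₃ CV.σ-convolution

  V-Q : P.V Q PR.≈ PR.1# PR.- PI.int (+ 48) PR.* E₃ PR.+ PI.int (+ 576) PR.* (E₃ PR.* E₃) PR.+ PI.int (+ 288) PR.* P.V (P.D E)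
  V-Q = PR.trans (P.V-cong Q-E) (PR.trans (P.V-+ _ (PI.int (+ 288) PR.* P.D E)) (PR.+-cong
    (PR.trans (P.V-+ _ (PI.int (+ 576) PR.* (E PR.* E))) (PR.+-cong
      (PR.trans (P.V-+ PR.1# (PR.- (PI.int (+ 48) PR.* E))) (PR.+-cong P.V-1 (PR.trans (P.V-neg (PI.int (+ 48) PR.* E)) (PR.-‿cong (V-nat* 48 E)))))
      (PR.trans (V-nat* 576 (E PR.* E)) (PR.*-congˡ (P.V-mul E E)))))
    (V-nat* 288 (P.D E))))

  D-aF : P.D aF PR.≈ X PR.* aF PR.+ PI.int (+ 9) PR.* (y′ PR.* n)
  D-aF = PR.trans (P.D-cong aF-b) (PR.trans (P.D-+ b (PI.int (+ 9) PR.* y′)) (PR.trans (PR.+-cong D-b (PR.trans (D-nat* 9 y′) (PR.*-congˡ D-y)))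
    (PR.trans (PW.D-a E E₃ E₉ b y′ n W-value) (PR.+-congʳ (PR.*-congˡ (PR.sym aF-b))))))

  D-M : PI.int (+ 12) PR.* P.D E PR.- PI.int (+ 36) PR.* (PI.int (+ 3) PR.* P.V (P.D E)) PR.≈ PI.int (+ 2) PR.* (aF PR.* aF PR.* X PR.+ PI.int (+ 9) PR.* (aF PR.* (y′ PR.* n)))
  D-M = begin
    PI.int (+ 12) PR.* P.D E PR.- PI.int (+ 36) PR.* (PI.int (+ 3) PR.* P.V (P.D E))
      ≈⟨ PR.+-cong (PR.trans (PR.+-cong CV.D-1 (D-nat* 12 E)) (PR.+-identityˡ _)) (PR.-‿cong (PR.trans (D-nat* 36 E₃) (PR.*-congˡ (D-V E)))) ⟨
    P.D PR.1# PR.+ P.D (PI.int (+ 12) PR.* E) PR.- P.D (PI.int (+ 36) PR.* E₃)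
      ≈⟨ PR.trans (P.D-+ (PR.1# PR.+ PI.int (+ 12) PR.* E) (PR.- (PI.int (+ 36) PR.* E₃))) (PR.+-cong (P.D-+ PR.1# (PI.int (+ 12) PR.* E)) (P.D-neg (PI.int (+ 36) PR.* E₃))) ⟨
    P.D M                                                    ≈⟨ PR.trans (P.D-cong M-value) (P.D-mul aF aF) ⟩
    P.D aF PR.* aF PR.+ aF PR.* P.D aF                        ≈⟨ PR.+-cong (PR.*-congʳ D-aF) (PR.*-congˡ D-aF) ⟩
    (X PR.* aF PR.+ PI.int (+ 9) PR.* (y′ PR.* n)) PR.* aF PR.+ aF PR.* (X PR.* aF PR.+ PI.int (+ 9) PR.* (y′ PR.* n))   ≈⟨ PW.a-Da aF X (y′ PR.* n) ⟩
    PI.int (+ 2) PR.* (aF PR.* aF PR.* X PR.+ PI.int (+ 9) PR.* (aF PR.* (y′ PR.* n))) ∎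

  Gₛ VGₛ : P.Ser
  Gₛ = PW.GForm u y′
  VGₛ = PW.VGForm u y′

  V-fourth : ∀ f g → P.V f PR.≈ g → P.V (PW.fourth f) PR.≈ PW.fourth g
  V-fourth f g p = V-square (f PR.* f) (g PR.* g) (V-square f g p)

  V-yn : P.V (y′ PR.* n) PR.≈ cube y′
  V-yn = PR.trans (P.V-cong (PR.sym κ-cubed)) (PR.sym y-cubed)

  V-ayn : P.V (aF PR.* (y′ PR.* n)) PR.≈ u PR.* cube y′
  V-ayn = PR.trans (P.V-mul aF (y′ PR.* n)) (PR.*-cong V-aF V-yn)

  V-G : P.V Gₛ PR.≈ VGₛ
  V-G = PR.trans (P.V-+ (PW.fourth aF) (PI.int (+ 216) PR.* (aF PR.* (y′ PR.* n)))) (PR.+-cong (V-fourth aF u V-aF) (PR.trans (V-nat* 216 (aF PR.* (y′ PR.* n))) (PR.*-congˡ V-ayn)))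

  -- Both series have the same value of f - 9 f(q³), so their difference is 9 times its own image
  -- under `V`; it vanishes because the constant terms are both 1.
  Q-G : Q PR.≈ Gₛ
  Q-G = difference-zero (V-descent PR.1# (PI.int (+ 9)) (Q PR.- Gₛ) refl
    (minus-0 (trans (+-congˡ (zeroʳ _)) (+-identityʳ _)) (trans (+-cong (square-0 (aF PR.* aF) (square-0 aF aF-0)) (trans (*-congˡ (trans (*-congˡ (trans (*-congʳ y-0) (zeroˡ _))) (zeroʳ _))) (zeroʳ _))) (+-identityʳ _)))
    (PR.trans (PR.*-identityˡ _) (PR.trans
      (PW.R-difference Q Gₛ (P.V Q) VGₛ _ (PR.trans (PR.+-cong Q-E (PR.-‿cong (PR.*-congˡ V-Q))) (PW.Q-difference E E₃ (P.D E) (P.V (P.D E)) aF (y′ PR.* n) M-value D-M)) (PW.G-difference u y′))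
      (PR.*-congˡ (PR.sym (PR.trans (P.V-+ Q (PR.- Gₛ)) (PR.+-congˡ (PR.trans (P.V-neg Gₛ) (PR.-‿cong V-G)))))))))

  V-Q-value : P.V Q PR.≈ VGₛ
  V-Q-value = PR.trans (P.V-cong Q-G) V-G

  VV-Q-value : P.V (P.V Q) PR.≈ PW.fourth u PR.- PI.int (+ 24) PR.* (u PR.* cube y′)
  VV-Q-value = PR.trans (P.V-cong (PR.trans V-Q-value (PW.VG-in-a u y′))) (PR.trans (P.V-+ (PW.fourth aF) (PR.- (PI.int (+ 24) PR.* (aF PR.* (y′ PR.* n)))))
    (PR.+-cong (V-fourth aF u V-aF) (PR.trans (P.V-neg (PI.int (+ 24) PR.* (aF PR.* (y′ PR.* n)))) (PR.-‿cong (PR.trans (V-nat* 24 (aF PR.* (y′ PR.* n))) (PR.*-congˡ V-ayn))))))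

  character : ℤ₃ → Carrier → Carrier
  character 0₃ x = 0#
  character 1₃ x = x
  character 2₃ x = - x

  twist : P.Ser → P.Ser
  twist f m = character (res m) (f m)

  character-cong : ∀ r {x z} → x ≈ z → character r x ≈ character r z
  character-cong 0₃ p = refl
  character-cong 1₃ p = p
  character-cong 2₃ p = -‿cong p

  twist-Q : twist Q PR.≈ PI.int (+ 240) PR.* twist CV.S₃
  twist-Q m = trans (by m) (sym (CV.nat-coefficient 240 (twist CV.S₃) m))
    where
    scale : ∀ r c x → character r (c * x) ≈ c * character r x
    scale 0₃ c x = sym (zeroʳ c)
    scale 1₃ c x = refl
    scale 2₃ c x = Algebra.Properties.Ring.-‿distribʳ-* ring c x
    by : ∀ m → twist Q m ≈ KI.nat 240 * twist CV.S₃ m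
    by zero = sym (zeroʳ _)
    by (suc m) = trans (character-cong (res (suc m)) (trans (+-identityˡ _) (CV.nat-coefficient 240 CV.S₃ (suc m)))) (scale (res (suc m)) (KI.nat 240) (CV.S₃ (suc m)))

  private
    Pgraded-cube : ∀ {r f} → PGraded r f → PGraded (r +₃ r +₃ r) (cube f)
    Pgraded-cube {r} {f} p = Pgraded-* {r +₃ r} {r} {f PR.* f} {f} (Pgraded-* {r} {r} {f} {f} p p) p

    G-graded : PHomogeneous (three (PW.G₀ u y′) (PW.G₁ u y′) (PW.G₂ u y′))
    G-graded = three-homogeneous
      (Pgraded-+ {f = PW.fourth u} {PI.int (+ 6696) PR.* (u PR.* cube y′)} (Pgraded-* {0₃} {0₃} {u PR.* u} {u PR.* u} gu² gu²) (Pgraded-* {0₃} {0₃} {PI.int (+ 6696)} {u PR.* cube y′} (Pgraded-nat 6696) (Pgraded-* {0₃} {0₃} {u} {cube y′} u-graded gy³)))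
      (Pgraded-* {0₃} {1₃} {PI.int (+ 240)} {u PR.* u PR.* u PR.* y′ PR.+ PI.int (+ 54) PR.* (cube y′ PR.* y′)} (Pgraded-nat 240) (Pgraded-+ {f = u PR.* u PR.* u PR.* y′} {PI.int (+ 54) PR.* (cube y′ PR.* y′)}
        (Pgraded-* {0₃} {1₃} {u PR.* u PR.* u} {y′} (Pgraded-cube {0₃} {u} u-graded) y-graded) (Pgraded-* {0₃} {1₃} {PI.int (+ 54)} {cube y′ PR.* y′} (Pgraded-nat 54) (Pgraded-* {0₃} {1₃} {cube y′} {y′} gy³ y-graded))))
      (Pgraded-* {0₃} {2₃} {PI.int (+ 240)} {PI.int (+ 9) PR.* (u PR.* u PR.* (y′ PR.* y′))} (Pgraded-nat 240) (Pgraded-* {0₃} {2₃} {PI.int (+ 9)} {u PR.* u PR.* (y′ PR.* y′)} (Pgraded-nat 9) (Pgraded-* {0₃} {2₃} {u PR.* u} {y′ PR.* y′} gu² (Pgraded-* {1₃} {1₃} {y′} {y′} y-graded y-graded))))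
      where
      gu² : PGraded 0₃ (u PR.* u)
      gu² = Pgraded-* {0₃} {0₃} {u} {u} u-graded u-graded
      gy³ : PGraded 0₃ (cube y′)
      gy³ = Pgraded-cube {1₃} {y′} y-graded

  twist-total : ∀ f → PHomogeneous f → twist (P-total f) PR.≈ f 1₃ PR.- f 2₃
  twist-total f h m = trans (character-cong (res m) (P-total-at f h m)) (by (res m) ≡.refl)
    where
    off : ∀ r s → res m ≡ s → r ≢ s → f r m ≈ 0#
    off r s e ne = h r m (λ e′ → ne (≡.trans (≡.sym e′) e))
    minus-zero : ∀ {x z} → z ≈ 0# → x + - z ≈ x
    minus-zero p = trans (+-congˡ (trans (-‿cong p) (Algebra.Properties.Ring.-0#≈0# ring))) (+-identityʳ _)
    by : ∀ r → res m ≡ r → character r (f r m) ≈ f 1₃ m + - f 2₃ m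
    by 0₃ e = sym (trans (minus-zero (off 2₃ 0₃ e (λ ()))) (off 1₃ 0₃ e (λ ())))
    by 1₃ e = sym (minus-zero (off 2₃ 1₃ e (λ ())))
    by 2₃ e = sym (trans (+-congʳ (off 1₃ 2₃ e (λ ()))) (+-identityˡ _))

  twist-S₃ : PI.int (+ 240) PR.* twist CV.S₃ PR.≈ PW.G₁ u y′ PR.- PW.G₂ u y′
  twist-S₃ = PR.trans (PR.sym twist-Q) (PR.trans (λ m → character-cong (res m) (PR.trans Q-G (PW.G-components u y′) m)) (twist-total (three (PW.G₀ u y′) (PW.G₁ u y′) (PW.G₂ u y′)) G-graded))

  eisenstein-value : PI.int (+ 81) PR.* Q PR.- PI.int (+ 84) PR.* P.V Q PR.+ PI.int (+ 243) PR.* P.V (P.V Q) PR.- PI.int (+ 3) PR.* (PI.int (+ 240) PR.* twist CV.S₃) PR.≈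
    PI.int (+ 240) PR.* (cube (cube euler) PR.* CΦ PR.+ PI.int (+ 6) PR.* (b PR.* (y′ PR.* n)))
  eisenstein-value = PR.trans (PR.+-cong (PR.+-cong (PR.+-cong (PR.*-congˡ Q-G) (PR.-‿cong (PR.*-congˡ V-Q-value))) (PR.*-congˡ VV-Q-value)) (PR.-‿cong (PR.*-congˡ twist-S₃)))
    (PR.trans (PW.eisenstein-combination u y′) (PR.*-congˡ (PR.+-cong (PR.trans (PR.+-congʳ (PR.*-congʳ (PC.cubed-cong (PR.sym b-form)))) (PR.sym CΦ-value)) (PR.*-congˡ (PR.*-congʳ (PR.sym b-form))))))

  eta-value : cube (cube euler) PR.* CΦ PR.≈
    PI.int (+ 324) PR.* (b PR.* (y′ PR.* n)) PR.+ PI.int (+ 19683) PR.* PW.fourth y′ PR.- PI.int (+ 240) PR.* (cube b PR.* y′) PR.- PI.int (+ 1458) PR.* (b PR.* b PR.* (y′ PR.* y′)) PR.+ PW.fourth b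
  eta-value = PR.trans CΦ-value (PR.trans (PR.+-congʳ (PR.*-congʳ (PC.cubed-cong b-form))) (PR.trans (PW.eta-combination u y′)
    (PR.+-cong (PR.+-cong (PR.+-cong (PR.+-congʳ (PR.*-congˡ (PR.*-congʳ (PR.sym b-form)))) (PR.-‿cong (PR.*-congˡ (PR.*-congʳ (PC.cubed-cong (PR.sym b-form))))))
      (PR.-‿cong (PR.*-congˡ (PR.*-congʳ (PR.*-cong (PR.sym b-form) (PR.sym b-form)))))) (PR.*-cong (PR.*-cong (PR.sym b-form) (PR.sym b-form)) (PR.*-cong (PR.sym b-form) (PR.sym b-form))))))

-- Rational coefficients

open Defs

ℚring : CommutativeRing 0ℓ 0ℓ
ℚring = ℚP.+-*-commutativeRing

module Qℚ = Series ℚring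
module ℚI = Integers ℚring

fromℚᵘ-+ : ∀ p q → ℚ.fromℚᵘ (p ℚᵘ.+ q) ≡ ℚ.fromℚᵘ p ℚ.+ ℚ.fromℚᵘ q
fromℚᵘ-+ p q = ℚP.toℚᵘ-injective (ℚᵘP.≃-trans (ℚP.toℚᵘ-fromℚᵘ (p ℚᵘ.+ q)) (ℚᵘP.≃-sym (ℚᵘP.≃-trans (ℚP.toℚᵘ-homo-+ (ℚ.fromℚᵘ p) (ℚ.fromℚᵘ q))
  (ℚᵘP.+-cong (ℚP.toℚᵘ-fromℚᵘ p) (ℚP.toℚᵘ-fromℚᵘ q)))))

ℕ→ℚ-nat : ∀ n → ℕ→ℚ n ≡ ℚI.nat n
ℕ→ℚ-nat zero = ≡.refl
ℕ→ℚ-nat (suc zero) = ≡.refl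
ℕ→ℚ-nat (suc (suc n)) = ≡.trans (≡.trans (ℚP.fromℚᵘ-cong {mkℚᵘ (+ suc (suc n)) 0} {mkℚᵘ (+ 1) 0 ℚᵘ.+ mkℚᵘ (+ suc n) 0} (*≡* (lin (+ suc n)))) (fromℚᵘ-+ (mkℚᵘ (+ 1) 0) (mkℚᵘ (+ suc n) 0)))
  (≡.cong (1ℚ ℚ.+_) (ℕ→ℚ-nat (suc n)))
  where
  lin : ∀ n → (+ 1 ℤ.+ n) ℤ.* + 1 ≡ (+ 1 ℤ.* + 1 ℤ.+ n ℤ.* + 1) ℤ.* + 1
  lin = ℤ-solve-∀

nat-regular : ∀ n → Qℚ.Regular (ℚI.nat (suc n))
nat-regular n x e = ≡.trans (≡.sym (ℚP.*-identityˡ x)) (≡.trans (≡.cong (ℚ._* x) (≡.sym (ℚP.*-inverseˡ r))) (≡.trans (ℚP.*-assoc (ℚ.1/ r) r x) (≡.trans (≡.cong (ℚ.1/ r ℚ.*_) (≡.trans (≡.cong (ℚ._* x) (ℕ→ℚ-nat (suc n))) e)) (ℚP.*-zeroʳ (ℚ.1/ r)))))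
  where
  r : ℚ
  r = ℕ→ℚ (suc n)
  instance
    r≢0 : ℚ.NonZero r
    r≢0 = ℚP.pos⇒nonZero r {{ℚP.normalize-pos (suc n) 1}}

∑< : ℕ → (ℕ → ℚ) → ℚ
∑< zero g = 0ℚ
∑< (suc n) g = g 0 ℚ.+ ∑< n (λ i → g (suc i))

sumℚ-applyUpTo : ∀ n (g : ℕ → ℚ) (f : ℕ → ℕ) → sumℚ (map g (applyUpTo f n)) ≡ ∑< n (λ i → g (f i))
sumℚ-applyUpTo zero g f = ≡.refl
sumℚ-applyUpTo (suc n) g f = ≡.cong (g (f 0) ℚ.+_) (sumℚ-applyUpTo n g (λ i → f (suc i)))

∑<-cong : ∀ n {f g : ℕ → ℚ} → (∀ i → f i ≡ g i) → ∑< n f ≡ ∑< n g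
∑<-cong zero p = ≡.refl
∑<-cong (suc n) p = ≡.cong₂ ℚ._+_ (p 0) (∑<-cong n (λ i → p (suc i)))

∑<-zero : ∀ n f → (∀ i → f i ≡ 0ℚ) → ∑< n f ≡ 0ℚ
∑<-zero zero f z = ≡.refl
∑<-zero (suc n) f z = ≡.cong₂ ℚ._+_ (z 0) (∑<-zero n (λ i → f (suc i)) (λ i → z (suc i)))

∑<-extend : ∀ n d f → (∀ i → n ℕ.≤ i → f i ≡ 0ℚ) → ∑< (n ℕ.+ d) f ≡ ∑< n f
∑<-extend zero d f z = ∑<-zero d f (λ i → z i z≤n)
∑<-extend (suc n) d f z = ≡.cong (f 0 ℚ.+_) (∑<-extend n d (λ i → f (suc i)) (λ i le → z (suc i) (s≤s le)))

⊛-mul : ∀ f g → f ⊛ g Qℚ.≋ Qℚ.mul f g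
⊛-mul f g n = ≡.trans (sumℚ-applyUpTo (suc n) (λ i → f i ℚ.* g (n ℕ.∸ i)) (λ i → i)) (go f n)
  where
  go : ∀ f n → ∑< (suc n) (λ i → f i ℚ.* g (n ℕ.∸ i)) ≡ Qℚ.mul f g n
  go f zero = ℚP.+-identityʳ _
  go f (suc n) = ≡.cong (f 0 ℚ.* g (suc n) ℚ.+_) (go (λ i → f (suc i)) n)

⊛-cong : ∀ {f f′ g g′} → f Qℚ.≋ f′ → g Qℚ.≋ g′ → f ⊛ g Qℚ.≋ Qℚ.mul f′ g′
⊛-cong {f} {f′} {g} {g′} p q n = ≡.trans (⊛-mul f g n) (Qℚ.mul-cong {f} {f′} {g} {g′} p q n)

one-1 : one Qℚ.≋ Qℚ.1ₛ
one-1 zero = ≡.refl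
one-1 (suc n) = ≡.refl

qPow-q^ : ∀ m → qPow m Qℚ.≋ Qℚ.q^ m
qPow-q^ m n with m ℕP.≟ n
... | yes ≡.refl = ≡.trans (≡.cong (λ b → if b then 1ℚ else 0ℚ) (dec-true (m ℕP.≟ m) ≡.refl)) (≡.sym (Qℚ.mon-diag 1ℚ m))
... | no ne = ≡.trans (≡.cong (λ b → if b then 1ℚ else 0ℚ) (dec-false (m ℕP.≟ n) ne)) (≡.sym (Qℚ.mon-off 1ℚ m n ne))

-- `invRev` stores coefficients in decreasing order, so zipping it with increasing indices is a
-- convolution. The padding `0ℚ` suppresses the term of index 0, which the new coefficient supplies.
inv-mul : ∀ f → f 0 ≡ 1ℚ → Qℚ.mul f (inv f) Qℚ.≋ Qℚ.1ₛ
inv-mul f f₀ zero = ≡.trans (ℚP.*-identityʳ (f 0)) f₀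
inv-mul f f₀ (suc m) = ≡.trans (≡.cong (ℚ._+ rest) (≡.trans (≡.cong (ℚ._* inv f (suc m)) f₀) (≡.trans (ℚP.*-identityˡ (inv f (suc m))) (≡.cong ℚ.-_ first)))) (ℚP.+-inverseˡ rest)
  where
  rest : ℚ
  rest = Qℚ.mul (λ i → f (suc i)) (inv f) m
  tail : ∀ (h : ℕ → ℕ) m → sumℚ (zipWith (λ i gi → f i ℚ.* gi) (applyUpTo h (suc m)) (invRev f m)) ≡ Qℚ.mul (λ i → f (h i)) (inv f) m
  tail h zero = ℚP.+-identityʳ _
  tail h (suc m) = ≡.cong (f (h 0) ℚ.* inv f (suc m) ℚ.+_) (tail (λ i → h (suc i)) m)
  first : f 0 ℚ.* 0ℚ ℚ.+ sumℚ (zipWith (λ i gi → f i ℚ.* gi) (applyUpTo suc (suc m)) (invRev f m)) ≡ rest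
  first = ≡.trans (≡.cong₂ ℚ._+_ (ℚP.*-zeroʳ (f 0)) (tail suc m)) (ℚP.+-identityˡ rest)

module QB = Bivariate ℚring

finProd-1 : ∀ N → finProd 1 N Qℚ.≋ QB.fq N
finProd-1 zero = one-1
finProd-1 (suc N) = ⊛-cong {one ⊖ qPow (1 ℕ.* suc N)} {QB.PR.1# QB.PR.+ QB.PR.- Qℚ.q^ (suc N)} {finProd 1 N} {QB.fq N}
  (λ n → ≡.cong₂ (λ x y → x ℚ.+ ℚ.- y) (one-1 n) (≡.trans (≡.cong (λ m → qPow m n) (ℕP.+-identityʳ (suc N))) (qPow-q^ (suc N) n))) (finProd-1 N)

finProd-V : ∀ a N → finProd (3 ℕ.* a) N Qℚ.≋ Qℚ.V (finProd a N)
finProd-V a zero n = ≡.trans (one-1 n) (≡.sym (QB.PR.trans (Qℚ.V-cong one-1) Qℚ.V-1 n))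
finProd-V a (suc N) n = ≡.trans (⊛-cong {one ⊖ qPow (3 ℕ.* a ℕ.* suc N)} {Qℚ.V (one ⊖ qPow (a ℕ.* suc N))} {finProd (3 ℕ.* a) N} {Qℚ.V (finProd a N)} factor (finProd-V a N) n)
  (≡.trans (≡.sym (Qℚ.V-mul (one ⊖ qPow (a ℕ.* suc N)) (finProd a N) n)) (Qℚ.V-cong {Qℚ.mul (one ⊖ qPow (a ℕ.* suc N)) (finProd a N)} {finProd a (suc N)} (λ m → ≡.sym (⊛-mul (one ⊖ qPow (a ℕ.* suc N)) (finProd a N) m)) n))
  where
  factor : one ⊖ qPow (3 ℕ.* a ℕ.* suc N) Qℚ.≋ Qℚ.V (one ⊖ qPow (a ℕ.* suc N))
  factor m = ≡.sym (≡.trans (Qℚ.V-+ one (λ i → ℚ.- qPow (a ℕ.* suc N) i) m) (≡.cong₂ ℚ._+_ (≡.trans (QB.PR.trans (Qℚ.V-cong one-1) Qℚ.V-1 m) (≡.sym (one-1 m)))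
    (≡.trans (Qℚ.V-neg (qPow (a ℕ.* suc N)) m) (≡.cong ℚ.-_ (≡.trans (QB.PR.trans (Qℚ.V-cong (qPow-q^ (a ℕ.* suc N))) (Qℚ.V-mon 1ℚ (a ℕ.* suc N)) m) (≡.trans (≡.cong (λ e → Qℚ.q^ e m) (≡.sym (ℕP.*-assoc 3 a (suc N)))) (≡.sym (qPow-q^ (3 ℕ.* a ℕ.* suc N) m))))))))

poch-1 : poch 1 Qℚ.≋ QB.euler
poch-1 n = finProd-1 n n

poch-3 : poch 3 Qℚ.≋ Qℚ.V QB.euler
poch-3 n = ≡.trans (finProd-V 1 n n) (≡.trans (Qℚ.V-cong (finProd-1 n) n) (≡.sym (Qℚ.V-cong[] {suc n} (QB.euler-fq n) n ℕP.≤-refl)))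

poch-9 : poch 9 Qℚ.≋ Qℚ.V (Qℚ.V QB.euler)
poch-9 n = ≡.trans (finProd-V 3 n n) (≡.trans (Qℚ.V-cong (QB.PR.trans (finProd-V 1 n) (Qℚ.V-cong (finProd-1 n))) n) (≡.sym (Qℚ.V-cong[] {suc n} (Qℚ.V-cong[] {suc n} (QB.euler-fq n)) n ℕP.≤-refl)))

module QC = Convolution ℚring

lambert-term : ℕ → ℕ → ℕ → ℚ
lambert-term b n k = if does ((b ℕ.* suc k) ∣? n) then ℕ→ℚ (suc k ℕ.^ 3) else 0ℚ

if-cong : ∀ {A B : Set} (d : Dec A) (d′ : Dec B) (x : ℚ) → (A → B) → (B → A) → (if does d then x else 0ℚ) ≡ (if does d′ then x else 0ℚ)
if-cong (yes _) (yes _) x f g = ≡.refl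
if-cong (yes a) (no b) x f g = ⊥-elim (b (f a))
if-cong (no a) (yes b) x f g = ⊥-elim (a (g b))
if-cong (no _) (no _) x f g = ≡.refl

if-no : ∀ {A : Set} (d : Dec A) (x : ℚ) → (A → ⊥) → (if does d then x else 0ℚ) ≡ 0ℚ
if-no (yes a) x f = ⊥-elim (f a)
if-no (no _) x f = ≡.refl

lambert-∑ : ∀ b n → lambert3 b (suc n) ≡ ∑< (suc n) (lambert-term b (suc n))
lambert-∑ b n = sumℚ-applyUpTo (suc n) (lambert-term b (suc n)) (λ i → i)

∑-∑< : ∀ n (F : ℕ → Qℚ.Ser) m → QC.∑ n F m ≡ ∑< n (λ k → F k m)
∑-∑< zero F m = ≡.refl
∑-∑< (suc n) F m = ≡.trans (QC.∑-front n F m) (≡.cong (F 0 m ℚ.+_) (∑-∑< n (λ k → F (suc k)) m))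

cube-power : ∀ m → m ℕ.^ 3 ≡ m ℕ.* m ℕ.* m
cube-power = lin
  where
  lin : ∀ m → m ℕ.* (m ℕ.* (m ℕ.* 1)) ≡ m ℕ.* m ℕ.* m
  lin = ℕ-solve-∀

S₃-term : ∀ k n → (QC.PI.nat (suc k ℕ.* suc k ℕ.* suc k) QC.PR.* QC.U k) (suc n) ≡ (if does (suc k ∣? suc n) then ℕ→ℚ (suc k ℕ.^ 3) else 0ℚ)
S₃-term k n = ≡.trans (QC.nat-coefficient (suc k ℕ.* suc k ℕ.* suc k) (QC.U k) (suc n)) (by (suc k ∣? suc n))
  where
  by : (d : Dec (suc k ∣ suc n)) → QC.KI.nat (suc k ℕ.* suc k ℕ.* suc k) ℚ.* (if does d then 1ℚ else 0ℚ) ≡ (if does d then ℕ→ℚ (suc k ℕ.^ 3) else 0ℚ)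
  by (yes _) = ≡.trans (ℚP.*-identityʳ _) (≡.trans (≡.sym (ℕ→ℚ-nat (suc k ℕ.* suc k ℕ.* suc k))) (≡.cong ℕ→ℚ (≡.sym (cube-power (suc k)))))
  by (no _) = ℚP.*-zeroʳ (QC.KI.nat (suc k ℕ.* suc k ℕ.* suc k))

S₃-∑ : ∀ n → QC.S₃ (suc n) ≡ ∑< (suc n) (λ k → if does (suc k ∣? suc n) then ℕ→ℚ (suc k ℕ.^ 3) else 0ℚ)
S₃-∑ n = ≡.trans (∑-∑< (suc n) _ (suc n)) (∑<-cong (suc n) (λ k → S₃-term k n))

lambert3-1 : lambert3 1 Qℚ.≋ QC.S₃
lambert3-1 zero = ≡.refl
lambert3-1 (suc n) = ≡.trans (lambert-∑ 1 n) (≡.trans (∑<-cong (suc n) (λ k → if-cong (1 ℕ.* suc k ∣? suc n) (suc k ∣? suc n) (ℕ→ℚ (suc k ℕ.^ 3))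
  (≡.subst (_∣ suc n) (ℕP.*-identityˡ (suc k))) (≡.subst (_∣ suc n) (≡.sym (ℕP.*-identityˡ (suc k)))))) (≡.sym (S₃-∑ n)))

lambert3-V : ∀ b → lambert3 (3 ℕ.* suc b) Qℚ.≋ Qℚ.V (lambert3 (suc b))
lambert3-V b n = by (Qℚ.mod3 n)
  where
  off : ∀ n → (3 ∣ suc n → ⊥) → lambert3 (3 ℕ.* suc b) (suc n) ≡ 0ℚ
  off n ne = ≡.trans (lambert-∑ (3 ℕ.* suc b) n) (∑<-zero (suc n) (lambert-term (3 ℕ.* suc b) (suc n)) (λ k → if-no (3 ℕ.* suc b ℕ.* suc k ∣? suc n) (ℕ→ℚ (suc k ℕ.^ 3)) (λ d → ne (∣-trans (≡.subst (3 ∣_) (≡.sym (ℕP.*-assoc 3 (suc b) (suc k))) (m∣m*n (suc b ℕ.* suc k))) d))))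
  not-1 : ∀ k → 3 ∣ suc (3 ℕ.* k) → ⊥
  not-1 k d with ∣m+n∣m⇒∣n {3} {3 ℕ.* k} {1} (≡.subst (3 ∣_) (ℕP.+-comm 1 (3 ℕ.* k)) d) (m∣m*n k)
  ... | e with s≤s () ← ∣⇒≤ e
  not-2 : ∀ k → 3 ∣ suc (suc (3 ℕ.* k)) → ⊥
  not-2 k d with ∣m+n∣m⇒∣n {3} {3 ℕ.* k} {2} (≡.subst (3 ∣_) (ℕP.+-comm 2 (3 ℕ.* k)) d) (m∣m*n k)
  ... | e with s≤s (s≤s ()) ← ∣⇒≤ e
  -- The sum on the left has three times as many terms; after cancelling 3 in the divisibility the
  -- extra ones vanish, as a divisor of m + 1 cannot exceed it.
  at : ∀ m → lambert3 (3 ℕ.* suc b) (3 ℕ.* suc m) ≡ lambert3 (suc b) (suc m)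
  at m = ≡.trans (lambert-∑ (3 ℕ.* suc b) (m ℕ.+ 2 ℕ.* suc m)) (≡.trans (∑<-extend (suc m) (2 ℕ.* suc m) (lambert-term (3 ℕ.* suc b) (3 ℕ.* suc m))
      (λ i le → if-no (3 ℕ.* suc b ℕ.* suc i ∣? 3 ℕ.* suc m) (ℕ→ℚ (suc i ℕ.^ 3)) (λ d → ℕP.<⇒≱ (s≤s le) (ℕP.≤-trans (ℕP.m≤n*m (suc i) (suc b)) (∣⇒≤ (cancel i d))))))
    (≡.trans (∑<-cong (suc m) (λ i → if-cong (3 ℕ.* suc b ℕ.* suc i ∣? 3 ℕ.* suc m) (suc b ℕ.* suc i ∣? suc m) (ℕ→ℚ (suc i ℕ.^ 3)) (cancel i) (λ d → ≡.subst (_∣ 3 ℕ.* suc m) (≡.sym (ℕP.*-assoc 3 (suc b) (suc i))) (*-monoʳ-∣ 3 d))))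
      (≡.sym (lambert-∑ (suc b) m))))
    where
    cancel : ∀ i → 3 ℕ.* suc b ℕ.* suc i ∣ 3 ℕ.* suc m → suc b ℕ.* suc i ∣ suc m
    cancel i d = *-cancelˡ-∣ 3 (≡.subst (_∣ 3 ℕ.* suc m) (ℕP.*-assoc 3 (suc b) (suc i)) d)
  by : ∀ {n} → Qℚ.Mod3 n → lambert3 (3 ℕ.* suc b) n ≡ Qℚ.V (lambert3 (suc b)) n
  by (Qℚ.rem0 zero) = ≡.refl
  by (Qℚ.rem0 (suc m)) = ≡.trans (at m) (≡.sym (Qℚ.V-at (lambert3 (suc b)) (suc m)))
  by (Qℚ.rem1 k) = ≡.trans (off (3 ℕ.* k) (not-1 k)) (≡.sym (Qℚ.V-at1 (lambert3 (suc b)) k))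
  by (Qℚ.rem2 k) = ≡.trans (off (suc (3 ℕ.* k)) (not-2 k)) (≡.sym (Qℚ.V-at2 (lambert3 (suc b)) k))

σ3-nat : ∀ n → ℕ→ℚ (σ3 (suc n)) ≡ QC.S₃ (suc n)
σ3-nat n = ≡.trans (cast (suc n) (λ i → i)) (≡.sym (S₃-∑ n))
  where
  g : ℕ → ℕ
  g d = if does (suc d ∣? suc n) then suc d ℕ.^ 3 else 0
  push : ∀ {A : Set} (d : Dec A) x → ℕ→ℚ (if does d then x else 0) ≡ (if does d then ℕ→ℚ x else 0ℚ)
  push (yes _) x = ≡.refl
  push (no _) x = ≡.refl
  ℕ→ℚ-+ : ∀ x y → ℕ→ℚ (x ℕ.+ y) ≡ ℕ→ℚ x ℚ.+ ℕ→ℚ y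
  ℕ→ℚ-+ x y = ≡.trans (ℕ→ℚ-nat (x ℕ.+ y)) (≡.trans (ℚI.nat-+ x y) (≡.cong₂ ℚ._+_ (≡.sym (ℕ→ℚ-nat x)) (≡.sym (ℕ→ℚ-nat y))))
  cast : ∀ m f → ℕ→ℚ (sum (map g (applyUpTo f m))) ≡ ∑< m (λ k → if does (suc (f k) ∣? suc n) then ℕ→ℚ (suc (f k) ℕ.^ 3) else 0ℚ)
  cast zero f = ≡.refl
  cast (suc m) f = ≡.trans (ℕ→ℚ-+ (g (f 0)) (sum (map g (applyUpTo (λ i → f (suc i)) m)))) (≡.cong₂ ℚ._+_ (push (suc (f 0) ∣? suc n) (suc (f 0) ℕ.^ 3)) (cast m (λ i → f (suc i))))

E₀ : Qℚ.Ser
E₀ = QB.euler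

E₀-0 : E₀ 0 ≡ 1ℚ
E₀-0 = ≡.refl

κ₀ b₀ : Qℚ.Ser
κ₀ = Qℚ.mul (inv E₀) (CubicForms.cubed Qℚ.seriesRing (Qℚ.V E₀))
b₀ = Qℚ.mul (inv (Qℚ.V E₀)) (CubicForms.cubed Qℚ.seriesRing E₀)

mul-inv : ∀ f g → f 0 ≡ 1ℚ → Qℚ.mul f (Qℚ.mul (inv f) g) Qℚ.≋ g
mul-inv f g p n = ≡.trans (≡.sym (Qℚ.mul-assoc f (inv f) g n)) (≡.trans (Qℚ.mul-cong {Qℚ.mul f (inv f)} {Qℚ.1ₛ} {g} {g} (inv-mul f p) (λ _ → ≡.refl) n) (Qℚ.mul-identityˡ g n))

module W4 = WeightFour ℚring nat-regular κ₀ b₀ (mul-inv E₀ (CubicForms.cubed Qℚ.seriesRing (Qℚ.V E₀)) E₀-0) (mul-inv (Qℚ.V E₀) (CubicForms.cubed Qℚ.seriesRing E₀) E₀-0)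

legendre-value : ℕ → ℤ
legendre-value 0 = + 0
legendre-value 1 = + 1
legendre-value (suc (suc _)) = -[1+ 0 ]

legendre3-% : ∀ n → legendre3 n ≡ legendre-value (n % 3)
legendre3-% n with n % 3
... | 0 = ≡.refl
... | 1 = ≡.refl
... | suc (suc _) = ≡.refl

legendre-character : ∀ n x → W4.character (res n) x ≡ ℤ→ℚ (legendre3 n) ℚ.* x
legendre-character n x = ≡.trans (go n) (≡.cong (λ z → ℤ→ℚ z ℚ.* x) (≡.sym (legendre3-% n)))
  where
  go : ∀ n → W4.character (res n) x ≡ ℤ→ℚ (legendre-value (n % 3)) ℚ.* x
  go 0 = ≡.sym (ℚP.*-zeroˡ x)
  go 1 = ≡.sym (ℚP.*-identityˡ x)
  go 2 = ≡.trans (≡.cong ℚ.-_ (≡.sym (ℚP.*-identityˡ x))) (ℚP.neg-distribˡ-* 1ℚ x)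
  go (suc (suc (suc n))) = ≡.trans (≡.cong (λ r → W4.character r x) (suc₃³ (res n))) (≡.trans (go n) (≡.cong (λ m → ℤ→ℚ (legendre-value m) ℚ.* x) (≡.sym (≡.trans (≡.cong (_% 3) (ℕP.+-comm 3 n)) ([m+n]%n≡m%n n 3)))))

E94-twist : E94 Qℚ.≋ W4.twist QC.S₃
E94-twist zero = ≡.refl
E94-twist (suc n) = ≡.trans (≡.cong (ℤ→ℚ (legendre3 (suc n)) ℚ.*_) (σ3-nat n)) (≡.sym (legendre-character (suc n) (QC.S₃ (suc n))))

-- Translation into quotients of Euler products and conclusion

module EtaQuotients (R : CommutativeRing 0ℓ 0ℓ) where
  open CommutativeRing R hiding (zero)
  open Integers R
  open CubicForms R
  open CommutativeRingPowers R
  open WeightFourForms R using (fourth)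

  private
    pw : ∀ {m} → ℕ → Polynomial m → Polynomial m
    pw zero x = con (+ 1)
    pw (suc n) x = x :* pw n x

    times-1 : ∀ {x i} → i ≈ 1# → x * i ≈ x
    times-1 p = trans (*-congˡ p) (*-identityʳ _)

  module _ {e₁ e₃ e₉ q b y z I₁ I₂ I₃ I₄ : Carrier}
      (b-eq : e₃ * b ≈ cubed e₁) (y-eq : e₃ * y ≈ q * cubed e₉) (z-eq : q * power 8 e₃ ≈ z)
      (I₁-eq : power 9 e₁ * I₁ ≈ 1#) (I₂-eq : power 9 e₁ * power 4 e₃ * I₂ ≈ 1#)
      (I₃-eq : power 4 e₃ * I₃ ≈ 1#) (I₄-eq : power 3 e₁ * power 4 e₃ * I₄ ≈ 1#) where

    term₁ : ∀ m → power 9 e₁ * (m * q * power 8 e₃ * I₁) ≈ m * z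
    term₁ m = trans (l (power 9 e₁) m q (power 8 e₃) I₁) (trans (times-1 I₁-eq) (*-congˡ z-eq))
      where
      l : ∀ p m q e i → p * (m * q * e * i) ≈ m * (q * e) * (p * i)
      l = solve 5 (λ p m q e i → p :* (m :* q :* e :* i) := m :* (q :* e) :* (p :* i)) refl

    -- After multiplication by e₁⁹ this term and the next three are of degree 4 in e₁³ = e₃ b and q
    -- e₉³ = e₃ y; the resulting e₃⁴ is removed by the inverse.
    term₂ : ∀ m q₄ → q₄ ≈ fourth q → power 9 e₁ * (m * q₄ * power 12 e₉ * I₂) ≈ m * fourth y
    term₂ m q₄ r = trans (*-congˡ (*-congʳ (*-congʳ (*-congˡ r)))) (trans (l₁ m q e₉ (power 9 e₁) I₂)
      (trans (*-congʳ (*-congˡ (*-cong (*-cong (sym y-eq) (sym y-eq)) (*-cong (sym y-eq) (sym y-eq))))) (trans (l₂ m e₃ y (power 9 e₁) I₂) (times-1 I₂-eq))))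
      where
      l₁ : ∀ m q e p i → p * (m * fourth q * power 12 e * i) ≈ m * fourth (q * cubed e) * (p * i)
      l₁ = solve 5 (λ m q e p i → let t = q :* (e :* e :* e) in p :* (m :* (q :* q :* (q :* q)) :* pw 12 e :* i) := m :* (t :* t :* (t :* t)) :* (p :* i)) refl
      l₂ : ∀ m e y p i → m * fourth (e * y) * (p * i) ≈ m * fourth y * (p * power 4 e * i)
      l₂ = solve 5 (λ m e y p i → let t = e :* y in m :* (t :* t :* (t :* t)) :* (p :* i) := m :* (y :* y :* (y :* y)) :* (p :* pw 4 e :* i)) refl

    term₃ : ∀ m → power 9 e₁ * (m * q * power 3 e₉ * I₃) ≈ m * (cubed b * y)
    term₃ m = trans (l₁ m q e₁ e₉ I₃) (trans (*-congʳ (*-congˡ (*-cong (cubed-cong (sym b-eq)) (sym y-eq)))) (trans (l₂ m e₃ b y I₃) (times-1 I₃-eq)))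
      where
      l₁ : ∀ m q e₁ e₉ i → power 9 e₁ * (m * q * power 3 e₉ * i) ≈ m * (cubed (cubed e₁) * (q * cubed e₉)) * i
      l₁ = solve 5 (λ m q e₁ e₉ i → let t = e₁ :* e₁ :* e₁ in pw 9 e₁ :* (m :* q :* pw 3 e₉ :* i) := m :* (t :* t :* t :* (q :* (e₉ :* e₉ :* e₉))) :* i) refl
      l₂ : ∀ m e b y i → m * (cubed (e * b) * (e * y)) * i ≈ m * (cubed b * y) * (power 4 e * i)
      l₂ = solve 5 (λ m e b y i → let t = e :* b in m :* (t :* t :* t :* (e :* y)) :* i := m :* (b :* b :* b :* y) :* (pw 4 e :* i)) refl

    term₄ : ∀ m q₂ → q₂ ≈ q * q → power 9 e₁ * (m * q₂ * power 6 e₉ * I₄) ≈ m * (b * b * (y * y))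
    term₄ m q₂ r = trans (*-congˡ (*-congʳ (*-congʳ (*-congˡ r)))) (trans (l₁ m q e₁ e₉ I₄)
      (trans (*-congʳ (*-congˡ (*-cong (*-cong (sym b-eq) (sym b-eq)) (*-cong (sym y-eq) (sym y-eq))))) (trans (l₂ m e₃ b y (power 3 e₁) I₄) (times-1 I₄-eq))))
      where
      l₁ : ∀ m q e₁ e₉ i → power 9 e₁ * (m * (q * q) * power 6 e₉ * i) ≈ m * (cubed e₁ * cubed e₁ * (q * cubed e₉ * (q * cubed e₉))) * (power 3 e₁ * i)
      l₁ = solve 5 (λ m q e₁ e₉ i → let t = e₁ :* e₁ :* e₁ ; s = q :* (e₉ :* e₉ :* e₉) in pw 9 e₁ :* (m :* (q :* q) :* pw 6 e₉ :* i) := m :* (t :* t :* (s :* s)) :* (pw 3 e₁ :* i)) refl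
      l₂ : ∀ m e b y p i → m * (e * b * (e * b) * (e * y * (e * y))) * (p * i) ≈ m * (b * b * (y * y)) * (p * power 4 e * i)
      l₂ = solve 6 (λ m e b y p i → m :* (e :* b :* (e :* b) :* (e :* y :* (e :* y))) :* (p :* i) := m :* (b :* b :* (y :* y)) :* (p :* pw 4 e :* i)) refl

    term₅ : power 9 e₁ * (power 3 e₁ * I₃) ≈ fourth b
    term₅ = trans (l₁ e₁ I₃) (trans (*-congʳ (*-cong (*-cong (sym b-eq) (sym b-eq)) (*-cong (sym b-eq) (sym b-eq)))) (trans (l₂ e₃ b I₃) (times-1 I₃-eq)))
      where
      l₁ : ∀ e₁ i → power 9 e₁ * (power 3 e₁ * i) ≈ fourth (cubed e₁) * i
      l₁ = solve 2 (λ e₁ i → let t = e₁ :* e₁ :* e₁ in pw 9 e₁ :* (pw 3 e₁ :* i) := t :* t :* (t :* t) :* i) refl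
      l₂ : ∀ e b i → fourth (e * b) * i ≈ fourth b * (power 4 e * i)
      l₂ = solve 3 (λ e b i → let t = e :* b in t :* t :* (t :* t) :* i := b :* b :* (b :* b) :* (pw 4 e :* i)) refl

  eight-nine : ∀ e → e * power 8 e ≈ cubed (cubed e)
  eight-nine = solve 1 (λ e → let t = e :* e :* e in e :* pw 8 e := t :* t :* t) refl

  distribute : ∀ p t₁ t₂ t₃ t₄ t₅ → p * (t₁ + t₂ - t₃ - t₄ + t₅) ≈ p * t₁ + p * t₂ - p * t₃ - p * t₄ + p * t₅
  distribute = solve 6 (λ p t₁ t₂ t₃ t₄ t₅ → p :* (t₁ :+ t₂ :- t₃ :- t₄ :+ t₅) := p :* t₁ :+ p :* t₂ :- p :* t₃ :- p :* t₄ :+ p :* t₅) refl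

  eisenstein-rescaled : ∀ E₁ E₂ E₃ E₄ Q₁ Q₂ Q₃ θ z → int (+ 240) * E₁ ≈ Q₁ → int (+ 240) * E₂ ≈ Q₂ → int (+ 240) * E₃ ≈ Q₃ →
    int (+ 81) * Q₁ - int (+ 84) * Q₂ + int (+ 243) * Q₃ - int (+ 3) * (int (+ 240) * E₄) ≈ int (+ 240) * (θ + int (+ 6) * z) →
    int (+ 240) * (int (+ 81) * E₁ - int (+ 84) * E₂ + int (+ 243) * E₃ - int (+ 3) * E₄ - int (+ 6) * z) ≈ int (+ 240) * θ
  eisenstein-rescaled E₁ E₂ E₃ E₄ Q₁ Q₂ Q₃ θ z p₁ p₂ p₃ e = trans (l₁ E₁ E₂ E₃ E₄ z) (trans (+-congʳ (trans (+-congʳ (+-cong (+-cong (*-congˡ p₁) (-‿cong (*-congˡ p₂))) (*-congˡ p₃))) e)) (l₂ θ z))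
    where
    l₁ : ∀ E₁ E₂ E₃ E₄ z → int (+ 240) * (int (+ 81) * E₁ - int (+ 84) * E₂ + int (+ 243) * E₃ - int (+ 3) * E₄ - int (+ 6) * z) ≈
      int (+ 81) * (int (+ 240) * E₁) - int (+ 84) * (int (+ 240) * E₂) + int (+ 243) * (int (+ 240) * E₃) - int (+ 3) * (int (+ 240) * E₄) - int (+ 1440) * z
    l₁ = solve 5 (λ E₁ E₂ E₃ E₄ z → con (+ 240) :* (con (+ 81) :* E₁ :- con (+ 84) :* E₂ :+ con (+ 243) :* E₃ :- con (+ 3) :* E₄ :- con (+ 6) :* z) :=
      con (+ 81) :* (con (+ 240) :* E₁) :- con (+ 84) :* (con (+ 240) :* E₂) :+ con (+ 243) :* (con (+ 240) :* E₃) :- con (+ 3) :* (con (+ 240) :* E₄) :- con (+ 1440) :* z) refl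
    l₂ : ∀ θ z → int (+ 240) * (θ + int (+ 6) * z) - int (+ 1440) * z ≈ int (+ 240) * θ
    l₂ = solve 2 (λ θ z → con (+ 240) :* (θ :+ con (+ 6) :* z) :- con (+ 1440) :* z := con (+ 240) :* θ) refl

private
  module P = W4.P
  module PR = W4.PR
  module PI = W4.PI
  module PP = CommutativeRingPowers W4.P.seriesRing
  module EQ = EtaQuotients W4.P.seriesRing

^-power : ∀ e {f g} → f P.≋ g → f ^ e P.≋ PP.power e g
^-power zero p = one-1
^-power (suc e) {f} {g} p = ⊛-cong {f} {g} {f ^ e} {PP.power e g} p (^-power e p)

scaled : ∀ m f {g} → f P.≋ g → c (+ m) · f P.≋ PI.nat m PR.* g
scaled m f {g} p n = ≡.trans (≡.cong₂ ℚ._*_ (ℕ→ℚ-nat m) (p n)) (≡.sym (W4.CV.nat-coefficient m g n))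

inv-of : ∀ f {g} → f P.≋ g → f 0 ≡ 1ℚ → g PR.* inv f PR.≈ PR.1#
inv-of f {g} p f₀ n = ≡.trans (P.mul-cong {g} {f} {inv f} {inv f} (λ i → ≡.sym (p i)) (λ _ → ≡.refl) n) (inv-mul f f₀ n)

CΦ9-CΦ : CΦ9 P.≋ W4.CΦ
CΦ9-CΦ n = ℕ→ℚ-nat (cφ 9 n)

e₁ e₃ e₉ : P.Ser
e₁ = W4.euler
e₃ = W4.euler₃
e₉ = W4.euler₉

z : P.Ser
z = b₀ PR.* (W4.y′ PR.* W4.n)

z-eq : P.q^ 1 PR.* PP.power 8 e₃ PR.≈ z
z-eq = W4.eighth-power (PP.power 8 e₃) (EQ.eight-nine e₃)

CΦ-e₁⁹ : PP.power 9 e₁ PR.* CΦ9 PR.≈ W4.cube (W4.cube e₁) PR.* W4.CΦ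
CΦ-e₁⁹ = P.mul-cong {PP.power 9 e₁} {W4.cube (W4.cube e₁)} {CΦ9} {W4.CΦ} (PP.power-9 e₁) CΦ9-CΦ

I₁ I₂ I₃ I₄ : P.Ser
I₁ = inv (poch 1 ^ 9)
I₂ = inv (poch 1 ^ 9 ⊛ poch 3 ^ 4)
I₃ = inv (poch 3 ^ 4)
I₄ = inv (poch 1 ^ 3 ⊛ poch 3 ^ 4)

I₁-eq : PP.power 9 e₁ PR.* I₁ PR.≈ PR.1#
I₁-eq = inv-of (poch 1 ^ 9) (^-power 9 poch-1) ≡.refl

I₂-eq : PP.power 9 e₁ PR.* PP.power 4 e₃ PR.* I₂ PR.≈ PR.1#
I₂-eq = inv-of (poch 1 ^ 9 ⊛ poch 3 ^ 4) (⊛-cong {poch 1 ^ 9} {PP.power 9 e₁} {poch 3 ^ 4} {PP.power 4 e₃} (^-power 9 poch-1) (^-power 4 poch-3)) ≡.refl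

I₃-eq : PP.power 4 e₃ PR.* I₃ PR.≈ PR.1#
I₃-eq = inv-of (poch 3 ^ 4) (^-power 4 poch-3) ≡.refl

I₄-eq : PP.power 3 e₁ PR.* PP.power 4 e₃ PR.* I₄ PR.≈ PR.1#
I₄-eq = inv-of (poch 1 ^ 3 ⊛ poch 3 ^ 4) (⊛-cong {poch 1 ^ 3} {PP.power 3 e₁} {poch 3 ^ 4} {PP.power 4 e₃} (^-power 3 poch-1) (^-power 4 poch-3)) ≡.refl

product₃ : ∀ m k (f g : P.Ser) {f′} → f P.≋ f′ → c (+ m) · qPow k ⊛ f ⊛ g P.≋ PI.nat m PR.* P.q^ k PR.* f′ PR.* g
product₃ m k f g {f′} p = ⊛-cong {c (+ m) · qPow k ⊛ f} {PI.nat m PR.* P.q^ k PR.* f′} {g} {g}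
  (⊛-cong {c (+ m) · qPow k} {PI.nat m PR.* P.q^ k} {f} {f′} (scaled m (qPow k) (qPow-q^ k)) p) (λ _ → ≡.refl)

RHS₁-value : RHS₁ PR.≈ PI.int (+ 324) PR.* P.q^ 1 PR.* PP.power 8 e₃ PR.* I₁ PR.+ PI.int (+ 19683) PR.* P.q^ 4 PR.* PP.power 12 e₉ PR.* I₂
  PR.- PI.int (+ 240) PR.* P.q^ 1 PR.* PP.power 3 e₉ PR.* I₃ PR.- PI.int (+ 1458) PR.* P.q^ 2 PR.* PP.power 6 e₉ PR.* I₄ PR.+ PP.power 3 e₁ PR.* I₃
RHS₁-value = PR.+-cong (PR.+-cong (PR.+-cong (PR.+-cong
    (product₃ 324 1 (poch 3 ^ 8) I₁ (^-power 8 poch-3)) (product₃ 19683 4 (poch 9 ^ 12) I₂ (^-power 12 poch-9)))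
    (PR.-‿cong (product₃ 240 1 (poch 9 ^ 3) I₃ (^-power 3 poch-9)))) (PR.-‿cong (product₃ 1458 2 (poch 9 ^ 6) I₄ (^-power 6 poch-9))))
  (⊛-cong {poch 1 ^ 3} {PP.power 3 e₁} {I₃} {I₃} (^-power 3 poch-1) (λ _ → ≡.refl))

q^-* : ∀ i j → P.q^ i PR.* P.q^ j PR.≈ P.q^ (i ℕ.+ j)
q^-* i j = PR.trans (P.mon-mul 1ℚ 1ℚ i j) (P.mon-cong (i ℕ.+ j) ≡.refl)

power₉-cancel : ∀ {f g} → PP.power 9 e₁ PR.* f PR.≈ PP.power 9 e₁ PR.* g → f PR.≈ g
power₉-cancel {f} {g} = P.mul-cancel (PP.power 9 e₁) f g (P.unit-regular ≡.refl)

b-eq : e₃ PR.* b₀ PR.≈ W4.cube e₁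
b-eq = mul-inv e₃ (W4.cube e₁) ≡.refl

κ-eq : e₁ PR.* κ₀ PR.≈ W4.cube e₃
κ-eq = mul-inv e₁ (W4.cube e₃) ≡.refl

CΦ9-RHS₁ : CΦ9 PR.≈ RHS₁
CΦ9-RHS₁ = power₉-cancel (PR.trans CΦ-e₁⁹ (PR.trans W4.eta-value (PR.sym (PR.trans (PR.*-congˡ RHS₁-value) (PR.trans (EQ.distribute (PP.power 9 e₁) _ _ _ _ _)
  (PR.+-cong (PR.+-cong (PR.+-cong (PR.+-cong (EQ.term₁ b-eq y-eq z-eq I₁-eq I₂-eq I₃-eq I₄-eq (PI.nat 324)) (EQ.term₂ b-eq y-eq z-eq I₁-eq I₂-eq I₃-eq I₄-eq (PI.nat 19683) (P.q^ 4) q⁴))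
    (PR.-‿cong (EQ.term₃ b-eq y-eq z-eq I₁-eq I₂-eq I₃-eq I₄-eq (PI.nat 240)))) (PR.-‿cong (EQ.term₄ b-eq y-eq z-eq I₁-eq I₂-eq I₃-eq I₄-eq (PI.nat 1458) (P.q^ 2) (PR.sym (q^-* 1 1))))) (EQ.term₅ b-eq y-eq z-eq I₁-eq I₂-eq I₃-eq I₄-eq)))))))
  where
  y-eq : e₃ PR.* W4.y′ PR.≈ P.q^ 1 PR.* W4.cube e₉
  y-eq = W4.y-product κ-eq b-eq
  q⁴ : P.q^ 4 PR.≈ W4.PW.fourth (P.q^ 1)
  q⁴ = PR.sym (PR.trans (PR.*-cong (q^-* 1 1) (q^-* 1 1)) (q^-* 2 2))

E9-value : ∀ ℓ {s} → ℓ P.≋ s → PI.nat 240 PR.* (const (+ 1 ℚ./ 240) ⊕ ℓ) PR.≈ PR.1# PR.+ PI.nat 240 PR.* s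
E9-value ℓ {s} p n = ≡.trans (W4.CV.nat-coefficient 240 (const (+ 1 ℚ./ 240) ⊕ ℓ) n) (≡.trans (ℚP.*-distribˡ-+ N (r ℚ.* one n) (ℓ n))
  (≡.cong₂ ℚ._+_ (≡.trans (≡.sym (ℚP.*-assoc N r (one n))) (≡.trans (≡.cong (ℚ._* one n) unit) (≡.trans (ℚP.*-identityˡ (one n)) (one-1 n))))
    (≡.trans (≡.cong (N ℚ.*_) (p n)) (≡.sym (W4.CV.nat-coefficient 240 s n)))))
  where
  N r : ℚ
  N = W4.KI.nat 240
  r = + 1 ℚ./ 240
  unit : N ℚ.* r ≡ 1ℚ
  unit = ≡.trans (≡.cong (ℚ._* r) (≡.sym (ℕ→ℚ-nat 240))) ≡.refl

V-1+240 : ∀ f → P.V (PR.1# PR.+ PI.nat 240 PR.* f) PR.≈ PR.1# PR.+ PI.nat 240 PR.* P.V f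
V-1+240 f = PR.trans (P.V-+ PR.1# (PI.nat 240 PR.* f)) (PR.+-cong P.V-1 (W4.V-nat* 240 f))

lambert3-3 : lambert3 3 P.≋ P.V W4.CV.S₃
lambert3-3 = PR.trans (lambert3-V 0) (P.V-cong lambert3-1)

lambert3-9 : lambert3 9 P.≋ P.V (P.V W4.CV.S₃)
lambert3-9 = PR.trans (lambert3-V 2) (P.V-cong lambert3-3)

eisenstein : P.Ser
eisenstein = c (+ 81) · E91 ⊖ c (+ 84) · E92 ⊕ c (+ 243) · E93 ⊖ c (+ 3) · E94 ⊖ c (+ 6) · qPow 1 ⊛ poch 3 ^ 8

-- The comparison is made after multiplication by 240, which clears the constant terms 1/240 and
-- turns the three Lambert series into E₄ at q, q³ and q⁹.
eisenstein-CΦ : eisenstein PR.≈ PP.power 9 e₁ PR.* CΦ9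
eisenstein-CΦ = W4.nat-cancel 239 (PR.trans (PR.*-congˡ {PI.nat 240} linear-form)
  (PR.trans (EQ.eisenstein-rescaled E91 E92 E93 (W4.twist W4.CV.S₃) W4.Q (P.V W4.Q) (P.V (P.V W4.Q)) (W4.cube (W4.cube e₁) PR.* W4.CΦ) z
      (E9-value (lambert3 1) lambert3-1)
      (PR.trans (E9-value (lambert3 3) lambert3-3) (PR.sym (V-1+240 W4.CV.S₃)))
      (PR.trans (E9-value (lambert3 9) lambert3-9) (PR.sym (PR.trans (P.V-cong (V-1+240 W4.CV.S₃)) (V-1+240 (P.V W4.CV.S₃)))))
      W4.eisenstein-value)
    (PR.*-congˡ {PI.nat 240} (PR.sym CΦ-e₁⁹))))
  where
  linear-form : eisenstein PR.≈ PI.int (+ 81) PR.* E91 PR.- PI.int (+ 84) PR.* E92 PR.+ PI.int (+ 243) PR.* E93 PR.- PI.int (+ 3) PR.* W4.twist W4.CV.S₃ PR.- PI.int (+ 6) PR.* z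
  linear-form = PR.+-cong (PR.+-cong (PR.+-cong (PR.+-cong (scaled 81 E91 (λ _ → ≡.refl)) (PR.-‿cong (scaled 84 E92 (λ _ → ≡.refl)))) (scaled 243 E93 (λ _ → ≡.refl))) (PR.-‿cong (scaled 3 E94 E94-twist)))
    (PR.-‿cong (PR.trans (⊛-cong {c (+ 6) · qPow 1} {PI.nat 6 PR.* P.q^ 1} {poch 3 ^ 8} {PP.power 8 e₃} (scaled 6 (qPow 1) (qPow-q^ 1)) (^-power 8 poch-3)) (PR.trans (PR.*-assoc (PI.nat 6) (P.q^ 1) (PP.power 8 e₃)) (PR.*-congˡ {PI.nat 6} z-eq))))

CΦ9-RHS₂ : CΦ9 PR.≈ RHS₂
CΦ9-RHS₂ = power₉-cancel (PR.trans (PR.sym eisenstein-CΦ) (PR.sym (PR.trans (PR.*-congˡ {PP.power 9 e₁} (⊛-mul I₁ eisenstein))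
  (PR.trans (PR.sym (PR.*-assoc (PP.power 9 e₁) I₁ eisenstein)) (PR.trans (PR.*-congʳ {eisenstein} I₁-eq) (PR.*-identityˡ eisenstein))))))

theorem5p1 : ((n : ℕ) → CΦ9 n ≡ RHS₁ n) × ((n : ℕ) → CΦ9 n ≡ RHS₂ n)
theorem5p1 = CΦ9-RHS₁ , CΦ9-RHS₂
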